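{- (Affine Fertility Formula) For every $v\in\widetilde S_n$, $$\lvert\widetilde{\mathtt s}^{ -1}(v)\rvert=\sum_{\mathcal H\in\mathrm{AVHC}(v)}C_{\mathbf q^{\mathcal H}} .$$
   Context: An affine permutation of size $n$ is a bijection $w:\mathbb Z\to\mathbb Z$ with $w(i+n)=w(i)+n$ for all $i\in\mathbb Z$ and $\sum_{i=1}^n w(i)=\binom{n+1}{2}$. They form the affine symmetric group $\widetilde S_n$ under composition (trivial if $n=1$), a Coxeter group with simple generators $\widetilde s_1,\ldots,\widetilde s_n$, where $\widetilde s_i$ swaps $i+mn$ and $i+mn+1$ for all $m\in\mathbb Z$ and fixes all other integers. The left weak order is $x\leq_L y\iff\ell(yx^{ -1})=\ell(y)-\ell(x)$, $\ell$ being Coxeter length. Affine sylvester congruence. For $w\in\widetilde S_n$ define a partial order $\preceq_w$ on $\mathbb Z$ (positions): for $i<j$, the positions $i,j$ are incomparable if and only if there is $k$ with $i<k<j$ and $w(k)>\max\{w(i),w(j)\}$; otherwise the position with the smaller value of $w$ is below the other. (This is the descendant order of the decreasing affine binary plane tree with in-order reading $w$.) The affine sylvester congruence is $v\equiv_{\widetilde{\mathrm{syl}}}w\iff{\preceq_v}={\preceq_w}$; it is a semilattice congruence on $(\widetilde S_n,\leq_L)$ in which $\{e\}$ is a class, and each class has a unique $\leq_L$-minimal element. Let $\pi_\downarrow(w)$ be the minimal element of the class of $w$. The affine stack-sorting map is $\widetilde{\mathtt s}:\widetilde S_n\to\widetilde S_n$, $\widetilde{\mathtt s}(w)=w\,(\pi_\downarrow(w))^{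 -1}$. Valid hook configurations. Let $z=z(1)\cdots z(N)$ be a finite permutation (a word of distinct integers) with plot $\{(i,z(i))\}$. A hook of $z$ joins points $(i,z(i))$ (southwest endpoint) and $(j,z(j))$ (northeast endpoint) with $i<j$, $z(i)<z(j)$; it consists of the vertical segment from $(i,z(i))$ up to $(i,z(j))$ followed by the horizontal segment from $(i,z(j))$ to $(j,z(j))$. If the descents of $z$ (indices $d$ with $z(d)>z(d+1)$) are $d_1<\cdots<d_k$, a valid hook configuration of $z$ is a tuple $(H_1,\ldots,H_k)$ of hooks such that: (1) the southwest endpoint of $H_i$ is $(d_i,z(d_i))$ for each $i$; (2) no point of the plot lies directly above a hook; (3) no two hooks intersect or overlap, except that the northeast endpoint of one may be the southwest endpoint of another. $\mathrm{VHC}(z)$ is the set of these. For $\mathcal H=(H_1,\dots,H_k)\in\mathrm{VHC}(z)$, color each point of the plot that is not a northeast endpoint of a hook: the point looks vertically upward (a southwest endpoint of a hook looks around the left side of that hook, so it ignores it) and gets the color of the first hook it sees, or blue if it sees none. Let $q_i$ be the number of points colored with the color of $H_i$, $q_0$ the number of blue points, and $\mathbf q^{\mathcal H}=(q_0,\ldots,q_k)$. The empty permutation has exactly one (empty) valid hook configuration, whose $\mathbf q$ is the empty composition. For a tuple $\mathbf q$ of nonnegative integers, $C_{\mathbf q}$ is the product over its parts $q$ of the Catalan numbers $C_q=\frac1{q+1}\binom{2q}{q}$ (empty product $=1$). Affine valid hook configurations. Let $v\in\widetilde S_n$. A left-to-right maximum of $v$ is an integer $m$ larger than every integer to its left in the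 word $\cdots v(0)v(1)v(2)\cdots$. $\mathrm{Sky}(v)$ is the collection of nonempty $n$-periodic (i.e. invariant under translation by $\pm n$) subsets of the set of left-to-right maxima of $v$. Write $\mathscr M\in\mathrm{Sky}(v)$ as $\{\cdots<m_0<m_1<m_2<\cdots\}$ with $v^{ -1}(m_1)\le1<v^{ -1}(m_2)$, let $r(\mathscr M)$ be the positive integer with $m_{j+r(\mathscr M)}=m_j+n$ for all $j$, and let $z_i^{\mathscr M}$ be the (possibly empty) permutation formed by the entries of $v$ strictly between $m_i$ and $m_{i+1}$. An affine valid hook configuration $\mathcal H$ of $v$ consists of some $\mathscr M\in\mathrm{Sky}(v)$ (giving the "skyline" of hooks joining $(v^{ -1}(m_i),m_i)$ to $(v^{ -1}(m_{i+1}),m_{i+1})$ for all $i$) together with a choice of $\mathcal H_i\in\mathrm{VHC}(z_i^{\mathscr M})$ for $1\le i\le r(\mathscr M)$ (repeated periodically). $\mathrm{AVHC}(v)$ is the set of these, and $\mathbf q^{\mathcal H}$ is the concatenation of $\mathbf q^{\mathcal H_1},\ldots,\mathbf q^{\mathcal H_{r(\mathscr M)}}$. -}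

module Defs where

open import Data.Bool.Base using (Bool; T)
open import Data.Fin.Base as Fin using (Fin; toℕ)
import Data.Fin.Properties as Fin
open import Data.Integer.Base as ℤ using (ℤ; +_; 0ℤ; 1ℤ; _⊔_; _⊓_; ∣_∣)
import Data.Integer.Properties as ℤ
open import Data.List.Base as List using (List; []; _∷_; length; foldr)
open import Data.List.Relation.Unary.All using (All)
open import Data.Nat.Base as ℕ using (ℕ; zero; suc)
open import Data.Nat.Combinatorics using (_C_)
open import Data.Nat.DivMod using (_/_)
open import Data.Nat.ListAction using (sum; product)
import Data.Nat.Properties as ℕ
open import Data.Product.Base using (Σ; ∃; ∃-syntax; Σ-syntax; _×_; _,_; proj₁)
open import Data.Product.Relation.Binary.Pointwise.NonDependent using (×-setoid)
open import Data.Sum.Base using (_⊎_)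
import Data.Vec.Base as Vec
open import Data.Vec.Functional using (Vector)
open import Function.Base using (_∘_; _∘′_; id)
open import Function.Bundles using (_↔_; _⇔_; Inverse)
open import Level using (0ℓ)
open import Relation.Binary.Bundles using (Setoid)
import Relation.Binary.Construct.On as On
open import Relation.Binary.PropositionalEquality
  using (_≡_; _≢_; _≗_; setoid; _→-setoid_)
open import Relation.Nullary using (¬_; ¬?; Dec; _×-dec_; _→-dec_)
open import Relation.Unary using (Pred; Decidable)

HasCardinality : Setoid 0ℓ 0ℓ → ℕ → Set
HasCardinality S N = Inverse S (setoid (Fin N))

HasSum : (S : Setoid 0ℓ 0ℓ) → (Setoid.Carrier S → ℕ) → ℕ → Set
HasSum S f N =
  ∃[ k ] Σ[ e ∈ HasCardinality S k ] sum (List.tabulate (f ∘ Inverse.from e)) ≡ N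

record AffinePermutation (n : ℕ) : Set where
  field
    bijection  : ℤ ↔ ℤ
  open Inverse bijection using (to)
  field
    periodic   : ∀ i → to (i ℤ.+ + n) ≡ to i ℤ.+ + n
    normalised : foldr ℤ._+_ 0ℤ (List.applyUpTo (λ i → to (+ suc i)) n) ≡ + (suc n C 2)

infix 9 _⟦_⟧ _⁻¹⟦_⟧

_⟦_⟧ : ∀ {n} → AffinePermutation n → ℤ → ℤ
w ⟦ i ⟧ = Inverse.to (AffinePermutation.bijection w) i

_⁻¹⟦_⟧ : ∀ {n} → AffinePermutation n → ℤ → ℤ
w ⁻¹⟦ i ⟧ = Inverse.from (AffinePermutation.bijection w) i

infix 4 _≈_

_≈_ : ∀ {n} → AffinePermutation n → AffinePermutation n → Set
v ≈ w = ∀ i → v ⟦ i ⟧ ≡ w ⟦ i ⟧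

record IsSimpleReflection (n : ℕ) (i : ℤ) (s : ℤ → ℤ) : Set where
  field
    up    : ∀ m → s (i ℤ.+ m ℤ.* + n) ≡ i ℤ.+ m ℤ.* + n ℤ.+ 1ℤ
    down  : ∀ m → s (i ℤ.+ m ℤ.* + n ℤ.+ 1ℤ) ≡ i ℤ.+ m ℤ.* + n
    fixes : ∀ x → (∀ m → x ≢ i ℤ.+ m ℤ.* + n) →
                  (∀ m → x ≢ i ℤ.+ m ℤ.* + n ℤ.+ 1ℤ) → s x ≡ x

-- The generators are s₁, …, sₙ. For n = 1 the conditions `up` and `down` are
-- contradictory, so there is no generator, as befits the trivial group.
IsGenerator : (n : ℕ) → (ℤ → ℤ) → Set
IsGenerator n s = Σ[ i ∈ Fin n ] IsSimpleReflection n (+ suc (toℕ i)) s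

IsWordFor : (n : ℕ) → (ℤ → ℤ) → List (ℤ → ℤ) → Set
IsWordFor n f ss = All (IsGenerator n) ss × foldr _∘′_ id ss ≗ f

HasLength : (n : ℕ) → (ℤ → ℤ) → ℕ → Set
HasLength n f k =
  (∃[ ss ] IsWordFor n f ss × length ss ≡ k) ×
  (∀ ss → IsWordFor n f ss → k ℕ.≤ length ss)

infix 4 _≤L_

_≤L_ : ∀ {n} → AffinePermutation n → AffinePermutation n → Set
_≤L_ {n} x y = ∃[ a ] ∃[ b ] ∃[ c ]
  HasLength n (x ⟦_⟧) a ×
  HasLength n (y ⟦_⟧) b ×
  HasLength n (λ i → y ⟦ x ⁻¹⟦ i ⟧ ⟧) c ×
  + c ≡ + b ℤ.- + a

-- ⊓ and ⊔ treat i < j and j < i at once. No k qualifies when i ≡ j, so _≼[_]_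
-- is reflexive.
Separated : ∀ {n} → AffinePermutation n → ℤ → ℤ → Set
Separated w i j =
  ∃[ k ] i ⊓ j ℤ.< k × k ℤ.< i ⊔ j × w ⟦ i ⟧ ⊔ w ⟦ j ⟧ ℤ.< w ⟦ k ⟧

infix 4 _≼[_]_ _≡syl_

_≼[_]_ : ∀ {n} → ℤ → AffinePermutation n → ℤ → Set
i ≼[ w ] j = w ⟦ i ⟧ ℤ.≤ w ⟦ j ⟧ × ¬ Separated w i j

_≡syl_ : ∀ {n} → AffinePermutation n → AffinePermutation n → Set
v ≡syl w = ∀ i j → (i ≼[ v ] j) ⇔ (i ≼[ w ] j)

-- The graph of π↓: u is a ≤L-minimal element of the class of w.
IsProjection : ∀ {n} → AffinePermutation n → AffinePermutation n → Set
IsProjection w u = u ≡syl w × (∀ x → x ≡syl w → x ≤L u → x ≈ u)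

-- The graph of the affine stack-sorting map: w is sent to v = w ∘ π↓(w)⁻¹.
StackSortsTo : ∀ {n} → AffinePermutation n → AffinePermutation n → Set
StackSortsTo w v = ∃[ u ] IsProjection w u × (∀ i → v ⟦ i ⟧ ≡ w ⟦ u ⁻¹⟦ i ⟧ ⟧)

-- Elements are compared as permutations; the witness for π↓ is ignored.
Fiber : ∀ {n} → AffinePermutation n → Setoid 0ℓ 0ℓ
Fiber {n} v =
  On.setoid {B = Σ[ w ∈ AffinePermutation n ] StackSortsTo w v}
            (ℤ →-setoid ℤ) (λ (w , _) → w ⟦_⟧)

-- The plot of z(0) ⋯ z(N-1). Distinctness of the entries is not built in; it holds
-- for the words to which this is applied, as they are factors of a permutation.
module _ {N : ℕ} (z : Vector ℤ N) where

  IsDescent : Fin N → Set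
  IsDescent d = ∃[ e ] toℕ e ≡ suc (toℕ d) × z e ℤ.< z d

  isDescent? : Decidable IsDescent
  isDescent? d = Fin.any? λ e → toℕ e ℕ.≟ suc (toℕ d) ×-dec z e ℤ.<? z d

  descents : List (Fin N)
  descents = List.filter isDescent? (List.allFin N)

  record Hook : Set where
    field
      sw ne : Fin N
      sw<ne : sw Fin.< ne
      rises : z sw ℤ.< z ne

  open Hook public using (sw; ne)

  SW NE : Hook → Fin N × ℤ
  SW H = sw H , z (sw H)
  NE H = ne H , z (ne H)

  -- The lattice points on a hook. The segments are axis-parallel with lattice
  -- endpoints, so two hooks that meet at all meet in a lattice point.
  OnHook : Hook → Fin N × ℤ → Set
  OnHook H (x , y) =
    (x ≡ sw H × z (sw H) ℤ.≤ y × y ℤ.≤ z (ne H)) ⊎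
    (y ≡ z (ne H) × sw H Fin.≤ x × x Fin.≤ ne H)

  LiesAbove : Fin N → Hook → Set
  LiesAbove p H = sw H Fin.≤ p × p Fin.≤ ne H × z (ne H) ℤ.< z p

  record VHC : Set where
    field
      hooks      : Vector Hook (length descents)
      atDescents : ∀ i → sw (hooks i) ≡ List.lookup descents i
      noneAbove  : ∀ i p → ¬ LiesAbove p (hooks i)
      disjoint   : ∀ i j → i ≢ j → ∀ pt →
                   OnHook (hooks i) pt → OnHook (hooks j) pt →
                   (pt ≡ NE (hooks i) × pt ≡ SW (hooks j)) ⊎
                   (pt ≡ SW (hooks i) × pt ≡ NE (hooks j))

  -- The vertical ray upwards from the point at p meets H. Since sw H < p is
  -- strict, a southwest endpoint does not see its own hook.
  Sees : Fin N → Hook → Set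
  Sees p H = sw H Fin.< p × p Fin.≤ ne H × z p ℤ.< z (ne H)

  sees? : ∀ p H → Dec (Sees p H)
  sees? p H = sw H Fin.<? p ×-dec p Fin.≤? ne H ×-dec z p ℤ.<? z (ne H)

  module _ (𝓗 : VHC) where
    open VHC 𝓗 using (hooks)

    IsColoured : Fin N → Set
    IsColoured p = ∀ j → ¬ (p ≡ ne (hooks j))

    isColoured? : Decidable IsColoured
    isColoured? p = Fin.all? λ j → ¬? (p Fin.≟ ne (hooks j))

    -- The first hook seen is the lowest of those met by the ray.
    HasColour : Fin (length descents) → Fin N → Set
    HasColour i p = IsColoured p × Sees p (hooks i) ×
      (∀ j → Sees p (hooks j) → z (ne (hooks i)) ℤ.≤ z (ne (hooks j)))

    hasColour? : ∀ i → Decidable (HasColour i)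
    hasColour? i p = isColoured? p ×-dec sees? p (hooks i) ×-dec
      Fin.all? (λ j → sees? p (hooks j) →-dec z (ne (hooks i)) ℤ.≤? z (ne (hooks j)))

    IsBlue : Fin N → Set
    IsBlue p = IsColoured p × (∀ j → ¬ Sees p (hooks j))

    isBlue? : Decidable IsBlue
    isBlue? p = isColoured? p ×-dec Fin.all? (λ j → ¬? (sees? p (hooks j)))

    -- (q₀, …, qₖ), for a nonempty word.
    colourCounts : List ℕ
    colourCounts = Vec.count isBlue? (Vec.allFin N) ∷
      List.tabulate (λ i → Vec.count (hasColour? i) (Vec.allFin N))

    endpoints : List (ℕ × ℕ)
    endpoints = List.tabulate (λ i → toℕ (sw (hooks i)) , toℕ (ne (hooks i)))

composition : ∀ {N} (z : Vector ℤ N) → VHC z → List ℕ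
composition {zero}  z 𝓗 = []
composition {suc _} z 𝓗 = colourCounts z 𝓗

catalan : ℕ → ℕ
catalan q = ((2 ℕ.* q) C q) / suc q

catalanProduct : List ℕ → ℕ
catalanProduct qs = product (List.map catalan qs)

module _ {n : ℕ} (v : AffinePermutation n) where

  IsLeftToRightMaximum : ℤ → Set
  IsLeftToRightMaximum m = ∀ i → i ℤ.< v ⁻¹⟦ m ⟧ → v ⟦ i ⟧ ℤ.< m

  -- Subsets of ℤ are given by their characteristic functions.
  record Sky : Set where
    field
      member   : ℤ → Bool
      nonempty : ∃[ m ] T (member m)
      periodic : ∀ m → member (m ℤ.+ + n) ≡ member m
      maxima   : ∀ m → T (member m) → IsLeftToRightMaximum m

  -- M = {⋯ < m₀ < m₁ < m₂ < ⋯}, with v⁻¹(m₁) ≤ 1 < v⁻¹(m₂). The values of m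
  -- and r are determined by M, so this involves no choice.
  record Indexing (M : Sky) : Set where
    open Sky M using (member)
    field
      m          : ℤ → ℤ
      increasing : ∀ j → m j ℤ.< m (j ℤ.+ 1ℤ)
      range      : ∀ x → T (member x) ⇔ (∃[ j ] m j ≡ x)
      m₁≤1       : v ⁻¹⟦ m (+ 1) ⟧ ℤ.≤ 1ℤ
      1<m₂       : 1ℤ ℤ.< v ⁻¹⟦ m (+ 2) ⟧
      r          : ℕ
      r>0        : 0 ℕ.< r
      shift      : ∀ j → m (j ℤ.+ + r) ≡ m j ℤ.+ + n

    position : ℤ → ℤ
    position j = v ⁻¹⟦ m j ⟧

    gap : ℤ → ℕ
    gap j = ∣ position (j ℤ.+ 1ℤ) ℤ.- position j ∣ ℕ.∸ 1

    -- The entries of v strictly between mⱼ and mⱼ₊₁.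
    between : (j : ℤ) → Vector ℤ (gap j)
    between j a = v ⟦ position j ℤ.+ + suc (toℕ a) ⟧

    -- z₁, …, zᵣ, indexed from 0.
    z : (i : Fin r) → Vector ℤ (gap (+ suc (toℕ i)))
    z i = between (+ suc (toℕ i))

  record AVHC : Set where
    field
      skyline  : Sky
      indexing : Indexing skyline
    open Indexing indexing using (r; z)
    field
      configurations : (i : Fin r) → VHC (z i)

    affineComposition : List ℕ
    affineComposition = List.concat (List.tabulate (λ i → composition (z i) (configurations i)))

    hookData : List (List (ℕ × ℕ))
    hookData = List.tabulate (λ i → endpoints (z i) (configurations i))

  -- Two affine valid hook configurations are equal when they have the same
  -- skyline and the same hooks. The hooks of the i-th word are compared through
  -- the positions of their endpoints, because the types of z depend on the skyline.
  AVHC-setoid : Setoid 0ℓ 0ℓ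
  AVHC-setoid =
    On.setoid {B = AVHC}
              (×-setoid (ℤ →-setoid Bool) (setoid (List (List (ℕ × ℕ)))))
              (λ 𝓗 → Sky.member (AVHC.skyline 𝓗) , AVHC.hookData 𝓗)

  weight : AVHC → ℕ
  weight 𝓗 = catalanProduct (AVHC.affineComposition 𝓗)

{-# OPTIONS --safe #-}
-- A word w lies in the fibre over v exactly when w = v ∘ u with u = π↓(w), and u is minimal
-- in its class if and only if it avoids the pattern 231.  The left-to-right maxima of such a
-- u form a skyline of v; between consecutive elements s < s′ of the skyline, u sends s + 1
-- to s′ and is otherwise the inorder-to-postorder permutation of a decreasing binary tree
-- on the entries of v strictly between them.  So the fibre is counted by the sum over all
-- skylines of the products of the numbers of decreasing trees of the blocks.  For a single
-- word, decreasing trees and weighted valid hook configurations obey the same recursion on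
-- the last letter: the splits at a descent are the hooks ending at the last point, and all
-- other splits are absorbed by the Catalan recurrence, since the points not under a hook
-- cut the word at its blue points.
module Submission where

open import Defs
open import Data.Nat using (ℕ; NonZero)
open import Data.Product using (_×_; ∃-syntax)
open import Data.Bool.Base using (Bool; true; false; T; if_then_else_; _∧_)
import Data.Bool.Properties as Bool
open import Data.Empty using (⊥; ⊥-elim)
open import Data.Fin.Base as Fin using (Fin; toℕ; fromℕ<)
open import Data.Fin.Permutation using (permutation; Permutation)
import Data.Fin.Properties as Fin
open import Data.Integer.Base as ℤ using (ℤ; +_; -[1+_]; 0ℤ; 1ℤ; ∣_∣)
import Data.Integer.DivMod as ℤ
import Data.Integer.Properties as ℤ
import Data.Integer.Solver as ℤSolver
open import Data.List.Base as List using (List; []; _∷_; _++_)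
open import Data.List.Membership.Propositional using (_∈_)
import Data.List.Membership.Propositional.Properties as ∈
import Data.List.Properties as List
open import Data.List.Relation.Unary.All as All using (All; []; _∷_)
import Data.List.Relation.Unary.All.Properties as All
open import Data.List.Relation.Unary.AllPairs using (AllPairs; []; _∷_)
open import Data.List.Relation.Unary.Any as Any using (here; there)
import Data.List.Relation.Unary.Any.Properties as Any
open import Data.List.Relation.Unary.Unique.Propositional using (Unique)
import Data.List.Relation.Unary.Unique.Propositional.Properties as Unique
open import Data.List.Reverse using (Reverse; reverseView; []; _∶_∶ʳ_)
open import Data.Nat.Base as ℕ using (zero; suc)
open import Data.Nat.Combinatorics using (_C_; nC1≡n; nCk+nC[k+1]≡[n+1]C[k+1]; k>n⇒nCk≡0)
import Data.Nat.DivMod as ℕ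
open import Data.Nat.ListAction using (sum; product)
import Data.Nat.ListAction.Properties as ℕ
import Data.Nat.Properties as ℕ
import Data.Nat.Solver as ℕSolver
open import Data.Product.Base using (Σ; Σ-syntax; _,_; proj₁; proj₂)
open import Data.Sum.Base using (_⊎_; inj₁; inj₂)
open import Data.Unit.Base using (⊤; tt)
open import Data.Vec.Base as Vec using (Vec; []; _∷_)
open import Data.Vec.Functional using (Vector)
open import Data.Vec.N-ary using (N-ary; _$ⁿ_; curryⁿ; ∀ⁿ)
import Data.Vec.Properties as Vec
open import Function.Base using (_∘_; _∘′_; id; case_of_; _$_)
open import Function.Bundles using (_⇔_; mk⇔; Equivalence; Inverse; mk↔ₛ′)
open import Function.Definitions using (Injective)
open import Level using (0ℓ)
open import Relation.Binary.Bundles using (Setoid)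
open import Relation.Binary.Definitions using (tri<; tri≈; tri>)
open import Relation.Binary.PropositionalEquality
open import Relation.Nullary using (¬_; Dec; yes; no; does; contradiction)
open import Relation.Nullary.Decidable using (does-⇔; dec-true; dec-false; _×-dec_; _→-dec_; map′)
import Algebra.Properties.CommutativeSemigroup ℤ.+-commutativeSemigroup as ℤ+
import Algebra.Properties.CommutativeMonoid.Sum ℤ.+-0-commutativeMonoid as ∑

-- Linear arithmetic by Farkas certificates

Row : ℕ → Set
Row k = Vec ℤ (suc k)

dot : ∀ {k} → Vec ℤ k → Vec ℤ k → ℤ
dot []       []       = 0ℤ
dot (c ∷ cs) (x ∷ xs) = c ℤ.* x ℤ.+ dot cs xs

zeroRow : ∀ {k} → Vec ℤ k
zeroRow = Vec.replicate _ 0ℤ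

infixl 6 _⊞_
infixr 7 _⊡_

_⊞_ : ∀ {k} → Vec ℤ k → Vec ℤ k → Vec ℤ k
_⊞_ = Vec.zipWith ℤ._+_

_⊡_ : ∀ {k} → ℤ → Vec ℤ k → Vec ℤ k
c ⊡ u = Vec.map (c ℤ.*_) u

dot-zero : ∀ {k} (ρ : Vec ℤ k) → dot zeroRow ρ ≡ 0ℤ
dot-zero []      = refl
dot-zero (x ∷ ρ) = trans (cong₂ ℤ._+_ (ℤ.*-zeroˡ x) (dot-zero ρ)) refl

dot-⊞ : ∀ {k} (u v ρ : Vec ℤ k) → dot (u ⊞ v) ρ ≡ dot u ρ ℤ.+ dot v ρ
dot-⊞ []      []      []      = refl
dot-⊞ (a ∷ u) (b ∷ v) (x ∷ ρ) =
  trans (cong₂ ℤ._+_ (ℤ.*-distribʳ-+ x a b) (dot-⊞ u v ρ))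
        (ℤ+.interchange (a ℤ.* x) (b ℤ.* x) (dot u ρ) (dot v ρ))

dot-⊡ : ∀ {k} c (u ρ : Vec ℤ k) → dot (c ⊡ u) ρ ≡ c ℤ.* dot u ρ
dot-⊡ c []      []      = sym (ℤ.*-zeroʳ c)
dot-⊡ c (a ∷ u) (x ∷ ρ) =
  trans (cong₂ ℤ._+_ (ℤ.*-assoc c a x) (dot-⊡ c u ρ))
        (sym (ℤ.*-distribˡ-+ c (a ℤ.* x) (dot u ρ)))

data Expr (k : ℕ) : Set where
  var  : Fin k → Expr k
  lit  : ℕ → Expr k
  _:+_ : Expr k → Expr k → Expr k
  _:-_ : Expr k → Expr k → Expr k
  _:*_ : ℕ → Expr k → Expr k

data ExprN (k : ℕ) : Set where
  var  : Fin k → ExprN k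
  lit  : ℕ → ExprN k
  _:+_ : ExprN k → ExprN k → ExprN k
  _:*_ : ℕ → ExprN k → ExprN k

data Atom (E : Set) : Set where
  _:≤_ _:<_ _:≡_ : E → E → Atom E
  :⊥             : Atom E

data Sequent (E : Set) : Set where
  _⊢_ : List (Atom E) → Atom E → Sequent E

infixl 7 _:+_ _:-_
infixr 8 _:*_
infix  6 _:≤_ _:<_ _:≡_
infix  3 _⊢_

unit : ∀ {k} → Fin k → Vec ℤ k
unit Fin.zero    = 1ℤ ∷ zeroRow
unit (Fin.suc i) = 0ℤ ∷ unit i

dot-unit : ∀ {k} (i : Fin k) ρ → dot (unit i) ρ ≡ Vec.lookup ρ i
dot-unit Fin.zero    (x ∷ ρ) =
  trans (cong₂ ℤ._+_ (ℤ.*-identityˡ x) (dot-zero ρ)) (ℤ.+-identityʳ x)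
dot-unit (Fin.suc i) (x ∷ ρ) =
  trans (cong₂ ℤ._+_ (ℤ.*-zeroˡ x) (dot-unit i ρ)) (ℤ.+-identityˡ _)

row : ∀ {k} → Expr k → Row k
row (var i)  = 0ℤ ∷ unit i
row (lit n)  = + n ∷ zeroRow
row (a :+ b) = row a ⊞ row b
row (a :- b) = row a ⊞ (ℤ.- 1ℤ ⊡ row b)
row (n :* a) = + n ⊡ row a

⟪_⟫ : ∀ {k} → Expr k → Vec ℤ k → ℤ
⟪ var i  ⟫ ρ = Vec.lookup ρ i
⟪ lit n  ⟫ ρ = + n
⟪ a :+ b ⟫ ρ = ⟪ a ⟫ ρ ℤ.+ ⟪ b ⟫ ρ
⟪ a :- b ⟫ ρ = ⟪ a ⟫ ρ ℤ.- ⟪ b ⟫ ρ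
⟪ n :* a ⟫ ρ = + n ℤ.* ⟪ a ⟫ ρ

row-correct : ∀ {k} (e : Expr k) ρ → dot (row e) (1ℤ ∷ ρ) ≡ ⟪ e ⟫ ρ
row-correct (var i)  ρ = trans (ℤ.+-identityˡ _) (dot-unit i ρ)
row-correct (lit n)  ρ =
  trans (cong₂ ℤ._+_ (ℤ.*-identityʳ (+ n)) (dot-zero ρ)) (ℤ.+-identityʳ (+ n))
row-correct (a :+ b) ρ =
  trans (dot-⊞ (row a) (row b) _) (cong₂ ℤ._+_ (row-correct a ρ) (row-correct b ρ))
row-correct (a :- b) ρ =
  trans (dot-⊞ (row a) _ _)
    (cong₂ ℤ._+_ (row-correct a ρ)
      (trans (dot-⊡ (ℤ.- 1ℤ) (row b) _)
        (trans (ℤ.-1*i≡-i _) (cong ℤ.-_ (row-correct b ρ)))))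
row-correct (n :* a) ρ = trans (dot-⊡ (+ n) (row a) _) (cong (+ n ℤ.*_) (row-correct a ρ))

rowsOf : ∀ {k} → Atom (Expr k) → List (Row k)
rowsOf (a :≤ b) = row (b :- a) ∷ []
rowsOf (a :< b) = row (b :- (lit 1 :+ a)) ∷ []
rowsOf (a :≡ b) = row (b :- a) ∷ row (a :- b) ∷ []
rowsOf :⊥       = []

⟪_⟫ᵃ : ∀ {k} → Atom (Expr k) → Vec ℤ k → Set
⟪ a :≤ b ⟫ᵃ ρ = ⟪ a ⟫ ρ ℤ.≤ ⟪ b ⟫ ρ
⟪ a :< b ⟫ᵃ ρ = ⟪ a ⟫ ρ ℤ.< ⟪ b ⟫ ρ
⟪ a :≡ b ⟫ᵃ ρ = ⟪ a ⟫ ρ ≡ ⟪ b ⟫ ρ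
⟪ :⊥     ⟫ᵃ ρ = ⊥

NonNegRow : ∀ {k} → Vec ℤ k → Row k → Set
NonNegRow ρ u = 0ℤ ℤ.≤ dot u (1ℤ ∷ ρ)

row-nonneg : ∀ {k} (a b : Expr k) ρ → ⟪ a ⟫ ρ ℤ.≤ ⟪ b ⟫ ρ → NonNegRow ρ (row (b :- a))
row-nonneg a b ρ p = subst (0ℤ ℤ.≤_) (sym (row-correct (b :- a) ρ)) (ℤ.i≤j⇒0≤j-i p)

rowsOf-nonneg : ∀ {k} (h : Atom (Expr k)) ρ → ⟪ h ⟫ᵃ ρ → All (NonNegRow ρ) (rowsOf h)
rowsOf-nonneg (a :≤ b) ρ p = row-nonneg a b ρ p ∷ []
rowsOf-nonneg (a :< b) ρ p = row-nonneg (lit 1 :+ a) b ρ (ℤ.i<j⇒suc[i]≤j p) ∷ []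
rowsOf-nonneg (a :≡ b) ρ p =
  row-nonneg a b ρ (ℤ.≤-reflexive p) ∷ row-nonneg b a ρ (ℤ.≤-reflexive (sym p)) ∷ []
rowsOf-nonneg :⊥       ρ ()

combine : ∀ {k} → List ℕ → List (Row k) → Row k
combine (c ∷ cs) (u ∷ us) = (+ c ⊡ u) ⊞ combine cs us
combine _        _        = zeroRow

combine-nonneg : ∀ {k} cs {us : List (Row k)} ρ → All (NonNegRow ρ) us →
                 NonNegRow ρ (combine cs us)
combine-nonneg []       ρ ps = ℤ.≤-reflexive (sym (dot-zero (1ℤ ∷ ρ)))
combine-nonneg (c ∷ cs) ρ [] = ℤ.≤-reflexive (sym (dot-zero (1ℤ ∷ ρ)))
combine-nonneg (c ∷ cs) {u ∷ us} ρ (p ∷ ps) =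
  subst (0ℤ ℤ.≤_)
    (sym (trans (dot-⊞ (+ c ⊡ u) (combine cs us) _) (cong (ℤ._+ _) (dot-⊡ (+ c) u _))))
    (ℤ.+-mono-≤ (subst (ℤ._≤ + c ℤ.* dot u (1ℤ ∷ ρ)) (ℤ.*-zeroʳ (+ c))
                   (ℤ.*-monoˡ-≤-nonNeg (+ c) p))
                (combine-nonneg cs ρ ps))

allZero : ∀ {k} → Vec ℤ k → Bool
allZero []        = true
allZero (+ 0 ∷ u) = allZero u
allZero (_ ∷ u)   = false

isNegative : ∀ {k} → Row k → Bool
isNegative (-[1+ _ ] ∷ u) = allZero u
isNegative _              = false

allZero-dot : ∀ {k} (u : Vec ℤ k) ρ → T (allZero u) → dot u ρ ≡ 0ℤ
allZero-dot []              []      _ = refl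
allZero-dot (+ zero ∷ u)    (x ∷ ρ) t =
  trans (cong₂ ℤ._+_ (ℤ.*-zeroˡ x) (allZero-dot u ρ t)) refl
allZero-dot (+ suc _ ∷ u)   (x ∷ ρ) ()
allZero-dot (-[1+ _ ] ∷ u)  (x ∷ ρ) ()

isNegative-refutes : ∀ {k} (u : Row k) ρ → T (isNegative u) → ¬ NonNegRow ρ u
isNegative-refutes (+ _ ∷ u) ρ ()
isNegative-refutes (-[1+ n ] ∷ u) ρ t p
  with subst (0ℤ ℤ.≤_)
         (trans (cong₂ ℤ._+_ (ℤ.*-identityʳ -[1+ n ]) (allZero-dot u ρ t))
                (ℤ.+-identityʳ -[1+ n ])) p
... | ()

-- The search for a certificate is Fourier–Motzkin elimination; it is not trusted,
-- as its outcome is checked by `isNegative ∘ combine`.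
module Search where
  Item : ℕ → Set
  Item k = Vec ℤ k × ℤ × List ℕ

  addCert : List ℕ → List ℕ → List ℕ
  addCert []       ds       = ds
  addCert cs       []       = cs
  addCert (c ∷ cs) (d ∷ ds) = c ℕ.+ d ∷ addCert cs ds

  scale : ∀ {k} → ℕ → Item k → Item k
  scale c (u , a , cs) = (+ c ⊡ u) , + c ℤ.* a , List.map (c ℕ.*_) cs

  add : ∀ {k} → Item k → Item k → Item k
  add (u , a , cs) (v , b , ds) = u ⊞ v , a ℤ.+ b , addCert cs ds

  tail : ∀ {k} → Item (suc k) → Item k
  tail (_ ∷ u , a , cs) = u , a , cs

  zeros positives negatives : ∀ {k} → List (Item (suc k)) → List (Item (suc k))
  zeros [] = []
  zeros (i@(+ 0 ∷ _ , _) ∷ is) = i ∷ zeros is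
  zeros (_ ∷ is) = zeros is
  positives [] = []
  positives (i@(+ suc _ ∷ _ , _) ∷ is) = i ∷ positives is
  positives (_ ∷ is) = positives is
  negatives [] = []
  negatives (i@(-[1+ _ ] ∷ _ , _) ∷ is) = i ∷ negatives is
  negatives (_ ∷ is) = negatives is

  resolve : ∀ {k} → Item (suc k) → Item (suc k) → Item k
  resolve p@(c ∷ _ , _) q@(d ∷ _ , _) = tail (add (scale ∣ d ∣ p) (scale ∣ c ∣ q))

  eliminate : ∀ {k} → List (Item (suc k)) → List (Item k)
  eliminate is = List.map tail (zeros is) ++
    List.cartesianProductWith resolve (positives is) (negatives is)

  contradictory : List (Item 0) → List ℕ
  contradictory [] = []
  contradictory (([] , -[1+ _ ] , cs) ∷ is) = cs
  contradictory (([] , + _ , cs) ∷ is) = contradictory is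

  run : ∀ k → List (Item k) → List ℕ
  run zero    is = contradictory is
  run (suc k) is = run k (eliminate is)

  start : ∀ {k} → ℕ → List (Row k) → List (Item k)
  start n []              = []
  start n ((a ∷ u) ∷ us) = (u , a , List.replicate n 0 ++ 1 ∷ []) ∷ start (suc n) us

certificate : ∀ {k} → List (Row k) → List ℕ
certificate us = Search.run _ (Search.start 0 us)

refutable : ∀ {k} → List (Row k) → Bool
refutable us = isNegative (combine (certificate us) us)

refute : ∀ {k} (us : List (Row k)) ρ → T (refutable us) → ¬ All (NonNegRow ρ) us
refute us ρ t ps =
  isNegative-refutes (combine (certificate us) us) ρ t (combine-nonneg (certificate us) ρ ps)

hypRows : ∀ {k} → List (Atom (Expr k)) → List (Row k)
hypRows []       = []
hypRows (h ∷ hs) = rowsOf h ++ hypRows hs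

provable : ∀ {k} → List (Row k) → Atom (Expr k) → Bool
provable us (a :≤ b) = refutable (row (a :- (lit 1 :+ b)) ∷ us)
provable us (a :< b) = refutable (row (a :- b) ∷ us)
provable us (a :≡ b) = provable us (a :≤ b) ∧ provable us (b :≤ a)
provable us :⊥       = refutable us

T-∧₁ : ∀ {x y} → T (x ∧ y) → T x
T-∧₁ {true} _ = tt

T-∧₂ : ∀ {x y} → T (x ∧ y) → T y
T-∧₂ {true} t = t

prove≤ : ∀ {k} (us : List (Row k)) a b ρ → T (provable us (a :≤ b)) →
         All (NonNegRow ρ) us → ⟪ a ⟫ ρ ℤ.≤ ⟪ b ⟫ ρ
prove≤ us a b ρ t ps with ⟪ a ⟫ ρ ℤ.≤? ⟪ b ⟫ ρ
... | yes p = p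
... | no ¬p = ⊥-elim (refute _ ρ t
        (row-nonneg (lit 1 :+ b) a ρ (ℤ.i<j⇒suc[i]≤j (ℤ.≰⇒> ¬p)) ∷ ps))

prove : ∀ {k} (us : List (Row k)) g ρ → T (provable us g) →
        All (NonNegRow ρ) us → ⟪ g ⟫ᵃ ρ
prove us (a :≤ b) ρ t ps = prove≤ us a b ρ t ps
prove us (a :< b) ρ t ps with ⟪ a ⟫ ρ ℤ.<? ⟪ b ⟫ ρ
... | yes p = p
... | no ¬p = ⊥-elim (refute _ ρ t (row-nonneg b a ρ (ℤ.≮⇒≥ ¬p) ∷ ps))
prove us (a :≡ b) ρ t ps =
  ℤ.≤-antisym (prove≤ us a b ρ (T-∧₁ t) ps)
              (prove≤ us b a ρ (T-∧₂ {provable us (a :≤ b)} t) ps)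
prove us :⊥ ρ t ps = refute us ρ t ps

Implies : {E : Set} → (Atom E → Set) → List (Atom E) → Atom E → Set
Implies ⟪_⟫ₕ []       g = ⟪ g ⟫ₕ
Implies ⟪_⟫ₕ (h ∷ hs) g = ⟪ h ⟫ₕ → Implies ⟪_⟫ₕ hs g

implies : {E : Set} {⟪_⟫ₕ : Atom E → Set} (hs : List (Atom E)) {g : Atom E} →
          (All ⟪_⟫ₕ hs → ⟪ g ⟫ₕ) → Implies ⟪_⟫ₕ hs g
implies []       f = f []
implies (h ∷ hs) f = λ p → implies hs (λ ps → f (p ∷ ps))

hypRows-nonneg : ∀ {k} (hs : List (Atom (Expr k))) ρ → All (λ h → ⟪ h ⟫ᵃ ρ) hs →
                 All (NonNegRow ρ) (hypRows hs)
hypRows-nonneg []       ρ []       = []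
hypRows-nonneg (h ∷ hs) ρ (p ∷ ps) =
  All.++⁺ (rowsOf-nonneg h ρ p) (hypRows-nonneg hs ρ ps)

∀ⁿ-intro : ∀ n {P : Vec ℤ n → Set} → (∀ ρ → P ρ) → ∀ⁿ n (curryⁿ P)
∀ⁿ-intro zero    f = f []
∀ⁿ-intro (suc n) f = λ x → ∀ⁿ-intro n (λ ρ → f (x ∷ ρ))

∀ⁿ-introℕ : ∀ n {P : Vec ℕ n → Set} → (∀ ρ → P ρ) → ∀ⁿ n (curryⁿ P)
∀ⁿ-introℕ zero    f = f []
∀ⁿ-introℕ (suc n) f = λ x → ∀ⁿ-introℕ n (λ ρ → f (x ∷ ρ))

decide : ∀ {k} → Sequent (Expr k) → Bool
decide (hs ⊢ g) = provable (hypRows hs) g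

⟪_⟫ˢ : ∀ {k} → Sequent (Expr k) → Vec ℤ k → Set
⟪ hs ⊢ g ⟫ˢ ρ = Implies (λ a → ⟪ a ⟫ᵃ ρ) hs g

decide-sound : ∀ {k} (s : Sequent (Expr k)) → T (decide s) → ∀ ρ → ⟪ s ⟫ˢ ρ
decide-sound (hs ⊢ g) t ρ =
  implies hs (λ ps → prove (hypRows hs) g ρ t (hypRows-nonneg hs ρ ps))

vars : ∀ n → Vec (Expr n) n
vars n = Vec.tabulate var

lia : ∀ n (f : N-ary n (Expr n) (Sequent (Expr n))) → {T (decide (f $ⁿ vars n))} →
      ∀ⁿ n (curryⁿ ⟪ f $ⁿ vars n ⟫ˢ)
lia n f {t} = ∀ⁿ-intro n (decide-sound (f $ⁿ vars n) t)

⟪_⟫ᴺ : ∀ {k} → ExprN k → Vec ℕ k → ℕ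
⟪ var i  ⟫ᴺ ρ = Vec.lookup ρ i
⟪ lit n  ⟫ᴺ ρ = n
⟪ a :+ b ⟫ᴺ ρ = ⟪ a ⟫ᴺ ρ ℕ.+ ⟪ b ⟫ᴺ ρ
⟪ n :* a ⟫ᴺ ρ = n ℕ.* ⟪ a ⟫ᴺ ρ

⟪_⟫ᴺᵃ : ∀ {k} → Atom (ExprN k) → Vec ℕ k → Set
⟪ a :≤ b ⟫ᴺᵃ ρ = ⟪ a ⟫ᴺ ρ ℕ.≤ ⟪ b ⟫ᴺ ρ
⟪ a :< b ⟫ᴺᵃ ρ = ⟪ a ⟫ᴺ ρ ℕ.< ⟪ b ⟫ᴺ ρ
⟪ a :≡ b ⟫ᴺᵃ ρ = ⟪ a ⟫ᴺ ρ ≡ ⟪ b ⟫ᴺ ρ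
⟪ :⊥     ⟫ᴺᵃ ρ = ⊥

fromN : ∀ {k} → ExprN k → Expr k
fromN (var i)  = var i
fromN (lit n)  = lit n
fromN (a :+ b) = fromN a :+ fromN b
fromN (n :* a) = n :* fromN a

fromNᵃ : ∀ {k} → Atom (ExprN k) → Atom (Expr k)
fromNᵃ (a :≤ b) = fromN a :≤ fromN b
fromNᵃ (a :< b) = fromN a :< fromN b
fromNᵃ (a :≡ b) = fromN a :≡ fromN b
fromNᵃ :⊥       = :⊥

fromN-correct : ∀ {k} (e : ExprN k) ρ → ⟪ fromN e ⟫ (Vec.map +_ ρ) ≡ + ⟪ e ⟫ᴺ ρ
fromN-correct (var i)  ρ = Vec-lookup-map i ρ
  where
  Vec-lookup-map : ∀ {k} (i : Fin k) ρ → Vec.lookup (Vec.map +_ ρ) i ≡ + Vec.lookup ρ i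
  Vec-lookup-map Fin.zero    (x ∷ ρ) = refl
  Vec-lookup-map (Fin.suc i) (x ∷ ρ) = Vec-lookup-map i ρ
fromN-correct (lit n)  ρ = refl
fromN-correct (a :+ b) ρ = cong₂ ℤ._+_ (fromN-correct a ρ) (fromN-correct b ρ)
fromN-correct (n :* a) ρ =
  trans (cong (+ n ℤ.*_) (fromN-correct a ρ)) (sym (ℤ.pos-* n (⟪ a ⟫ᴺ ρ)))

fromNᵃ-⇒ : ∀ {k} (h : Atom (ExprN k)) ρ → ⟪ h ⟫ᴺᵃ ρ → ⟪ fromNᵃ h ⟫ᵃ (Vec.map +_ ρ)
fromNᵃ-⇒ (a :≤ b) ρ p =
  subst₂ ℤ._≤_ (sym (fromN-correct a ρ)) (sym (fromN-correct b ρ)) (ℤ.+≤+ p)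
fromNᵃ-⇒ (a :< b) ρ p =
  subst₂ ℤ._<_ (sym (fromN-correct a ρ)) (sym (fromN-correct b ρ)) (ℤ.+<+ p)
fromNᵃ-⇒ (a :≡ b) ρ p =
  trans (fromN-correct a ρ) (trans (cong +_ p) (sym (fromN-correct b ρ)))
fromNᵃ-⇒ :⊥       ρ ()

fromNᵃ-⇐ : ∀ {k} (h : Atom (ExprN k)) ρ → ⟪ fromNᵃ h ⟫ᵃ (Vec.map +_ ρ) → ⟪ h ⟫ᴺᵃ ρ
fromNᵃ-⇐ (a :≤ b) ρ p =
  ℤ.drop‿+≤+ (subst₂ ℤ._≤_ (fromN-correct a ρ) (fromN-correct b ρ) p)
fromNᵃ-⇐ (a :< b) ρ p =
  ℤ.drop‿+<+ (subst₂ ℤ._<_ (fromN-correct a ρ) (fromN-correct b ρ) p)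
fromNᵃ-⇐ (a :≡ b) ρ p =
  ℤ.+-injective (trans (sym (fromN-correct a ρ)) (trans p (fromN-correct b ρ)))
fromNᵃ-⇐ :⊥       ρ ()

nonnegRows : ∀ k → List (Row k)
nonnegRows k = List.tabulate (λ i → row (var i))

nonnegRows-nonneg : ∀ {k} (ρ : Vec ℕ k) → All (NonNegRow (Vec.map +_ ρ)) (nonnegRows k)
nonnegRows-nonneg ρ = All.tabulate⁺ λ i → subst (0ℤ ℤ.≤_)
  (sym (trans (row-correct (var i) (Vec.map +_ ρ)) (fromN-correct (var i) ρ))) (ℤ.+≤+ ℕ.z≤n)

decideN : ∀ {k} → Sequent (ExprN k) → Bool
decideN {k} (hs ⊢ g) = provable (nonnegRows k ++ hypRows (List.map fromNᵃ hs)) (fromNᵃ g)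

⟪_⟫ᴺˢ : ∀ {k} → Sequent (ExprN k) → Vec ℕ k → Set
⟪ hs ⊢ g ⟫ᴺˢ ρ = Implies (λ a → ⟪ a ⟫ᴺᵃ ρ) hs g

decideN-sound : ∀ {k} (s : Sequent (ExprN k)) → T (decideN s) → ∀ ρ → ⟪ s ⟫ᴺˢ ρ
decideN-sound {k} (hs ⊢ g) t ρ = implies hs λ ps →
  fromNᵃ-⇐ g ρ (prove (nonnegRows k ++ hypRows (List.map fromNᵃ hs)) (fromNᵃ g) (Vec.map +_ ρ) t
    (All.++⁺ (nonnegRows-nonneg ρ)
      (hypRows-nonneg (List.map fromNᵃ hs) (Vec.map +_ ρ)
        (All.map⁺ (All.map (λ {h} → fromNᵃ-⇒ h ρ) ps)))))

varsN : ∀ n → Vec (ExprN n) n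
varsN n = Vec.tabulate var

liaN : ∀ n (f : N-ary n (ExprN n) (Sequent (ExprN n))) → {T (decideN (f $ⁿ varsN n))} →
       ∀ⁿ n (curryⁿ ⟪ f $ⁿ varsN n ⟫ᴺˢ)
liaN n f {t} = ∀ⁿ-introℕ n (decideN-sound (f $ⁿ varsN n) t)

-- The Catalan recurrence

module _ where
  open ≡-Reasoning
  open ℕSolver.+-*-Solver using (solve; _:=_; con) renaming (_:+_ to _⊕_; _:*_ to _⊗_)

  absorption : ∀ n k → suc k ℕ.* (suc n C suc k) ≡ suc n ℕ.* (n C k)
  absorption zero    zero    = refl
  absorption zero    (suc k) = trans
    (cong (suc (suc k) ℕ.*_) (k>n⇒nCk≡0 {1} {suc (suc k)} (ℕ.s≤s (ℕ.s≤s ℕ.z≤n))))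
    (trans (ℕ.*-zeroʳ (suc (suc k)))
           (sym (cong (1 ℕ.*_) (k>n⇒nCk≡0 {0} {suc k} (ℕ.s≤s ℕ.z≤n)))))
  absorption (suc n) zero    =
    trans (ℕ.*-identityˡ _) (trans (nC1≡n (suc (suc n))) (sym (ℕ.*-identityʳ _)))
  absorption (suc n) (suc k) = begin
    suc (suc k) ℕ.* (suc (suc n) C suc (suc k))
      ≡⟨ cong (suc (suc k) ℕ.*_) (nCk+nC[k+1]≡[n+1]C[k+1] (suc n) (suc k)) ⟨
    suc (suc k) ℕ.* (a ℕ.+ suc n C suc (suc k))
      ≡⟨ ℕ.*-distribˡ-+ (suc (suc k)) a _ ⟩
    suc (suc k) ℕ.* a ℕ.+ suc (suc k) ℕ.* (suc n C suc (suc k))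
      ≡⟨ cong₂ (λ p q → a ℕ.+ p ℕ.+ q) (absorption n k) (absorption n (suc k)) ⟩
    a ℕ.+ suc n ℕ.* (n C k) ℕ.+ suc n ℕ.* (n C suc k)
      ≡⟨ ℕ.+-assoc a _ _ ⟩
    a ℕ.+ (suc n ℕ.* (n C k) ℕ.+ suc n ℕ.* (n C suc k))
      ≡⟨ cong (a ℕ.+_) (ℕ.*-distribˡ-+ (suc n) (n C k) _) ⟨
    a ℕ.+ suc n ℕ.* (n C k ℕ.+ n C suc k)
      ≡⟨ cong (λ p → a ℕ.+ suc n ℕ.* p) (nCk+nC[k+1]≡[n+1]C[k+1] n k) ⟩
    suc (suc n) ℕ.* a ∎
    where a = suc n C suc k

  centralBinomial : ℕ → ℕ
  centralBinomial q = (2 ℕ.* q) C q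

  -- catalan q is the difference of two neighbouring binomial coefficients.
  catalan-centralBinomial : ∀ q → suc q ℕ.* catalan q ≡ centralBinomial q
  catalan-centralBinomial q = begin
    suc q ℕ.* catalan q           ≡⟨ cong (λ b → suc q ℕ.* (b ℕ./ suc q)) B≡ ⟨
    suc q ℕ.* (d ℕ.* suc q ℕ./ suc q) ≡⟨ cong (suc q ℕ.*_) (ℕ.m*n/n≡m d (suc q)) ⟩
    suc q ℕ.* d                   ≡⟨ ℕ.*-comm (suc q) d ⟩
    d ℕ.* suc q                   ≡⟨ B≡ ⟩
    B                           ∎
    where
    B = centralBinomial q
    A = (2 ℕ.* q) C suc q
    d = B ℕ.∸ A
    sucq*A : suc q ℕ.* A ≡ q ℕ.* B
    sucq*A = ℕ.+-cancelˡ-≡ (suc q ℕ.* B) _ _ $ begin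
      suc q ℕ.* B ℕ.+ suc q ℕ.* A  ≡⟨ ℕ.*-distribˡ-+ (suc q) B A ⟨
      suc q ℕ.* (B ℕ.+ A)        ≡⟨ cong (suc q ℕ.*_) (nCk+nC[k+1]≡[n+1]C[k+1] (2 ℕ.* q) q) ⟩
      suc q ℕ.* (suc (2 ℕ.* q) C suc q) ≡⟨ absorption (2 ℕ.* q) q ⟩
      suc (2 ℕ.* q) ℕ.* B
        ≡⟨ solve 2 (λ q B → (con 1 ⊕ con 2 ⊗ q) ⊗ B := (con 1 ⊕ q) ⊗ B ⊕ q ⊗ B) refl q B ⟩
      suc q ℕ.* B ℕ.+ q ℕ.* B      ∎
    B≡ : d ℕ.* suc q ≡ B
    B≡ = begin
      d ℕ.* suc q              ≡⟨ ℕ.*-comm d (suc q) ⟩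
      suc q ℕ.* (B ℕ.∸ A)      ≡⟨ ℕ.*-distribˡ-∸ (suc q) B A ⟩
      suc q ℕ.* B ℕ.∸ suc q ℕ.* A ≡⟨ cong (suc q ℕ.* B ℕ.∸_) sucq*A ⟩
      (B ℕ.+ q ℕ.* B) ℕ.∸ q ℕ.* B  ≡⟨ ℕ.m+n∸n≡m B (q ℕ.* B) ⟩
      B                      ∎

  centralBinomial-suc : ∀ q → suc q ℕ.* centralBinomial (suc q) ≡ 2 ℕ.* suc (2 ℕ.* q) ℕ.* centralBinomial q
  centralBinomial-suc q = begin
    suc q ℕ.* ((2 ℕ.* suc q) C suc q) ≡⟨ cong (λ m → suc q ℕ.* (m C suc q)) 2[1+q] ⟩
    suc q ℕ.* E                     ≡⟨ cong (suc q ℕ.*_) E≡2B ⟩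
    suc q ℕ.* (2 ℕ.* D)
      ≡⟨ solve 2 (λ q D → (con 1 ⊕ q) ⊗ (con 2 ⊗ D) := con 2 ⊗ ((con 1 ⊕ q) ⊗ D)) refl q D ⟩
    2 ℕ.* (suc q ℕ.* D)               ≡⟨ cong (2 ℕ.*_) (absorption (2 ℕ.* q) q) ⟩
    2 ℕ.* (suc (2 ℕ.* q) ℕ.* centralBinomial q) ≡⟨ ℕ.*-assoc 2 (suc (2 ℕ.* q)) _ ⟨
    2 ℕ.* suc (2 ℕ.* q) ℕ.* centralBinomial q   ∎
    where
    2[1+q] : 2 ℕ.* suc q ≡ suc (suc (2 ℕ.* q))
    2[1+q] = solve 1 (λ q → con 2 ⊗ (con 1 ⊕ q) := con 2 ⊕ con 2 ⊗ q) refl q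
    D = suc (2 ℕ.* q) C suc q
    F = suc (2 ℕ.* q) C q
    E = suc (suc (2 ℕ.* q)) C suc q
    E≡F+D : F ℕ.+ D ≡ E
    E≡F+D = nCk+nC[k+1]≡[n+1]C[k+1] (suc (2 ℕ.* q)) q
    E≡2F : E ≡ 2 ℕ.* F
    E≡2F = ℕ.*-cancelˡ-≡ E (2 ℕ.* F) (suc q) $ begin
      suc q ℕ.* E             ≡⟨ absorption (suc (2 ℕ.* q)) q ⟩
      suc (suc (2 ℕ.* q)) ℕ.* F
        ≡⟨ solve 2 (λ q F → (con 2 ⊕ con 2 ⊗ q) ⊗ F := (con 1 ⊕ q) ⊗ (con 2 ⊗ F)) refl q F ⟩
      suc q ℕ.* (2 ℕ.* F)       ∎
    F≡D : F ≡ D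
    F≡D = sym $ ℕ.+-cancelˡ-≡ F D F $ begin
      F ℕ.+ D   ≡⟨ E≡F+D ⟩
      E       ≡⟨ E≡2F ⟩
      2 ℕ.* F   ≡⟨ cong (F ℕ.+_) (ℕ.+-identityʳ F) ⟩
      F ℕ.+ F   ∎
    E≡2B : E ≡ 2 ℕ.* D
    E≡2B = trans E≡2F (cong (2 ℕ.*_) F≡D)

  catalan-suc : ∀ q → suc (suc q) ℕ.* catalan (suc q) ≡ (4 ℕ.* q ℕ.+ 2) ℕ.* catalan q
  catalan-suc q = ℕ.*-cancelˡ-≡ _ _ (suc q) $ begin
    suc q ℕ.* (suc (suc q) ℕ.* catalan (suc q)) ≡⟨ cong (suc q ℕ.*_) (catalan-centralBinomial (suc q)) ⟩
    suc q ℕ.* centralBinomial (suc q)         ≡⟨ centralBinomial-suc q ⟩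
    2 ℕ.* suc (2 ℕ.* q) ℕ.* centralBinomial q
      ≡⟨ cong (2 ℕ.* suc (2 ℕ.* q) ℕ.*_) (catalan-centralBinomial q) ⟨
    2 ℕ.* suc (2 ℕ.* q) ℕ.* (suc q ℕ.* catalan q)
      ≡⟨ solve 2 (λ q c → con 2 ⊗ (con 1 ⊕ con 2 ⊗ q) ⊗ ((con 1 ⊕ q) ⊗ c)
                       := (con 1 ⊕ q) ⊗ ((con 4 ⊗ q ⊕ con 2) ⊗ c)) refl q (catalan q) ⟩
    suc q ℕ.* ((4 ℕ.* q ℕ.+ 2) ℕ.* catalan q) ∎

  antidiagonalSum : ℕ → (ℕ → ℕ → ℕ) → ℕ
  antidiagonalSum zero    f = f 0 0
  antidiagonalSum (suc n) f = f (suc n) 0 ℕ.+ antidiagonalSum n (λ i j → f i (suc j))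

  antidiagonalSum-cong : ∀ n {f g : ℕ → ℕ → ℕ} → (∀ i j → i ℕ.+ j ≡ n → f i j ≡ g i j) →
                         antidiagonalSum n f ≡ antidiagonalSum n g
  antidiagonalSum-cong zero    h = h 0 0 refl
  antidiagonalSum-cong (suc n) h = cong₂ ℕ._+_ (h (suc n) 0 (ℕ.+-identityʳ (suc n)))
    (antidiagonalSum-cong n (λ i j eq → h i (suc j) (trans (ℕ.+-suc i j) (cong suc eq))))

  antidiagonalSum-+ : ∀ n (f g : ℕ → ℕ → ℕ) →
    antidiagonalSum n (λ i j → f i j ℕ.+ g i j) ≡ antidiagonalSum n f ℕ.+ antidiagonalSum n g
  antidiagonalSum-+ zero    f g = refl
  antidiagonalSum-+ (suc n) f g = trans
    (cong (f (suc n) 0 ℕ.+ g (suc n) 0 ℕ.+_) (antidiagonalSum-+ n _ _))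
    (solve 4 (λ a b c d → a ⊕ b ⊕ (c ⊕ d) := a ⊕ c ⊕ (b ⊕ d)) refl (f (suc n) 0) (g (suc n) 0) _ _)

  antidiagonalSum-* : ∀ n c (f : ℕ → ℕ → ℕ) →
    antidiagonalSum n (λ i j → c ℕ.* f i j) ≡ c ℕ.* antidiagonalSum n f
  antidiagonalSum-* zero    c f = refl
  antidiagonalSum-* (suc n) c f = trans
    (cong (c ℕ.* f (suc n) 0 ℕ.+_) (antidiagonalSum-* n c _))
    (sym (ℕ.*-distribˡ-+ c (f (suc n) 0) _))

  antidiagonalSum-sucˡ : ∀ n (f : ℕ → ℕ → ℕ) →
    antidiagonalSum (suc n) f ≡ f 0 (suc n) ℕ.+ antidiagonalSum n (λ i j → f (suc i) j)
  antidiagonalSum-sucˡ zero    f = ℕ.+-comm (f 1 0) (f 0 1)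
  antidiagonalSum-sucˡ (suc n) f = trans
    (cong (f (suc (suc n)) 0 ℕ.+_) (antidiagonalSum-sucˡ n (λ i j → f i (suc j))))
    (solve 3 (λ a b c → a ⊕ (b ⊕ c) := b ⊕ (a ⊕ c)) refl (f (suc (suc n)) 0) (f 0 (suc (suc n))) _)

  antidiagonalSum-swap : ∀ n (f : ℕ → ℕ → ℕ) →
    antidiagonalSum n f ≡ antidiagonalSum n (λ i j → f j i)
  antidiagonalSum-swap zero    f = refl
  antidiagonalSum-swap (suc n) f = trans
    (cong (f (suc n) 0 ℕ.+_) (antidiagonalSum-swap n (λ i j → f i (suc j))))
    (sym (antidiagonalSum-sucˡ n (λ i j → f j i)))

  private
    cc : ℕ → ℕ → ℕ
    cc i j = catalan i ℕ.* catalan j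

    icc : ℕ → ℕ → ℕ
    icc i j = i ℕ.* cc i j

  antidiagonalSum-icc : ∀ n → 2 ℕ.* antidiagonalSum n icc ≡ n ℕ.* antidiagonalSum n cc
  antidiagonalSum-icc n = begin
    2 ℕ.* D                                            ≡⟨ cong (D ℕ.+_) (ℕ.+-identityʳ D) ⟩
    D ℕ.+ D                                            ≡⟨ cong (D ℕ.+_) (antidiagonalSum-swap n icc) ⟩
    D ℕ.+ antidiagonalSum n (λ i j → icc j i)          ≡⟨ antidiagonalSum-+ n icc _ ⟨
    antidiagonalSum n (λ i j → icc i j ℕ.+ icc j i)    ≡⟨ antidiagonalSum-cong n lemma ⟩
    antidiagonalSum n (λ i j → n ℕ.* cc i j)           ≡⟨ antidiagonalSum-* n n cc ⟩
    n ℕ.* antidiagonalSum n cc                         ∎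
    where
    D = antidiagonalSum n icc
    lemma : ∀ i j → i ℕ.+ j ≡ n → icc i j ℕ.+ icc j i ≡ n ℕ.* cc i j
    lemma i j refl = solve 4 (λ i j a b → i ⊗ (a ⊗ b) ⊕ j ⊗ (b ⊗ a) := (i ⊕ j) ⊗ (a ⊗ b))
      refl i j (catalan i) (catalan j)

  -- Both sides of Σ (i+1) cᵢ cⱼ over i + j = n + 1 are computed: by symmetry, and by
  -- applying catalan-suc to the factor cᵢ.
  catalan-recurrence : ∀ n → catalan (suc n) ≡ antidiagonalSum n (λ i j → catalan i ℕ.* catalan j)
  catalan-recurrence zero    = refl
  catalan-recurrence (suc n) = ℕ.*-cancelˡ-≡ _ _ (suc (suc (suc n))) $ begin
    suc (suc (suc n)) ℕ.* catalan (suc (suc n))  ≡⟨ catalan-suc (suc n) ⟩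
    (4 ℕ.* suc n ℕ.+ 2) ℕ.* c                        ≡⟨ solve 2 (λ n c → (con 4 ⊗ (con 1 ⊕ n) ⊕ con 2) ⊗ c
                                                    := con 2 ⊗ c ⊕ (con 4 ⊗ n ⊕ con 4) ⊗ c) refl n c ⟩
    2 ℕ.* c ℕ.+ (4 ℕ.* n ℕ.+ 4) ℕ.* c
      ≡⟨ cong (λ s → 2 ℕ.* c ℕ.+ (4 ℕ.* n ℕ.+ 4) ℕ.* s) (catalan-recurrence n) ⟩
    2 ℕ.* c ℕ.+ (4 ℕ.* n ℕ.+ 4) ℕ.* S
      ≡⟨ solve 3 (λ n c S → con 2 ⊗ c ⊕ (con 4 ⊗ n ⊕ con 4) ⊗ S
                                                    := con 2 ⊗ c ⊕ (con 4 ⊗ (n ⊗ S) ⊕ con 4 ⊗ S)) refl n c S ⟩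
    2 ℕ.* c ℕ.+ (4 ℕ.* (n ℕ.* S) ℕ.+ 4 ℕ.* S)
      ≡⟨ cong (λ s → 2 ℕ.* c ℕ.+ (4 ℕ.* s ℕ.+ 4 ℕ.* S)) (antidiagonalSum-icc n) ⟨
    2 ℕ.* c ℕ.+ (4 ℕ.* (2 ℕ.* D) ℕ.+ 4 ℕ.* S)
      ≡⟨ solve 3 (λ c D S → con 2 ⊗ c ⊕ (con 4 ⊗ (con 2 ⊗ D) ⊕ con 4 ⊗ S)
                                                    := con 2 ⊗ (c ⊕ (con 4 ⊗ D ⊕ con 2 ⊗ S))) refl c D S ⟩
    2 ℕ.* (c ℕ.+ (4 ℕ.* D ℕ.+ 2 ℕ.* S))                  ≡⟨ cong (2 ℕ.*_) L≡ ⟨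
    2 ℕ.* L                                      ≡⟨ cong (2 ℕ.*_) L≡′ ⟩
    2 ℕ.* (D′ ℕ.+ S′)                              ≡⟨ ℕ.*-distribˡ-+ 2 D′ S′ ⟩
    2 ℕ.* D′ ℕ.+ 2 ℕ.* S′                            ≡⟨ cong (ℕ._+ 2 ℕ.* S′) (antidiagonalSum-icc (suc n)) ⟩
    suc n ℕ.* S′ ℕ.+ 2 ℕ.* S′                        ≡⟨ solve 2 (λ n S → (con 1 ⊕ n) ⊗ S ⊕ con 2 ⊗ S
                                                    := (con 3 ⊕ n) ⊗ S) refl n S′ ⟩
    suc (suc (suc n)) ℕ.* S′                     ∎
    where
    c = catalan (suc n)
    S = antidiagonalSum n cc
    D = antidiagonalSum n icc
    S′ = antidiagonalSum (suc n) cc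
    D′ = antidiagonalSum (suc n) icc
    L = antidiagonalSum (suc n) (λ i j → suc i ℕ.* cc i j)
    L≡′ : L ≡ D′ ℕ.+ S′
    L≡′ = trans (antidiagonalSum-+ (suc n) cc icc) (ℕ.+-comm S′ D′)
    term : ∀ i j → suc (suc i) ℕ.* cc (suc i) j ≡ 4 ℕ.* icc i j ℕ.+ 2 ℕ.* cc i j
    term i j = begin
      suc (suc i) ℕ.* (catalan (suc i) ℕ.* catalan j) ≡⟨ ℕ.*-assoc (suc (suc i)) (catalan (suc i)) (catalan j) ⟨
      suc (suc i) ℕ.* catalan (suc i) ℕ.* catalan j   ≡⟨ cong (ℕ._* catalan j) (catalan-suc i) ⟩
      (4 ℕ.* i ℕ.+ 2) ℕ.* catalan i ℕ.* catalan j         ≡⟨ solve 3 (λ i a b → (con 4 ⊗ i ⊕ con 2) ⊗ a ⊗ b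
                                                       := con 4 ⊗ (i ⊗ (a ⊗ b)) ⊕ con 2 ⊗ (a ⊗ b))
                                                       refl i (catalan i) (catalan j) ⟩
      4 ℕ.* icc i j ℕ.+ 2 ℕ.* cc i j                    ∎
    L≡ : L ≡ c ℕ.+ (4 ℕ.* D ℕ.+ 2 ℕ.* S)
    L≡ = begin
      L ≡⟨ antidiagonalSum-sucˡ n (λ i j → suc i ℕ.* cc i j) ⟩
      1 ℕ.* (1 ℕ.* c) ℕ.+ antidiagonalSum n (λ i j → suc (suc i) ℕ.* cc (suc i) j)
        ≡⟨ cong₂ ℕ._+_ (solve 1 (λ c → con 1 ⊗ (con 1 ⊗ c) := c) refl c) (antidiagonalSum-cong n
          (λ i j _ → term i j)) ⟩
      c ℕ.+ antidiagonalSum n (λ i j → 4 ℕ.* icc i j ℕ.+ 2 ℕ.* cc i j)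
        ≡⟨ cong (c ℕ.+_) (antidiagonalSum-+ n _ _) ⟩
      c ℕ.+ (antidiagonalSum n (λ i j → 4 ℕ.* icc i j) ℕ.+ antidiagonalSum n (λ i j → 2 ℕ.* cc i j))
        ≡⟨ cong (c ℕ.+_) (cong₂ ℕ._+_ (antidiagonalSum-* n 4 icc) (antidiagonalSum-* n 2 cc)) ⟩
      c ℕ.+ (4 ℕ.* D ℕ.+ 2 ℕ.* S) ∎

-- Enumerating decreasing trees and hook configurations on a word

concatSplits : {X : Set} → ℕ → (ℕ → ℕ → List X) → List X
concatSplits zero    F = F 0 0
concatSplits (suc n) F = F (suc n) 0 ++ concatSplits n (λ i j → F i (suc j))

module _ {X : Set} where

  concatSplits-cong : ∀ n {F G : ℕ → ℕ → List X} →
    (∀ i j → i ℕ.+ j ≡ n → F i j ≡ G i j) → concatSplits n F ≡ concatSplits n G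
  concatSplits-cong zero    h = h 0 0 refl
  concatSplits-cong (suc n) h = cong₂ _++_ (h (suc n) 0 (ℕ.+-identityʳ (suc n)))
    (concatSplits-cong n λ i j eq → h i (suc j) (trans (ℕ.+-suc i j) (cong suc eq)))

  ∈-concatSplits⁺ : ∀ i j (F : ℕ → ℕ → List X) {x} → x ∈ F i j → x ∈ concatSplits (i ℕ.+ j) F
  ∈-concatSplits⁺ zero    zero    F p = p
  ∈-concatSplits⁺ (suc i) zero    F p rewrite ℕ.+-identityʳ i = ∈.∈-++⁺ˡ p
  ∈-concatSplits⁺ i       (suc j) F p rewrite ℕ.+-suc i j =
    ∈.∈-++⁺ʳ _ (∈-concatSplits⁺ i j (λ i j → F i (suc j)) p)

  ∈-concatSplits⁻ : ∀ n (F : ℕ → ℕ → List X) {x} → x ∈ concatSplits n F →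
    ∃[ i ] ∃[ j ] i ℕ.+ j ≡ n × x ∈ F i j
  ∈-concatSplits⁻ zero    F p = 0 , 0 , refl , p
  ∈-concatSplits⁻ (suc n) F p with ∈.∈-++⁻ (F (suc n) 0) p
  ... | inj₁ q = suc n , 0 , ℕ.+-identityʳ (suc n) , q
  ... | inj₂ q with i , j , eq , r ← ∈-concatSplits⁻ n (λ i j → F i (suc j)) q =
    i , suc j , trans (ℕ.+-suc i j) (cong suc eq) , r

  concatSplits-unique : ∀ n (F : ℕ → ℕ → List X) (key : X → ℕ) →
    (∀ i j → i ℕ.+ j ≡ n → Unique (F i j)) → (∀ i j {x} → x ∈ F i j → key x ≡ i) →
    Unique (concatSplits n F)
  concatSplits-unique zero    F key u k = u 0 0 refl
  concatSplits-unique (suc n) F key u k = Unique.++⁺ (u (suc n) 0 (ℕ.+-identityʳ (suc n)))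
    (concatSplits-unique n _ key (λ i j eq → u i (suc j) (trans (ℕ.+-suc i j) (cong suc eq)))
      (λ i j → k i (suc j)))
    λ (p , q) → case ∈-concatSplits⁻ n _ q of λ (i , j , eq , r) →
      liaN 3 (λ i j n → i :+ j :≡ n ∷ i :≡ lit 1 :+ n ∷ [] ⊢ :⊥) i j n eq
        (trans (sym (k i (suc j) r)) (k (suc n) 0 p))

sumMap : {X : Set} → (X → ℕ) → List X → ℕ
sumMap f xs = sum (List.map f xs)

module _ {X : Set} where

  sumMap-++ : ∀ (f : X → ℕ) xs ys → sumMap f (xs ++ ys) ≡ sumMap f xs ℕ.+ sumMap f ys
  sumMap-++ f xs ys = trans (cong sum (List.map-++ f xs ys)) (ℕ.sum-++ (List.map f xs) (List.map f ys))

  sumMap-cong : ∀ {f g : X → ℕ} xs → (∀ {x} → x ∈ xs → f x ≡ g x) → sumMap f xs ≡ sumMap g xs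
  sumMap-cong []       h = refl
  sumMap-cong (x ∷ xs) h = cong₂ ℕ._+_ (h (here refl)) (sumMap-cong xs (h ∘ there))

  sumMap-+ : ∀ (f g : X → ℕ) xs → sumMap (λ x → f x ℕ.+ g x) xs ≡ sumMap f xs ℕ.+ sumMap g xs
  sumMap-+ f g []       = refl
  sumMap-+ f g (x ∷ xs) = trans (cong (f x ℕ.+ g x ℕ.+_) (sumMap-+ f g xs))
    (liaN 4 (λ a b c d → [] ⊢ a :+ b :+ (c :+ d) :≡ a :+ c :+ (b :+ d))
      (f x) (g x) (sumMap f xs) (sumMap g xs))

  sumMap-*ˡ : ∀ c (f : X → ℕ) xs → sumMap (λ x → c ℕ.* f x) xs ≡ c ℕ.* sumMap f xs
  sumMap-*ˡ c f []       = sym (ℕ.*-zeroʳ c)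
  sumMap-*ˡ c f (x ∷ xs) =
    trans (cong (c ℕ.* f x ℕ.+_) (sumMap-*ˡ c f xs)) (sym (ℕ.*-distribˡ-+ c (f x) _))

  sumMap-*ʳ : ∀ c (f : X → ℕ) xs → sumMap (λ x → f x ℕ.* c) xs ≡ sumMap f xs ℕ.* c
  sumMap-*ʳ c f xs = trans (sumMap-cong xs (λ {x} _ → ℕ.*-comm (f x) c))
    (trans (sumMap-*ˡ c f xs) (ℕ.*-comm c _))

  sumMap-1 : ∀ (xs : List X) → sumMap (λ _ → 1) xs ≡ List.length xs
  sumMap-1 []       = refl
  sumMap-1 (x ∷ xs) = cong suc (sumMap-1 xs)

  sumMap-concatSplits : ∀ n (f : X → ℕ) F →
    sumMap f (concatSplits n F) ≡ antidiagonalSum n (λ i j → sumMap f (F i j))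
  sumMap-concatSplits zero    f F = refl
  sumMap-concatSplits (suc n) f F = trans (sumMap-++ f (F (suc n) 0) _)
    (cong (sumMap f (F (suc n) 0) ℕ.+_) (sumMap-concatSplits n f _))

module _ {X Y : Set} where

  sumMap-map : ∀ (f : Y → ℕ) (g : X → Y) xs → sumMap f (List.map g xs) ≡ sumMap (f ∘ g) xs
  sumMap-map f g xs = cong sum (sym (List.map-∘ xs))

module _ {X Y Z : Set} where

  sumMap-product : ∀ (h : X → Y → Z) (f : Z → ℕ) (p : X → ℕ) (q : Y → ℕ) →
    (∀ x y → f (h x y) ≡ p x ℕ.* q y) → ∀ xs ys →
    sumMap f (List.cartesianProductWith h xs ys) ≡ sumMap p xs ℕ.* sumMap q ys
  sumMap-product h f p q eq []       ys = refl
  sumMap-product h f p q eq (x ∷ xs) ys = begin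
    sumMap f (List.map (h x) ys ++ List.cartesianProductWith h xs ys)
      ≡⟨ sumMap-++ f (List.map (h x) ys) _ ⟩
    sumMap f (List.map (h x) ys) ℕ.+ sumMap f (List.cartesianProductWith h xs ys)
      ≡⟨ cong₂ ℕ._+_ (trans (sumMap-map f (h x) ys) (sumMap-cong ys (λ {y} _ → eq x y)))
                     (sumMap-product h f p q eq xs ys) ⟩
    sumMap (λ y → p x ℕ.* q y) ys ℕ.+ sumMap p xs ℕ.* sumMap q ys
      ≡⟨ cong (ℕ._+ sumMap p xs ℕ.* sumMap q ys) (sumMap-*ˡ (p x) q ys) ⟩
    p x ℕ.* sumMap q ys ℕ.+ sumMap p xs ℕ.* sumMap q ys
      ≡⟨ ℕ.*-distribʳ-+ (sumMap q ys) (p x) (sumMap p xs) ⟨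
    (p x ℕ.+ sumMap p xs) ℕ.* sumMap q ys ∎
    where open ≡-Reasoning

data Tree : Set where
  leaf : Tree
  node : Tree → Tree → Tree

size : Tree → ℕ
size leaf       = 0
size (node l r) = suc (size l ℕ.+ size r)

-- `blue c` appends a blue point to the word of c, and `hook a b` appends a point that is
-- the northeast endpoint of a hook whose southwest endpoint is the last point of the word
-- of a, and below which the word of b lies.
data Config : Set where
  nil  : Config
  blue : Config → Config
  hook : Config → Config → Config

width : Config → ℕ
width nil        = 0
width (blue c)   = suc (width c)
width (hook a b) = suc (width a ℕ.+ width b)

blues : Config → ℕ
blues nil        = 0
blues (blue c)   = suc (blues c)
blues (hook a b) = blues a

otherWeight : Config → ℕ
otherWeight nil        = 1
otherWeight (blue c)   = otherWeight c
otherWeight (hook a b) = otherWeight a ℕ.* (catalan (blues b) ℕ.* otherWeight b)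

configWeight : Config → ℕ
configWeight c = catalan (blues c) ℕ.* otherWeight c

module Word (g : ℕ → ℤ) where

  Dominates : ℕ → ℕ → Set
  Dominates lo n = ∀ {k} → k ℕ.< n → g (lo ℕ.+ k) ℤ.< g (lo ℕ.+ n)

  dominates? : ∀ lo n → Dec (Dominates lo n)
  dominates? lo n = ℕ.allUpTo? (λ k → g (lo ℕ.+ k) ℤ.<? g (lo ℕ.+ n)) n

  Drop : ℕ → ℕ → ℕ → Set
  Drop lo (suc a) (suc b) = g (lo ℕ.+ suc a) ℤ.< g (lo ℕ.+ a)
  Drop lo _       _       = ⊥

  drop? : ∀ lo a b → Dec (Drop lo a b)
  drop? lo zero    b       = no id
  drop? lo (suc a) zero    = no id
  drop? lo (suc a) (suc b) = g (lo ℕ.+ suc a) ℤ.<? g (lo ℕ.+ a)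

  Decreasing : ℕ → Tree → Set
  Decreasing lo leaf       = ⊤
  Decreasing lo (node l r) =
    Decreasing lo l × Decreasing (lo ℕ.+ size l) r × Dominates lo (size l ℕ.+ size r)

  Valid : ℕ → Config → Set
  Valid lo nil        = ⊤
  Valid lo (blue c)   = Valid lo c × Dominates lo (width c)
  Valid lo (hook a b) = Valid lo a × Valid (lo ℕ.+ width a) b ×
    Drop lo (width a) (width b) × Dominates lo (width a ℕ.+ width b)

  nodes : (ℕ → ℕ → List Tree) → ℕ → ℕ → List Tree
  nodes rec lo n = if does (dominates? lo n)
    then concatSplits n (λ a b → List.cartesianProductWith node (rec lo a) (rec (lo ℕ.+ a) b))
    else []

  hooksOver : (ℕ → ℕ → List Config) → ℕ → ℕ → ℕ → List Config
  hooksOver rec lo a b = if does (drop? lo a b)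
    then List.cartesianProductWith hook (rec lo a) (rec (lo ℕ.+ a) b) else []

  extensions : (ℕ → ℕ → List Config) → ℕ → ℕ → List Config
  extensions rec lo n = if does (dominates? lo n)
    then List.map blue (rec lo n) ++ concatSplits n (hooksOver rec lo) else []

  -- The first argument bounds the depth of the recursion.
  treesF : ℕ → ℕ → ℕ → List Tree
  treesF f       lo zero    = leaf ∷ []
  treesF zero    lo (suc n) = []
  treesF (suc f) lo (suc n) = nodes (treesF f) lo n

  configsF : ℕ → ℕ → ℕ → List Config
  configsF f       lo zero    = nil ∷ []
  configsF zero    lo (suc n) = []
  configsF (suc f) lo (suc n) = extensions (configsF f) lo n

  opaque
    trees : ℕ → ℕ → List Tree
    trees lo n = treesF n lo n

    configs : ℕ → ℕ → List Config
    configs lo n = configsF n lo n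

  i≤sum : ∀ {n} i j → i ℕ.+ j ≡ n → i ℕ.≤ n
  i≤sum i j refl = ℕ.m≤m+n i j

  j≤sum : ∀ {n} i j → i ℕ.+ j ≡ n → j ℕ.≤ n
  j≤sum i j refl = ℕ.m≤n+m j i

  nodes-cong : ∀ {r r′} lo n → (∀ lo a → a ℕ.≤ n → r lo a ≡ r′ lo a) →
               nodes r lo n ≡ nodes r′ lo n
  nodes-cong lo n h = cong (if does (dominates? lo n) then_else [])
    (concatSplits-cong n λ i j eq → cong₂ (List.cartesianProductWith node)
      (h lo i (i≤sum i j eq)) (h (lo ℕ.+ i) j (j≤sum i j eq)))

  extensions-cong : ∀ {r r′} lo n → (∀ lo a → a ℕ.≤ n → r lo a ≡ r′ lo a) →
                    extensions r lo n ≡ extensions r′ lo n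
  extensions-cong lo n h = cong (if does (dominates? lo n) then_else [])
    (cong₂ _++_ (cong (List.map blue) (h lo n ℕ.≤-refl))
      (concatSplits-cong n λ i j eq → cong (if does (drop? lo i j) then_else [])
        (cong₂ (List.cartesianProductWith hook)
          (h lo i (i≤sum i j eq)) (h (lo ℕ.+ i) j (j≤sum i j eq)))))

  treesF-stable : ∀ f f′ lo n → n ℕ.≤ f → n ℕ.≤ f′ → treesF f lo n ≡ treesF f′ lo n
  treesF-stable f       f′       lo zero    p         q         = refl
  treesF-stable (suc f) (suc f′) lo (suc n) (ℕ.s≤s p) (ℕ.s≤s q) = nodes-cong lo n
    λ lo a a≤n → treesF-stable f f′ lo a (ℕ.≤-trans a≤n p) (ℕ.≤-trans a≤n q)

  configsF-stable : ∀ f f′ lo n → n ℕ.≤ f → n ℕ.≤ f′ → configsF f lo n ≡ configsF f′ lo n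
  configsF-stable f       f′       lo zero    p         q         = refl
  configsF-stable (suc f) (suc f′) lo (suc n) (ℕ.s≤s p) (ℕ.s≤s q) = extensions-cong lo n
    λ lo a a≤n → configsF-stable f f′ lo a (ℕ.≤-trans a≤n p) (ℕ.≤-trans a≤n q)

  opaque
    unfolding trees

    trees-zero : ∀ lo → trees lo 0 ≡ leaf ∷ []
    trees-zero lo = refl

    configs-zero : ∀ lo → configs lo 0 ≡ nil ∷ []
    configs-zero lo = refl

    trees-suc : ∀ lo n → trees lo (suc n) ≡ nodes trees lo n
    trees-suc lo n = nodes-cong lo n λ lo a a≤n → treesF-stable n a lo a a≤n ℕ.≤-refl

    configs-suc : ∀ lo n → configs lo (suc n) ≡ extensions configs lo n
    configs-suc lo n = extensions-cong lo n λ lo a a≤n → configsF-stable n a lo a a≤n ℕ.≤-refl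

  ∈-if⁻ : ∀ {P X : Set} (d : Dec P) {xs : List X} {x} →
          x ∈ (if does d then xs else []) → P × x ∈ xs
  ∈-if⁻ (yes p) m = p , m
  ∈-if⁻ (no _) ()

  ∈-if⁺ : ∀ {P X : Set} (d : Dec P) {xs : List X} {x} →
          P → x ∈ xs → x ∈ (if does d then xs else [])
  ∈-if⁺ (yes _) p m = m
  ∈-if⁺ (no ¬p) p m = contradiction p ¬p

  unique-if : ∀ {P X : Set} (d : Dec P) {xs : List X} →
              Unique xs → Unique (if does d then xs else [])
  unique-if (yes _) u = u
  unique-if (no _)  u = []

  ∈-treesF⁻ : ∀ f lo n {t} → t ∈ treesF f lo n → Decreasing lo t × size t ≡ n
  ∈-treesF⁻ f lo zero (here refl) = tt , refl
  ∈-treesF⁻ f lo zero (there ())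
  ∈-treesF⁻ (suc f) lo (suc n) m
    with dom , m₁ ← ∈-if⁻ (dominates? lo n) m
    with a , b , eq , m₂ ← ∈-concatSplits⁻ n _ m₁
    with l , r , ml , mr , refl ← ∈.∈-cartesianProductWith⁻ node (treesF f lo a) (treesF f (lo ℕ.+ a) b) m₂
    with dl , refl ← ∈-treesF⁻ f lo a ml
    with dr , refl ← ∈-treesF⁻ f (lo ℕ.+ a) b mr
    with refl ← eq = (dl , dr , dom) , refl

  ∈-configsF⁻ : ∀ f lo n {c} → c ∈ configsF f lo n → Valid lo c × width c ≡ n
  ∈-configsF⁻ f lo zero (here refl) = tt , refl
  ∈-configsF⁻ f lo zero (there ())
  ∈-configsF⁻ (suc f) lo (suc n) m with ∈-if⁻ (dominates? lo n) m
  ... | dom , m₁ with ∈.∈-++⁻ (List.map blue (configsF f lo n)) m₁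
  ... | inj₁ m₂ with c , mc , refl ← ∈.∈-map⁻ blue m₂
               with vc , refl ← ∈-configsF⁻ f lo n mc = (vc , dom) , refl
  ... | inj₂ m₂
    with a , b , eq , m₃ ← ∈-concatSplits⁻ n _ m₂
    with dr , m₄ ← ∈-if⁻ (drop? lo a b) m₃
    with l , r , ml , mr , refl ← ∈.∈-cartesianProductWith⁻ hook (configsF f lo a) (configsF f (lo ℕ.+ a) b) m₄
    with vl , refl ← ∈-configsF⁻ f lo a ml
    with vr , refl ← ∈-configsF⁻ f (lo ℕ.+ a) b mr
    with refl ← eq = (vl , vr , dr , dom) , refl

  opaque
    unfolding trees

    ∈-trees⁻ : ∀ lo n {t} → t ∈ trees lo n → Decreasing lo t × size t ≡ n
    ∈-trees⁻ lo n = ∈-treesF⁻ n lo n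

  opaque
    unfolding trees

    ∈-configs⁻ : ∀ lo n {c} → c ∈ configs lo n → Valid lo c × width c ≡ n
    ∈-configs⁻ lo n = ∈-configsF⁻ n lo n

  ∈-trees⁺ : ∀ lo t → Decreasing lo t → t ∈ trees lo (size t)
  ∈-trees⁺ lo leaf       _             = subst (leaf ∈_) (sym (trees-zero lo)) (here refl)
  ∈-trees⁺ lo (node l r) (dl , dr , dom) =
    subst (node l r ∈_) (sym (trees-suc lo (size l ℕ.+ size r)))
      (∈-if⁺ (dominates? lo _) dom (∈-concatSplits⁺ (size l) (size r) _
        (∈.∈-cartesianProductWith⁺ node (∈-trees⁺ lo l dl) (∈-trees⁺ _ r dr))))

  ∈-configs⁺ : ∀ lo c → Valid lo c → c ∈ configs lo (width c)
  ∈-configs⁺ lo nil        _             = subst (nil ∈_) (sym (configs-zero lo)) (here refl)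
  ∈-configs⁺ lo (blue c)   (vc , dom) =
    subst (blue c ∈_) (sym (configs-suc lo (width c)))
      (∈-if⁺ (dominates? lo _) dom (∈.∈-++⁺ˡ (∈.∈-map⁺ blue (∈-configs⁺ lo c vc))))
  ∈-configs⁺ lo (hook a b) (va , vb , dr , dom) =
    subst (hook a b ∈_) (sym (configs-suc lo (width a ℕ.+ width b)))
      (∈-if⁺ (dominates? lo _) dom (∈.∈-++⁺ʳ _ (∈-concatSplits⁺ (width a) (width b) _
        (∈-if⁺ (drop? lo _ (width b)) dr
          (∈.∈-cartesianProductWith⁺ hook (∈-configs⁺ lo a va) (∈-configs⁺ _ b vb))))))

  node-injective : ∀ {l l′ r r′} → node l r ≡ node l′ r′ → l ≡ l′ × r ≡ r′
  node-injective refl = refl , refl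

  hook-injective : ∀ {l l′ r r′} → hook l r ≡ hook l′ r′ → l ≡ l′ × r ≡ r′
  hook-injective refl = refl , refl

  blue-injective : ∀ {c c′} → blue c ≡ blue c′ → c ≡ c′
  blue-injective refl = refl

  treesF-unique : ∀ f lo n → Unique (treesF f lo n)
  treesF-unique f       lo zero    = [] ∷ []
  treesF-unique zero    lo (suc n) = []
  treesF-unique (suc f) lo (suc n) = unique-if (dominates? lo n)
    (concatSplits-unique n _ key
      (λ a b _ → Unique.cartesianProductWith⁺ node node-injective
        (treesF-unique f lo a) (treesF-unique f (lo ℕ.+ a) b)) keyed)
    where
    key : Tree → ℕ
    key leaf       = 0
    key (node l r) = size l
    keyed : ∀ a b {t} → t ∈ List.cartesianProductWith node (treesF f lo a) (treesF f (lo ℕ.+ a) b) →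
            key t ≡ a
    keyed a b m with l , r , ml , mr , refl ← ∈.∈-cartesianProductWith⁻ node (treesF f lo a) _ m =
      proj₂ (∈-treesF⁻ f lo a ml)

  opaque
    unfolding trees

    trees-unique : ∀ lo n → Unique (trees lo n)
    trees-unique lo n = treesF-unique n lo n

  configsF-unique : ∀ f lo n → Unique (configsF f lo n)
  configsF-unique f       lo zero    = [] ∷ []
  configsF-unique zero    lo (suc n) = []
  configsF-unique (suc f) lo (suc n) = unique-if (dominates? lo n)
    (Unique.++⁺ (Unique.map⁺ blue-injective (configsF-unique f lo n))
      (concatSplits-unique n _ key
        (λ a b _ → unique-if (drop? lo a b) (Unique.cartesianProductWith⁺ hook hook-injective
          (configsF-unique f lo a) (configsF-unique f (lo ℕ.+ a) b))) keyed)
      disjoint)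
    where
    key : Config → ℕ
    key (hook a b) = width a
    key _          = 0
    keyed : ∀ a b {t} → t ∈ hooksOver (configsF f) lo a b → key t ≡ a
    keyed a b m with _ , m′ ← ∈-if⁻ (drop? lo a b) m
      with l , r , ml , mr , refl ← ∈.∈-cartesianProductWith⁻ hook (configsF f lo a) _ m′ =
      proj₂ (∈-configsF⁻ f lo a ml)
    disjoint : ∀ {c} → ¬ (c ∈ List.map blue (configsF f lo n) × c ∈ concatSplits n (hooksOver (configsF f) lo))
    disjoint (p , q)
      with _ , _ , refl ← ∈.∈-map⁻ blue p
      with a , b , _ , m ← ∈-concatSplits⁻ n _ q
      with _ , m′ ← ∈-if⁻ (drop? lo a b) m
      with _ , _ , _ , _ , () ← ∈.∈-cartesianProductWith⁻ hook (configsF f lo a) _ m′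

  opaque
    unfolding trees

    configs-unique : ∀ lo n → Unique (configs lo n)
    configs-unique lo n = configsF-unique n lo n

antidiagonalSum-assoc : ∀ n (F : ℕ → ℕ → ℕ → ℕ) →
  antidiagonalSum n (λ a b → antidiagonalSum b (F a)) ≡
  antidiagonalSum n (λ e b → antidiagonalSum e (λ a c → F a c b))
antidiagonalSum-assoc zero    F = refl
antidiagonalSum-assoc (suc n) F = trans
  (cong (F (suc n) 0 0 ℕ.+_) (trans (antidiagonalSum-+ n (λ a b → F a (suc b) 0) _)
    (cong (antidiagonalSum n (λ a b → F a (suc b) 0) ℕ.+_)
      (antidiagonalSum-assoc n (λ a b c → F a b (suc c))))))
  (sym (ℕ.+-assoc (F (suc n) 0 0) _ _))

antidiagonalSum-zero : ∀ n {f : ℕ → ℕ → ℕ} → (∀ a b → a ℕ.+ b ≡ n → f a b ≡ 0) →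
                       antidiagonalSum n f ≡ 0
antidiagonalSum-zero zero    h = h 0 0 refl
antidiagonalSum-zero (suc n) h = cong₂ ℕ._+_ (h (suc n) 0 (ℕ.+-identityʳ (suc n)))
  (antidiagonalSum-zero n λ i j eq → h i (suc j) (trans (ℕ.+-suc i j) (cong suc eq)))

if-true : ∀ {A : Set} {b} {x y : A} → b ≡ true → (if b then x else y) ≡ x
if-true refl = refl

if-false : ∀ {A : Set} {b} {x y : A} → b ≡ false → (if b then x else y) ≡ y
if-false refl = refl

module FertilityFormula (g : ℕ → ℤ) (g-injective : Injective _≡_ _≡_ g) where
  open Word g

  weigh : (ℕ → ℕ) → Config → ℕ
  weigh φ c = φ (blues c) ℕ.* otherWeight c

  blues-pos : ∀ lo c {n} → Valid lo c → width c ≡ suc n → ∃[ q ] blues c ≡ suc q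
  blues-pos lo (blue c)   v eq = blues c , refl
  blues-pos lo (hook a b) (va , _ , dr , _) eq with width a in wa
  ... | suc _ = blues-pos lo a va wa

  opaque
    total : (ℕ → ℕ) → ℕ → ℕ → ℕ
    total φ lo n = sumMap (weigh φ) (configs lo n)

    total-zero : ∀ φ lo → total φ lo 0 ≡ φ 0
    total-zero φ lo = trans (cong (sumMap (weigh φ)) (configs-zero lo)) $
      trans (ℕ.+-identityʳ _) (ℕ.*-identityʳ (φ 0))

  hooksTotal : (ℕ → ℕ) → ℕ → ℕ → ℕ → ℕ
  hooksTotal φ lo a b =
    if does (drop? lo a b) then total φ lo a ℕ.* total catalan (lo ℕ.+ a) b else 0

  opaque
    unfolding total

    sumMap-hooksOver : ∀ φ lo a b → sumMap (weigh φ) (hooksOver configs lo a b) ≡ hooksTotal φ lo a b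
    sumMap-hooksOver φ lo a b with drop? lo a b
    ... | yes _ = sumMap-product hook (weigh φ) (weigh φ) configWeight
                    (λ c d → sym (ℕ.*-assoc (φ (blues c)) _ _)) (configs lo a) _
    ... | no _  = refl

    total-suc : ∀ φ lo n → total φ lo (suc n) ≡
      (if does (dominates? lo n)
       then total (φ ∘ suc) lo n ℕ.+ antidiagonalSum n (hooksTotal φ lo) else 0)
    total-suc φ lo n = trans (cong (sumMap (weigh φ)) (configs-suc lo n)) helper
      where
      helper : sumMap (weigh φ) (extensions configs lo n) ≡
        (if does (dominates? lo n)
         then total (φ ∘ suc) lo n ℕ.+ antidiagonalSum n (hooksTotal φ lo) else 0)
      helper with dominates? lo n
      ... | no _  = refl
      ... | yes _ = trans (sumMap-++ (weigh φ) (List.map blue (configs lo n)) _)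
        (cong₂ ℕ._+_ (sumMap-map (weigh φ) blue (configs lo n))
          (trans (sumMap-concatSplits n (weigh φ) _)
                 (antidiagonalSum-cong n λ a b _ → sumMap-hooksOver φ lo a b)))

    total-cong : ∀ {φ φ′ : ℕ → ℕ} lo n → (∀ q → φ q ≡ φ′ q) → total φ lo n ≡ total φ′ lo n
    total-cong lo n h = sumMap-cong (configs lo n) λ {c} _ → cong (ℕ._* otherWeight c) (h (blues c))

    total-cong-pos : ∀ {φ φ′ : ℕ → ℕ} lo n → (∀ q → φ (suc q) ≡ φ′ (suc q)) →
                     total φ lo (suc n) ≡ total φ′ lo (suc n)
    total-cong-pos {φ} {φ′} lo n h = sumMap-cong (configs lo (suc n)) λ {c} m →
      let v , w = ∈-configs⁻ lo (suc n) m
          q , eq = blues-pos lo c v w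
      in cong (ℕ._* otherWeight c) (subst (λ q → φ q ≡ φ′ q) (sym eq) (h q))

    total-+ : ∀ φ φ′ lo n → total (λ q → φ q ℕ.+ φ′ q) lo n ≡ total φ lo n ℕ.+ total φ′ lo n
    total-+ φ φ′ lo n = trans
      (sumMap-cong (configs lo n) λ {c} _ → ℕ.*-distribʳ-+ (otherWeight c) (φ (blues c)) (φ′ (blues c)))
      (sumMap-+ (weigh φ) (weigh φ′) (configs lo n))

    total-*ʳ : ∀ k φ lo n → total (λ q → φ q ℕ.* k) lo n ≡ total φ lo n ℕ.* k
    total-*ʳ k φ lo n = trans
      (sumMap-cong (configs lo n) λ {c} _ →
        trans (ℕ.*-assoc (φ (blues c)) k _)
          (trans (cong (φ (blues c) ℕ.*_) (ℕ.*-comm k _)) (sym (ℕ.*-assoc (φ (blues c)) _ k))))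
      (sumMap-*ʳ k (weigh φ) (configs lo n))

    total-0 : ∀ lo n → total (λ _ → 0) lo n ≡ 0
    total-0 lo n = sumMap-*ˡ 0 (λ _ → 0) (configs lo n)

    total-*ˡ : ∀ k φ lo n → total (λ q → k ℕ.* φ q) lo n ≡ k ℕ.* total φ lo n
    total-*ˡ k φ lo n = trans
      (sumMap-cong (configs lo n) λ {c} _ → ℕ.*-assoc k (φ (blues c)) _)
      (sumMap-*ˡ k (weigh φ) (configs lo n))

  total-suc-yes : ∀ φ lo n → Dominates lo n → total φ lo (suc n) ≡
    total (φ ∘ suc) lo n ℕ.+ antidiagonalSum n (hooksTotal φ lo)
  total-suc-yes φ lo n dom = trans (total-suc φ lo n)
    (if-true (dec-true (dominates? lo n) dom))

  total-suc-no : ∀ φ lo n → ¬ Dominates lo n → total φ lo (suc n) ≡ 0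
  total-suc-no φ lo n ¬dom = trans (total-suc φ lo n)
    (if-false (dec-false (dominates? lo n) ¬dom))

  total-antidiagonalSum : ∀ m (F : ℕ → ℕ → ℕ → ℕ) lo n →
    total (λ i → antidiagonalSum m (F i)) lo n ≡
    antidiagonalSum m (λ a b → total (λ i → F i a b) lo n)
  total-antidiagonalSum zero    F lo n = refl
  total-antidiagonalSum (suc m) F lo n = trans (total-+ (λ i → F i (suc m) 0) _ lo n)
    (cong (total (λ i → F i (suc m) 0) lo n ℕ.+_) (total-antidiagonalSum m _ lo n))

  dominates-suffix : ∀ lo a b → Dominates lo (a ℕ.+ b) → Dominates (lo ℕ.+ a) b
  dominates-suffix lo a b dom {k} k<b rewrite ℕ.+-assoc lo a k | ℕ.+-assoc lo a b =
    dom (ℕ.+-monoʳ-< a k<b)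

  ¬drop-rises : ∀ lo a b → ¬ Drop lo (suc a) (suc b) → g (lo ℕ.+ a) ℤ.< g (lo ℕ.+ suc a)
  ¬drop-rises lo a b ¬dr = ℤ.≤∧≢⇒< (ℤ.≮⇒≥ ¬dr) λ eq →
    ℕ.<⇒≢ (ℕ.n<1+n a) (ℕ.+-cancelˡ-≡ lo _ _ (g-injective eq))

  first≤root : ∀ lo a b → Dominates (lo ℕ.+ suc a) b →
               g (lo ℕ.+ suc a) ℤ.≤ g (lo ℕ.+ (suc a ℕ.+ b))
  first≤root lo a zero    dom = ℤ.≤-reflexive (cong (λ x → g (lo ℕ.+ x)) (sym (ℕ.+-identityʳ (suc a))))
  first≤root lo a (suc b) dom = ℤ.<⇒≤ (subst₂ (λ x y → g x ℤ.< g y) (ℕ.+-identityʳ _)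
    (ℕ.+-assoc lo (suc a) (suc b)) (dom {0} (ℕ.s≤s ℕ.z≤n)))

  ¬drop-dominates : ∀ lo a b → ¬ Drop lo (suc a) (suc b) → Dominates lo a →
                    Dominates (lo ℕ.+ suc a) b → Dominates lo (suc a ℕ.+ b)
  ¬drop-dominates lo a b ¬dr dom₁ dom₂ {k} k<
    with first≤root ← first≤root lo a b dom₂
    with ℕ.<-cmp k a
  ... | tri< k<a _ _ = ℤ.<-trans (dom₁ k<a) (ℤ.<-≤-trans (¬drop-rises lo a b ¬dr) first≤root)
  ... | tri≈ _ refl _ = ℤ.<-≤-trans (¬drop-rises lo a b ¬dr) first≤root
  ... | tri> _ _ a<k with k′ , refl ← ℕ.m≤n⇒∃[o]m+o≡n a<k =
    subst₂ (λ x y → g x ℤ.< g y) (ℕ.+-assoc lo (suc a) k′) (ℕ.+-assoc lo (suc a) b)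
      (dom₂ (ℕ.+-cancelˡ-< (suc a) k′ b k<))

  Drop-shift : ∀ lo a b c → Drop (lo ℕ.+ a) (suc b) c ⇔ Drop lo (a ℕ.+ suc b) c
  Drop-shift lo a b zero rewrite ℕ.+-suc a b = mk⇔ id id
  Drop-shift lo a b (suc c) rewrite ℕ.+-suc a b | ℕ.+-assoc lo a (suc b) | ℕ.+-suc a b | ℕ.+-assoc lo a b = mk⇔ id id

  convolutionTerm : (ℕ → ℕ → ℕ) → ℕ → ℕ → ℕ → ℕ
  convolutionTerm ψ lo a b =
    if does (drop? lo a b) then 0 else total (λ i → total (ψ i) (lo ℕ.+ a) b) lo a

  vanishing : (ℕ → ℕ → ℕ) → ℕ → ℕ → ℕ
  vanishing ψ i zero    = 0
  vanishing ψ i (suc j) = ψ i (suc j)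

  shift : (ℕ → ℕ → ℕ) → ℕ → ℕ → ℕ
  shift ψ i j = ψ i (suc j)

  convolutionTerm-undominated : ∀ ψ lo a b → ¬ Dominates lo (a ℕ.+ b) →
                                convolutionTerm ψ lo a (suc b) ≡ 0
  convolutionTerm-undominated ψ lo zero b ¬dom = trans (total-zero _ lo)
    (total-suc-no (ψ 0) (lo ℕ.+ 0) b (subst (λ l → ¬ Dominates l b) (sym (ℕ.+-identityʳ lo)) ¬dom))
  convolutionTerm-undominated ψ lo (suc a) b ¬dom
    with drop? lo (suc a) (suc b)
  ... | yes _  = refl
  ... | no ¬dr with dominates? (lo ℕ.+ suc a) b
  ...   | no ¬dom₂ = trans (total-cong lo (suc a) λ q → total-suc-no (ψ q) (lo ℕ.+ suc a) b ¬dom₂)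
    (total-0 lo (suc a))
  ...   | yes dom₂ = total-suc-no _ lo a λ dom₁ → ¬dom (¬drop-dominates lo a b ¬dr dom₁ dom₂)

  private
    Q : (ℕ → ℕ → ℕ) → ℕ → ℕ → ℕ → ℕ → ℕ
    Q ψ lo a b c = if does (drop? lo (a ℕ.+ b) c)
      then convolutionTerm (vanishing ψ) lo a b ℕ.* total catalan (lo ℕ.+ (a ℕ.+ b)) c else 0

    if-0 : ∀ b → (if b then 0 else 0) ≡ 0
    if-0 true  = refl
    if-0 false = refl

    vanishing-0 : ∀ ψ lo a → convolutionTerm (vanishing ψ) lo a 0 ≡ 0
    vanishing-0 ψ lo a with drop? lo a 0
    ... | yes _ = refl
    ... | no _  = trans (total-cong lo a λ q → total-zero (vanishing ψ q) (lo ℕ.+ a)) (total-0 lo a)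

    Q-0 : ∀ ψ lo a c → Q ψ lo a 0 c ≡ 0
    Q-0 ψ lo a c rewrite vanishing-0 ψ lo a = if-0 (does (drop? lo (a ℕ.+ 0) c))

  -- The last point of the right factor is either blue or the northeast endpoint of a hook.
  convolutionTerm-suc : ∀ ψ lo a b → Dominates lo (a ℕ.+ b) → convolutionTerm ψ lo a (suc b) ≡
    convolutionTerm (shift ψ) lo a b ℕ.+ antidiagonalSum b (Q ψ lo a)
  convolutionTerm-suc ψ lo a b dom with drop? lo a (suc b)
  ... | yes dr = sym (cong₂ ℕ._+_ (U≡0 a b dr dom) (antidiagonalSum-zero b λ c d _ → Q≡0 a c d dr))
    where
    U≡0 : ∀ a b → Drop lo a (suc b) → Dominates lo (a ℕ.+ b) → convolutionTerm (shift ψ) lo a b ≡ 0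
    U≡0 (suc a) zero    dr dom = contradiction dr (ℤ.<-asym
      (subst (λ x → g (lo ℕ.+ a) ℤ.< g (lo ℕ.+ x)) (ℕ.+-identityʳ (suc a)) (dom (ℕ.s≤s (ℕ.m≤m+n a 0)))))
    U≡0 (suc a) (suc b) dr dom =
      cong (if_then 0 else total (λ i → total (shift ψ i) (lo ℕ.+ suc a) (suc b)) lo (suc a))
        (dec-true (drop? lo (suc a) (suc b)) dr)
    Q≡0 : ∀ a c d → Drop lo a (suc b) → Q ψ lo a c d ≡ 0
    Q≡0 a       zero    d dr = Q-0 ψ lo a d
    Q≡0 (suc a) (suc c) d dr
      rewrite dec-true (g (lo ℕ.+ suc a) ℤ.<? g (lo ℕ.+ a)) dr = if-0 (does (drop? lo (suc a ℕ.+ suc c) d))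
  ... | no ¬dr = begin
    total (λ i → total (ψ i) (lo ℕ.+ a) (suc b)) lo a
      ≡⟨ total-cong lo a (λ i → total-suc-yes (ψ i) (lo ℕ.+ a) b (dominates-suffix lo a b dom)) ⟩
    total (λ i → total (shift ψ i) (lo ℕ.+ a) b ℕ.+ antidiagonalSum b (hooksTotal (ψ i) (lo ℕ.+ a))) lo a
      ≡⟨ total-+ _ _ lo a ⟩
    total (λ i → total (shift ψ i) (lo ℕ.+ a) b) lo a ℕ.+
    total (λ i → antidiagonalSum b (hooksTotal (ψ i) (lo ℕ.+ a))) lo a
      ≡⟨ cong₂ ℕ._+_ (U≡ a b ¬dr)
           (trans (total-antidiagonalSum b (λ i → hooksTotal (ψ i) (lo ℕ.+ a)) lo a)
                  (antidiagonalSum-cong b λ c d _ → V≡ c d)) ⟩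
    convolutionTerm (shift ψ) lo a b ℕ.+ antidiagonalSum b (Q ψ lo a) ∎
    where
    open ≡-Reasoning
    U≡ : ∀ a b → ¬ Drop lo a (suc b) →
      total (λ i → total (shift ψ i) (lo ℕ.+ a) b) lo a ≡ convolutionTerm (shift ψ) lo a b
    U≡ zero    b       ¬dr = refl
    U≡ (suc a) zero    ¬dr = refl
    U≡ (suc a) (suc b) ¬dr =
      cong (if_then 0 else total (λ i → total (shift ψ i) (lo ℕ.+ suc a) (suc b)) lo (suc a))
        (sym (dec-false (drop? lo (suc a) (suc b)) ¬dr))
    convolve : ∀ a c → ¬ Drop lo a (suc b) → total (λ i → total (ψ i) (lo ℕ.+ a) (suc c)) lo a ≡
      convolutionTerm (vanishing ψ) lo a (suc c)
    convolve zero    c ¬dr = total-cong lo 0 λ i → total-cong-pos (lo ℕ.+ 0) c λ q → refl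
    convolve (suc a) c ¬dr rewrite dec-false (g (lo ℕ.+ suc a) ℤ.<? g (lo ℕ.+ a)) ¬dr =
      total-cong lo (suc a) λ i → total-cong-pos (lo ℕ.+ suc a) c λ q → refl
    V≡ : ∀ c d → total (λ i → hooksTotal (ψ i) (lo ℕ.+ a) c d) lo a ≡ Q ψ lo a c d
    V≡ zero    d = trans (total-0 lo a) (sym (Q-0 ψ lo a d))
    V≡ (suc c) d
      rewrite sym (ℕ.+-assoc lo a (suc c))
            | sym (convolve a c ¬dr)
            | sym (does-⇔ (Drop-shift lo a c d) (drop? (lo ℕ.+ a) (suc c) d) (drop? lo (a ℕ.+ suc c) d))
      with drop? (lo ℕ.+ a) (suc c) d
    ... | yes _ = total-*ʳ _ (λ i → total (ψ i) (lo ℕ.+ a) (suc c)) lo a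
    ... | no _  = total-0 lo a

  convolution : ∀ N n lo ψ → n ℕ.≤ N →
    antidiagonalSum n (convolutionTerm ψ lo) ≡ total (λ q → antidiagonalSum q ψ) lo n
  convolution N       zero    lo ψ _         = trans (total-zero _ lo)
    (trans (total-zero (ψ 0) (lo ℕ.+ 0)) (sym (total-zero (λ q → antidiagonalSum q ψ) lo)))
  convolution (suc N) (suc n) lo ψ (ℕ.s≤s n≤N) with dominates? lo n
  ... | no ¬dom = trans
    (cong₂ ℕ._+_
      (trans (total-cong lo (suc n) λ q → total-zero (ψ q) (lo ℕ.+ suc n)) (total-suc-no _ lo n ¬dom))
      (antidiagonalSum-zero n λ a b eq →
        convolutionTerm-undominated ψ lo a b (subst (λ m → ¬ Dominates lo m) (sym eq) ¬dom)))
    (sym (total-suc-no _ lo n ¬dom))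
  ... | yes dom = begin
    convolutionTerm ψ lo (suc n) 0 ℕ.+ antidiagonalSum n (λ a b → convolutionTerm ψ lo a (suc b))
      ≡⟨ cong₂ ℕ._+_ (total-cong lo (suc n) λ q → total-zero (ψ q) (lo ℕ.+ suc n)) inner ⟩
    total (λ q → ψ q 0) lo (suc n) ℕ.+ total Φ lo (suc n)
      ≡⟨ total-+ (λ q → ψ q 0) Φ lo (suc n) ⟨
    total (λ q → ψ q 0 ℕ.+ Φ q) lo (suc n)
      ≡⟨ total-cong-pos lo n (λ q → refl) ⟩
    total (λ q → antidiagonalSum q ψ) lo (suc n) ∎
    where
    open ≡-Reasoning
    Φ : ℕ → ℕ
    Φ q = antidiagonalSum q (vanishing ψ)
    collect : ∀ e c → e ℕ.+ c ≡ n → antidiagonalSum e (λ a b → Q ψ lo a b c) ≡ hooksTotal Φ lo e c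
    collect e c eq = trans
      (antidiagonalSum-cong e {g = λ a b → if does (drop? lo e c)
          then convolutionTerm (vanishing ψ) lo a b ℕ.* total catalan (lo ℕ.+ e) c else 0}
        λ where a b refl → refl)
      collect′
      where
      collect′ : antidiagonalSum e (λ a b → if does (drop? lo e c)
          then convolutionTerm (vanishing ψ) lo a b ℕ.* total catalan (lo ℕ.+ e) c else 0) ≡ hooksTotal Φ lo e c
      collect′ with drop? lo e c
      ... | no _  = antidiagonalSum-zero e λ _ _ _ → refl
      ... | yes _ = trans
        (antidiagonalSum-cong e λ a b _ → ℕ.*-comm (convolutionTerm (vanishing ψ) lo a b) _)
        (trans (antidiagonalSum-* e (total catalan (lo ℕ.+ e) c) _)
          (trans (ℕ.*-comm _ (antidiagonalSum e (convolutionTerm (vanishing ψ) lo)))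
            (cong (ℕ._* total catalan (lo ℕ.+ e) c)
              (convolution N e lo (vanishing ψ) (ℕ.≤-trans (subst (e ℕ.≤_) eq (ℕ.m≤m+n e c)) n≤N)))))
    inner : antidiagonalSum n (λ a b → convolutionTerm ψ lo a (suc b)) ≡ total Φ lo (suc n)
    inner = begin
      antidiagonalSum n (λ a b → convolutionTerm ψ lo a (suc b))
        ≡⟨ antidiagonalSum-cong n (λ a b eq → convolutionTerm-suc ψ lo a b
          (subst (Dominates lo) (sym eq) dom)) ⟩
      antidiagonalSum n (λ a b → convolutionTerm (shift ψ) lo a b ℕ.+ antidiagonalSum b (Q ψ lo a))
        ≡⟨ antidiagonalSum-+ n _ _ ⟩
      antidiagonalSum n (convolutionTerm (shift ψ) lo)
        ℕ.+ antidiagonalSum n (λ a b → antidiagonalSum b (Q ψ lo a))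
        ≡⟨ cong₂ ℕ._+_ (convolution N n lo (shift ψ) n≤N)
             (trans (antidiagonalSum-assoc n (Q ψ lo)) (antidiagonalSum-cong n collect)) ⟩
      total (Φ ∘ suc) lo n ℕ.+ antidiagonalSum n (hooksTotal Φ lo)
        ≡⟨ total-suc-yes Φ lo n dom ⟨
      total Φ lo (suc n) ∎

  length-trees-suc : ∀ lo n → List.length (trees lo (suc n)) ≡
    (if does (dominates? lo n)
     then antidiagonalSum n (λ a b → List.length (trees lo a) ℕ.* List.length (trees (lo ℕ.+ a) b)) else 0)
  length-trees-suc lo n = trans (cong List.length (trees-suc lo n)) helper
    where
    helper : List.length (nodes trees lo n) ≡
      (if does (dominates? lo n)
       then antidiagonalSum n (λ a b → List.length (trees lo a) ℕ.* List.length (trees (lo ℕ.+ a) b)) else 0)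
    helper with dominates? lo n
    ... | no _  = refl
    ... | yes _ = trans (sym (sumMap-1 (concatSplits n _))) (trans (sumMap-concatSplits n (λ _ → 1) _)
      (antidiagonalSum-cong n λ a b _ →
        trans (sumMap-product node (λ _ → 1) (λ _ → 1) (λ _ → 1) (λ _ _ → refl) (trees lo a)
          (trees (lo ℕ.+ a) b))
          (cong₂ ℕ._*_ (sumMap-1 (trees lo a)) (sumMap-1 (trees (lo ℕ.+ a) b)))))

  fertility′ : ∀ N n lo → n ℕ.≤ N → List.length (trees lo n) ≡ total catalan lo n
  fertility′ N       zero    lo _           =
    trans (cong List.length (trees-zero lo)) (sym (total-zero catalan lo))
  fertility′ (suc N) (suc n) lo (ℕ.s≤s n≤N) =
    trans (length-trees-suc lo n) (trans (cong (if does (dominates? lo n) then_else 0) splitting)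
      (sym (total-suc catalan lo n)))
    where
    open ≡-Reasoning
    term : ∀ a b → a ℕ.+ b ≡ n → List.length (trees lo a) ℕ.* List.length (trees (lo ℕ.+ a) b) ≡
      convolutionTerm (λ i j → catalan i ℕ.* catalan j) lo a b ℕ.+ hooksTotal catalan lo a b
    term a b eq
      rewrite fertility′ N a lo (ℕ.≤-trans (i≤sum a b eq) n≤N)
            | fertility′ N b (lo ℕ.+ a) (ℕ.≤-trans (j≤sum a b eq) n≤N)
      with drop? lo a b
    ... | yes _ = refl
    ... | no _  = trans
      (sym (trans (total-cong lo a λ i → total-*ˡ (catalan i) catalan (lo ℕ.+ a) b)
                  (total-*ʳ (total catalan (lo ℕ.+ a) b) catalan lo a)))
      (sym (ℕ.+-identityʳ _))
    splitting : antidiagonalSum n (λ a b → List.length (trees lo a) ℕ.* List.length (trees (lo ℕ.+ a) b)) ≡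
                total (catalan ∘ suc) lo n ℕ.+ antidiagonalSum n (hooksTotal catalan lo)
    splitting = begin
      _ ≡⟨ antidiagonalSum-cong n term ⟩
      _ ≡⟨ antidiagonalSum-+ n _ _ ⟩
      antidiagonalSum n (convolutionTerm (λ i j → catalan i ℕ.* catalan j) lo)
        ℕ.+ antidiagonalSum n (hooksTotal catalan lo)
        ≡⟨ cong (ℕ._+ antidiagonalSum n (hooksTotal catalan lo))
             (trans (convolution n n lo _ ℕ.≤-refl) (total-cong lo n λ q → sym (catalan-recurrence q))) ⟩
      total (catalan ∘ suc) lo n ℕ.+ antidiagonalSum n (hooksTotal catalan lo) ∎

  opaque
    unfolding total

    fertility : ∀ lo n → List.length (trees lo n) ≡ sumMap configWeight (configs lo n)
    fertility lo n = fertility′ n n lo ℕ.≤-refl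

countRange : {P : ℕ → Set} → (∀ p → Dec (P p)) → ℕ → ℕ → ℕ
countRange P? lo zero    = 0
countRange P? lo (suc n) = countRange P? lo n ℕ.+ (if does (P? (lo ℕ.+ n)) then 1 else 0)

module _ {P : ℕ → Set} (P? : ∀ p → Dec (P p)) where

  countRange-yes : ∀ lo n → P (lo ℕ.+ n) → countRange P? lo (suc n) ≡ suc (countRange P? lo n)
  countRange-yes lo n p = trans (cong (countRange P? lo n ℕ.+_) (if-true (dec-true (P? (lo ℕ.+ n)) p)))
                                (ℕ.+-comm _ 1)

  countRange-no : ∀ lo a b → (∀ {p} → lo ℕ.+ a ℕ.≤ p → p ℕ.< lo ℕ.+ (a ℕ.+ b) → ¬ P p) →
                  countRange P? lo (a ℕ.+ b) ≡ countRange P? lo a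
  countRange-no lo a zero    h = cong (countRange P? lo) (ℕ.+-identityʳ a)
  countRange-no lo a (suc b) h rewrite ℕ.+-suc a b = trans
    (cong₂ ℕ._+_
      (countRange-no lo a b λ q r → h q (ℕ.<-trans r (ℕ.+-monoʳ-< lo (ℕ.n<1+n (a ℕ.+ b)))))
      (if-false (dec-false (P? _) (h (ℕ.+-monoʳ-≤ lo (ℕ.m≤m+n a b)) (ℕ.+-monoʳ-< lo (ℕ.n<1+n (a ℕ.+ b)))))))
    (ℕ.+-identityʳ _)

  countRange-cons : ∀ lo n → countRange P? lo (suc n) ≡
    (if does (P? lo) then 1 else 0) ℕ.+ countRange P? (suc lo) n
  countRange-cons lo zero    rewrite ℕ.+-identityʳ lo = sym (ℕ.+-identityʳ _)
  countRange-cons lo (suc n) = trans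
    (cong₂ ℕ._+_ (countRange-cons lo n) (cong (λ x → if does (P? x) then 1 else 0) (ℕ.+-suc lo n)))
    (ℕ.+-assoc (if does (P? lo) then 1 else 0) _ _)

  countRange-skip : ∀ lo a b → (∀ {p} → lo ℕ.≤ p → p ℕ.< lo ℕ.+ a → ¬ P p) →
                    countRange P? lo (a ℕ.+ b) ≡ countRange P? (lo ℕ.+ a) b
  countRange-skip lo zero    b h = cong (λ l → countRange P? l b) (sym (ℕ.+-identityʳ lo))
  countRange-skip lo (suc a) b h = trans (countRange-cons lo (a ℕ.+ b)) (trans
    (cong (ℕ._+ countRange P? (suc lo) (a ℕ.+ b))
      (if-false (dec-false (P? lo) (h ℕ.≤-refl (ℕ.m<m+n lo (ℕ.s≤s ℕ.z≤n))))))
    (trans (countRange-skip (suc lo) a b λ {p} q r → h (ℕ.<⇒≤ q) (subst (p ℕ.<_) (sym (ℕ.+-suc lo a)) r))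
           (cong (λ l → countRange P? l b) (sym (ℕ.+-suc lo a)))))

  countRange-cong : ∀ {Q : ℕ → Set} (Q? : ∀ p → Dec (Q p)) lo n →
    (∀ {p} → lo ℕ.≤ p → p ℕ.< lo ℕ.+ n → P p ⇔ Q p) → countRange P? lo n ≡ countRange Q? lo n
  countRange-cong Q? lo zero    h = refl
  countRange-cong Q? lo (suc n) h = cong₂ ℕ._+_
    (countRange-cong Q? lo n λ q r → h q (ℕ.<-trans r (ℕ.+-monoʳ-< lo (ℕ.n<1+n n))))
    (cong (if_then 1 else 0) (does-⇔ (h (ℕ.m≤m+n lo n) (ℕ.+-monoʳ-< lo (ℕ.n<1+n n))) (P? _) (Q? _)))

hookList : ℕ → Config → List (ℕ × ℕ)
hookList lo nil        = []
hookList lo (blue c)   = hookList lo c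
hookList lo (hook a b) = hookList lo a ++
  (ℕ.pred (lo ℕ.+ width a) , lo ℕ.+ (width a ℕ.+ width b)) ∷ hookList (lo ℕ.+ width a) b

module AbstractHooks (g : ℕ → ℤ) (g-injective : Injective _≡_ _≡_ g) where
  open Word g

  Descent : ℕ → Set
  Descent d = g (suc d) ℤ.< g d

  descent? : ∀ d → Dec (Descent d)
  descent? d = g (suc d) ℤ.<? g d

  lastDescent : ℕ → ℕ → List ℕ
  lastDescent lo zero    = []
  lastDescent lo (suc m) = if does (descent? (lo ℕ.+ m)) then lo ℕ.+ m ∷ [] else []

  descentsIn : ℕ → ℕ → List ℕ
  descentsIn lo zero    = []
  descentsIn lo (suc n) = descentsIn lo n ++ lastDescent lo n

  descentsIn-split : ∀ lo m b → Descent (lo ℕ.+ m) → descentsIn lo (suc m ℕ.+ suc b) ≡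
    descentsIn lo (suc m) ++ lo ℕ.+ m ∷ descentsIn (lo ℕ.+ suc m) (suc b)
  descentsIn-split lo m zero    ds rewrite ℕ.+-comm m 1 =
    cong (descentsIn lo (suc m) ++_) (if-true (dec-true (descent? (lo ℕ.+ m)) ds))
  descentsIn-split lo m (suc b) ds = begin
    descentsIn lo (suc m ℕ.+ suc (suc b))
      ≡⟨ cong (descentsIn lo) (ℕ.+-suc (suc m) (suc b)) ⟩
    descentsIn lo (suc m ℕ.+ suc b) ++ lastDescent lo (suc m ℕ.+ suc b)
      ≡⟨ cong₂ _++_ (descentsIn-split lo m b ds) (cong (λ x → if does (descent? x) then x ∷ [] else [])
           (liaN 3 (λ lo m b → [] ⊢ lo :+ (m :+ (lit 1 :+ b)) :≡ lo :+ (lit 1 :+ m) :+ b) lo m b)) ⟩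
    (descentsIn lo (suc m) ++ lo ℕ.+ m ∷ descentsIn (lo ℕ.+ suc m) (suc b))
      ++ lastDescent (lo ℕ.+ suc m) (suc b)
      ≡⟨ List.++-assoc (descentsIn lo (suc m)) _ _ ⟩
    descentsIn lo (suc m) ++ lo ℕ.+ m ∷ descentsIn (lo ℕ.+ suc m) (suc (suc b)) ∎
    where open ≡-Reasoning

  record Hooked (E : ℕ → ℕ) (lo hi : ℕ) : Set where
    field
      rightwards : ∀ {d} → lo ℕ.≤ d → suc d ℕ.< hi → Descent d → d ℕ.< E d
      inside     : ∀ {d} → lo ℕ.≤ d → suc d ℕ.< hi → Descent d → E d ℕ.< hi
      upwards    : ∀ {d} → lo ℕ.≤ d → suc d ℕ.< hi → Descent d → g d ℤ.< g (E d)
      highest    : ∀ {d p} → lo ℕ.≤ d → suc d ℕ.< hi → Descent d → d ℕ.≤ p → p ℕ.≤ E d → g p ℤ.≤ g (E d)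
      nested     : ∀ {d d′} → lo ℕ.≤ d → suc d ℕ.< hi → Descent d →
                   d ℕ.< d′ → d′ ℕ.< E d → suc d′ ℕ.< hi → Descent d′ → E d′ ℕ.< E d

  g-rises : ∀ d → ¬ Descent d → g d ℤ.< g (suc d)
  g-rises d ¬ds = ℤ.≤∧≢⇒< (ℤ.≮⇒≥ ¬ds) λ eq → ℕ.<⇒≢ (ℕ.n<1+n d) (g-injective eq)

  module _ (E : ℕ → ℕ) where

    Uncovered : ℕ → ℕ → Set
    Uncovered lo p = ∀ {d} → d ℕ.< p → lo ℕ.≤ d × Descent d → E d ℕ.< p

    uncovered? : ∀ lo p → Dec (Uncovered lo p)
    uncovered? lo p = ℕ.allUpTo? (λ d → (lo ℕ.≤? d ×-dec descent? d) →-dec E d ℕ.<? p) p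

    covered : ∀ lo p → ¬ Uncovered lo p → ∃[ d ] d ℕ.< p × lo ℕ.≤ d × Descent d × p ℕ.≤ E d
    covered lo p ¬u with ℕ.anyUpTo? (λ d → (lo ℕ.≤? d ×-dec descent? d) ×-dec p ℕ.≤? E d) p
    ... | yes (d , d<p , (lo≤d , ds) , p≤) = d , d<p , lo≤d , ds , p≤
    ... | no ¬c = contradiction (λ {d} d<p c → ℕ.≰⇒> λ p≤ → ¬c (d , d<p , c , p≤)) ¬u

    uncoveredCount : ℕ → ℕ → ℕ
    uncoveredCount lo n = countRange (uncovered? lo) lo n

    hooksIn : ℕ → ℕ → List (ℕ × ℕ)
    hooksIn lo n = List.map (λ d → d , E d) (descentsIn lo n)

    hookFactor : ℕ → ℕ
    hookFactor d = catalan (uncoveredCount (suc d) (E d ℕ.∸ suc d))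

    hookFactors : ℕ → ℕ → ℕ
    hookFactors lo n = product (List.map hookFactor (descentsIn lo n))

    -- Everything strictly left of the last point climbs to it, hook by hook.
    hooked-dominates : ∀ {lo n} → Hooked E lo (lo ℕ.+ suc n) → Dominates lo n
    hooked-dominates {lo} {n} H {k} k<n = climb n (ℕ.m≤n+m n k) k<n
      where
      open Hooked H
      hi = lo ℕ.+ n
      fits : ∀ {k} → k ℕ.< n → suc (lo ℕ.+ k) ℕ.< lo ℕ.+ suc n
      fits {k} p = liaN 3 (λ lo k n → k :< n ∷ [] ⊢ lit 1 :+ (lo :+ k) :< lo :+ (lit 1 :+ n)) lo k n p
      climb : ∀ m {k} → n ℕ.≤ k ℕ.+ m → k ℕ.< n → g (lo ℕ.+ k) ℤ.< g (lo ℕ.+ n)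
      to-top : ∀ m {p} → lo ℕ.≤ p → p ℕ.≤ hi → lo ℕ.+ n ℕ.≤ p ℕ.+ m → g p ℤ.≤ g (lo ℕ.+ n)
      climb zero {k} n≤k k<n = ⊥-elim (liaN 2 (λ n k → n :≤ k :+ lit 0 ∷ k :< n ∷ [] ⊢ :⊥) n k n≤k k<n)
      climb (suc m) {k} n≤ k<n with descent? (lo ℕ.+ k)
      ... | yes ds = ℤ.<-≤-trans (upwards (ℕ.m≤m+n lo k) (fits k<n) ds)
        (to-top m (ℕ.≤-trans (ℕ.m≤m+n lo k) (ℕ.<⇒≤ d<E))
          (ℕ.s≤s⁻¹ (subst (E (lo ℕ.+ k) ℕ.<_) (ℕ.+-suc lo n) (inside (ℕ.m≤m+n lo k) (fits k<n) ds)))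
          (liaN 5 (λ lo k n m e → n :≤ k :+ (lit 1 :+ m) ∷ lo :+ k :< e ∷ [] ⊢ lo :+ n :≤ e :+ m)
            lo k n m (E (lo ℕ.+ k)) n≤ d<E))
        where d<E = rightwards (ℕ.m≤m+n lo k) (fits k<n) ds
      ... | no ¬ds = ℤ.<-≤-trans (g-rises (lo ℕ.+ k) ¬ds)
        (to-top m (ℕ.m≤n⇒m≤1+n (ℕ.m≤m+n lo k)) (ℕ.+-monoʳ-< lo k<n)
          (liaN 4 (λ lo k n m → n :≤ k :+ (lit 1 :+ m) ∷ [] ⊢ lo :+ n :≤ lit 1 :+ (lo :+ k) :+ m)
            lo k n m n≤))
      to-top m {p} lo≤p p≤hi hi≤ with ℕ.<-cmp p hi
      ... | tri< p<hi _ _ with k , refl ← ℕ.m≤n⇒∃[o]m+o≡n lo≤p =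
        ℤ.<⇒≤ (climb m (liaN 4 (λ lo k n m → lo :+ n :≤ lo :+ k :+ m ∷ [] ⊢ n :≤ k :+ m) lo k n m hi≤)
                       (ℕ.+-cancelˡ-< lo k n p<hi))
      ... | tri≈ _ refl _ = ℤ.≤-refl
      ... | tri> _ _ p>hi = contradiction p≤hi (ℕ.<⇒≱ p>hi)

    restrict : ∀ {lo hi lo′ hi′} → lo ℕ.≤ lo′ → hi′ ℕ.≤ hi → Hooked E lo hi →
      (∀ {d} → lo′ ℕ.≤ d → suc d ℕ.< hi′ → Descent d → E d ℕ.< hi′) → Hooked E lo′ hi′
    restrict l h H ins = record
      { rightwards = λ p q → rightwards (ℕ.≤-trans l p) (ℕ.<-≤-trans q h)
      ; inside     = ins
      ; upwards    = λ p q → upwards (ℕ.≤-trans l p) (ℕ.<-≤-trans q h)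
      ; highest    = λ p q → highest (ℕ.≤-trans l p) (ℕ.<-≤-trans q h)
      ; nested     = λ p q ds a b c → nested (ℕ.≤-trans l p) (ℕ.<-≤-trans q h) ds a b (ℕ.<-≤-trans c h)
      }
      where open Hooked H

    Decomposition : ℕ → ℕ → Set
    Decomposition lo n = Σ[ c ∈ Config ] Valid lo c × width c ≡ n × hookList lo c ≡ hooksIn lo n ×
      blues c ≡ uncoveredCount lo n × otherWeight c ≡ hookFactors lo n

    lastDescent-none : ∀ lo n → Dominates lo n → lastDescent lo n ≡ []
    lastDescent-none lo zero    dom = refl
    lastDescent-none lo (suc n) dom = if-false (dec-false (descent? (lo ℕ.+ n)) λ ds →
      ℤ.<-asym ds (subst (λ x → g (lo ℕ.+ n) ℤ.< g x) (ℕ.+-suc lo n) (dom (ℕ.n<1+n n))))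

    decompose : ∀ N lo n → n ℕ.≤ N → Hooked E lo (lo ℕ.+ n) → Decomposition lo n
    decompose N       lo zero    _         H = nil , tt , refl , refl , refl , refl
    decompose (suc N) lo (suc n) (ℕ.s≤s n≤N) H = split (uncovered? lo (lo ℕ.+ n))
      where
      split : Dec (Uncovered lo (lo ℕ.+ n)) → Decomposition lo (suc n)
      split (yes unc) =
        let c , v , w , hs , bl , ow = decompose N lo n n≤N (restrict ℕ.≤-refl (ℕ.+-monoʳ-≤ lo (ℕ.n≤1+n n)) H
              λ {d} p q ds → unc (ℕ.<-trans (ℕ.n<1+n d) q) (p , ds))
        in blue c , (v , subst (Dominates lo) (sym w) dom) , cong suc w ,
           trans hs (cong (List.map (λ d → d , E d)) ds≡) ,
           trans (cong suc bl) (sym (countRange-yes (uncovered? lo) lo n unc)) ,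
           trans ow (cong (product ∘ List.map hookFactor) ds≡)
        where
        dom = hooked-dominates H
        ds≡ : descentsIn lo n ≡ descentsIn lo (suc n)
        ds≡ = sym (trans (cong (descentsIn lo n ++_) (lastDescent-none lo n dom)) (List.++-identityʳ _))
      split (no ¬unc)
        with _ , d<hi , lo≤d , ds , hi≤E ← covered lo (lo ℕ.+ n) ¬unc
        with m , refl ← ℕ.m≤n⇒∃[o]m+o≡n lo≤d
        with b , eq ← ℕ.m≤n⇒∃[o]m+o≡n (ℕ.+-cancelˡ-< lo m n d<hi) = result b eq
        where
        open Hooked H
        dom = hooked-dominates H
        d = lo ℕ.+ m
        suc-d<hi : suc d ℕ.< lo ℕ.+ suc n
        suc-d<hi = subst (suc d ℕ.<_) (sym (ℕ.+-suc lo n)) (ℕ.s≤s d<hi)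
        E≡ : E d ≡ lo ℕ.+ n
        E≡ = ℕ.≤-antisym (ℕ.s≤s⁻¹ (subst (E d ℕ.<_) (ℕ.+-suc lo n) (inside lo≤d suc-d<hi ds))) hi≤E
        result : ∀ b → suc m ℕ.+ b ≡ n → Decomposition lo (suc n)
        result zero eq = contradiction (upwards lo≤d suc-d<hi ds) (ℤ.<-asym
          (subst (λ x → g x ℤ.< g d) (trans (liaN 3 (λ lo m n → lit 1 :+ m :+ lit 0 :≡ n ∷ []
             ⊢ lit 1 :+ (lo :+ m) :≡ lo :+ n) lo m n eq) (sym E≡)) ds))
        result (suc b) refl =
          let ca , va , wa , hsa , bla , owa = decompose N lo (suc m)
                (ℕ.≤-trans (liaN 2 (λ m b → [] ⊢ lit 1 :+ m :≤ lit 1 :+ m :+ (lit 1 :+ b)) m b) n≤N)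
                (restrict ℕ.≤-refl (ℕ.+-monoʳ-≤ lo (liaN 2 (λ m b → [] ⊢
                   lit 1 :+ m :≤ lit 1 :+ (lit 1 :+ m :+ (lit 1 :+ b))) m b)) H left-inside)
              cb , vb , wb , hsb , blb , owb = decompose N (lo ℕ.+ suc m) (suc b)
                (ℕ.≤-trans (ℕ.m≤n+m (suc b) (suc m)) n≤N)
                (restrict (ℕ.m≤m+n lo (suc m)) (liaN 3 (λ lo m b → [] ⊢
                   lo :+ (lit 1 :+ m) :+ (lit 1 :+ b) :≤ lo :+ (lit 1 :+ (lit 1 :+ m :+ (lit 1 :+ b)))) lo m b)
                   H right-inside)
          in hook ca cb ,
             (va , subst (λ x → Valid (lo ℕ.+ x) cb) (sym wa) vb ,
              subst₂ (Drop lo) (sym wa) (sym wb) (subst (λ x → g x ℤ.< g d) (sym (ℕ.+-suc lo m)) ds) ,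
              subst₂ (λ x y → Dominates lo (x ℕ.+ y)) (sym wa) (sym wb) dom) ,
             cong suc (cong₂ ℕ._+_ wa wb) ,
             hooks≡ wa wb hsa hsb ,
             trans bla (sym counts≡) ,
             weights≡ owa (trans blb right-count) owb
          where
          hi<→ : ∀ {d′} → lo ℕ.≤ d′ → suc d′ ℕ.< lo ℕ.+ suc m → d′ ℕ.< d
          hi<→ {d′} p q = ℕ.s≤s⁻¹ (subst (suc d′ ℕ.<_) (ℕ.+-suc lo m) q)
          widen : ∀ {d′} → d′ ℕ.< d → suc d′ ℕ.< lo ℕ.+ suc n
          widen p = ℕ.<-trans (ℕ.s≤s p) suc-d<hi
          left-inside : ∀ {d′} → lo ℕ.≤ d′ → suc d′ ℕ.< lo ℕ.+ suc m → Descent d′ → E d′ ℕ.< lo ℕ.+ suc m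
          left-inside {d′} p q ds′ with E d′ ℕ.<? lo ℕ.+ suc m
          ... | yes r = r
          ... | no ¬r = contradiction
            (nested p (widen (hi<→ p q)) ds′ (hi<→ p q)
              (subst (ℕ._≤ E d′) (ℕ.+-suc lo m) (ℕ.≮⇒≥ ¬r)) suc-d<hi ds)
            (ℕ.≤⇒≯ (subst (E d′ ℕ.≤_) (sym E≡)
              (ℕ.s≤s⁻¹ (subst (E d′ ℕ.<_) (ℕ.+-suc lo n) (inside p (widen (hi<→ p q)) ds′)))))
          end : lo ℕ.+ suc m ℕ.+ suc b ≡ lo ℕ.+ n
          end = ℕ.+-assoc lo (suc m) (suc b)
          right-inside : ∀ {d′} → lo ℕ.+ suc m ℕ.≤ d′ → suc d′ ℕ.< lo ℕ.+ suc m ℕ.+ suc b → Descent d′ →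
                         E d′ ℕ.< lo ℕ.+ suc m ℕ.+ suc b
          right-inside {d′} p q ds′ = subst (E d′ ℕ.<_) (trans E≡ (sym end))
            (nested lo≤d suc-d<hi ds (subst (ℕ._≤ d′) (ℕ.+-suc lo m) p)
              (subst (d′ ℕ.<_) (sym E≡) (ℕ.<-trans (ℕ.n<1+n d′) (subst (suc d′ ℕ.<_) end q)))
              (ℕ.<-trans (subst (suc d′ ℕ.<_) end q) (ℕ.+-monoʳ-< lo (ℕ.n<1+n n))) ds′)
          ds≡ : descentsIn lo (suc n) ≡ descentsIn lo (suc m) ++ d ∷ descentsIn (lo ℕ.+ suc m) (suc b)
          ds≡ = trans (trans (cong (descentsIn lo n ++_) (lastDescent-none lo n dom)) (List.++-identityʳ _))
                      (descentsIn-split lo m b ds)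
          hooks≡ : ∀ {ca cb} → width ca ≡ suc m → width cb ≡ suc b → hookList lo ca ≡ hooksIn lo (suc m) →
            hookList (lo ℕ.+ suc m) cb ≡ hooksIn (lo ℕ.+ suc m) (suc b) →
            hookList lo (hook ca cb) ≡ hooksIn lo (suc n)
          hooks≡ wa wb ha hb rewrite wa | wb | ha | hb | ℕ.+-suc lo m = trans
            (cong (λ e → hooksIn lo (suc m) ++ (d , e) ∷ hooksIn (suc d) (suc b)) (sym E≡))
            (trans (sym (List.map-++ _ (descentsIn lo (suc m)) _))
              (cong (List.map (λ d → d , E d)) (sym (subst (λ x → descentsIn lo (suc n) ≡
                descentsIn lo (suc m) ++ d ∷ descentsIn x (suc b)) (ℕ.+-suc lo m) ds≡))))
          counts≡ : uncoveredCount lo (suc n) ≡ uncoveredCount lo (suc m)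
          counts≡ = trans (cong (uncoveredCount lo) (sym (ℕ.+-suc (suc m) (suc b))))
            (countRange-no (uncovered? lo) lo (suc m) (suc (suc b)) λ {p} p≥ p< unc →
              ℕ.<⇒≱ (unc (subst (ℕ._≤ p) (ℕ.+-suc lo m) p≥) (lo≤d , ds))
                (subst (p ℕ.≤_) (sym E≡) (liaN 4 (λ lo m b p →
                  p :< lo :+ (lit 1 :+ m :+ (lit 1 :+ (lit 1 :+ b))) ∷ [] ⊢ p :≤ lo
                    :+ (lit 1 :+ m :+ (lit 1 :+ b)))
                  lo m b p p<)))
          right-count : uncoveredCount (lo ℕ.+ suc m) (suc b) ≡ uncoveredCount (suc d) (E d ℕ.∸ suc d)
          right-count = cong₂ uncoveredCount (ℕ.+-suc lo m) (sym (trans (cong (ℕ._∸ suc d) (trans E≡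
            (trans (sym end) (cong (ℕ._+ suc b) (ℕ.+-suc lo m))))) (ℕ.m+n∸m≡n (suc d) (suc b))))
          weights≡ : ∀ {x y z} → x ≡ hookFactors lo (suc m) → y ≡ uncoveredCount (suc d) (E d ℕ.∸ suc d) →
            z ≡ hookFactors (lo ℕ.+ suc m) (suc b) → x ℕ.* (catalan y ℕ.* z) ≡ hookFactors lo (suc n)
          weights≡ refl refl refl = sym (trans (cong (product ∘ List.map hookFactor) ds≡)
            (trans (cong product (List.map-++ hookFactor (descentsIn lo (suc m)) _))
                   (ℕ.product-++ (List.map hookFactor (descentsIn lo (suc m))) _)))

module ConfigHooks (g : ℕ → ℤ) (g-injective : Injective _≡_ _≡_ g) where
  open Word g
  open AbstractHooks g g-injective

  edge : ℕ → Config → ℕ → ℕ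
  edge lo nil        d = 0
  edge lo (blue c)   d = edge lo c d
  edge lo (hook a b) d with ℕ.<-cmp (suc d) (lo ℕ.+ width a)
  ... | tri< _ _ _ = edge lo a d
  ... | tri≈ _ _ _ = lo ℕ.+ (width a ℕ.+ width b)
  ... | tri> _ _ _ = edge (lo ℕ.+ width a) b d

  no-last-descent : ∀ {lo n d} → Dominates lo n → lo ℕ.≤ d → suc d ℕ.< lo ℕ.+ suc n → Descent d →
                    suc d ℕ.< lo ℕ.+ n
  no-last-descent {lo} {n} {d} dom lo≤d d< ds =
    ℕ.≤∧≢⇒< (ℕ.s≤s⁻¹ (subst (suc d ℕ.<_) (ℕ.+-suc lo n) d<)) λ eq →
      let k , k≡ = ℕ.m≤n⇒∃[o]m+o≡n lo≤d in
      ℤ.<-asym ds (subst₂ (λ x y → g x ℤ.< g y) k≡ (sym eq)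
        (dom (ℕ.+-cancelˡ-< lo k n (subst₂ ℕ._<_ (sym k≡) eq (ℕ.n<1+n d)))))

  edge-hooked : ∀ lo c → Valid lo c → Hooked (edge lo c) lo (lo ℕ.+ width c)
  edge-hooked lo nil v = record
    { rightwards = λ p q _ → absurd p q ; inside = λ p q _ → absurd p q
    ; upwards = λ p q _ → absurd p q ; highest = λ p q _ _ _ → absurd p q
    ; nested = λ p q _ _ _ _ _ → absurd p q }
    where
    absurd : ∀ {A : Set} {d} → lo ℕ.≤ d → suc d ℕ.< lo ℕ.+ 0 → A
    absurd {d = d} p q = ⊥-elim (liaN 2 (λ lo d → lo :≤ d ∷ lit 1 :+ d :< lo :+ lit 0 ∷ [] ⊢ :⊥) lo d p q)
  edge-hooked lo (blue c) (v , dom) = record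
    { rightwards = λ p q ds → rightwards p (fit p q ds) ds
    ; inside     = λ p q ds → ℕ.<-trans (inside p (fit p q ds) ds) (ℕ.+-monoʳ-< lo (ℕ.n<1+n (width c)))
    ; upwards    = λ p q ds → upwards p (fit p q ds) ds
    ; highest    = λ p q ds → highest p (fit p q ds) ds
    ; nested     = λ p q ds a b q′ ds′ →
        nested p (fit p q ds) ds a b (fit (ℕ.≤-trans p (ℕ.<⇒≤ a)) q′ ds′) ds′
    }
    where
    open Hooked (edge-hooked lo c v)
    fit : ∀ {d} → lo ℕ.≤ d → suc d ℕ.< lo ℕ.+ suc (width c) → Descent d → suc d ℕ.< lo ℕ.+ width c
    fit = no-last-descent dom
  edge-hooked lo (hook a b) (va , vb , dr , dom) = record
    { rightwards = λ {d} p q ds → rightwards d (view p q ds)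
    ; inside     = λ {d} p q ds → ℕ.≤-<-trans (below d (view p q ds)) (ℕ.+-monoʳ-< lo (ℕ.n<1+n n))
    ; upwards    = λ {d} p q ds → upwards d p ds (view p q ds)
    ; highest    = λ {d} p q ds → highest d p ds (view p q ds)
    ; nested     = λ {d} {d′} p q ds i j q′ ds′ →
        nested d d′ p ds i j (view p q ds) ds′ (view (ℕ.≤-trans p (ℕ.<⇒≤ i)) q′ ds′)
    }
    where
    module A = Hooked (edge-hooked lo a va)
    module B = Hooked (edge-hooked (lo ℕ.+ width a) b vb)
    n = width a ℕ.+ width b
    hi = lo ℕ.+ n
    mid = lo ℕ.+ width a
    mid+ : mid ℕ.+ width b ≡ hi
    mid+ = ℕ.+-assoc lo (width a) (width b)
    E = edge lo (hook a b)
    data View (d : ℕ) : Set where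
      left   : lo ℕ.≤ d → suc d ℕ.< mid → Descent d → E d ≡ edge lo a d → View d
      middle : suc d ≡ mid → lo ℕ.≤ d → suc d ℕ.< hi → E d ≡ hi → View d
      right  : mid ℕ.≤ d → suc d ℕ.< mid ℕ.+ width b → Descent d → E d ≡ edge mid b d → View d
    view : ∀ {d} → lo ℕ.≤ d → suc d ℕ.< lo ℕ.+ suc n → Descent d → View d
    view {d} p q ds with ℕ.<-cmp (suc d) (lo ℕ.+ width a) in eq
    ... | tri< d< _ _ = left p d< ds (E≡ eq)
      where E≡ : ∀ {x y z} → ℕ.<-cmp (suc d) (lo ℕ.+ width a) ≡ tri< x y z → E d ≡ edge lo a d
            E≡ eq rewrite eq = refl
    ... | tri≈ _ d≡ _ = middle d≡ p (no-last-descent dom p q ds) (E≡ eq)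
      where E≡ : ∀ {x y z} → ℕ.<-cmp (suc d) (lo ℕ.+ width a) ≡ tri≈ x y z → E d ≡ hi
            E≡ eq rewrite eq = refl
    ... | tri> _ _ d> = right (ℕ.s≤s⁻¹ d>) (subst (suc d ℕ.<_) (sym mid+) (no-last-descent dom p q ds))
      ds (E≡ eq)
      where E≡ : ∀ {x y z} → ℕ.<-cmp (suc d) (lo ℕ.+ width a) ≡ tri> x y z → E d ≡ edge mid b d
            E≡ eq rewrite eq = refl
    mid≤hi : mid ℕ.≤ hi
    mid≤hi = ℕ.+-monoʳ-≤ lo (ℕ.m≤m+n (width a) (width b))
    top : ∀ {p} → lo ℕ.≤ p → p ℕ.< hi → g p ℤ.< g hi
    top {p} lo≤p p<hi with k , refl ← ℕ.m≤n⇒∃[o]m+o≡n lo≤p = dom (ℕ.+-cancelˡ-< lo k n p<hi)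
    top′ : ∀ {p} → lo ℕ.≤ p → p ℕ.≤ hi → g p ℤ.≤ g hi
    top′ lo≤p p≤hi with ℕ.m≤n⇒m<n∨m≡n p≤hi
    ... | inj₁ p<hi = ℤ.<⇒≤ (top lo≤p p<hi)
    ... | inj₂ refl = ℤ.≤-refl
    rightwards : ∀ d → View d → d ℕ.< E d
    rightwards d (left p q ds eq)  = subst (d ℕ.<_) (sym eq) (A.rightwards p q ds)
    rightwards d (middle _ _ q eq) = subst (d ℕ.<_) (sym eq) (ℕ.<-trans (ℕ.n<1+n d) q)
    rightwards d (right p q ds eq) = subst (d ℕ.<_) (sym eq) (B.rightwards p q ds)
    below : ∀ d → View d → E d ℕ.≤ hi
    below d (left p q ds eq)  = subst (ℕ._≤ hi) (sym eq) (ℕ.≤-trans (ℕ.<⇒≤ (A.inside p q ds)) mid≤hi)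
    below d (middle _ _ _ eq) = ℕ.≤-reflexive eq
    below d (right p q ds eq) = subst₂ ℕ._≤_ (sym eq) mid+ (ℕ.<⇒≤ (B.inside p q ds))
    upwards : ∀ d → lo ℕ.≤ d → Descent d → View d → g d ℤ.< g (E d)
    upwards d _ _ (left p q ds eq)   = subst (λ e → g d ℤ.< g e) (sym eq) (A.upwards p q ds)
    upwards d p _ (middle _ _ q eq)  = subst (λ e → g d ℤ.< g e) (sym eq) (top p (ℕ.<-trans (ℕ.n<1+n d) q))
    upwards d _ _ (right p q ds eq)  = subst (λ e → g d ℤ.< g e) (sym eq) (B.upwards p q ds)
    highest : ∀ d → lo ℕ.≤ d → Descent d → View d → ∀ {p} → d ℕ.≤ p → p ℕ.≤ E d → g p ℤ.≤ g (E d)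
    highest d _ _ (left p q ds eq) i j rewrite eq = A.highest p q ds i j
    highest d p _ (middle _ _ q eq) i j rewrite eq = top′ (ℕ.≤-trans p i) j
    highest d _ _ (right p q ds eq) i j rewrite eq = B.highest p q ds i j
    nested : ∀ d d′ → lo ℕ.≤ d → Descent d → d ℕ.< d′ → d′ ℕ.< E d → View d → Descent d′ → View d′ →
      E d′ ℕ.< E d
    nested d d′ _ _ i j (left p q ds eq) ds′ (left p′ q′ _ eq′) rewrite eq | eq′ = A.nested p q ds i j q′ ds′
    nested d d′ _ _ i j (left p q ds eq) ds′ (middle d≡ _ _ _) rewrite eq =
      contradiction (A.inside p q ds) (ℕ.≤⇒≯ (subst (ℕ._≤ edge lo a d) d≡ j))
    nested d d′ _ _ i j (left p q ds eq) ds′ (right p′ _ _ _) rewrite eq =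
      contradiction (A.inside p q ds) (ℕ.<⇒≯ (ℕ.≤-<-trans p′ j))
    nested d d′ _ _ i j (middle _ _ _ eq) ds′ (left p′ q′ _ eq′) rewrite eq | eq′ =
      ℕ.<-≤-trans (A.inside p′ q′ ds′) mid≤hi
    nested d d′ _ _ i j (middle d≡ _ _ eq) ds′ (middle d′≡ _ _ eq′) =
      contradiction i (ℕ.<-irrefl (ℕ.suc-injective (trans d≡ (sym d′≡))))
    nested d d′ _ _ i j (middle _ _ _ eq) ds′ (right p′ q′ _ eq′) rewrite eq | eq′ =
      subst (edge mid b d′ ℕ.<_) mid+ (B.inside p′ q′ ds′)
    nested d d′ _ _ i j (right p q ds eq) ds′ (left _ q′ _ _) =
      contradiction (ℕ.<-trans (ℕ.≤-<-trans p i) (ℕ.n<1+n d′)) (ℕ.<⇒≯ q′)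
    nested d d′ _ _ i j (right p q ds eq) ds′ (middle d′≡ _ _ _) =
      contradiction (ℕ.<-trans (ℕ.≤-<-trans p i) (ℕ.n<1+n d′)) (ℕ.<-irrefl (sym d′≡))
    nested d d′ _ _ i j (right p q ds eq) ds′ (right p′ q′ _ eq′) rewrite eq | eq′ = B.nested p q ds i j q′ ds′

  ∈-descentsIn⁻ : ∀ lo n → All (λ d → lo ℕ.≤ d × suc d ℕ.< lo ℕ.+ n) (descentsIn lo n)
  ∈-descentsIn⁻ lo zero    = []
  ∈-descentsIn⁻ lo (suc n) = All.++⁺
    (All.map (λ (p , q) → p , ℕ.<-trans q (ℕ.+-monoʳ-< lo (ℕ.n<1+n n))) (∈-descentsIn⁻ lo n)) (last n)
    where
    last : ∀ n → All (λ d → lo ℕ.≤ d × suc d ℕ.< lo ℕ.+ suc n) (lastDescent lo n)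
    last zero    = []
    last (suc n) with does (descent? (lo ℕ.+ n))
    ... | false = []
    ... | true  = (ℕ.m≤m+n lo n ,
      liaN 2 (λ lo n → [] ⊢ lit 1 :+ (lo :+ n) :< lo :+ (lit 1 :+ (lit 1 :+ n))) lo n) ∷ []

  edge-hooksIn : ∀ lo c → Valid lo c → hooksIn (edge lo c) lo (width c) ≡ hookList lo c
  edge-hooksIn lo nil        v         = refl
  edge-hooksIn lo (blue c)   (v , dom) = trans
    (cong (List.map _) (trans
      (cong (descentsIn lo (width c) ++_) (lastDescent-none (edge lo c) lo (width c) dom))
      (List.++-identityʳ _)))
    (edge-hooksIn lo c v)
  edge-hooksIn lo (hook a b) (va , vb , dr , dom) = split (width a) (width b) refl refl dr
    where
    E = edge lo (hook a b)
    at : (ℕ → ℕ) → ℕ → ℕ × ℕ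
    at E d = d , E d
    split : ∀ x y → width a ≡ x → width b ≡ y → Drop lo x y →
      hooksIn E lo (suc (width a ℕ.+ width b)) ≡ hookList lo (hook a b)
    split (suc m) (suc y) wa wb dr = begin
      List.map (at E) (descentsIn lo n ++ lastDescent lo n)
        ≡⟨ cong (List.map (at E)) (trans (cong (descentsIn lo n ++_) (lastDescent-none E lo n dom))
          (List.++-identityʳ _)) ⟩
      List.map (at E) (descentsIn lo n)
        ≡⟨ cong (List.map (at E)) (cong₂ (λ x y → descentsIn lo (x ℕ.+ y)) wa wb) ⟩
      List.map (at E) (descentsIn lo (suc m ℕ.+ suc y))
        ≡⟨ cong (List.map (at E)) (descentsIn-split lo m y
          (subst (λ x → g x ℤ.< g (lo ℕ.+ m)) (ℕ.+-suc lo m) dr)) ⟩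
      List.map (at E) (descentsIn lo (suc m) ++ lo ℕ.+ m ∷ descentsIn (lo ℕ.+ suc m) (suc y))
        ≡⟨ List.map-++ (at E) (descentsIn lo (suc m)) _ ⟩
      List.map (at E) (descentsIn lo (suc m)) ++ at E (lo ℕ.+ m)
        ∷ List.map (at E) (descentsIn (lo ℕ.+ suc m) (suc y))
        ≡⟨ cong₂ (λ x y → List.map (at E) (descentsIn lo x) ++ at E (lo ℕ.+ m)
          ∷ List.map (at E) (descentsIn (lo ℕ.+ x) y)) wa wb ⟨
      List.map (at E) (descentsIn lo (width a)) ++ at E (lo ℕ.+ m)
        ∷ List.map (at E) (descentsIn (lo ℕ.+ width a) (width b))
        ≡⟨ cong₂ (λ x y → x ++ at E (lo ℕ.+ m) ∷ y)
             (List.map-cong-local (All.map (λ (_ , q) → cong (_ ,_) (E-left q)) (∈-descentsIn⁻ lo (width a))))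
             (List.map-cong-local (All.map (λ (p , _) → cong (_ ,_) (E-right p))
               (∈-descentsIn⁻ (lo ℕ.+ width a) (width b)))) ⟩
      hooksIn (edge lo a) lo (width a) ++ at E (lo ℕ.+ m)
        ∷ hooksIn (edge (lo ℕ.+ width a) b) (lo ℕ.+ width a) (width b)
        ≡⟨ cong₂ (λ x y → x ++ at E (lo ℕ.+ m) ∷ y) (edge-hooksIn lo a va) (edge-hooksIn
          (lo ℕ.+ width a) b vb) ⟩
      hookList lo a ++ at E (lo ℕ.+ m) ∷ hookList (lo ℕ.+ width a) b
        ≡⟨ cong (λ x → hookList lo a ++ x ∷ hookList (lo ℕ.+ width a) b)
             (cong₂ _,_ (cong ℕ.pred mid≡) (E-middle mid≡)) ⟩
      hookList lo (hook a b) ∎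
      where
      open ≡-Reasoning
      n = width a ℕ.+ width b
      mid≡ : suc (lo ℕ.+ m) ≡ lo ℕ.+ width a
      mid≡ = trans (sym (ℕ.+-suc lo m)) (cong (lo ℕ.+_) (sym wa))
      E-left : ∀ {d} → suc d ℕ.< lo ℕ.+ width a → E d ≡ edge lo a d
      E-left {d} d< with ℕ.<-cmp (suc d) (lo ℕ.+ width a)
      ... | tri< _ _ _   = refl
      ... | tri≈ ¬p _ _  = contradiction d< ¬p
      ... | tri> ¬p _ _  = contradiction d< ¬p
      E-middle : ∀ {d} → suc d ≡ lo ℕ.+ width a → E d ≡ lo ℕ.+ (width a ℕ.+ width b)
      E-middle {d} d≡ with ℕ.<-cmp (suc d) (lo ℕ.+ width a)
      ... | tri< _ ¬p _  = contradiction d≡ ¬p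
      ... | tri≈ _ _ _   = refl
      ... | tri> _ ¬p _  = contradiction d≡ ¬p
      E-right : ∀ {d} → lo ℕ.+ width a ℕ.≤ d → E d ≡ edge (lo ℕ.+ width a) b d
      E-right {d} d≥ with ℕ.<-cmp (suc d) (lo ℕ.+ width a)
      ... | tri< _ _ ¬p  = contradiction (ℕ.s≤s d≥) ¬p
      ... | tri≈ _ _ ¬p  = contradiction (ℕ.s≤s d≥) ¬p
      ... | tri> _ _ _   = refl

  hookList-below : ∀ lo c → All (λ h → proj₂ h ℕ.< lo ℕ.+ width c) (hookList lo c)
  hookList-below lo nil        = []
  hookList-below lo (blue c)   =
    All.map (λ p → ℕ.<-trans p (ℕ.+-monoʳ-< lo (ℕ.n<1+n (width c)))) (hookList-below lo c)
  hookList-below lo (hook a b) = All.++⁺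
    (All.map (λ p → ℕ.<-≤-trans p (ℕ.+-monoʳ-≤ lo (ℕ.m≤n⇒m≤1+n (ℕ.m≤m+n (width a) (width b)))))
      (hookList-below lo a))
    (ℕ.+-monoʳ-< lo (ℕ.n<1+n _) ∷
     All.map (λ p → ℕ.<-trans p (ℕ.≤-<-trans (ℕ.≤-reflexive (ℕ.+-assoc lo (width a) (width b)))
                      (ℕ.+-monoʳ-< lo (ℕ.n<1+n _)))) (hookList-below (lo ℕ.+ width a) b))

  private
    Below : ℕ → ℕ × ℕ → Set
    Below e h = proj₂ h ℕ.< e

  split-unique : ∀ e {d d′} xs xs′ {ys ys′ : List (ℕ × ℕ)} → All (Below e) xs → All (Below e) xs′ →
    All (Below e) ys → All (Below e) ys′ → xs ++ (d , e) ∷ ys ≡ xs′ ++ (d′ , e) ∷ ys′ →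
    xs ≡ xs′ × d ≡ d′ × ys ≡ ys′
  split-unique e []       []         _ _ _ _ refl = refl , refl , refl
  split-unique e []       (x ∷ xs′)  _ (b ∷ _) _ _ refl = contradiction b (ℕ.<-irrefl refl)
  split-unique e (x ∷ xs) []         (b ∷ _) _ _ _ refl = contradiction b (ℕ.<-irrefl refl)
  split-unique e (x ∷ xs) (x′ ∷ xs′) (_ ∷ bs) (_ ∷ bs′) cs cs′ eq
    with refl , eq′ ← List.∷-injective eq
    with refl , rest ← split-unique e xs xs′ bs bs′ cs cs′ eq′ = refl , rest

  no-split : ∀ e {d} xs {ys zs : List (ℕ × ℕ)} → All (Below e) zs → ¬ (xs ++ (d , e) ∷ ys ≡ zs)
  no-split e []       (b ∷ _)  refl = ℕ.<-irrefl refl b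
  no-split e (x ∷ xs) (_ ∷ bs) eq   = no-split e xs bs (proj₂ (List.∷-injective eq))

  hookList-injective : ∀ lo c c′ → Valid lo c → Valid lo c′ → width c ≡ width c′ →
                       hookList lo c ≡ hookList lo c′ → c ≡ c′
  hookList-injective lo nil        nil         v v′ w eq = refl
  hookList-injective lo (blue c)   (blue c′)   (v , _) (v′ , _) w eq =
    cong blue (hookList-injective lo c c′ v v′ (ℕ.suc-injective w) eq)
  hookList-injective lo (blue c)   (hook a b)  v v′ w eq =
    contradiction (sym eq) (no-split _ (hookList lo a)
      (subst (λ n → All (Below (lo ℕ.+ n)) (hookList lo c)) (ℕ.suc-injective w) (hookList-below lo c)))
  hookList-injective lo (hook a b) (blue c)    v v′ w eq =
    contradiction eq (no-split _ (hookList lo a)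
      (subst (λ n → All (Below (lo ℕ.+ n)) (hookList lo c)) (sym (ℕ.suc-injective w)) (hookList-below lo c)))
  hookList-injective lo (hook a b) (hook a′ b′) (va , vb , dr , _) (va′ , vb′ , dr′ , _) w eq =
    combined (split-unique (lo ℕ.+ (width a ℕ.+ width b)) (hookList lo a) (hookList lo a′)
      (left a b) (subst (λ n → All (Below (lo ℕ.+ n)) (hookList lo a′)) (sym w′) (left a′ b′))
      (right a b) (subst (λ n → All (Below (lo ℕ.+ n)) (hookList (lo ℕ.+ width a′) b′)) (sym w′) (right a′ b′))
      (trans eq (cong (λ n → hookList lo a′ ++ (ℕ.pred (lo ℕ.+ width a′) , lo ℕ.+ n)
        ∷ hookList (lo ℕ.+ width a′) b′) (sym w′))))
    where
    w′ = ℕ.suc-injective w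
    left : ∀ a b → All (Below (lo ℕ.+ (width a ℕ.+ width b))) (hookList lo a)
    left a b = All.map (λ p → ℕ.<-≤-trans p (ℕ.+-monoʳ-≤ lo (ℕ.m≤m+n (width a) (width b))))
      (hookList-below lo a)
    right : ∀ a b → All (Below (lo ℕ.+ (width a ℕ.+ width b))) (hookList (lo ℕ.+ width a) b)
    right a b = subst (λ e → All (Below e) (hookList (lo ℕ.+ width a) b)) (ℕ.+-assoc lo (width a) (width b))
      (hookList-below (lo ℕ.+ width a) b)
    pred-injective : ∀ x x′ {y y′} → Drop lo x y → Drop lo x′ y′ →
                     ℕ.pred (lo ℕ.+ x) ≡ ℕ.pred (lo ℕ.+ x′) → x ≡ x′
    pred-injective (suc x) (suc x′) _ _ eq =
      cong suc (ℕ.+-cancelˡ-≡ lo x x′ (subst₂ (λ p q → ℕ.pred p ≡ ℕ.pred q) (ℕ.+-suc lo x) (ℕ.+-suc lo x′) eq))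
    combined : hookList lo a ≡ hookList lo a′ × ℕ.pred (lo ℕ.+ width a) ≡ ℕ.pred (lo ℕ.+ width a′) ×
      hookList (lo ℕ.+ width a) b ≡ hookList (lo ℕ.+ width a′) b′ → hook a b ≡ hook a′ b′
    combined (ea , ed , eb) with hookList-injective lo a a′ va va′
      (pred-injective (width a) (width a′) {width b} {width b′} dr dr′ ed) ea
    ... | refl = cong (hook a) (hookList-injective (lo ℕ.+ width a) b b′ vb vb′
                   (ℕ.+-cancelˡ-≡ (width a) _ _ w′) eb)

lookup-distinct : ∀ {A : Set} {_≈ₐ_ : A → A → Set} → (∀ {x y} → x ≈ₐ y → y ≈ₐ x) →
  ∀ {xs} → AllPairs (λ x y → ¬ (x ≈ₐ y)) xs → ∀ i j → List.lookup xs i ≈ₐ List.lookup xs j → i ≡ j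
lookup-distinct sym (_ ∷ _)  Fin.zero    Fin.zero    eq = refl
lookup-distinct sym (n ∷ _)  Fin.zero    (Fin.suc j) eq = contradiction eq (All.lookup n (∈.∈-lookup j))
lookup-distinct sym (n ∷ _)  (Fin.suc i) Fin.zero    eq = contradiction (sym eq) (All.lookup n (∈.∈-lookup i))
lookup-distinct sym (_ ∷ ns) (Fin.suc i) (Fin.suc j) eq = cong Fin.suc (lookup-distinct sym ns i j eq)

map-filter : ∀ {A B : Set} {P : A → Set} {Q : B → Set} (P? : ∀ x → Dec (P x)) (Q? : ∀ y → Dec (Q y))
  (f : A → B) → (∀ x → P x ⇔ Q (f x)) → ∀ xs → List.map f (List.filter P? xs) ≡ List.filter Q? (List.map f xs)
map-filter P? Q? f h []       = refl
map-filter P? Q? f h (x ∷ xs) with P? x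
... | yes p = trans (cong (f x ∷_) (map-filter P? Q? f h xs))
                    (sym (List.filter-accept Q? (Equivalence.to (h x) p)))
... | no ¬p = trans (map-filter P? Q? f h xs)
                    (sym (List.filter-reject Q? (¬p ∘ Equivalence.from (h x))))

tabulate-toℕ : ∀ {A : Set} n (f : ℕ → A) → List.tabulate {n = n} (f ∘ toℕ) ≡ List.applyUpTo f n
tabulate-toℕ zero    f = refl
tabulate-toℕ (suc n) f = cong (f 0 ∷_) (tabulate-toℕ n (f ∘ suc))

count-countRange : ∀ {A : Set} {P : A → Set} {Q : ℕ → Set} (P? : ∀ x → Dec (P x)) (Q? : ∀ p → Dec (Q p)) →
  ∀ n (f : Fin n → A) lo → (∀ i → P (f i) ⇔ Q (lo ℕ.+ toℕ i)) →
  Vec.count P? (Vec.tabulate f) ≡ countRange Q? lo n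
count-countRange P? Q? zero    f lo h = refl
count-countRange {P = P} {Q} P? Q? (suc n) f lo h = trans (head (P? (f Fin.zero)) (Q? lo)
    (subst (λ p → P (f Fin.zero) ⇔ Q p) (ℕ.+-identityʳ lo) (h Fin.zero)))
  (trans (cong ((if does (Q? lo) then 1 else 0) ℕ.+_)
      (count-countRange P? Q? n (f ∘ Fin.suc) (suc lo) λ i → subst (λ p → P (f (Fin.suc i)) ⇔ Q p)
        (ℕ.+-suc lo (toℕ i)) (h (Fin.suc i))))
    (sym (countRange-cons Q? lo n)))
  where
  head : ∀ {X Y : Set} (d : Dec X) (d′ : Dec Y) → X ⇔ Y → ∀ {m} →
    (if does d then suc else id) m ≡ (if does d′ then 1 else 0) ℕ.+ m
  head (yes _) (yes _) _ = refl
  head (no _)  (no _)  _ = refl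
  head (yes x) (no ¬y) e = contradiction (Equivalence.to e x) ¬y
  head (no ¬x) (yes y) e = contradiction (Equivalence.from e y) ¬x

module WordVHC (g : ℕ → ℤ) (g-injective : Injective _≡_ _≡_ g) (N : ℕ) where
  open Word g
  open AbstractHooks g g-injective
  open ConfigHooks g g-injective

  word : Vector ℤ N
  word a = g (toℕ a)

  private
    Inner : ℕ → Set
    Inner d = suc d ℕ.< N × Descent d

    inner? : ∀ d → Dec (Inner d)
    inner? d = suc d ℕ.<? N ×-dec descent? d

    isDescent⇔ : ∀ d → IsDescent word d ⇔ Inner (toℕ d)
    isDescent⇔ d = mk⇔
      (λ (e , e≡ , lt) → subst (ℕ._< N) e≡ (Fin.toℕ<n e) , subst (λ x → g x ℤ.< g (toℕ d)) e≡ lt)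
      (λ (d< , ds) → fromℕ< d< , Fin.toℕ-fromℕ< d< ,
        subst (λ x → g x ℤ.< g (toℕ d)) (sym (Fin.toℕ-fromℕ< d<)) ds)

    filter-upTo : ∀ m → m ℕ.< N → List.filter inner? (List.upTo m) ≡ descentsIn 0 (suc m)
    filter-upTo zero    _  = refl
    filter-upTo (suc m) m< = trans (cong (List.filter inner?) (sym (List.upTo-∷ʳ m)))
      (trans (List.filter-++ inner? (List.upTo m) (m ∷ []))
        (cong₂ _++_ (filter-upTo m (ℕ.<-trans (ℕ.n<1+n m) m<)) (last (descent? m))))
      where
      last : (d : Dec (Descent m)) → List.filter inner? (m ∷ []) ≡ (if does d then m ∷ [] else [])
      last (yes ds) = List.filter-accept inner? (m< , ds)
      last (no ¬ds) = List.filter-reject inner? (¬ds ∘ proj₂)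

  descents-toℕ : List.map toℕ (descents word) ≡ descentsIn 0 N
  descents-toℕ = trans (map-filter (isDescent? word) inner? toℕ isDescent⇔ (List.allFin N))
    (trans (cong (List.filter inner?) (trans (List.map-tabulate id toℕ) (tabulate-toℕ N id)))
           (filter-all N refl))
    where
    filter-all : ∀ n → n ≡ N → List.filter inner? (List.upTo n) ≡ descentsIn 0 n
    filter-all zero    _  = refl
    filter-all (suc m) eq = trans (cong (List.filter inner?) (sym (List.upTo-∷ʳ m)))
      (trans (List.filter-++ inner? (List.upTo m) (m ∷ []))
        (trans (cong₂ _++_ (filter-upTo m (ℕ.≤-reflexive eq))
          (List.filter-reject inner? λ (p , _) → ℕ.<-irrefl eq p)) (List.++-identityʳ _)))

  descents-unique : Unique (descents word)
  descents-unique = Unique.filter⁺ (isDescent? word) (Unique.allFin⁺ N)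

  lookup-descent : ∀ i → suc (toℕ (List.lookup (descents word) i)) ℕ.< N ×
                         Descent (toℕ (List.lookup (descents word) i))
  lookup-descent i = Equivalence.to (isDescent⇔ _)
    (proj₂ (∈.∈-filter⁻ (isDescent? word) {xs = List.allFin N} (∈.∈-lookup {xs = descents word} i)))

  descent-index : ∀ {d} → suc d ℕ.< N → Descent d → ∃[ i ] toℕ (List.lookup (descents word) i) ≡ d
  descent-index {d} d< ds =
    Any.index m , trans (cong toℕ (sym (Any.lookup-index m))) (Fin.toℕ-fromℕ< d<N)
    where
    d<N = ℕ.<-trans (ℕ.n<1+n d) d<
    m : fromℕ< d<N ∈ descents word
    m = ∈.∈-filter⁺ (isDescent? word) (∈.∈-allFin (fromℕ< d<N)) (Equivalence.from (isDescent⇔ _)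
          (subst Inner (sym (Fin.toℕ-fromℕ< d<N)) (d< , ds)))

  tabulate-hooksIn : ∀ (E : ℕ → ℕ) (f : Fin (List.length (descents word)) → ℕ × ℕ) →
    (∀ i → f i ≡ (toℕ (List.lookup (descents word) i) , E (toℕ (List.lookup (descents word) i)))) →
    List.tabulate f ≡ hooksIn E 0 N
  tabulate-hooksIn E f h = begin
    List.tabulate f
      ≡⟨ List.tabulate-cong h ⟩
    List.tabulate (λ i → at (List.lookup (descents word) i))
      ≡⟨ List.map-tabulate (List.lookup (descents word)) at ⟨
    List.map at (List.tabulate (List.lookup (descents word)))
      ≡⟨ cong (List.map at) (List.tabulate-lookup (descents word)) ⟩
    List.map at (descents word)
      ≡⟨ List.map-∘ (descents word) ⟩
    List.map (λ d → d , E d) (List.map toℕ (descents word))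
      ≡⟨ cong (List.map (λ d → d , E d)) descents-toℕ ⟩
    hooksIn E 0 N ∎
    where
    open ≡-Reasoning
    at : Fin N → ℕ × ℕ
    at d = toℕ d , E (toℕ d)

  module FromVHC (𝓗 : VHC word) where
    open VHC 𝓗

    start end : Fin (List.length (descents word)) → ℕ
    start i = toℕ (sw (hooks i))
    end   i = toℕ (ne (hooks i))

    E : ℕ → ℕ
    E d with Fin.any? (λ i → start i ℕ.≟ d)
    ... | yes (i , _) = end i
    ... | no _        = 0

    start-injective : ∀ i j → start i ≡ start j → i ≡ j
    start-injective i j eq = lookup-distinct sym descents-unique i j
      (trans (sym (atDescents i)) (trans (Fin.toℕ-injective eq) (atDescents j)))

    E-start : ∀ i → E (start i) ≡ end i
    E-start i with Fin.any? (λ j → start j ℕ.≟ start i)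
    ... | yes (j , eq) = cong end (start-injective j i eq)
    ... | no ¬p        = contradiction (i , refl) ¬p

    start-descent : ∀ i → suc (start i) ℕ.< N × Descent (start i)
    start-descent i = subst (λ d → Inner (toℕ d)) (sym (atDescents i)) (lookup-descent i)

    hook-at : ∀ {d} → suc d ℕ.< N → Descent d → ∃[ i ] start i ≡ d
    hook-at d< ds with i , refl ← descent-index d< ds = i , cong toℕ (atDescents i)

    below-end : ∀ i p → start i ℕ.≤ p → p ℕ.≤ end i → g p ℤ.≤ g (end i)
    below-end i p s≤p p≤e = ℤ.≮⇒≥ λ lt → noneAbove i (fromℕ< p<N)
      (subst (start i ℕ.≤_) p≡ s≤p , subst (ℕ._≤ end i) p≡ p≤e , subst (λ x → g (end i) ℤ.< g x) p≡ lt)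
      where
      p<N = ℕ.≤-<-trans p≤e (Fin.toℕ<n (ne (hooks i)))
      p≡ = sym (Fin.toℕ-fromℕ< p<N)

    below-end′ : ∀ i p → start i ℕ.≤ p → p ℕ.≤ end i → p ≢ end i → g p ℤ.< g (end i)
    below-end′ i p a b p≢ = ℤ.≤∧≢⇒< (below-end i p a b) (p≢ ∘ g-injective)

    nested-ends : ∀ i j → start i ℕ.< start j → start j ℕ.< end i → end j ℕ.< end i
    nested-ends i j i<j j<e = ℕ.≰⇒> λ e≤ → ℤ.<⇒≱ lower
      (below-end j (end i) (ℕ.<⇒≤ j<e) e≤)
      where
      lower : g (end j) ℤ.< g (end i)
      lower = ℤ.≰⇒> λ ge → case disjoint i j (λ eq → ℕ.<⇒≢ i<j (cong start eq))
          (sw (hooks j) , g (end i))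
          (inj₂ (refl , ℕ.<⇒≤ i<j , ℕ.<⇒≤ j<e))
          (inj₁ (refl , below-end i (start j) (ℕ.<⇒≤ i<j) (ℕ.<⇒≤ j<e) , ge)) of λ where
        (inj₁ (eq , _)) → ℕ.<⇒≢ j<e (cong (toℕ ∘ proj₁) eq)
        (inj₂ (eq , _)) → ℕ.<⇒≢ i<j (cong (toℕ ∘ proj₁) (sym eq))

    hooked : Hooked E 0 N
    hooked = record
      { rightwards = λ _ p ds → via p ds λ i → subst (start i ℕ.<_) (sym (E-start i)) (Hook.sw<ne (hooks i))
      ; inside     = λ _ p ds → via p ds λ i → subst (ℕ._< N) (sym (E-start i)) (Fin.toℕ<n (ne (hooks i)))
      ; upwards    = λ _ p ds → via p ds λ i →
          subst (λ e → g (start i) ℤ.< g e) (sym (E-start i)) (Hook.rises (hooks i))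
      ; highest    = λ {_} {q} _ p ds → via p ds {λ d → d ℕ.≤ q → q ℕ.≤ E d → g q ℤ.≤ g (E d)} λ i →
          subst (λ e → start i ℕ.≤ q → q ℕ.≤ e → g q ℤ.≤ g e) (sym (E-start i)) (below-end i q)
      ; nested     = λ {_} {d′} _ p ds →
        via p ds {λ d → d ℕ.< d′ → d′ ℕ.< E d → suc d′ ℕ.< N → Descent d′ → E d′ ℕ.< E d}
          λ i a b p′ ds′ → via p′ ds′ {λ d′ → start i ℕ.< d′ → d′ ℕ.< E (start i) → E d′ ℕ.< E (start i)}
            (λ j → subst₂ (λ x y → start i ℕ.< start j → start j ℕ.< x → y ℕ.< x)
              (sym (E-start i)) (sym (E-start j)) (nested-ends i j)) a b
      }
      where
      via : ∀ {d} → suc d ℕ.< N → Descent d → {P : ℕ → Set} → (∀ i → P (start i)) → P d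
      via p ds {P} h = let i , eq = hook-at p ds in subst P eq (h i)

    open Hooked hooked

    endpoints≡ : endpoints word 𝓗 ≡ hooksIn E 0 N
    endpoints≡ = tabulate-hooksIn E _ λ i → subst (λ d → (start i , end i) ≡ (toℕ d , E (toℕ d))) (atDescents i)
      (cong (start i ,_) (sym (E-start i)))

    isBlue⇔ : ∀ p → IsBlue word 𝓗 p ⇔ Uncovered E 0 (toℕ p)
    isBlue⇔ p = mk⇔
      (λ (col , unseen) {d} d<p (_ , ds) → ℕ.≰⇒> λ p≤E →
        let i , i≡ = hook-at (ℕ.≤-<-trans d<p (Fin.toℕ<n p)) ds
            s<p = subst (ℕ._< toℕ p) (sym i≡) d<p
            p≤e = subst (toℕ p ℕ.≤_) (trans (cong E (sym i≡)) (E-start i)) p≤E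
        in unseen i (s<p , p≤e , below-end′ i (toℕ p) (ℕ.<⇒≤ s<p) p≤e (col i ∘ Fin.toℕ-injective)))
      (λ unc →
        (λ j p≡ → ℕ.<-irrefl (trans (E-start j) (cong toℕ (sym p≡)))
          (unc (subst (start j ℕ.<_) (cong toℕ (sym p≡)) (Hook.sw<ne (hooks j)))
            (ℕ.z≤n , proj₂ (start-descent j)))) ,
        (λ j (s<p , p≤e , _) → ℕ.<⇒≱ (unc s<p (ℕ.z≤n , proj₂ (start-descent j)))
          (subst (toℕ p ℕ.≤_) (sym (E-start j)) p≤e)))

    Under : ℕ → ℕ → Set
    Under d p = (suc d ℕ.≤ p × p ℕ.< E d) × Uncovered E (suc d) p

    under? : ∀ d p → Dec (Under d p)
    under? d p = (suc d ℕ.≤? p ×-dec p ℕ.<? E d) ×-dec uncovered? E (suc d) p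

    -- A hook seen from a point under the i-th hook, but not coming from under it, is
    -- higher than the i-th hook.
    hasColour⇔ : ∀ i p → HasColour word 𝓗 i p ⇔ Under (start i) (toℕ p)
    hasColour⇔ i p = mk⇔ to from
      where
      to : HasColour word 𝓗 i p → Under (start i) (toℕ p)
      to (col , (s<p , p≤e , _) , first) =
        (s<p , subst (toℕ p ℕ.<_) (sym (E-start i)) (ℕ.≤∧≢⇒< p≤e (col i ∘ Fin.toℕ-injective))) ,
        λ {d} d<p (i<d , ds) → ℕ.≰⇒> λ p≤E →
          let j , j≡ = hook-at (ℕ.≤-<-trans d<p (Fin.toℕ<n p)) ds
              sj<p = subst (ℕ._< toℕ p) (sym j≡) d<p
              p≤ej = subst (toℕ p ℕ.≤_) (trans (cong E (sym j≡)) (E-start j)) p≤E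
              p<ei = ℕ.≤∧≢⇒< p≤e (col i ∘ Fin.toℕ-injective)
              ej<ei = nested-ends i j (subst (start i ℕ.<_) (sym j≡) i<d) (ℕ.<-trans sj<p p<ei)
          in ℤ.<⇒≱ (below-end′ i (end j) (ℕ.<⇒≤ (ℕ.<-≤-trans s<p p≤ej)) (ℕ.<⇒≤ ej<ei) (ℕ.<⇒≢ ej<ei))
               (first j (sj<p , p≤ej , below-end′ j (toℕ p) (ℕ.<⇒≤ sj<p) p≤ej (col j ∘ Fin.toℕ-injective)))
      from : Under (start i) (toℕ p) → HasColour word 𝓗 i p
      from ((s<p , p<E) , unc) =
        (λ j p≡ → not-end j (cong toℕ p≡)) ,
        (s<p , ℕ.<⇒≤ p<e , below-end′ i (toℕ p) (ℕ.<⇒≤ s<p) (ℕ.<⇒≤ p<e) (ℕ.<⇒≢ p<e)) ,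
        (λ j (sj<p , p≤ej , _) → lower j sj<p p≤ej)
        where
        p<e = subst (toℕ p ℕ.<_) (E-start i) p<E
        inner : ∀ j → start j ℕ.< toℕ p → toℕ p ℕ.≤ end j → start j ℕ.≤ start i
        inner j sj<p p≤ej = ℕ.≮⇒≥ λ i<j → ℕ.<⇒≱ (unc sj<p (i<j , proj₂ (start-descent j)))
          (subst (toℕ p ℕ.≤_) (sym (E-start j)) p≤ej)
        not-end : ∀ j → ¬ (toℕ p ≡ end j)
        not-end j p≡ with ℕ.m≤n⇒m<n∨m≡n
          (inner j (subst (start j ℕ.<_) (sym p≡) (Hook.sw<ne (hooks j))) (ℕ.≤-reflexive p≡))
        ... | inj₁ j<i = ℕ.<⇒≱ (nested-ends j i j<i (subst (start i ℕ.<_) p≡ s<p))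
                           (subst (ℕ._≤ end i) p≡ (ℕ.<⇒≤ p<e))
        ... | inj₂ j≡i with refl ← start-injective j i j≡i = ℕ.<-irrefl p≡ p<e
        lower : ∀ j → start j ℕ.< toℕ p → toℕ p ℕ.≤ end j → g (end i) ℤ.≤ g (end j)
        lower j sj<p p≤ej with ℕ.m≤n⇒m<n∨m≡n (inner j sj<p p≤ej)
        ... | inj₂ j≡i with refl ← start-injective j i j≡i = ℤ.≤-refl
        ... | inj₁ j<i = below-end j (end i) (ℕ.<⇒≤ (ℕ.<-trans j<i (Hook.sw<ne (hooks i))))
                           (ℕ.<⇒≤ (nested-ends j i j<i (ℕ.<-≤-trans s<p p≤ej)))

    count-under : ∀ d → suc d ℕ.< N → Descent d →
      countRange (under? d) 0 N ≡ uncoveredCount E (suc d) (E d ℕ.∸ suc d)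
    count-under d d< ds = begin
      countRange (under? d) 0 N
        ≡⟨ cong (countRange (under? d) 0) N≡ ⟩
      countRange (under? d) 0 (suc d ℕ.+ (m ℕ.+ r))
        ≡⟨ countRange-skip (under? d) 0 (suc d) (m ℕ.+ r) (λ _ p< ((d<p , _) , _) → ℕ.<⇒≱ p< d<p) ⟩
      countRange (under? d) (suc d) (m ℕ.+ r)
        ≡⟨ countRange-no (under? d) (suc d) m r (λ {p} p≥ _ ((_ , p<) , _) →
             ℕ.<⇒≱ p< (subst (ℕ._≤ p) E≡ p≥)) ⟩
      countRange (under? d) (suc d) m
        ≡⟨ countRange-cong (under? d) (uncovered? E (suc d)) (suc d) m (λ {p} d<p p< →
             mk⇔ proj₂ (λ unc → (d<p , subst (p ℕ.<_) E≡ p<) , unc)) ⟩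
      uncoveredCount E (suc d) m ∎
      where
      open ≡-Reasoning
      m = E d ℕ.∸ suc d
      r = N ℕ.∸ E d
      E≡ : suc d ℕ.+ m ≡ E d
      E≡ = ℕ.m+[n∸m]≡n (rightwards ℕ.z≤n d< ds)
      N≡ : N ≡ suc d ℕ.+ (m ℕ.+ r)
      N≡ = sym (trans (sym (ℕ.+-assoc (suc d) m r))
        (trans (cong (ℕ._+ r) E≡) (ℕ.m+[n∸m]≡n (ℕ.<⇒≤ (inside ℕ.z≤n d< ds)))))

    private
      factors : List.map catalan (List.tabulate (λ i → Vec.count (hasColour? word 𝓗 i) (Vec.allFin N))) ≡
                List.map (hookFactor E) (descentsIn 0 N)
      factors = begin
        List.map catalan (List.tabulate (λ i → Vec.count (hasColour? word 𝓗 i) (Vec.allFin N)))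
          ≡⟨ List.map-tabulate _ catalan ⟩
        List.tabulate (λ i → catalan (Vec.count (hasColour? word 𝓗 i) (Vec.allFin N)))
          ≡⟨ List.tabulate-cong (λ i → trans
               (cong catalan (trans (count-countRange (hasColour? word 𝓗 i) (under? (start i)) N id 0
                 (hasColour⇔ i))
                 (count-under (start i) (proj₁ (start-descent i)) (proj₂ (start-descent i)))))
               (cong (hookFactor E ∘ toℕ) (atDescents i))) ⟩
        List.tabulate (λ i → hookFactor E (toℕ (List.lookup (descents word) i)))
          ≡⟨ List.map-tabulate (List.lookup (descents word)) (hookFactor E ∘ toℕ) ⟨
        List.map (hookFactor E ∘ toℕ) (List.tabulate (List.lookup (descents word)))
          ≡⟨ cong (List.map (hookFactor E ∘ toℕ)) (List.tabulate-lookup (descents word)) ⟩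
        List.map (hookFactor E ∘ toℕ) (descents word)
          ≡⟨ List.map-∘ (descents word) ⟩
        List.map (hookFactor E) (List.map toℕ (descents word))
          ≡⟨ cong (List.map (hookFactor E)) descents-toℕ ⟩
        List.map (hookFactor E) (descentsIn 0 N) ∎
        where open ≡-Reasoning

    private
      cons-product : ∀ c cs → catalanProduct (c ∷ cs) ≡ catalan c ℕ.* product (List.map catalan cs)
      cons-product c cs = refl

      blueCount : Vec.count (isBlue? word 𝓗) (Vec.allFin N) ≡ uncoveredCount E 0 N
      blueCount = count-countRange (isBlue? word 𝓗) (uncovered? E 0) N id 0 isBlue⇔

    colourProduct : catalanProduct (colourCounts word 𝓗) ≡ catalan (uncoveredCount E 0 N) ℕ.* hookFactors E 0 N
    colourProduct = trans
      (cons-product (Vec.count (isBlue? word 𝓗) (Vec.allFin N))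
                    (List.tabulate (λ i → Vec.count (hasColour? word 𝓗 i) (Vec.allFin N))))
      (cong₂ (λ b fs → catalan b ℕ.* product fs) blueCount factors)

    config : Σ[ c ∈ Config ] Valid 0 c × width c ≡ N × hookList 0 c ≡ endpoints word 𝓗 ×
             configWeight c ≡ catalanProduct (colourCounts word 𝓗)
    config = package (decompose E N 0 N ℕ.≤-refl hooked)
      where
      package : Decomposition E 0 N → _
      package (c , v , w , hs , bl , ow) = c , v , w , trans hs (sym endpoints≡) ,
        trans (cong₂ (λ b o → catalan b ℕ.* o) bl ow) (sym colourProduct)

  module ToVHC (E : ℕ → ℕ) (H : Hooked E 0 N) where
    open Hooked H

    private
      ds : Fin (List.length (descents word)) → Fin N
      ds = List.lookup (descents word)
      small : ∀ i → suc (toℕ (ds i)) ℕ.< N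
      small i = proj₁ (lookup-descent i)
      drops : ∀ i → Descent (toℕ (ds i))
      drops i = proj₂ (lookup-descent i)
      e : Fin (List.length (descents word)) → ℕ
      e i = E (toℕ (ds i))
      e<N : ∀ i → e i ℕ.< N
      e<N i = inside ℕ.z≤n (small i) (drops i)
      eF : Fin (List.length (descents word)) → Fin N
      eF i = fromℕ< (e<N i)
      eF≡ : ∀ i → toℕ (eF i) ≡ e i
      eF≡ i = Fin.toℕ-fromℕ< (e<N i)

      hookAt : ∀ i → Hook word
      hookAt i = record
        { sw    = ds i
        ; ne    = eF i
        ; sw<ne = subst (toℕ (ds i) ℕ.<_) (sym (eF≡ i)) (rightwards ℕ.z≤n (small i) (drops i))
        ; rises = subst (λ x → word (ds i) ℤ.< g x) (sym (eF≡ i)) (upwards ℕ.z≤n (small i) (drops i))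
        }

      on : ∀ i {x y} → OnHook word (hookAt i) (x , y) →
        toℕ (ds i) ℕ.≤ toℕ x × toℕ x ℕ.≤ e i × y ℤ.≤ g (e i) × (x ≡ ds i ⊎ y ≡ g (e i))
          × (x ≡ ds i → word (ds i) ℤ.≤ y)
      on i (inj₁ (refl , lo , hi)) =
        ℕ.≤-refl , ℕ.<⇒≤ (rightwards ℕ.z≤n (small i) (drops i)) ,
        subst (λ x → _ ℤ.≤ g x) (eF≡ i) hi , inj₁ refl , (λ _ → lo)
      on i (inj₂ (refl , lo , hi)) =
        lo , subst (toℕ _ ℕ.≤_) (eF≡ i) hi , ℤ.≤-reflexive (cong g (eF≡ i)) , inj₂ (cong g (eF≡ i)) ,
        λ _ → subst (λ x → word (ds i) ℤ.≤ g x) (sym (eF≡ i)) (ℤ.<⇒≤ (upwards ℕ.z≤n (small i) (drops i)))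

      meet : ∀ i j → toℕ (ds i) ℕ.< toℕ (ds j) → ∀ pt → OnHook word (hookAt i) pt → OnHook word (hookAt j) pt →
        pt ≡ NE word (hookAt i) × pt ≡ SW word (hookAt j)
      meet i j i<j (x , y) oi oj
        with lo-i , hi-i , y≤i , vi , _ ← on i oi | lo-j , hi-j , y≤j , vj , low-j ← on j oj
        with ℕ.<-cmp (e i) (toℕ (ds j))
      ... | tri< e<d _ _ = contradiction (ℕ.≤-trans lo-j hi-i) (ℕ.<⇒≱ e<d)
      ... | tri≈ _ e≡d _ = cong₂ _,_ x≡e y≡e , cong₂ _,_ x≡d (trans y≡e (cong g (trans (eF≡ i) e≡d)))
        where
        x≡d : x ≡ ds j
        x≡d = Fin.toℕ-injective (ℕ.≤-antisym (subst (toℕ x ℕ.≤_) e≡d hi-i) lo-j)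
        x≡e : x ≡ eF i
        x≡e = trans x≡d (Fin.toℕ-injective (sym (trans (eF≡ i) e≡d)))
        y≡e : y ≡ word (eF i)
        y≡e = ℤ.≤-antisym (subst (λ z → y ℤ.≤ g z) (sym (eF≡ i)) y≤i)
                (subst (λ z → g z ℤ.≤ y) (sym (trans (eF≡ i) e≡d)) (low-j x≡d))
      ... | tri> _ _ d<e with vi
      ...   | inj₁ refl = contradiction lo-j (ℕ.<⇒≱ i<j)
      ...   | inj₂ refl = contradiction y≤j (ℤ.<⇒≱ (ℤ.≤∧≢⇒<
                (highest ℕ.z≤n (small i) (drops i)
                  (ℕ.<⇒≤ (ℕ.<-trans i<j (rightwards ℕ.z≤n (small j) (drops j)))) (ℕ.<⇒≤ ej<ei))
                (λ eq → ℕ.<⇒≢ ej<ei (g-injective eq))))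
        where ej<ei = nested ℕ.z≤n (small i) (drops i) i<j d<e (small j) (drops j)

    vhc : VHC word
    vhc = record
      { hooks      = hookAt
      ; atDescents = λ i → refl
      ; noneAbove  = λ i p (d≤p , p≤e , above) → ℤ.<⇒≱ above
          (subst (λ x → word p ℤ.≤ g x) (sym (eF≡ i))
            (highest ℕ.z≤n (small i) (drops i) d≤p (subst (toℕ p ℕ.≤_) (eF≡ i) p≤e)))
      ; disjoint   = λ i j i≢j pt oi oj → apart i j i≢j pt oi oj
      }
      where
      apart : ∀ i j → i ≢ j → ∀ pt → OnHook word (hookAt i) pt → OnHook word (hookAt j) pt →
        (pt ≡ NE word (hookAt i) × pt ≡ SW word (hookAt j))
          ⊎ (pt ≡ SW word (hookAt i) × pt ≡ NE word (hookAt j))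
      apart i j i≢j pt oi oj with ℕ.<-cmp (toℕ (ds i)) (toℕ (ds j))
      ... | tri< i<j _ _ = inj₁ (meet i j i<j pt oi oj)
      ... | tri≈ _ eq _  = contradiction (lookup-distinct sym descents-unique i j (Fin.toℕ-injective eq)) i≢j
      ... | tri> _ _ j<i = let a , b = meet j i j<i pt oj oi in inj₂ (b , a)

    endpoints-vhc : endpoints word vhc ≡ hooksIn E 0 N
    endpoints-vhc = tabulate-hooksIn E _ λ i → cong (toℕ (ds i) ,_) (eF≡ i)

  fromConfig : ∀ c → Valid 0 c → width c ≡ N → VHC word
  fromConfig c v refl = ToVHC.vhc (edge 0 c) (edge-hooked 0 c v)

  endpoints-fromConfig : ∀ c (v : Valid 0 c) (w : width c ≡ N) → endpoints word (fromConfig c v w)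
    ≡ hookList 0 c
  endpoints-fromConfig c v refl =
    trans (ToVHC.endpoints-vhc (edge 0 c) (edge-hooked 0 c v)) (edge-hooksIn 0 c v)

  toConfig : ∀ 𝓗 → Σ[ c ∈ Config ] Valid 0 c × width c ≡ N × hookList 0 c ≡ endpoints word 𝓗 ×
             configWeight c ≡ catalanProduct (colourCounts word 𝓗)
  toConfig = FromVHC.config

  colourProduct-fromConfig : ∀ c v w → catalanProduct (colourCounts word (fromConfig c v w)) ≡ configWeight c
  colourProduct-fromConfig c v w =
    unique {fromConfig c v w} (toConfig (fromConfig c v w)) (endpoints-fromConfig c v w)
    where
    unique : ∀ {𝓗} → Σ[ c′ ∈ Config ] Valid 0 c′ × width c′ ≡ N × hookList 0 c′ ≡ endpoints word 𝓗 ×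
             configWeight c′ ≡ catalanProduct (colourCounts word 𝓗) →
             endpoints word 𝓗 ≡ hookList 0 c → catalanProduct (colourCounts word 𝓗) ≡ configWeight c
    unique (c′ , v′ , w′ , hs , wt) eq = trans (sym wt)
      (cong configWeight (hookList-injective 0 c′ c v′ v (trans w′ (sym w)) (trans hs eq)))

composition-weight : ∀ {N} (z : Vector ℤ N) 𝓗 → catalanProduct (composition z 𝓗)
  ≡ catalanProduct (colourCounts z 𝓗)
composition-weight {zero}  z 𝓗 = refl
composition-weight {suc N} z 𝓗 = refl

-- Periodic bijections of the integers

foldr-∷ʳ-+ : ∀ xs y → List.foldr ℤ._+_ 0ℤ (xs List.∷ʳ y) ≡ List.foldr ℤ._+_ 0ℤ xs ℤ.+ y
foldr-∷ʳ-+ []       y = ℤ.+-comm y 0ℤ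
foldr-∷ʳ-+ (x ∷ xs) y = trans (cong (ℤ._+_ x) (foldr-∷ʳ-+ xs y)) (sym (ℤ.+-assoc x _ y))

triangular : ∀ m → List.foldr ℤ._+_ 0ℤ (List.applyUpTo (λ i → + suc i) m) ≡ + (suc m C 2)
triangular zero    = refl
triangular (suc m) = begin
  List.foldr ℤ._+_ 0ℤ (List.applyUpTo (λ i → + suc i) (suc m))
    ≡⟨ cong (List.foldr ℤ._+_ 0ℤ) (List.applyUpTo-∷ʳ (λ i → + suc i) m) ⟨
  List.foldr ℤ._+_ 0ℤ (List.applyUpTo (λ i → + suc i) m List.∷ʳ + suc m)
    ≡⟨ foldr-∷ʳ-+ (List.applyUpTo (λ i → + suc i) m) (+ suc m) ⟩
  List.foldr ℤ._+_ 0ℤ (List.applyUpTo (λ i → + suc i) m) ℤ.+ + suc m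
    ≡⟨ cong₂ (λ a b → a ℤ.+ + b) (triangular m) (sym (nC1≡n (suc m))) ⟩
  + (suc m C 2 ℕ.+ suc m C 1)
    ≡⟨ cong +_ (trans (ℕ.+-comm (suc m C 2) _) (nCk+nC[k+1]≡[n+1]C[k+1] (suc m) 1)) ⟩
  + (suc (suc m) C 2) ∎
  where open ≡-Reasoning

foldr-applyUpTo : ∀ m (f : ℕ → ℤ) →
  List.foldr ℤ._+_ 0ℤ (List.applyUpTo f m) ≡ ∑.sum {m} (λ i → f (toℕ i))
foldr-applyUpTo zero    f = refl
foldr-applyUpTo (suc m) f = cong (ℤ._+_ (f 0)) (foldr-applyUpTo m (f ∘ suc))

sum-const : ∀ m c → ∑.sum {m} (λ _ → c) ≡ + m ℤ.* c
sum-const zero    c = sym (ℤ.*-zeroˡ c)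
sum-const (suc m) c = trans (cong (ℤ._+_ c) (sum-const m c)) (sym (ℤ.suc-* (+ m) c))

module Periodic (n : ℕ) .{{_ : ℕ.NonZero n}} where

  0<n : 0ℤ ℤ.< + n
  0<n = ℤ.+<+ (ℕ.>-nonZero⁻¹ n)

  suc-*′ : ∀ m c → + suc m ℤ.* c ≡ + m ℤ.* c ℤ.+ c
  suc-*′ m c = trans (ℤ.suc-* (+ m) c) (ℤ.+-comm c (+ m ℤ.* c))

  neg-* : ∀ m c → -[1+ m ] ℤ.* c ≡ 0ℤ ℤ.- + suc m ℤ.* c
  neg-* m c = trans (sym (ℤ.neg-distribˡ-* (+ suc m) c)) (sym (ℤ.+-identityˡ _))

  module _ (f : ℤ → ℤ) (c : ℤ) (h : ∀ x → f (x ℤ.+ + n) ≡ f x ℤ.+ c) where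

    shift-ℕ : ∀ m x → f (x ℤ.+ + m ℤ.* + n) ≡ f x ℤ.+ + m ℤ.* c
    shift-ℕ zero    x rewrite ℤ.*-zeroˡ (+ n) | ℤ.*-zeroˡ c | ℤ.+-identityʳ x = sym (ℤ.+-identityʳ (f x))
    shift-ℕ (suc m) x = begin
      f (x ℤ.+ + suc m ℤ.* + n)
        ≡⟨ cong (λ y → f (x ℤ.+ y)) (suc-*′ m (+ n)) ⟩
      f (x ℤ.+ (+ m ℤ.* + n ℤ.+ + n))
        ≡⟨ cong f (ℤ.+-assoc x (+ m ℤ.* + n) (+ n)) ⟨
      f (x ℤ.+ + m ℤ.* + n ℤ.+ + n)
        ≡⟨ h (x ℤ.+ + m ℤ.* + n) ⟩
      f (x ℤ.+ + m ℤ.* + n) ℤ.+ c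
        ≡⟨ cong (ℤ._+ c) (shift-ℕ m x) ⟩
      f x ℤ.+ + m ℤ.* c ℤ.+ c
        ≡⟨ ℤ.+-assoc (f x) (+ m ℤ.* c) c ⟩
      f x ℤ.+ (+ m ℤ.* c ℤ.+ c)
        ≡⟨ cong (ℤ._+_ (f x)) (suc-*′ m c) ⟨
      f x ℤ.+ + suc m ℤ.* c ∎
      where open ≡-Reasoning

    shift-* : ∀ k x → f (x ℤ.+ k ℤ.* + n) ≡ f x ℤ.+ k ℤ.* c
    shift-* (+ m)    x = shift-ℕ m x
    shift-* -[1+ m ] x = lia 4 (λ fx fy p q → fx :≡ fy :+ p ∷ q :≡ lit 0 :- p ∷ [] ⊢ fy :≡ fx :+ q)
      (f x) (f y) (+ suc m ℤ.* c) (-[1+ m ] ℤ.* c) (trans (cong f back) (shift-ℕ (suc m) y)) (neg-* m c)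
      where
      y = x ℤ.+ -[1+ m ] ℤ.* + n
      back : x ≡ y ℤ.+ + suc m ℤ.* + n
      back = lia 3 (λ x p q → q :≡ lit 0 :- p ∷ [] ⊢ x :≡ x :+ q :+ p)
        x (+ suc m ℤ.* + n) (-[1+ m ] ℤ.* + n) (neg-* m (+ n))

  residue-unique : ∀ {a b} → a ℕ.< n → b ℕ.< n → ∀ k → + a ≡ + b ℤ.+ k ℤ.* + n → a ≡ b × k ≡ 0ℤ
  residue-unique {a} {b} a<n b<n (+ zero)  eq =
    ℤ.+-injective (trans eq (trans (cong (ℤ._+_ (+ b)) (ℤ.*-zeroˡ (+ n))) (ℤ.+-identityʳ (+ b)))) , refl
  residue-unique {a} {b} a<n b<n (+ suc m) eq = ⊥-elim $
    liaN 4 (λ a b n k → a :< n ∷ a :≡ b :+ (n :+ k) ∷ [] ⊢ :⊥) a b n (m ℕ.* n) a<n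
      (ℤ.+-injective (trans eq (cong (ℤ._+_ (+ b))
        (trans (ℤ.suc-* (+ m) (+ n)) (cong (ℤ._+_ (+ n)) (sym (ℤ.pos-* m n)))))))
  residue-unique {a} {b} a<n b<n -[1+ m ] eq = ⊥-elim $
    liaN 4 (λ a b n k → b :< n ∷ b :≡ a :+ (n :+ k) ∷ [] ⊢ :⊥) a b n (m ℕ.* n) b<n
      (ℤ.+-injective (trans (lia 4 (λ a b p q → a :≡ b :+ q ∷ q :≡ lit 0 :- p ∷ [] ⊢ b :≡ a :+ p)
          (+ a) (+ b) (+ suc m ℤ.* + n) (-[1+ m ] ℤ.* + n) eq
          (neg-* m (+ n)))
        (cong (ℤ._+_ (+ a)) (trans (ℤ.suc-* (+ m) (+ n)) (cong (ℤ._+_ (+ n)) (sym (ℤ.pos-* m n)))))))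

  residue : ℤ → Fin n
  residue x = fromℕ< (ℤ.n%ℕd<d x n)

  quotient : ℤ → ℤ
  quotient x = x ℤ./ℕ n

  residue-quotient : ∀ x → x ≡ + toℕ (residue x) ℤ.+ quotient x ℤ.* + n
  residue-quotient x = trans (ℤ.a≡a%ℕn+[a/ℕn]*n x n)
    (cong (λ r → + r ℤ.+ quotient x ℤ.* + n) (sym (Fin.toℕ-fromℕ< (ℤ.n%ℕd<d x n))))

  residue-≡ : ∀ {x} (i : Fin n) k → x ≡ + toℕ i ℤ.+ k ℤ.* + n → residue x ≡ i
  residue-≡ {x} i k eq = Fin.toℕ-injective
    (proj₁ (residue-unique (Fin.toℕ<n (residue x)) (Fin.toℕ<n i) (k ℤ.- quotient x)
    (lia 5 (λ r i p q d → r :+ q :≡ i :+ p ∷ d :≡ p :- q ∷ [] ⊢ r :≡ i :+ d)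
      (+ toℕ (residue x)) (+ toℕ i) (k ℤ.* + n) (quotient x ℤ.* + n) ((k ℤ.- quotient x) ℤ.* + n)
      (trans (sym (residue-quotient x)) eq) (*-distribʳ-- k (quotient x)))))
    where
    *-distribʳ-- : ∀ k q → (k ℤ.- q) ℤ.* + n ≡ k ℤ.* + n ℤ.- q ℤ.* + n
    *-distribʳ-- k q = trans (ℤ.*-distribʳ-+ (+ n) k (ℤ.- q))
      (cong (ℤ._+_ (k ℤ.* + n)) (sym (ℤ.neg-distribˡ-* q (+ n))))

  record PeriodicBijection : Set where
    field
      to from     : ℤ → ℤ
      to-from     : ∀ x → to (from x) ≡ x
      from-to     : ∀ x → from (to x) ≡ x
      equivariant : ∀ x → to (x ℤ.+ + n) ≡ to x ℤ.+ + n

    to-injective : ∀ {x y} → to x ≡ to y → x ≡ y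
    to-injective {x} {y} eq = trans (sym (from-to x)) (trans (cong from eq) (from-to y))

    to-shift : ∀ k x → to (x ℤ.+ k ℤ.* + n) ≡ to x ℤ.+ k ℤ.* + n
    to-shift = shift-* to (+ n) equivariant

    from-equivariant : ∀ x → from (x ℤ.+ + n) ≡ from x ℤ.+ + n
    from-equivariant x = trans (cong (λ y → from (y ℤ.+ + n)) (sym (to-from x)))
      (trans (cong from (sym (equivariant (from x)))) (from-to _))

    from-shift : ∀ k x → from (x ℤ.+ k ℤ.* + n) ≡ from x ℤ.+ k ℤ.* + n
    from-shift = shift-* from (+ n) from-equivariant

  open PeriodicBijection

  idᵇ : PeriodicBijection
  idᵇ = record { to = id ; from = id ; to-from = λ _ → refl ; from-to = λ _ → refl ; equivariant = λ _ → refl }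

  infixr 9 _∘ᵇ_

  _∘ᵇ_ : PeriodicBijection → PeriodicBijection → PeriodicBijection
  f ∘ᵇ g = record
    { to = to f ∘ to g ; from = from g ∘ from f
    ; to-from = λ x → trans (cong (to f) (to-from g (from f x))) (to-from f x)
    ; from-to = λ x → trans (cong (from g) (from-to f (to g x))) (from-to g x)
    ; equivariant = λ x → trans (cong (to f) (equivariant g x)) (equivariant f (to g x)) }

  _⁻¹ᵇ : PeriodicBijection → PeriodicBijection
  f ⁻¹ᵇ = record { to = from f ; from = to f ; to-from = from-to f ; from-to = to-from f
                 ; equivariant = from-equivariant f }

  translation : ℤ → PeriodicBijection
  translation c = record
    { to = λ x → c ℤ.+ x ; from = λ x → x ℤ.- c
    ; to-from = λ x → lia 2 (λ c x → [] ⊢ c :+ (x :- c) :≡ x) c x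
    ; from-to = λ x → lia 2 (λ c x → [] ⊢ c :+ x :- c :≡ x) c x
    ; equivariant = λ x → sym (ℤ.+-assoc c x (+ n)) }

  ∑ : (ℤ → ℤ) → ℤ
  ∑ h = ∑.sum {n} (λ i → h (+ toℕ i))

  ∑-cong : ∀ {h k : ℤ → ℤ} → (∀ x → h x ≡ k x) → ∑ h ≡ ∑ k
  ∑-cong eq = ∑.sum-cong-≗ {n} (λ i → eq (+ toℕ i))

  ∑-+ : ∀ h k → ∑ (λ x → h x ℤ.+ k x) ≡ ∑ h ℤ.+ ∑ k
  ∑-+ h k = ∑.∑-distrib-+ (λ (i : Fin n) → h (+ toℕ i)) (λ i → k (+ toℕ i))

  residuePermutation : PeriodicBijection → Permutation n n
  residuePermutation g = permutation (λ i → residue (to g (+ toℕ i))) (λ i → residue (from g (+ toℕ i)))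
    (λ i → inverse (g ⁻¹ᵇ) i) (λ i → inverse g i)
    where
    inverse : ∀ g (i : Fin n) → residue (from g (+ toℕ (residue (to g (+ toℕ i))))) ≡ i
    inverse g i = residue-≡ i (ℤ.- quotient y) (begin
      from g (+ toℕ (residue y))              ≡⟨ cong (from g) y≡ ⟩
      from g (y ℤ.+ ℤ.- quotient y ℤ.* + n)   ≡⟨ from-shift g (ℤ.- quotient y) y ⟩
      from g y ℤ.+ ℤ.- quotient y ℤ.* + n     ≡⟨ cong (ℤ._+ ℤ.- quotient y ℤ.* + n) (from-to g (+ toℕ i)) ⟩
      + toℕ i ℤ.+ ℤ.- quotient y ℤ.* + n      ∎)
      where
      open ≡-Reasoning
      y = to g (+ toℕ i)
      y≡ : + toℕ (residue y) ≡ y ℤ.+ ℤ.- quotient y ℤ.* + n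
      y≡ = lia 4 (λ r y p q → y :≡ r :+ p ∷ q :≡ lit 0 :- p ∷ [] ⊢ r :≡ y :+ q)
        (+ toℕ (residue y)) y (quotient y ℤ.* + n) (ℤ.- quotient y ℤ.* + n) (residue-quotient y)
        (trans (sym (ℤ.neg-distribˡ-* (quotient y) (+ n))) (sym (ℤ.+-identityˡ _)))

  ∑-reindex : ∀ g h → (∀ x → h (x ℤ.+ + n) ≡ h x) → ∑ (h ∘ to g) ≡ ∑ h
  ∑-reindex g h period = trans
    (∑.sum-cong-≗ {n} λ i → let y = to g (+ toℕ i) in
      trans (cong h (residue-quotient y)) (trans
        (shift-* h 0ℤ (λ x → trans (period x) (sym (ℤ.+-identityʳ (h x)))) (quotient y) (+ toℕ (residue y)))
        (trans (cong (ℤ._+_ (h (+ toℕ (residue y)))) (ℤ.*-zeroʳ (quotient y))) (ℤ.+-identityʳ _))))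
    (sym (∑.sum-permute (λ i → h (+ toℕ i)) (residuePermutation g)))

  displacement : PeriodicBijection → ℤ → ℤ
  displacement f x = to f x ℤ.- x

  displacement-periodic : ∀ f x → displacement f (x ℤ.+ + n) ≡ displacement f x
  displacement-periodic f x = trans (cong (ℤ._- (x ℤ.+ + n)) (equivariant f x))
    (lia 3 (λ y x n → [] ⊢ y :+ n :- (x :+ n) :≡ y :- x) (to f x) x (+ n))

  drift : PeriodicBijection → ℤ
  drift f = ∑ (displacement f)

  drift-∘ : ∀ f g → drift (f ∘ᵇ g) ≡ drift f ℤ.+ drift g
  drift-∘ f g = trans
    (∑-cong λ x → lia 3 (λ z y x → [] ⊢ z :- x :≡ (z :- y) :+ (y :- x)) (to f (to g x)) (to g x) x)
    (trans (∑-+ (displacement f ∘ to g) (displacement g))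
           (cong (ℤ._+ drift g) (∑-reindex g (displacement f) (displacement-periodic f))))

  drift-cong : ∀ {f g} → (∀ x → to f x ≡ to g x) → drift f ≡ drift g
  drift-cong eq = ∑-cong λ x → cong (ℤ._- x) (eq x)

  drift-id : drift idᵇ ≡ 0ℤ
  drift-id = trans (∑-cong λ x → ℤ.+-inverseʳ x) (trans (sum-const n 0ℤ) (ℤ.*-zeroʳ (+ n)))

  drift-translation : ∀ c → drift (translation c) ≡ + n ℤ.* c
  drift-translation c = trans (∑-cong λ x → lia 2 (λ c x → [] ⊢ c :+ x :- x :≡ c) c x) (sum-const n c)

  window-sum : ∀ f → List.foldr ℤ._+_ 0ℤ (List.applyUpTo (λ i → to f (+ suc i)) n) ≡ drift f ℤ.+ + (suc n C 2)
  window-sum f = begin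
    List.foldr ℤ._+_ 0ℤ (List.applyUpTo (λ i → to f (+ suc i)) n)
      ≡⟨ foldr-applyUpTo n (λ i → to f (+ suc i)) ⟩
    ∑ (λ x → to f (1ℤ ℤ.+ x))
      ≡⟨ ∑-cong (λ x → lia 2 (λ y x → [] ⊢ y :≡ (y :- x) :+ x) (to f (1ℤ ℤ.+ x)) (1ℤ ℤ.+ x)) ⟩
    ∑ (λ x → displacement f (1ℤ ℤ.+ x) ℤ.+ (1ℤ ℤ.+ x))
      ≡⟨ ∑-+ (λ x → displacement f (1ℤ ℤ.+ x)) (ℤ._+_ 1ℤ) ⟩
    ∑ (λ x → displacement f (1ℤ ℤ.+ x)) ℤ.+ ∑ (ℤ._+_ 1ℤ)
      ≡⟨ cong₂ ℤ._+_ (∑-reindex (translation 1ℤ) (displacement f) (displacement-periodic f))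
           (trans (sym (foldr-applyUpTo n (λ i → + suc i))) (triangular n)) ⟩
    drift f ℤ.+ + (suc n C 2) ∎
    where open ≡-Reasoning

  fromAffine : AffinePermutation n → PeriodicBijection
  fromAffine w = record
    { to = w ⟦_⟧ ; from = w ⁻¹⟦_⟧
    ; to-from = Inverse.strictlyInverseˡ (AffinePermutation.bijection w)
    ; from-to = Inverse.strictlyInverseʳ (AffinePermutation.bijection w)
    ; equivariant = AffinePermutation.periodic w }

  drift-affine : ∀ w → drift (fromAffine w) ≡ 0ℤ
  drift-affine w = lia 2 (λ d c → d :+ c :≡ c ∷ [] ⊢ d :≡ lit 0) (drift (fromAffine w)) (+ (suc n C 2))
    (trans (sym (window-sum (fromAffine w))) (AffinePermutation.normalised w))

  toAffine : (f : PeriodicBijection) → drift f ≡ 0ℤ → AffinePermutation n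
  toAffine f eq = record
    { bijection  = mk↔ₛ′ (to f) (from f) (to-from f) (from-to f)
    ; periodic   = equivariant f
    ; normalised = trans (window-sum f) (trans (cong (ℤ._+ + (suc n C 2)) eq) (ℤ.+-identityˡ _)) }

  -- If f preserves the half-line x ≤ a, then it permutes the window a < x ≤ a + n.
  drift-cut : ∀ f a → (∀ x → x ℤ.≤ a → to f x ℤ.≤ a) → (∀ x → a ℤ.< x → a ℤ.< to f x) → drift f ≡ 0ℤ
  drift-cut f a low high = begin
    drift f
      ≡⟨ ∑-reindex (translation (1ℤ ℤ.+ a)) (displacement f) (displacement-periodic f) ⟨
    D
      ≡⟨ lia 2 (λ d s → [] ⊢ d :≡ (d :+ s) :- s) D (∑ id) ⟩
    (D ℤ.+ ∑ id) ℤ.- ∑ id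
      ≡⟨ cong (ℤ._- ∑ id) (trans (sym (∑-+ (λ x → displacement f (1ℤ ℤ.+ a ℤ.+ x)) id)) window) ⟩
    ∑ id ℤ.- ∑ id
      ≡⟨ ℤ.+-inverseʳ (∑ id) ⟩
    0ℤ ∎
    where
    open ≡-Reasoning
    D = ∑ (λ x → displacement f (1ℤ ℤ.+ a ℤ.+ x))
    Stable : (ℤ → ℤ) → Set
    Stable t = (∀ x → x ℤ.≤ a → t x ℤ.≤ a) × (∀ x → a ℤ.< x → a ℤ.< t x) × (∀ x → t (x ℤ.+ + n) ≡ t x ℤ.+ + n)
    stable-to : Stable (to f)
    stable-to = low , high , equivariant f
    stable-from : Stable (from f)
    stable-from =
      (λ x x≤a → ℤ.≮⇒≥ λ a< → ℤ.<⇒≱ (subst (a ℤ.<_) (to-from f x) (high _ a<)) x≤a) ,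
      (λ x a<x → ℤ.≰⇒> λ ≤a → ℤ.<⇒≱ a<x (subst (ℤ._≤ a) (to-from f x) (low _ ≤a))) ,
      from-equivariant f
    module _ {t : ℤ → ℤ} (S : Stable t) (i : Fin n) where
      x = 1ℤ ℤ.+ a ℤ.+ + toℕ i
      y = t x ℤ.- (1ℤ ℤ.+ a)
      0≤y : 0ℤ ℤ.≤ y
      0≤y = lia 2 (λ a t → a :< t ∷ [] ⊢ lit 0 :≤ t :- (lit 1 :+ a)) a (t x)
        (proj₁ (proj₂ S) x (lia 2 (λ a i → lit 0 :≤ i ∷ [] ⊢ a :< lit 1 :+ a :+ i) a (+ toℕ i) (ℤ.+≤+ ℕ.z≤n)))
      y<n : y ℤ.< + n
      y<n = lia 3 (λ a t n → t :- n :≤ a ∷ [] ⊢ t :- (lit 1 :+ a) :< n) a (t x) (+ n)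
        (subst (ℤ._≤ a) (lia 3 (λ u t n → t :≡ u :+ n ∷ [] ⊢ u :≡ t :- n) (t (x ℤ.- + n)) (t x) (+ n)
            (trans (cong t (lia 2 (λ x n → [] ⊢ x :≡ x :- n :+ n) x (+ n))) (proj₂ (proj₂ S) (x ℤ.- + n))))
          (proj₁ S (x ℤ.- + n) (lia 3 (λ a i n → i :< n ∷ [] ⊢ lit 1 :+ a :+ i :- n :≤ a) a (+ toℕ i) (+ n)
            (ℤ.+<+ (Fin.toℕ<n i)))))
      ∣y∣<n : ∣ y ∣ ℕ.< n
      ∣y∣<n = ℤ.drop‿+<+ (subst (ℤ._< + n) (sym (ℤ.0≤i⇒+∣i∣≡i 0≤y)) y<n)
      windowMap : Fin n
      windowMap = fromℕ< ∣y∣<n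
      windowMap-≡ : + toℕ windowMap ≡ y
      windowMap-≡ = trans (cong +_ (Fin.toℕ-fromℕ< ∣y∣<n)) (ℤ.0≤i⇒+∣i∣≡i 0≤y)
    windowMap-inverse : ∀ {t u : ℤ → ℤ} (S : Stable t) (S′ : Stable u) → (∀ x → t (u x) ≡ x) →
                        ∀ i → windowMap S (windowMap S′ i) ≡ i
    windowMap-inverse {t} {u} S S′ inv i = Fin.toℕ-injective (ℤ.+-injective
      (trans (windowMap-≡ S (windowMap S′ i))
        (lia 4 (λ t i a t′ → t :≡ t′ ∷ t′ :≡ lit 1 :+ a :+ i ∷ [] ⊢ t :- (lit 1 :+ a) :≡ i)
          (t (1ℤ ℤ.+ a ℤ.+ + toℕ (windowMap S′ i))) (+ toℕ i) a (t (u (1ℤ ℤ.+ a ℤ.+ + toℕ i)))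
          (cong t (trans (cong (ℤ._+_ (1ℤ ℤ.+ a)) (windowMap-≡ S′ i))
            (lia 2 (λ b u → [] ⊢ b :+ (u :- b) :≡ u) (1ℤ ℤ.+ a) (u (1ℤ ℤ.+ a ℤ.+ + toℕ i)))))
          (inv _))))
    π : Permutation n n
    π = permutation (windowMap stable-to) (windowMap stable-from)
      (windowMap-inverse stable-to stable-from (to-from f))
      (windowMap-inverse stable-from stable-to (from-to f))
    window : ∑ (λ x → displacement f (1ℤ ℤ.+ a ℤ.+ x) ℤ.+ x) ≡ ∑ id
    window = trans
      (∑.sum-cong-≗ {n} λ i → trans
        (lia 3 (λ y a x → [] ⊢ y :- (lit 1 :+ a :+ x) :+ x :≡ y :- (lit 1 :+ a))
          (to f (1ℤ ℤ.+ a ℤ.+ + toℕ i)) a (+ toℕ i))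
        (sym (windowMap-≡ stable-to i)))
      (sym (∑.sum-permute (λ i → + toℕ i) π))

  cut-aligned : ∀ f a b → drift f ≡ 0ℤ → (∀ x → x ℤ.≤ a → to f x ℤ.≤ b) → (∀ x → a ℤ.< x → b ℤ.< to f x) → a ≡ b
  cut-aligned f a b d0 low high = conclude (ℤ.i*j≡0⇒i≡0∨j≡0 (+ n) product≡0)
    where
    open ≡-Reasoning
    c = a ℤ.- b
    conclude : + n ≡ 0ℤ ⊎ c ≡ 0ℤ → a ≡ b
    conclude (inj₁ n≡0) = ⊥-elim (ℤ.<-irrefl (sym n≡0) 0<n)
    conclude (inj₂ c≡0) = ℤ.i-j≡0⇒i≡j a b c≡0
    product≡0 : + n ℤ.* c ≡ 0ℤ
    product≡0 = begin
      + n ℤ.* c                       ≡⟨ ℤ.+-identityʳ (+ n ℤ.* c) ⟨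
      + n ℤ.* c ℤ.+ 0ℤ                ≡⟨ cong₂ ℤ._+_ (drift-translation c) d0 ⟨
      drift (translation c) ℤ.+ drift f ≡⟨ drift-∘ (translation c) f ⟨
      drift (translation c ∘ᵇ f)      ≡⟨ drift-cut (translation c ∘ᵇ f) a
          (λ x p → lia 3 (λ a b y → y :≤ b ∷ [] ⊢ a :- b :+ y :≤ a) a b (to f x) (low x p))
          (λ x p → lia 3 (λ a b y → b :< y ∷ [] ⊢ a :< a :- b :+ y) a b (to f x) (high x p)) ⟩
      0ℤ                              ∎

sum-head-two : ∀ m (F G : ℕ → ℤ) → 1 ℕ.< m → (∀ i → 1 ℕ.< i → i ℕ.< m → F i ≡ G i) →
  ∑.sum {m} (λ i → F (toℕ i)) ℤ.+ (G 0 ℤ.+ G 1) ≡ ∑.sum {m} (λ i → G (toℕ i)) ℤ.+ (F 0 ℤ.+ F 1)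
sum-head-two (suc (suc m)) F G _ eq = trans
  (cong (λ s → F 0 ℤ.+ (F 1 ℤ.+ s) ℤ.+ (G 0 ℤ.+ G 1))
    (∑.sum-cong-≗ {m} λ i → eq (suc (suc (toℕ i))) (ℕ.s≤s (ℕ.s≤s ℕ.z≤n)) (ℕ.s≤s (ℕ.s≤s (Fin.toℕ<n i)))))
  (lia 5 (λ a b c d s → [] ⊢ a :+ (b :+ s) :+ (c :+ d) :≡ c :+ (d :+ s) :+ (a :+ b))
    (F 0) (F 1) (G 0) (G 1) (∑.sum {m} (λ i → G (suc (suc (toℕ i))))))
sum-head-two (suc zero) F G (ℕ.s≤s ()) eq

foldr-∷ʳ-∘ : ∀ (ss : List (ℤ → ℤ)) t i →
  List.foldr _∘′_ id (ss List.∷ʳ t) i ≡ List.foldr _∘′_ id ss (t i)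
foldr-∷ʳ-∘ []       t i = refl
foldr-∷ʳ-∘ (s ∷ ss) t i = cong s (foldr-∷ʳ-∘ ss t i)

¬¬-minimum : ∀ {P : ℕ → Set} k → P k → ¬ ¬ (∃[ m ] P m × (∀ j → P j → m ℕ.≤ j))
¬¬-minimum {P} k p ¬min = go k k ℕ.≤-refl p
  where
  go : ∀ b k → k ℕ.≤ b → ¬ P k
  go b k k≤b p = ¬min (k , p , λ j q → ℕ.≮⇒≥ λ j<k → below b k k≤b j j<k q)
    where
    below : ∀ b k → k ℕ.≤ b → ∀ j → j ℕ.< k → ¬ P j
    below zero    zero    _  j ()
    below (suc b) k k≤b j j<k = go b j (ℕ.s≤s⁻¹ (ℕ.<-≤-trans j<k k≤b))

module Projections (n : ℕ) .{{_ : ℕ.NonZero n}} where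
  open Periodic n
  open PeriodicBijection

  suc-shift : ∀ a k x → a ℤ.+ (k ℤ.+ 1ℤ) ℤ.* + n ℤ.+ x ≡ a ℤ.+ k ℤ.* + n ℤ.+ x ℤ.+ + n
  suc-shift a k x = trans (cong (λ y → a ℤ.+ y ℤ.+ x) (trans (ℤ.*-distribʳ-+ (+ n) k 1ℤ)
      (cong (ℤ._+_ (k ℤ.* + n)) (ℤ.*-identityˡ (+ n)))))
    (lia 4 (λ a p n x → [] ⊢ a :+ (p :+ n) :+ x :≡ a :+ p :+ x :+ n) a (k ℤ.* + n) (+ n) x)

  pred-shift : ∀ a k x → a ℤ.+ (k ℤ.- 1ℤ) ℤ.* + n ℤ.+ x ℤ.+ + n ≡ a ℤ.+ k ℤ.* + n ℤ.+ x
  pred-shift a k x = trans (sym (suc-shift a (k ℤ.- 1ℤ) x))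
    (cong (λ y → a ℤ.+ y ℤ.* + n ℤ.+ x) (lia 1 (λ k → [] ⊢ k :- lit 1 :+ lit 1 :≡ k) k))

  module Reflection {a : ℤ} {t : ℤ → ℤ} (R : IsSimpleReflection n a t) where
    open IsSimpleReflection R

    data View (p : ℤ) : Set where
      lower : ∀ k → p ≡ a ℤ.+ k ℤ.* + n → t p ≡ p ℤ.+ 1ℤ → View p
      upper : ∀ k → p ≡ a ℤ.+ k ℤ.* + n ℤ.+ 1ℤ → t p ≡ p ℤ.- 1ℤ → View p
      fixed : (∀ m → p ≢ a ℤ.+ m ℤ.* + n) → (∀ m → p ≢ a ℤ.+ m ℤ.* + n ℤ.+ 1ℤ) → t p ≡ p → View p

    lower′ : ∀ {p} k → p ≡ a ℤ.+ k ℤ.* + n → View p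
    lower′ k refl = lower k refl (up k)

    upper′ : ∀ {p} k → p ≡ a ℤ.+ k ℤ.* + n ℤ.+ 1ℤ → View p
    upper′ k refl = upper k refl
      (trans (down k) (lia 1 (λ x → [] ⊢ x :≡ x :+ lit 1 :- lit 1) (a ℤ.+ k ℤ.* + n)))

    view : ∀ p → View p
    view p = go (toℕ (residue (p ℤ.- a))) (Fin.toℕ<n (residue (p ℤ.- a)))
      (lia 4 (λ p a r q → p :- a :≡ r :+ q ∷ [] ⊢ p :≡ a :+ q :+ r) p a (+ toℕ (residue (p ℤ.- a)))
        (quotient (p ℤ.- a) ℤ.* + n) (residue-quotient (p ℤ.- a)))
      where
      q = quotient (p ℤ.- a)
      go : ∀ r → r ℕ.< n → p ≡ a ℤ.+ q ℤ.* + n ℤ.+ + r → View p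
      go zero          r<n eq = lower′ q (trans eq (ℤ.+-identityʳ _))
      go (suc zero)    r<n eq = upper′ q eq
      go (suc (suc r)) r<n eq =
        fixed (λ m eq′ → excluded 0 (λ ()) (ℕ.<-trans (ℕ.s≤s ℕ.z≤n) r<n) m (trans eq′ (sym (ℤ.+-identityʳ _))))
          (λ m → excluded 1 (λ ()) (ℕ.<-trans (ℕ.s≤s (ℕ.s≤s ℕ.z≤n)) r<n) m)
          (fixes p (λ m eq′ → excluded 0 (λ ()) (ℕ.<-trans (ℕ.s≤s ℕ.z≤n) r<n) m
            (trans eq′ (sym (ℤ.+-identityʳ _))))
            (λ m → excluded 1 (λ ()) (ℕ.<-trans (ℕ.s≤s (ℕ.s≤s ℕ.z≤n)) r<n) m))
        where
        excluded : ∀ b → suc (suc r) ≢ b → b ℕ.< n → ∀ m → p ≢ a ℤ.+ m ℤ.* + n ℤ.+ + b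
        excluded b r≢b b<n m eq′ = r≢b (proj₁ (residue-unique r<n b<n (m ℤ.- q)
          (lia 7 (λ p a r b x y z → p :≡ a :+ y :+ r ∷ p :≡ a :+ x :+ b ∷ z :≡ x :- y ∷ [] ⊢ r :≡ b :+ z)
            p a (+ suc (suc r)) (+ b) (m ℤ.* + n) (q ℤ.* + n) ((m ℤ.- q) ℤ.* + n) eq eq′
            (trans (ℤ.*-distribʳ-+ (+ n) m (ℤ.- q))
              (cong (ℤ._+_ (m ℤ.* + n)) (sym (ℤ.neg-distribˡ-* q (+ n))))))))

    involutive : ∀ p → t (t p) ≡ p
    involutive p with view p
    ... | lower k refl eq = trans (cong t eq) (down k)
    ... | upper k refl eq = trans (cong t (down k)) (up k)
    ... | fixed _ _ eq    = trans (cong t eq) eq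

    equivariantᵗ : ∀ p → t (p ℤ.+ + n) ≡ t p ℤ.+ + n
    equivariantᵗ p with view p
    ... | lower k refl eq = trans (cong t (shifted))
            (trans (up (k ℤ.+ 1ℤ)) (trans (cong (ℤ._+ 1ℤ) (sym (shifted)))
              (trans (lia 2 (λ x n → [] ⊢ x :+ n :+ lit 1 :≡ x :+ lit 1 :+ n) (a ℤ.+ k ℤ.* + n) (+ n))
                (cong (ℤ._+ + n) (sym (up k))))))
      where
      shifted : a ℤ.+ k ℤ.* + n ℤ.+ + n ≡ a ℤ.+ (k ℤ.+ 1ℤ) ℤ.* + n
      shifted = trans (cong (ℤ._+ + n) (sym (ℤ.+-identityʳ (a ℤ.+ k ℤ.* + n))))
        (trans (sym (suc-shift a k 0ℤ)) (ℤ.+-identityʳ _))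
    ... | upper k refl eq = trans (cong t (sym (suc-shift a k 1ℤ))) (trans (down (k ℤ.+ 1ℤ))
            (trans (sym (ℤ.+-identityʳ _))
              (trans (suc-shift a k 0ℤ) (cong (ℤ._+ + n) (trans (ℤ.+-identityʳ _) (sym (down k)))))))
    ... | fixed ≢₀ ≢₁ eq  = trans
            (fixes (p ℤ.+ + n)
              (λ m eq′ → ≢₀ (m ℤ.- 1ℤ) (trans
                (cancel (trans eq′ (trans (sym (ℤ.+-identityʳ _)) (sym (pred-shift a m 0ℤ)))))
                (ℤ.+-identityʳ _)))
              (λ m eq′ → ≢₁ (m ℤ.- 1ℤ) (cancel (trans eq′ (sym (pred-shift a m 1ℤ))))))
            (cong (ℤ._+ + n) (sym eq))
      where
      cancel : ∀ {x y} → x ℤ.+ + n ≡ y ℤ.+ + n → x ≡ y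
      cancel {x} {y} = lia 3 (λ x y n → x :+ n :≡ y :+ n ∷ [] ⊢ x :≡ y) x y (+ n)

    reflection : PeriodicBijection
    reflection = record { to = t ; from = t ; to-from = involutive ; from-to = involutive
      ; equivariant = equivariantᵗ }

    drift-reflection : drift reflection ≡ 0ℤ
    drift-reflection = lia 1 (λ d → d :+ d :≡ lit 0 ∷ [] ⊢ d :≡ lit 0) (drift reflection)
      (trans (sym (drift-∘ reflection reflection))
        (trans (drift-cong {reflection ∘ᵇ reflection} {idᵇ} involutive) drift-id))

    drift-∘-reflection : ∀ f → drift f ≡ 0ℤ → drift (f ∘ᵇ reflection) ≡ 0ℤ
    drift-∘-reflection f eq = trans (drift-∘ f reflection) (cong₂ ℤ._+_ eq drift-reflection)

    orbit : ∀ f {p} k → p ≡ a ℤ.+ k ℤ.* + n →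
      to f p ≡ to f a ℤ.+ k ℤ.* + n × to f (p ℤ.+ 1ℤ) ≡ to f (a ℤ.+ 1ℤ) ℤ.+ k ℤ.* + n
    orbit f k refl = to-shift f k a , trans (cong (to f)
      (lia 2 (λ a x → [] ⊢ a :+ x :+ lit 1 :≡ a :+ lit 1 :+ x) a (k ℤ.* + n))) (to-shift f k (a ℤ.+ 1ℤ))

    Ascends Descends : PeriodicBijection → ℤ → Set
    Ascends  f p = to f p ℤ.< to f (p ℤ.+ 1ℤ)
    Descends f p = to f (p ℤ.+ 1ℤ) ℤ.< to f p

    ascends-orbit : ∀ f → Ascends f a → ∀ {p} k → p ≡ a ℤ.+ k ℤ.* + n → Ascends f p
    ascends-orbit f asc k eq = let e₁ , e₂ = orbit f k eq in
      subst₂ ℤ._<_ (sym e₁) (sym e₂) (ℤ.+-monoˡ-< (k ℤ.* + n) asc)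

    descends-orbit : ∀ f → Descends f a → ∀ {p} k → p ≡ a ℤ.+ k ℤ.* + n → Descends f p
    descends-orbit f dsc k eq = let e₁ , e₂ = orbit f k eq in
      subst₂ ℤ._<_ (sym e₂) (sym e₁) (ℤ.+-monoˡ-< (k ℤ.* + n) dsc)

    ascends-orbit⁻ : ∀ f {p} k → p ≡ a ℤ.+ k ℤ.* + n → Ascends f p → Ascends f a
    ascends-orbit⁻ f k eq asc = let e₁ , e₂ = orbit f k eq in
      lia 3 (λ x y z → x :+ z :< y :+ z ∷ [] ⊢ x :< y) (to f a) (to f (a ℤ.+ 1ℤ)) (k ℤ.* + n)
        (subst₂ ℤ._<_ e₁ e₂ asc)

    meet : ∀ {x y} → x ℤ.< y → ¬ (t x ℤ.< t y) → t x ≡ x ℤ.+ 1ℤ → t y ≡ y ℤ.- 1ℤ → y ≡ x ℤ.+ 1ℤ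
    meet {x} {y} x<y ¬p tx ty with y ℤ.≟ x ℤ.+ 1ℤ
    ... | yes y≡ = y≡
    ... | no y≢  = ⊥-elim (ℤ.<-irrefl (trans (sym (involutive x)) (trans (cong t t≡) (involutive y))) x<y)
      where
      t≡ : t x ≡ t y
      t≡ = lia 4 (λ x y tx ty → x :+ lit 1 :< y ∷ ty :≤ tx ∷ tx :≡ x :+ lit 1 ∷ ty :≡ y :- lit 1 ∷ []
        ⊢ tx :≡ ty)
        x y (t x) (t y) (ℤ.≤∧≢⇒< (lia 2 (λ x y → x :< y ∷ [] ⊢ x :+ lit 1 :≤ y) x y x<y) (y≢ ∘ sym))
          (ℤ.≮⇒≥ ¬p) tx ty

    increases : ∀ {x y} → x ℤ.< y → (t x ℤ.< t y) ⊎ (∃[ m ] x ≡ a ℤ.+ m ℤ.* + n × y ≡ a ℤ.+ m ℤ.* + n ℤ.+ 1ℤ)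
    increases {x} {y} x<y with t x ℤ.<? t y | view x | view y
    ... | yes p | _ | _ = inj₁ p
    ... | no ¬p | lower k eq tx | upper k′ eq′ ty =
      inj₂ (k , eq , trans (meet x<y ¬p tx ty) (cong (ℤ._+ 1ℤ) eq))
    ... | no ¬p | lower k eq tx | lower k′ eq′ ty = contradiction
            (lia 4 (λ x y tx ty → x :< y ∷ tx :≡ x :+ lit 1 ∷ ty :≡ y :+ lit 1 ∷ [] ⊢ tx :< ty) x y
              (t x) (t y) x<y tx ty) ¬p
    ... | no ¬p | lower k eq tx | fixed _ ≢₁ ty = contradiction
            (lia 4 (λ x y tx ty → x :+ lit 1 :< y ∷ tx :≡ x :+ lit 1 ∷ ty :≡ y ∷ [] ⊢ tx :< ty) x y (t x) (t y)
              (ℤ.≤∧≢⇒< (lia 2 (λ x y → x :< y ∷ [] ⊢ x :+ lit 1 :≤ y) x y x<y)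
                (λ e → ≢₁ k (trans (sym e) (cong (ℤ._+ 1ℤ) eq)))) tx ty) ¬p
    ... | no ¬p | upper k eq tx | lower k′ eq′ ty = contradiction
            (lia 4 (λ x y tx ty → x :< y ∷ tx :≡ x :- lit 1 ∷ ty :≡ y :+ lit 1 ∷ [] ⊢ tx :< ty) x y
              (t x) (t y) x<y tx ty) ¬p
    ... | no ¬p | upper k eq tx | upper k′ eq′ ty = contradiction
            (lia 4 (λ x y tx ty → x :< y ∷ tx :≡ x :- lit 1 ∷ ty :≡ y :- lit 1 ∷ [] ⊢ tx :< ty) x y
              (t x) (t y) x<y tx ty) ¬p
    ... | no ¬p | upper k eq tx | fixed _ _ ty = contradiction
            (lia 4 (λ x y tx ty → x :< y ∷ tx :≡ x :- lit 1 ∷ ty :≡ y ∷ [] ⊢ tx :< ty) x y (t x)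
              (t y) x<y tx ty) ¬p
    ... | no ¬p | fixed _ _ tx | lower k′ eq′ ty = contradiction
            (lia 4 (λ x y tx ty → x :< y ∷ tx :≡ x ∷ ty :≡ y :+ lit 1 ∷ [] ⊢ tx :< ty) x y (t x)
              (t y) x<y tx ty) ¬p
    ... | no ¬p | fixed ≢₀ _ tx | upper k′ eq′ ty = contradiction
            (lia 4 (λ x y tx ty → x :< y :- lit 1 ∷ tx :≡ x ∷ ty :≡ y :- lit 1 ∷ [] ⊢ tx :< ty) x y (t x) (t y)
              (ℤ.≤∧≢⇒< (lia 2 (λ x y → x :< y ∷ [] ⊢ x :≤ y :- lit 1) x y x<y)
                (λ e → ≢₀ k′ (trans e (lia 2 (λ y z → y :≡ z :+ lit 1 ∷ [] ⊢ y :- lit 1 :≡ z) y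
                  (a ℤ.+ k′ ℤ.* + n) eq′)))) tx ty) ¬p
    ... | no ¬p | fixed _ _ tx | fixed _ _ ty = contradiction (subst₂ ℤ._<_ (sym tx) (sym ty) x<y) ¬p

    -- Stripping the last letter t of a word for x changes u to u ∘ t, unless this would
    -- turn a non-inversion of u into an inversion.
    strip-keep : ∀ u x → (∀ p q → p ℤ.< q → to u q ℤ.< to u p → to x q ℤ.< to x p) →
      Ascends u a → Descends x a → ∀ p q → p ℤ.< q → to u q ℤ.< to u p → to x (t q) ℤ.< to x (t p)
    strip-keep u x ⊆ asc dsc p q p<q inv =
      let p* , p*<q , inv₁ , x₁ = left (view p)
          q* , p*<q* , inv₂ , x₂ = right p*<q inv₁ (view q)
      in ℤ.<-≤-trans (ℤ.≤-<-trans x₂ (⊆ p* q* p*<q* inv₂)) x₁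
      where
      predecessor : ∀ {p} k → p ≡ a ℤ.+ k ℤ.* + n ℤ.+ 1ℤ → p ℤ.- 1ℤ ≡ a ℤ.+ k ℤ.* + n
      predecessor {p} k = lia 2 (λ p z → p :≡ z :+ lit 1 ∷ [] ⊢ p :- lit 1 :≡ z) p (a ℤ.+ k ℤ.* + n)
      rejoin : ∀ p → p ℤ.- 1ℤ ℤ.+ 1ℤ ≡ p
      rejoin p = lia 1 (λ p → [] ⊢ p :- lit 1 :+ lit 1 :≡ p) p
      left : View p → ∃[ p* ] p* ℤ.< q × to u q ℤ.< to u p* × to x p* ℤ.≤ to x (t p)
      left (lower k eq tp) = p ℤ.+ 1ℤ ,
        ℤ.≤∧≢⇒< (lia 2 (λ p q → p :< q ∷ [] ⊢ p :+ lit 1 :≤ q) p q p<q)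
          (λ e → ℤ.<-asym inv (subst (λ z → to u p ℤ.< to u z) e (ascends-orbit u asc k eq))) ,
        ℤ.<-trans inv (ascends-orbit u asc k eq) , ℤ.≤-reflexive (cong (to x) (sym tp))
      left (upper k eq tp) = p , p<q , inv ,
        ℤ.<⇒≤ (subst₂ (λ y z → to x y ℤ.< to x z) (rejoin p) (sym tp)
          (descends-orbit x dsc k (predecessor k eq)))
      left (fixed _ _ tp)  = p , p<q , inv , ℤ.≤-reflexive (cong (to x) (sym tp))
      right : ∀ {p*} → p* ℤ.< q → to u q ℤ.< to u p* → View q →
              ∃[ q* ] p* ℤ.< q* × to u q* ℤ.< to u p* × to x (t q) ℤ.≤ to x q*
      right p*<q inv₁ (lower k eq tq) = q , p*<q , inv₁ ,
        ℤ.<⇒≤ (subst (λ z → to x z ℤ.< to x q) (sym tq) (descends-orbit x dsc k eq))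
      right {p*} p*<q inv₁ (upper k eq tq) = q ℤ.- 1ℤ ,
          ℤ.≤∧≢⇒< (lia 2 (λ p q → p :< q ∷ [] ⊢ p :≤ q :- lit 1) p* q p*<q)
            (λ e → ℤ.<-irrefl (cong (to u) (sym e)) (ℤ.<-trans u↓ inv₁)) ,
          ℤ.<-trans u↓ inv₁ , ℤ.≤-reflexive (cong (to x) tq)
        where
        u↓ : to u (q ℤ.- 1ℤ) ℤ.< to u q
        u↓ = subst (λ z → to u (q ℤ.- 1ℤ) ℤ.< to u z) (rejoin q) (ascends-orbit u asc k (predecessor k eq))
      right p*<q inv₁ (fixed _ _ tq)  = q , p*<q , inv₁ , ℤ.≤-reflexive (cong (to x) tq)

    strip-both : ∀ u x → (∀ p q → p ℤ.< q → to u q ℤ.< to u p → to x q ℤ.< to x p) →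
      (Ascends u a → Ascends x a) →
      ∀ p q → p ℤ.< q → to u (t q) ℤ.< to u (t p) → to x (t q) ℤ.< to x (t p)
    strip-both u x ⊆ asc p q p<q inv with increases p<q
    ... | inj₁ tp<tq = ⊆ (t p) (t q) tp<tq inv
    ... | inj₂ (m , refl , refl) = subst₂ ℤ._<_ (sym (cong (to x) (down m))) (sym (cong (to x) (up m)))
      (ascends-orbit x (asc (ascends-orbit⁻ u m refl
        (subst₂ ℤ._<_ (cong (to u) (down m)) (cong (to u) (up m)) inv))) m refl)

  increasing⇒id : ∀ u → drift u ≡ 0ℤ → (∀ p q → p ℤ.< q → to u p ℤ.< to u q) → ∀ x → to u x ≡ x
  increasing⇒id u d0 incr a = sym (cut-aligned u a (to u a) d0
    (λ x x≤a → case ℤ.<-cmp x a of λ where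
      (tri< x<a _ _)  → ℤ.<⇒≤ (incr x a x<a)
      (tri≈ _ refl _) → ℤ.≤-refl
      (tri> _ _ x>a)  → contradiction x≤a (ℤ.<⇒≱ x>a))
    (λ x a<x → incr a x a<x))

  Shortened : PeriodicBijection → PeriodicBijection → ℕ → Set
  Shortened u x k = ∃[ ss ] IsWordFor n (to u) ss × List.length ss ℕ.≤ k ×
    ((∀ i → to u i ≡ to x i) ⊎ List.length ss ℕ.< k)

  ¬ascends⇒descends : ∀ u p → ¬ (to u p ℤ.< to u (p ℤ.+ 1ℤ)) → to u (p ℤ.+ 1ℤ) ℤ.< to u p
  ¬ascends⇒descends u p ¬asc = ℤ.≤∧≢⇒< (ℤ.≮⇒≥ ¬asc)
    λ eq → ℤ.<-irrefl (sym (to-injective u eq)) (lia 1 (λ p → [] ⊢ p :< p :+ lit 1) p)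

  shorten : ∀ {ss} → Reverse ss → ∀ x u → drift u ≡ 0ℤ → IsWordFor n (to x) ss →
    (∀ p q → p ℤ.< q → to u q ℤ.< to u p → to x q ℤ.< to x p) → Shortened u x (List.length ss)
  shorten []              x u d0 (gens , word) ⊆ =
    [] , ([] , λ i → sym (u≡id i)) , ℕ.z≤n , inj₁ λ i → trans (u≡id i) (word i)
    where
    u≡id = increasing⇒id u d0 λ p q p<q → ℤ.≤∧≢⇒<
      (ℤ.≮⇒≥ λ inv → ℤ.<-asym p<q (subst₂ ℤ._<_ (sym (word q)) (sym (word p)) (⊆ p q p<q inv)))
      (λ eq → ℤ.<-irrefl (to-injective u eq) p<q)
  shorten (ss ∶ rs ∶ʳ t) x u d0 (gens , word) ⊆ =
    choose (to u a ℤ.<? to u (a ℤ.+ 1ℤ)) (to x a ℤ.<? to x (a ℤ.+ 1ℤ))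
    where
    gen : IsGenerator n t
    gen = proj₂ (All.∷ʳ⁻ gens)
    a = + suc (toℕ (proj₁ gen))
    open Reflection (proj₂ gen)
    length≡ : List.length (ss List.∷ʳ t) ≡ suc (List.length ss)
    length≡ = trans (List.length-++ ss) (ℕ.+-comm (List.length ss) 1)
    word′ : IsWordFor n (to (x ∘ᵇ reflection)) ss
    word′ = proj₁ (All.∷ʳ⁻ gens) , λ i → trans (cong (List.foldr _∘′_ id ss) (sym (involutive i)))
      (trans (sym (foldr-∷ʳ-∘ ss t (t i))) (word (t i)))
    keep : Shortened u (x ∘ᵇ reflection) (List.length ss) → Shortened u x (List.length (ss List.∷ʳ t))
    keep (ss′ , w , le , _) rewrite length≡ = ss′ , w , ℕ.m≤n⇒m≤1+n le , inj₂ (ℕ.s≤s le)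
    both : Shortened (u ∘ᵇ reflection) (x ∘ᵇ reflection) (List.length ss) →
      Shortened u x (List.length (ss List.∷ʳ t))
    both (ss′ , (gs , w) , le , strict) rewrite length≡ =
      ss′ List.∷ʳ t , (All.∷ʳ⁺ gs gen , λ i → trans (foldr-∷ʳ-∘ ss′ t i)
        (trans (w (t i)) (cong (to u) (involutive i)))) ,
      subst (ℕ._≤ suc (List.length ss)) (sym length′) (ℕ.s≤s le) ,
      (case strict of λ where
        (inj₁ eq) → inj₁ λ i → trans (cong (to u) (sym (involutive i)))
          (trans (eq (t i)) (cong (to x) (involutive i)))
        (inj₂ lt) → inj₂ (subst (ℕ._< suc (List.length ss)) (sym length′) (ℕ.s≤s lt)))
      where
      length′ : List.length (ss′ List.∷ʳ t) ≡ suc (List.length ss′)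
      length′ = trans (List.length-++ ss′) (ℕ.+-comm (List.length ss′) 1)
    bothWhen : (Ascends u a → Ascends x a) → Shortened u x (List.length (ss List.∷ʳ t))
    bothWhen h = both (shorten rs (x ∘ᵇ reflection) (u ∘ᵇ reflection) (drift-∘-reflection u d0) word′
      (strip-both u x ⊆ h))
    choose : Dec (Ascends u a) → Dec (Ascends x a) → Shortened u x (List.length (ss List.∷ʳ t))
    choose (no ¬asc) _         = bothWhen λ asc → contradiction asc ¬asc
    choose (yes _)   (yes asc) = bothWhen λ _ → asc
    choose (yes asc) (no ¬asc) = keep (shorten rs (x ∘ᵇ reflection) u d0 word′
      (strip-keep u x ⊆ asc (¬ascends⇒descends x a ¬asc)))

  module Concrete (1<n : 1 ℕ.< n) (a : ℤ) where

    step : ℕ → ℤ → ℤ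
    step 0             x = x ℤ.+ 1ℤ
    step 1             x = x ℤ.- 1ℤ
    step (suc (suc _)) x = x

    swap : ℤ → ℤ
    swap x = step (toℕ (residue (x ℤ.- a))) x

    private
      swap-at : ∀ {x} b (b<n : b ℕ.< n) m → x ≡ a ℤ.+ m ℤ.* + n ℤ.+ + b → swap x ≡ step b x
      swap-at {x} b b<n m eq = cong (λ r → step r x) (trans (cong toℕ (residue-≡ (fromℕ< b<n) m
        (trans (lia 4 (λ x a p b → x :≡ a :+ p :+ b ∷ [] ⊢ x :- a :≡ b :+ p) x a (m ℤ.* + n) (+ b) eq)
          (cong (λ c → + c ℤ.+ m ℤ.* + n) (sym (Fin.toℕ-fromℕ< b<n)))))) (Fin.toℕ-fromℕ< b<n))

    isSimpleReflection : IsSimpleReflection n a swap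
    isSimpleReflection = record
      { up    = λ m → swap-at {a ℤ.+ m ℤ.* + n} 0 (ℕ.<-trans (ℕ.n<1+n 0) 1<n) m
        (sym (ℤ.+-identityʳ (a ℤ.+ m ℤ.* + n)))
      ; down  = λ m → trans (swap-at 1 1<n m refl)
        (lia 1 (λ x → [] ⊢ x :+ lit 1 :- lit 1 :≡ x) (a ℤ.+ m ℤ.* + n))
      ; fixes = λ x ≢₀ ≢₁ → fixes x ≢₀ ≢₁ (toℕ (residue (x ℤ.- a)))
          (lia 4 (λ p a r q → p :- a :≡ r :+ q ∷ [] ⊢ p :≡ a :+ q :+ r) x a (+ toℕ (residue (x ℤ.- a)))
            (quotient (x ℤ.- a) ℤ.* + n) (residue-quotient (x ℤ.- a)))
      }
      where
      fixes : ∀ x → (∀ m → x ≢ a ℤ.+ m ℤ.* + n) → (∀ m → x ≢ a ℤ.+ m ℤ.* + n ℤ.+ 1ℤ) →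
              ∀ r → x ≡ a ℤ.+ quotient (x ℤ.- a) ℤ.* + n ℤ.+ + r → step r x ≡ x
      fixes x ≢₀ ≢₁ zero          eq = contradiction (trans eq (ℤ.+-identityʳ _)) (≢₀ (quotient (x ℤ.- a)))
      fixes x ≢₀ ≢₁ (suc zero)    eq = contradiction eq (≢₁ (quotient (x ℤ.- a)))
      fixes x ≢₀ ≢₁ (suc (suc r)) eq = refl

  base : ℤ → ℤ
  base b = + suc (toℕ (residue (b ℤ.- 1ℤ)))

  base-≡ : ∀ b → b ≡ base b ℤ.+ quotient (b ℤ.- 1ℤ) ℤ.* + n
  base-≡ b = lia 3 (λ b r q → b :- lit 1 :≡ r :+ q ∷ [] ⊢ b :≡ lit 1 :+ r :+ q)
    b (+ toℕ (residue (b ℤ.- 1ℤ))) (quotient (b ℤ.- 1ℤ) ℤ.* + n) (residue-quotient (b ℤ.- 1ℤ))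

  descent⇒1<n : ∀ u {a} → to u (a ℤ.+ 1ℤ) ℤ.< to u a → 1 ℕ.< n
  descent⇒1<n u {a} dsc = ℕ.≤∧≢⇒< (ℕ.>-nonZero⁻¹ n) λ 1≡n → ℤ.<-asym dsc
    (subst (to u a ℤ.<_) (sym (trans (cong (λ m → to u (a ℤ.+ + m)) 1≡n) (equivariant u a)))
      (lia 2 (λ x n → lit 0 :< n ∷ [] ⊢ x :< x :+ n) (to u a) (+ n) 0<n))

  square : ℤ → ℤ
  square x = x ℤ.* x

  energy : PeriodicBijection → ℤ
  energy u = ∑ (λ x → square (displacement u x))

  energy-window : ∀ u a → energy u ≡ ∑ (λ x → square (displacement u (a ℤ.+ x)))
  energy-window u a = sym (∑-reindex (translation a) (λ x → square (displacement u x))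
    (λ x → cong square (displacement-periodic u x)))

  sum-nonneg : ∀ m (f : Fin m → ℤ) → (∀ i → 0ℤ ℤ.≤ f i) → 0ℤ ℤ.≤ ∑.sum {m} f
  sum-nonneg zero    f h = ℤ.≤-refl
  sum-nonneg (suc m) f h = ℤ.+-mono-≤ (h Fin.zero) (sum-nonneg m (f ∘ Fin.suc) (h ∘ Fin.suc))

  energy-nonneg : ∀ u → 0ℤ ℤ.≤ energy u
  energy-nonneg u = sum-nonneg n _ λ i → square-nonneg (displacement u (+ toℕ i))
    where
    square-nonneg : ∀ x → 0ℤ ℤ.≤ square x
    square-nonneg (+ zero)  = ℤ.≤-refl
    square-nonneg (+ suc m) = ℤ.+≤+ ℕ.z≤n
    square-nonneg -[1+ m ]  = ℤ.+≤+ ℕ.z≤n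

  energy-decreases : ∀ u {a t} (R : IsSimpleReflection n a t) → to u (a ℤ.+ 1ℤ) ℤ.< to u a →
    energy (u ∘ᵇ Reflection.reflection R) ℤ.< energy u
  energy-decreases u {a} {t} R dsc =
    lia 6 (λ x y e e′ f g → y :< x ∷ e′ :+ g :≡ e :+ f ∷ g :≡ f :+ 2 :* (x :- y) ∷ [] ⊢ e′ :< e)
    x y (energy u) (energy u′) (F 0 ℤ.+ F 1) (G 0 ℤ.+ G 1) dsc
    (trans (cong (ℤ._+ (G 0 ℤ.+ G 1)) (energy-window u′ a))
      (trans (sum-head-two n F G 1<n rest) (cong (ℤ._+ (F 0 ℤ.+ F 1)) (sym (energy-window u a)))))
    (trans (cong (λ p → square (p ℤ.- (a ℤ.+ 0ℤ)) ℤ.+ square (y ℤ.- (a ℤ.+ 1ℤ)))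
      (cong (to u) (ℤ.+-identityʳ a)))
      (trans (identity x y a) (cong (ℤ._+ + 2 ℤ.* (x ℤ.- y))
        (cong₂ (λ p q → square (p ℤ.- (a ℤ.+ 0ℤ)) ℤ.+ square (q ℤ.- (a ℤ.+ 1ℤ))) (cong (to u) (sym t₀))
          (cong (to u) (sym t₁))))))
    where
    open Reflection R
    open IsSimpleReflection R
    u′ = u ∘ᵇ reflection
    x = to u a
    y = to u (a ℤ.+ 1ℤ)
    F G : ℕ → ℤ
    F i = square (displacement u′ (a ℤ.+ + i))
    G i = square (displacement u (a ℤ.+ + i))
    1<n : 1 ℕ.< n
    1<n = descent⇒1<n u dsc
    a≡ : a ℤ.+ 0ℤ ℤ.* + n ≡ a
    a≡ = trans (cong (ℤ._+_ a) (ℤ.*-zeroˡ (+ n))) (ℤ.+-identityʳ a)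
    t₀ : t (a ℤ.+ 0ℤ) ≡ a ℤ.+ 1ℤ
    t₀ = trans (cong t (trans (ℤ.+-identityʳ a) (sym a≡))) (trans (up 0ℤ) (cong (ℤ._+ 1ℤ) a≡))
    t₁ : t (a ℤ.+ 1ℤ) ≡ a
    t₁ = trans (cong (λ z → t (z ℤ.+ 1ℤ)) (sym a≡)) (trans (down 0ℤ) a≡)
    rest : ∀ i → 1 ℕ.< i → i ℕ.< n → F i ≡ G i
    rest i 1<i i<n = cong (λ z → square (to u z ℤ.- (a ℤ.+ + i))) (fixes (a ℤ.+ + i)
      (λ m eq → ℕ.<-irrefl (sym (proj₁ (residue-unique i<n (ℕ.<-trans (ℕ.n<1+n 0) 1<n) m
        (lia 3 (λ a i p → a :+ i :≡ a :+ p ∷ [] ⊢ i :≡ lit 0 :+ p) a (+ i) (m ℤ.* + n) eq))))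
          (ℕ.<-trans (ℕ.n<1+n 0) 1<i))
      (λ m eq → ℕ.<-irrefl (sym (proj₁ (residue-unique i<n 1<n m
        (lia 3 (λ a i p → a :+ i :≡ a :+ p :+ lit 1 ∷ [] ⊢ i :≡ lit 1 :+ p) a (+ i) (m ℤ.* + n) eq)))) 1<i))
    identity : ∀ x y a → square (x ℤ.- (a ℤ.+ 0ℤ)) ℤ.+ square (y ℤ.- (a ℤ.+ 1ℤ)) ≡
      square (y ℤ.- (a ℤ.+ 0ℤ)) ℤ.+ square (x ℤ.- (a ℤ.+ 1ℤ)) ℤ.+ + 2 ℤ.* (x ℤ.- y)
    identity = solve 3 (λ x y a → (x ⊝ (a ⊕ con 0ℤ)) ⊗ (x ⊝ (a ⊕ con 0ℤ)) ⊕ (y ⊝ (a ⊕ con 1ℤ)) ⊗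
      (y ⊝ (a ⊕ con 1ℤ)) :=
        (y ⊝ (a ⊕ con 0ℤ)) ⊗ (y ⊝ (a ⊕ con 0ℤ)) ⊕ (x ⊝ (a ⊕ con 1ℤ)) ⊗ (x ⊝ (a ⊕ con 1ℤ)) ⊕ con (+ 2) ⊗
          (x ⊝ y)) refl
      where open ℤSolver.+-*-Solver using (solve; _:=_; con) renaming (_:+_ to _⊕_; _:*_ to _⊗_; _:-_ to _⊝_)

  locally-increasing : ∀ u → (∀ (i : Fin n) → to u (+ suc (toℕ i)) ℤ.< to u (+ suc (toℕ i) ℤ.+ 1ℤ)) →
                       ∀ p q → p ℤ.< q → to u p ℤ.< to u q
  locally-increasing u h p q p<q = subst (λ z → to u p ℤ.< to u z) (sym q≡) (climb k)
    where
    one : ∀ p → to u p ℤ.< to u (p ℤ.+ 1ℤ)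
    one p = subst₂ ℤ._<_
      (sym (trans (cong (to u) (base-≡ p)) (to-shift u k₀ (base p))))
      (sym (trans (cong (to u) (trans (cong (ℤ._+ 1ℤ) (base-≡ p))
        (lia 2 (λ a x → [] ⊢ a :+ x :+ lit 1 :≡ a :+ lit 1 :+ x) (base p) (k₀ ℤ.* + n))))
          (to-shift u k₀ (base p ℤ.+ 1ℤ))))
      (ℤ.+-monoˡ-< (k₀ ℤ.* + n) (h (residue (p ℤ.- 1ℤ))))
      where k₀ = quotient (p ℤ.- 1ℤ)
    k = ∣ q ℤ.- p ℤ.- 1ℤ ∣
    q≡ : q ≡ p ℤ.+ + suc k
    q≡ = lia 3 (λ p q k → k :≡ q :- p :- lit 1 ∷ [] ⊢ q :≡ p :+ (lit 1 :+ k)) p q (+ k)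
      (ℤ.0≤i⇒+∣i∣≡i (lia 2 (λ p q → p :< q ∷ [] ⊢ lit 0 :≤ q :- p :- lit 1) p q p<q))
    climb : ∀ k → to u p ℤ.< to u (p ℤ.+ + suc k)
    climb zero    = one p
    climb (suc k) = ℤ.<-trans (climb k) (subst (λ z → to u (p ℤ.+ + suc k) ℤ.< to u z)
      (lia 2 (λ p k → [] ⊢ p :+ (lit 1 :+ k) :+ lit 1 :≡ p :+ (lit 2 :+ k)) p (+ k)) (one (p ℤ.+ + suc k)))

  word-exists : ∀ k u → drift u ≡ 0ℤ → energy u ℤ.≤ + k → ∃[ ss ] IsWordFor n (to u) ss
  word-exists k u d0 e≤k = sort (Fin.any? λ i → to u (+ suc (toℕ i) ℤ.+ 1ℤ) ℤ.<? to u (+ suc (toℕ i)))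
    where
    sort : Dec (∃[ i ] to u (+ suc (toℕ i) ℤ.+ 1ℤ) ℤ.< to u (+ suc (toℕ i))) → ∃[ ss ] IsWordFor n (to u) ss
    sort (no ¬dsc) = [] , [] , λ i → sym (increasing⇒id u d0 (locally-increasing u λ i →
      ℤ.≤∧≢⇒< (ℤ.≮⇒≥ λ dsc → ¬dsc (i , dsc)) λ eq → ℤ.<-irrefl (to-injective u eq)
        (lia 1 (λ p → [] ⊢ p :< p :+ lit 1) (+ suc (toℕ i)))) i)
    sort (yes (i , dsc)) = extend k e≤k
      where
      open Concrete (descent⇒1<n u dsc) (+ suc (toℕ i))
      open Reflection isSimpleReflection
      less = energy-decreases u isSimpleReflection dsc
      extend : ∀ k → energy u ℤ.≤ + k → ∃[ ss ] IsWordFor n (to u) ss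
      extend zero    e≤ = ⊥-elim (ℤ.<⇒≱ (ℤ.<-≤-trans less e≤) (energy-nonneg (u ∘ᵇ reflection)))
      extend (suc k) e≤ =
        let ss , gens , w = word-exists k (u ∘ᵇ reflection) (drift-∘-reflection u d0)
              (lia 3 (λ e e′ k → e′ :< e ∷ e :≤ lit 1 :+ k ∷ [] ⊢ e′ :≤ k) (energy u)
                (energy (u ∘ᵇ reflection)) (+ k) less e≤)
        in ss List.∷ʳ swap , All.∷ʳ⁺ gens (i , isSimpleReflection) ,
           λ j → trans (foldr-∷ʳ-∘ ss swap j) (trans (w (swap j)) (cong (to u) (involutive j)))

module Avoidance (n : ℕ) .{{_ : ℕ.NonZero n}} where
  open Periodic n
  open PeriodicBijection
  open Projections n

  affine-injective : ∀ (w : AffinePermutation n) {x y} → w ⟦ x ⟧ ≡ w ⟦ y ⟧ → x ≡ y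
  affine-injective w = to-injective (fromAffine w)

  module _ (w : AffinePermutation n) where

    separated⁺ : ∀ {i j k} → i ℤ.< k → k ℤ.< j → w ⟦ i ⟧ ℤ.< w ⟦ k ⟧ → w ⟦ j ⟧ ℤ.< w ⟦ k ⟧ → Separated w i j
    separated⁺ {i} {j} {k} i<k k<j wi wj = k , ℤ.≤-<-trans (ℤ.i⊓j≤i i j) i<k , ℤ.<-≤-trans k<j (ℤ.i≤j⊔i i j) ,
      ⊔< wi wj
      where
      ⊔< : ∀ {x y z} → x ℤ.< z → y ℤ.< z → x ℤ.⊔ y ℤ.< z
      ⊔< {x} {y} x<z y<z with ℤ.⊔-sel x y
      ... | inj₁ eq = subst (ℤ._< _) (sym eq) x<z
      ... | inj₂ eq = subst (ℤ._< _) (sym eq) y<z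

    separated⁻ : ∀ {i j} → i ℤ.< j → Separated w i j →
      ∃[ k ] i ℤ.< k × k ℤ.< j × w ⟦ i ⟧ ℤ.< w ⟦ k ⟧ × w ⟦ j ⟧ ℤ.< w ⟦ k ⟧
    separated⁻ {i} {j} i<j (k , p , q , r) = k ,
      subst (ℤ._< k) (ℤ.i≤j⇒i⊓j≡i (ℤ.<⇒≤ i<j)) p , subst (k ℤ.<_) (ℤ.i≤j⇒i⊔j≡j (ℤ.<⇒≤ i<j)) q ,
      ℤ.≤-<-trans (ℤ.i≤i⊔j (w ⟦ i ⟧) (w ⟦ j ⟧)) r , ℤ.≤-<-trans (ℤ.i≤j⊔i (w ⟦ i ⟧) (w ⟦ j ⟧)) r

    separated-sym : ∀ {i j} → Separated w i j → Separated w j i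
    separated-sym {i} {j} (k , p , q , r) = k ,
      subst (ℤ._< k) (ℤ.⊓-comm i j) p , subst (k ℤ.<_) (ℤ.⊔-comm i j) q ,
      subst (ℤ._< w ⟦ k ⟧) (ℤ.⊔-comm (w ⟦ i ⟧) (w ⟦ j ⟧)) r

  Avoids231 : AffinePermutation n → Set
  Avoids231 u = ∀ {p k q} → p ℤ.< k → k ℤ.< q → u ⟦ q ⟧ ℤ.< u ⟦ p ⟧ → ¬ (u ⟦ p ⟧ ℤ.< u ⟦ k ⟧)

  ≡syl-sym : ∀ {v w : AffinePermutation n} → v ≡syl w → w ≡syl v
  ≡syl-sym e i j = mk⇔ (Equivalence.from (e i j)) (Equivalence.to (e i j))

  ≡syl-trans : ∀ {u v w : AffinePermutation n} → u ≡syl v → v ≡syl w → u ≡syl w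
  ≡syl-trans e f i j = mk⇔ (Equivalence.to (f i j) ∘ Equivalence.to (e i j))
                           (Equivalence.from (e i j) ∘ Equivalence.from (f i j))

  avoids⇒inversions : ∀ {u x : AffinePermutation n} → Avoids231 u → u ≡syl x →
    ∀ p q → p ℤ.< q → u ⟦ q ⟧ ℤ.< u ⟦ p ⟧ → x ⟦ q ⟧ ℤ.< x ⟦ p ⟧
  avoids⇒inversions {u} {x} avoids syl p q p<q inv = ℤ.≤∧≢⇒<
    (proj₁ (Equivalence.to (syl q p) (ℤ.<⇒≤ inv ,
      λ s → let k , p<k , k<q , up , _ = separated⁻ u p<q (separated-sym u s) in avoids p<k k<q inv up)))
    (λ eq → ℤ.<-irrefl (sym (affine-injective x eq)) p<q)

  avoids⇒projection : ∀ {u w : AffinePermutation n} → u ≡syl w → Avoids231 u → IsProjection w u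
  avoids⇒projection {u} {w} syl avoids = syl , minimal
    where
    trivial : ∀ {f : ℤ → ℤ} ts → IsWordFor n f ts → List.length ts ≡ 0 → ∀ i → i ≡ f i
    trivial []       (_ , word) _  = word
    trivial (_ ∷ ts) _          ()
    no-letters : ∀ {a b c l : ℕ} → + c ≡ + b ℤ.- + a → b ℕ.≤ l → l ℕ.≤ a → c ≡ 0
    no-letters {a} {b} {c} {l} c≡ b≤l l≤a = ℤ.+-injective (ℤ.≤-antisym
      (lia 4 (λ a b c l → c :≡ b :- a ∷ b :≤ l ∷ l :≤ a ∷ [] ⊢ c :≤ lit 0) (+ a) (+ b) (+ c) (+ l) c≡
        (ℤ.+≤+ b≤l) (ℤ.+≤+ l≤a))
      (ℤ.+≤+ ℕ.z≤n))
    minimal : ∀ x → x ≡syl w → x ≤L u → x ≈ u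
    minimal x x≡w (a , b , c , ((ss , word , ss≡a) , _) , (_ , b-least) , ((ts , word′ , ts≡c) , _) , c≡) j =
      trans (trivial ts word′ (trans ts≡c c≡0) (x ⟦ j ⟧)) (cong (u ⟦_⟧) (from-to (fromAffine x) j))
      where
      short : Shortened (fromAffine u) (fromAffine x) (List.length ss)
      short = shorten (reverseView ss) (fromAffine x) (fromAffine u) (drift-affine u) word
        (avoids⇒inversions {u} {x} avoids (≡syl-trans {u} {w} {x} syl (≡syl-sym {x} {w} x≡w)))
      c≡0 : c ≡ 0
      c≡0 = no-letters c≡ (b-least (proj₁ short) (proj₁ (proj₂ short)))
        (subst (List.length (proj₁ short) ℕ.≤_) ss≡a (proj₁ (proj₂ (proj₂ short))))

  adjacent⇒1<n : ∀ (u : AffinePermutation n) {p q} → p ℤ.< q → u ⟦ p ⟧ ≡ u ⟦ q ⟧ ℤ.+ 1ℤ → 1 ℕ.< n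
  adjacent⇒1<n u {p} {q} p<q adjacent = ℕ.≤∧≢⇒< (ℕ.>-nonZero⁻¹ n) λ 1≡n → ℤ.<-asym p<q
    (subst (q ℤ.<_) (sym (affine-injective u (trans adjacent
        (trans (cong (λ m → u ⟦ q ⟧ ℤ.+ + m) 1≡n) (sym (equivariant (fromAffine u) q))))))
      (lia 2 (λ x n → lit 0 :< n ∷ [] ⊢ x :< x :+ n) q (+ n) 0<n))

  module Exchange {u : AffinePermutation n} {q k p : ℤ} (p<k : p ℤ.< k) (k<q : k ℤ.< q)
      (adjacent : u ⟦ p ⟧ ≡ u ⟦ q ⟧ ℤ.+ 1ℤ) (higher : u ⟦ p ⟧ ℤ.< u ⟦ k ⟧)
      {a c : ℤ} (b≡ : u ⟦ q ⟧ ≡ a ℤ.+ c ℤ.* + n) {swap : ℤ → ℤ} (gen : IsGenerator n swap)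
      (isSimpleReflection : IsSimpleReflection n a swap) (1<n : 1 ℕ.< n) where
    U = fromAffine u
    b = u ⟦ q ⟧
    p<q = ℤ.<-trans p<k k<q

    open Reflection isSimpleReflection
    open IsSimpleReflection isSimpleReflection

    x : AffinePermutation n
    x = toAffine (reflection ∘ᵇ U)
      (trans (drift-∘ reflection U) (cong₂ ℤ._+_ drift-reflection (drift-affine u)))

    translate : ∀ m {y z} → u ⟦ y ⟧ ≡ a ℤ.+ m ℤ.* + n → u ⟦ z ⟧ ≡ a ℤ.+ m ℤ.* + n ℤ.+ 1ℤ →
      y ≡ q ℤ.+ (m ℤ.- c) ℤ.* + n × z ≡ p ℤ.+ (m ℤ.- c) ℤ.* + n
    translate m {y} {z} uy uz =
      affine-injective u (trans uy (sym (trans (to-shift U (m ℤ.- c) q) b+))) ,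
      affine-injective u (trans uz
        (sym (trans (to-shift U (m ℤ.- c) p) (trans (cong (ℤ._+ (m ℤ.- c) ℤ.* + n) adjacent)
        (lia 3 (λ b d z → b :+ d :≡ z ∷ [] ⊢ b :+ lit 1 :+ d :≡ z :+ lit 1) b ((m ℤ.- c) ℤ.* + n)
          (a ℤ.+ m ℤ.* + n) b+)))))
      where
      b+ : b ℤ.+ (m ℤ.- c) ℤ.* + n ≡ a ℤ.+ m ℤ.* + n
      b+ = lia 5 (λ a b x y z → b :≡ a :+ y ∷ z :≡ x :- y ∷ [] ⊢ b :+ z :≡ a :+ x)
        a b (m ℤ.* + n) (c ℤ.* + n) ((m ℤ.- c) ℤ.* + n) b≡
        (trans (ℤ.*-distribʳ-+ (+ n) m (ℤ.- c)) (cong (ℤ._+_ (m ℤ.* + n)) (sym (ℤ.neg-distribˡ-* c (+ n)))))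

    -- A separator of two positions with exchanged values that is higher than both.
    HighSeparator : AffinePermutation n → Set
    HighSeparator f = ∀ m {y z} → f ⟦ y ⟧ ≡ a ℤ.+ m ℤ.* + n → f ⟦ z ⟧ ≡ a ℤ.+ m ℤ.* + n ℤ.+ 1ℤ →
      ∃[ k ] y ℤ.⊓ z ℤ.< k × k ℤ.< y ℤ.⊔ z × a ℤ.+ m ℤ.* + n ℤ.+ 1ℤ ℤ.< f ⟦ k ⟧

    highSeparator-u : HighSeparator u
    highSeparator-u m {y} {z} uy uz = let y≡ , z≡ = translate m uy uz in at y≡ z≡
      where
      d = (m ℤ.- c) ℤ.* + n
      at : y ≡ q ℤ.+ d → z ≡ p ℤ.+ d →
        ∃[ k ] y ℤ.⊓ z ℤ.< k × k ℤ.< y ℤ.⊔ z × a ℤ.+ m ℤ.* + n ℤ.+ 1ℤ ℤ.< u ⟦ k ⟧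
      at y≡ z≡ = k ℤ.+ d ,
        ℤ.≤-<-trans (ℤ.i⊓j≤j y z) (subst (ℤ._< k ℤ.+ d) (sym z≡) (ℤ.+-monoˡ-< d p<k)) ,
        ℤ.<-≤-trans (subst (k ℤ.+ d ℤ.<_) (sym y≡) (ℤ.+-monoˡ-< d k<q)) (ℤ.i≤i⊔j y z) ,
        subst₂ ℤ._<_ (trans (sym (trans (cong (u ⟦_⟧) z≡) (to-shift U (m ℤ.- c) p))) uz)
          (sym (to-shift U (m ℤ.- c) k))
          (ℤ.+-monoˡ-< d higher)

    swap-above : ∀ m v → a ℤ.+ m ℤ.* + n ℤ.+ 1ℤ ℤ.< v → a ℤ.+ m ℤ.* + n ℤ.+ 1ℤ ℤ.< swap v
    swap-above m v e<v with increases e<v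
    ... | inj₁ lt = ℤ.≤∧≢⇒< (lia 3 (λ e te tv → te :≡ e ∷ te :< tv ∷ [] ⊢ e :+ lit 1 :≤ tv)
              (a ℤ.+ m ℤ.* + n) (swap (a ℤ.+ m ℤ.* + n ℤ.+ 1ℤ)) (swap v) (down m) lt)
            λ eq → ℤ.<-irrefl refl (ℤ.<-trans
              (subst (ℤ._< a ℤ.+ m ℤ.* + n ℤ.+ 1ℤ) (trans (sym (down m)) (trans (cong swap eq) (involutive v)))
              (lia 1 (λ e → [] ⊢ e :< e :+ lit 1) (a ℤ.+ m ℤ.* + n))) e<v)
    ... | inj₂ (m′ , e≡ , v≡) = contradiction (proj₁ (residue-unique 1<n 0<ℕn (m′ ℤ.- m) e≡′)) λ ()
      where
      0<ℕn : 0 ℕ.< n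
      0<ℕn = ℕ.>-nonZero⁻¹ n
      e≡′ : + 1 ≡ + 0 ℤ.+ (m′ ℤ.- m) ℤ.* + n
      e≡′ = lia 4 (λ a x y z → a :+ x :+ lit 1 :≡ a :+ y ∷ z :≡ y :- x ∷ [] ⊢ lit 1 :≡ lit 0 :+ z)
        a (m ℤ.* + n) (m′ ℤ.* + n) ((m′ ℤ.- m) ℤ.* + n) e≡
        (trans (ℤ.*-distribʳ-+ (+ n) m′ (ℤ.- m)) (cong (ℤ._+_ (m′ ℤ.* + n)) (sym (ℤ.neg-distribˡ-* m (+ n)))))

    highSeparator-x : HighSeparator x
    highSeparator-x m {y} {z} xy xz =
      let k′ , lo , hi , above = highSeparator-u m {z} {y}
            (trans (sym (involutive _)) (trans (cong swap xz) (down m)))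
            (trans (sym (involutive _)) (trans (cong swap xy) (up m)))
      in k′ , subst (ℤ._< k′) (ℤ.⊓-comm z y) lo , subst (k′ ℤ.<_) (ℤ.⊔-comm z y) hi ,
        swap-above m (u ⟦ k′ ⟧) above

    module Transfer (f g : AffinePermutation n) (g≡ : ∀ y → g ⟦ y ⟧ ≡ swap (f ⟦ y ⟧))
      (f≡ : ∀ y → f ⟦ y ⟧ ≡ swap (g ⟦ y ⟧))
        (Hf : HighSeparator f) (Hg : HighSeparator g) where

      rises : ∀ {y k} → f ⟦ y ⟧ ℤ.+ 1ℤ ℤ.< f ⟦ k ⟧ → g ⟦ y ⟧ ℤ.< g ⟦ k ⟧
      rises {y} {k} lt with increases (ℤ.<-trans (lia 1 (λ e → [] ⊢ e :< e :+ lit 1) (f ⟦ y ⟧)) lt)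
      ... | inj₁ r = subst₂ ℤ._<_ (sym (g≡ y)) (sym (g≡ k)) r
      ... | inj₂ (m , e , e′) = ⊥-elim (ℤ.<-irrefl (trans (cong (ℤ._+ 1ℤ) e) (sym e′)) lt)

      between : ∀ {i j y z w} → i ℤ.⊓ j ℤ.≤ y → y ℤ.≤ i ℤ.⊔ j → i ℤ.⊓ j ℤ.< z → z ℤ.< i ℤ.⊔ j →
                y ℤ.⊓ z ℤ.< w → w ℤ.< y ℤ.⊔ z → i ℤ.⊓ j ℤ.< w × w ℤ.< i ℤ.⊔ j
      between {i} {j} {y} {z} {w} y₁ y₂ z₁ z₂ w₁ w₂ =
        ℤ.≤-<-trans (ℤ.⊓-glb y₁ (ℤ.<⇒≤ z₁)) w₁ , ℤ.<-≤-trans w₂ (ℤ.⊔-lub y₂ (ℤ.<⇒≤ z₂))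

      glue : ∀ {y z k} → y ℤ.⊓ z ℤ.< k → k ℤ.< y ℤ.⊔ z → g ⟦ y ⟧ ℤ.< g ⟦ k ⟧ → g ⟦ z ⟧ ℤ.< g ⟦ k ⟧ →
        Separated g y z
      glue {y} {z} {k} k₁ k₂ ly lz with ℤ.⊔-sel (g ⟦ y ⟧) (g ⟦ z ⟧)
      ... | inj₁ eq = k , k₁ , k₂ , subst (ℤ._< g ⟦ k ⟧) (sym eq) ly
      ... | inj₂ eq = k , k₁ , k₂ , subst (ℤ._< g ⟦ k ⟧) (sym eq) lz

      separated : ∀ {y z} → Separated f y z → Separated g y z
      separated {y} {z} (k , k₁ , k₂ , r) = go (increases ly) (increases lz)
        where
        ly : f ⟦ y ⟧ ℤ.< f ⟦ k ⟧
        ly = ℤ.≤-<-trans (ℤ.i≤i⊔j (f ⟦ y ⟧) (f ⟦ z ⟧)) r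
        lz : f ⟦ z ⟧ ℤ.< f ⟦ k ⟧
        lz = ℤ.≤-<-trans (ℤ.i≤j⊔i (f ⟦ y ⟧) (f ⟦ z ⟧)) r
        far : ∀ {x y z : ℤ} → x ℤ.< y → y ℤ.< z → x ℤ.+ 1ℤ ℤ.< z
        far {x} {y} {z} = lia 3 (λ x y z → x :< y ∷ y :< z ∷ [] ⊢ x :+ lit 1 :< z) x y z
        higher-than : ∀ {m k′} → f ⟦ k ⟧ ≡ a ℤ.+ m ℤ.* + n ℤ.+ 1ℤ → a ℤ.+ m ℤ.* + n ℤ.+ 1ℤ ℤ.< f ⟦ k′ ⟧ →
          y ℤ.⊓ z ℤ.< k′ × k′ ℤ.< y ℤ.⊔ z → Separated g y z
        higher-than {m} {k′} fk fk′ (k₁′ , k₂′) = glue k₁′ k₂′ (rises (far ly k<k′)) (rises (far lz k<k′))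
          where k<k′ = subst (ℤ._< f ⟦ k′ ⟧) (sym fk) fk′
        Bad : ℤ → Set
        Bad y = ∃[ m ] f ⟦ y ⟧ ≡ a ℤ.+ m ℤ.* + n × f ⟦ k ⟧ ≡ a ℤ.+ m ℤ.* + n ℤ.+ 1ℤ
        go : swap (f ⟦ y ⟧) ℤ.< swap (f ⟦ k ⟧) ⊎ Bad y → swap (f ⟦ z ⟧) ℤ.< swap (f ⟦ k ⟧) ⊎ Bad z →
          Separated g y z
        go (inj₁ p) (inj₁ q) = glue k₁ k₂ (subst₂ ℤ._<_ (sym (g≡ y)) (sym (g≡ k)) p)
          (subst₂ ℤ._<_ (sym (g≡ z)) (sym (g≡ k)) q)
        go (inj₂ (m , fy , fk)) _ = let k′ , lo , hi , above = Hf m fy fk in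
          higher-than {m} {k′} fk above (between {y} {z} (ℤ.i⊓j≤i y z) (ℤ.i≤i⊔j y z) k₁ k₂ lo hi)
        go (inj₁ _) (inj₂ (m , fz , fk)) = let k′ , lo , hi , above = Hf m fz fk in
          higher-than {m} {k′} fk above (between {y} {z} (ℤ.i⊓j≤j y z) (ℤ.i≤j⊔i y z) k₁ k₂ lo hi)

    module UX = Transfer u x (λ y → refl) (λ y → sym (involutive _)) highSeparator-u highSeparator-x
    module XU = Transfer x u (λ y → sym (involutive _)) (λ y → refl) highSeparator-x highSeparator-u

    preserves : ∀ (f g : AffinePermutation n) → (∀ y → g ⟦ y ⟧ ≡ swap (f ⟦ y ⟧)) → HighSeparator f →
      (∀ {y z} → Separated g y z → Separated f y z) →
                ∀ {y z} → y ≼[ f ] z → y ≼[ g ] z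
    preserves f g g≡ Hf back {y} {z} (le , ¬s) = order , ¬s ∘ back
      where
      order : g ⟦ y ⟧ ℤ.≤ g ⟦ z ⟧
      order with f ⟦ y ⟧ ℤ.≟ f ⟦ z ⟧
      ... | yes eq = ℤ.≤-reflexive (trans (g≡ y) (trans (cong swap eq) (sym (g≡ z))))
      ... | no ≢ = ordered (increases (ℤ.≤∧≢⇒< le ≢))
        where
        ordered : swap (f ⟦ y ⟧) ℤ.< swap (f ⟦ z ⟧)
          ⊎ (∃[ m ] f ⟦ y ⟧ ≡ a ℤ.+ m ℤ.* + n × f ⟦ z ⟧ ≡ a ℤ.+ m ℤ.* + n ℤ.+ 1ℤ) → _
        ordered (inj₁ lt) = ℤ.<⇒≤ (subst₂ ℤ._<_ (sym (g≡ y)) (sym (g≡ z)) lt)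
        ordered (inj₂ (m , fy , fz)) = let k′ , lo , hi , above = Hf m fy fz in
          contradiction (k′ , lo , hi , ℤ.≤-<-trans (ℤ.⊔-lub le ℤ.≤-refl)
            (subst (ℤ._< f ⟦ k′ ⟧) (sym fz) above)) ¬s

    x≡syl-u : x ≡syl u
    x≡syl-u y z = mk⇔ (preserves x u (λ y → sym (involutive _)) highSeparator-x UX.separated)
                      (preserves u x (λ y → refl) highSeparator-u XU.separated)

    fewer-inversions : ∀ y z → y ℤ.< z → x ⟦ z ⟧ ℤ.< x ⟦ y ⟧ → u ⟦ z ⟧ ℤ.< u ⟦ y ⟧
    fewer-inversions y z y<z inv =
      ℤ.≰⇒> λ le → impossible (increases (ℤ.≤∧≢⇒< le λ eq → ℤ.<-irrefl (affine-injective u eq) y<z))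
      where
      impossible : swap (u ⟦ y ⟧) ℤ.< swap (u ⟦ z ⟧)
        ⊎ (∃[ m ] u ⟦ y ⟧ ≡ a ℤ.+ m ℤ.* + n × u ⟦ z ⟧ ≡ a ℤ.+ m ℤ.* + n ℤ.+ 1ℤ) → ⊥
      impossible (inj₁ lt) = ℤ.<-asym inv lt
      impossible (inj₂ (m , uy , uz)) = let y≡ , z≡ = translate m uy uz in
        ℤ.<-asym y<z (subst₂ ℤ._<_ (sym z≡) (sym y≡) (ℤ.+-monoˡ-< ((m ℤ.- c) ℤ.* + n) p<q))

    swap-b : swap b ≡ b ℤ.+ 1ℤ
    swap-b = trans (cong swap b≡) (trans (up c) (cong (ℤ._+ 1ℤ) (sym b≡)))

    b≢b+1 : b ≢ b ℤ.+ 1ℤ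
    b≢b+1 eq = lia 1 (λ b → b :≡ b :+ lit 1 ∷ [] ⊢ :⊥) b eq

    x≉u : ¬ (x ≈ u)
    x≉u eq = b≢b+1 (sym (trans (sym swap-b) (eq q)))

    x≤u : ∀ {l} → HasLength n (u ⟦_⟧) l → x ≤L u
    x≤u {l} hl@((ss , word , refl) , least) =
      build (shorten (reverseView ss) U (fromAffine x) (drift-affine x) word fewer-inversions)
      where
      build : Shortened (fromAffine x) U l → x ≤L u
      build (ss′ , word′ , le , inj₁ eq) = contradiction eq x≉u
      build (ss′ , word′ , le , inj₂ lt) =
        List.length ss′ , l , 1 , ((ss′ , word′ , refl) , x-least) , hl , swap-length ,
        lia 2 (λ k l → l :≡ lit 1 :+ k ∷ [] ⊢ lit 1 :≡ l :- k) (+ List.length ss′) (+ l)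
          (cong +_ (ℕ.≤-antisym (extend ss′ word′) lt))
        where
        extend : ∀ ts → IsWordFor n (x ⟦_⟧) ts → l ℕ.≤ suc (List.length ts)
        extend ts (gs , w) = least (swap ∷ ts) (gen ∷ gs , λ i → trans (cong swap (w i)) (involutive _))
        x-least : ∀ ts → IsWordFor n (x ⟦_⟧) ts → List.length ss′ ℕ.≤ List.length ts
        x-least ts w = ℕ.s≤s⁻¹ (ℕ.≤-trans lt (extend ts w))
        swap-value : ∀ i → u ⟦ x ⁻¹⟦ i ⟧ ⟧ ≡ swap i
        swap-value i = to-from U (swap i)
        swap-length : HasLength n (λ i → u ⟦ x ⁻¹⟦ i ⟧ ⟧) 1
        swap-length = (swap ∷ [] , (gen ∷ [] , λ i → sym (swap-value i)) , refl) , shortest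
          where
          shortest : ∀ ts → IsWordFor n (λ i → u ⟦ x ⁻¹⟦ i ⟧ ⟧) ts → 1 ℕ.≤ List.length ts
          shortest []       (_ , w) = contradiction (trans (w b) (trans (swap-value b) swap-b)) b≢b+1
          shortest (_ ∷ ts) _       = ℕ.s≤s ℕ.z≤n

  adjacent-pattern : ∀ (u : AffinePermutation n) d {p k q} → u ⟦ p ⟧ ≡ u ⟦ q ⟧ ℤ.+ + suc d → p ℤ.< k → k ℤ.< q →
    u ⟦ p ⟧ ℤ.< u ⟦ k ⟧ → ∃[ p ] ∃[ k ] ∃[ q ] p ℤ.< k × k ℤ.< q × u ⟦ p ⟧ ≡ u ⟦ q ⟧ ℤ.+ 1ℤ × u ⟦ p ⟧
      ℤ.< u ⟦ k ⟧
  adjacent-pattern u zero    {p} {k} {q} eq p<k k<q up = p , k , q , p<k , k<q , eq , up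
  adjacent-pattern u (suc d) {p} {k} {q} eq p<k k<q up = go (ℤ.<-cmp y k)
    where
    y = u ⁻¹⟦ u ⟦ q ⟧ ℤ.+ 1ℤ ⟧
    uy : u ⟦ y ⟧ ≡ u ⟦ q ⟧ ℤ.+ 1ℤ
    uy = to-from (fromAffine u) _
    uy<uk : u ⟦ y ⟧ ℤ.< u ⟦ k ⟧
    uy<uk = lia 5 (λ y q p k d → y :≡ q :+ lit 1 ∷ p :≡ q :+ (lit 2 :+ d) ∷ lit 0 :≤ d ∷ p :< k ∷ [] ⊢ y :< k)
      (u ⟦ y ⟧) (u ⟦ q ⟧) (u ⟦ p ⟧) (u ⟦ k ⟧) (+ d) uy eq (ℤ.+≤+ ℕ.z≤n) up
    go : _ → _
    go (tri< y<k _ _) = y , k , q , y<k , k<q , uy , uy<uk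
    go (tri≈ _ y≡k _) = contradiction (cong (u ⟦_⟧) y≡k) (ℤ.<⇒≢ uy<uk)
    go (tri> _ _ k<y) = adjacent-pattern u d {p} {k} {y}
      (lia 4 (λ y q p d → y :≡ q :+ lit 1 ∷ p :≡ q :+ (lit 2 :+ d) ∷ [] ⊢ p :≡ y :+ (lit 1 :+ d))
        (u ⟦ y ⟧) (u ⟦ q ⟧) (u ⟦ p ⟧) (+ d) uy eq) p<k k<y up

  projection⇒avoids : ∀ {u w : AffinePermutation n} → IsProjection w u → Avoids231 u
  projection⇒avoids {u} {w} (syl , minimal) {p} {k} {q} p<k k<q inv up =
    ¬¬-minimum {λ l → ∃[ ss ] IsWordFor n (u ⟦_⟧) ss × List.length ss ≡ l} (List.length (proj₁ word))
      (proj₁ word , proj₂ word , refl)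
      (λ (l , has , least) → contradict ((has , λ ss w → least (List.length ss) (ss , w , refl))))
    where
    word = word-exists ∣ energy (fromAffine u) ∣ (fromAffine u) (drift-affine u)
      (ℤ.≤-reflexive (sym (ℤ.0≤i⇒+∣i∣≡i (energy-nonneg (fromAffine u)))))
    d = ∣ u ⟦ p ⟧ ℤ.- u ⟦ q ⟧ ℤ.- 1ℤ ∣
    d≡ : u ⟦ p ⟧ ≡ u ⟦ q ⟧ ℤ.+ + suc d
    d≡ = lia 3 (λ p q d → d :≡ p :- q :- lit 1 ∷ [] ⊢ p :≡ q :+ (lit 1 :+ d)) (u ⟦ p ⟧) (u ⟦ q ⟧) (+ d)
      (ℤ.0≤i⇒+∣i∣≡i (lia 2 (λ p q → q :< p ∷ [] ⊢ lit 0 :≤ p :- q :- lit 1) (u ⟦ p ⟧) (u ⟦ q ⟧) inv))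
    contradict : ∀ {l} → ¬ HasLength n (u ⟦_⟧) l
    contradict hl =
      let p′ , k′ , q′ , p<k′ , k<q′ , adj , up′ = adjacent-pattern u d d≡ p<k k<q up
          1<n = adjacent⇒1<n u (ℤ.<-trans p<k′ k<q′) adj
          open Concrete 1<n (base (u ⟦ q′ ⟧))
          open Exchange {u} {q′} {k′} {p′} p<k′ k<q′ adj up′ {base (u ⟦ q′ ⟧)}
            {quotient (u ⟦ q′ ⟧ ℤ.- 1ℤ)} (base-≡ (u ⟦ q′ ⟧))
            (residue (u ⟦ q′ ⟧ ℤ.- 1ℤ) , isSimpleReflection) isSimpleReflection 1<n
      in x≉u (minimal x (≡syl-trans {x} {u} {w} x≡syl-u syl) (x≤u hl))

-- Skylines and their indexings

leastWitness : ∀ {P : ℕ → Set} → (∀ k → Dec (P k)) → ∀ m → P m →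
               ∃[ k ] P k × k ℕ.≤ m × (∀ j → j ℕ.< k → ¬ P j)
leastWitness P? zero    p = 0 , p , ℕ.≤-refl , λ _ ()
leastWitness P? (suc m) p with P? 0
... | yes p₀ = 0 , p₀ , ℕ.z≤n , λ _ ()
... | no ¬p₀ = let k , q , k≤m , least = leastWitness (P? ∘ suc) m p in
  suc k , q , ℕ.s≤s k≤m , λ { zero _ → ¬p₀ ; (suc j) (ℕ.s≤s j<k) → least j j<k }

gap-ℕ : ∀ {x y} → x ℤ.≤ y → ∃[ k ] y ≡ x ℤ.+ + k
gap-ℕ {x} {y} x≤y = ∣ y ℤ.- x ∣ , lia 3 (λ x y d → d :≡ y :- x ∷ [] ⊢ y :≡ x :+ d) x y (+ ∣ y ℤ.- x ∣)
  (ℤ.0≤i⇒+∣i∣≡i (ℤ.i≤j⇒0≤j-i x≤y))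

gap-suc : ∀ {x y} → x ℤ.< y → ∃[ k ] y ≡ x ℤ.+ + suc k
gap-suc {x} {y} x<y = let k , eq = gap-ℕ (ℤ.i<j⇒suc[i]≤j x<y) in
  k , trans eq (lia 2 (λ x k → [] ⊢ lit 1 :+ x :+ k :≡ x :+ (lit 1 :+ k)) x (+ k))

ℤ-induction : ∀ {P : ℤ → Set} i₀ → P i₀ → (∀ i → P i → P (i ℤ.+ 1ℤ)) → (∀ i → P (i ℤ.+ 1ℤ) → P i) → ∀ i → P i
ℤ-induction {P} i₀ p up down i with ℤ.≤-total i₀ i
... | inj₁ le = let k , eq = gap-ℕ le in subst P (sym eq) (climb k)
  where
  climb : ∀ k → P (i₀ ℤ.+ + k)
  climb zero    = subst P (sym (ℤ.+-identityʳ i₀)) p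
  climb (suc k) = subst P (lia 2 (λ x k → [] ⊢ x :+ k :+ lit 1 :≡ x :+ (lit 1 :+ k)) i₀ (+ k)) (up _ (climb k))
... | inj₂ le = let k , eq = gap-ℕ le in
  subst P (lia 3 (λ i₀ i k → i₀ :≡ i :+ k ∷ [] ⊢ i₀ :- k :≡ i) i₀ i (+ k) eq) (descend k)
  where
  descend : ∀ k → P (i₀ ℤ.- + k)
  descend zero    = subst P (sym (ℤ.+-identityʳ i₀)) p
  descend (suc k) = down _ (subst P (lia 2 (λ x k → [] ⊢ x :- k :≡ x :- (lit 1 :+ k) :+ lit 1) i₀ (+ k))
    (descend k))

≤-suc⇒≤ : ∀ {x y} → x ℤ.< y ℤ.+ 1ℤ → x ℤ.≤ y
≤-suc⇒≤ {x} {y} = lia 2 (λ x y → x :< y :+ lit 1 ∷ [] ⊢ x :≤ y) x y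

<⇒suc≤ : ∀ {x y} → x ℤ.< y → x ℤ.+ 1ℤ ℤ.≤ y
<⇒suc≤ {x} {y} = lia 2 (λ x y → x :< y ∷ [] ⊢ x :+ lit 1 :≤ y) x y

n<n+1 : ∀ x → x ℤ.< x ℤ.+ 1ℤ
n<n+1 x = lia 1 (λ x → [] ⊢ x :< x :+ lit 1) x

local-mono : ∀ (f : ℤ → ℤ) → (∀ j → f j ℤ.< f (j ℤ.+ 1ℤ)) → ∀ {i j} → i ℤ.< j → f i ℤ.< f j
local-mono f step {i} {j} i<j = let k , eq = gap-suc i<j in subst (λ j → f i ℤ.< f j) (sym eq) (climb k)
  where
  climb : ∀ k → f i ℤ.< f (i ℤ.+ + suc k)
  climb zero    = step i
  climb (suc k) = ℤ.<-trans (climb k) (subst (λ j → f (i ℤ.+ + suc k) ℤ.< f j)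
    (lia 2 (λ i k → [] ⊢ i :+ (lit 1 :+ k) :+ lit 1 :≡ i :+ (lit 2 :+ k)) i (+ k)) (step (i ℤ.+ + suc k)))

module StrictMono (f : ℤ → ℤ) (mono : ∀ {i j} → i ℤ.< j → f i ℤ.< f j) where

  mono-≤ : ∀ {i j} → i ℤ.≤ j → f i ℤ.≤ f j
  mono-≤ {i} {j} i≤j with i ℤ.≟ j
  ... | yes refl = ℤ.≤-refl
  ... | no ≢     = ℤ.<⇒≤ (mono (ℤ.≤∧≢⇒< i≤j ≢))

  reflect-< : ∀ {i j} → f i ℤ.< f j → i ℤ.< j
  reflect-< lt = ℤ.≰⇒> λ j≤i → ℤ.<⇒≱ lt (mono-≤ j≤i)

  injective : ∀ {i j} → f i ≡ f j → i ≡ j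
  injective {i} {j} eq with ℤ.<-cmp i j
  ... | tri< lt _ _ = contradiction eq (ℤ.<⇒≢ (mono lt))
  ... | tri≈ _ e _  = e
  ... | tri> _ _ gt = contradiction (sym eq) (ℤ.<⇒≢ (mono gt))

module PeriodicSubset (n : ℕ) .{{_ : ℕ.NonZero n}} (S : ℤ → Set) (S? : ∀ x → Dec (S x))
    (S-shift : ∀ k {x} → S x → S (x ℤ.+ k ℤ.* + n)) (s₀ : ℤ) (s₀∈S : S s₀) where
  open Periodic n

  above : ∀ x → ∃[ k ] S (x ℤ.+ + suc k) × (∀ j → j ℕ.< k → ¬ S (x ℤ.+ + suc j))
  above x = let k , s , _ , least = leastWitness (λ k → S? (x ℤ.+ + suc k)) (toℕ (residue d))
                  (subst S eq (S-shift (ℤ.- quotient d) s₀∈S))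
            in k , s , least
    where
    d = s₀ ℤ.- x ℤ.- 1ℤ
    eq : s₀ ℤ.+ ℤ.- quotient d ℤ.* + n ≡ x ℤ.+ + suc (toℕ (residue d))
    eq = lia 5 (λ s x r q q′ → s :- x :- lit 1 :≡ r :+ q ∷ q′ :≡ lit 0 :- q ∷ [] ⊢ s :+ q′ :≡ x :+ (lit 1 :+ r))
      s₀ x (+ toℕ (residue d)) (quotient d ℤ.* + n) (ℤ.- quotient d ℤ.* + n) (residue-quotient d)
      (trans (sym (ℤ.neg-distribˡ-* (quotient d) (+ n))) (sym (ℤ.+-identityˡ _)))

  below : ∀ x → ∃[ k ] S (x ℤ.- + suc k) × (∀ j → j ℕ.< k → ¬ S (x ℤ.- + suc j))
  below x = let k , s , _ , least = leastWitness (λ k → S? (x ℤ.- + suc k)) (toℕ (residue d))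
                  (subst S eq (S-shift (quotient d) s₀∈S))
            in k , s , least
    where
    d = x ℤ.- 1ℤ ℤ.- s₀
    eq : s₀ ℤ.+ quotient d ℤ.* + n ≡ x ℤ.- + suc (toℕ (residue d))
    eq = lia 4 (λ s x r q → x :- lit 1 :- s :≡ r :+ q ∷ [] ⊢ s :+ q :≡ x :- (lit 1 :+ r))
      s₀ x (+ toℕ (residue d)) (quotient d ℤ.* + n) (residue-quotient d)

  opaque
    next prev : ℤ → ℤ
    next x = x ℤ.+ + suc (proj₁ (above x))
    prev x = x ℤ.- + suc (proj₁ (below x))

    next∈S : ∀ x → S (next x)
    next∈S x = proj₁ (proj₂ (above x))

    prev∈S : ∀ x → S (prev x)
    prev∈S x = proj₁ (proj₂ (below x))

    x<next : ∀ x → x ℤ.< next x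
    x<next x = lia 2 (λ x k → lit 0 :≤ k ∷ [] ⊢ x :< x :+ (lit 1 :+ k)) x (+ proj₁ (above x)) (ℤ.+≤+ ℕ.z≤n)

    prev<x : ∀ x → prev x ℤ.< x
    prev<x x = lia 2 (λ x k → lit 0 :≤ k ∷ [] ⊢ x :- (lit 1 :+ k) :< x) x (+ proj₁ (below x)) (ℤ.+≤+ ℕ.z≤n)

    next-least : ∀ {x y} → x ℤ.< y → S y → next x ℤ.≤ y
    next-least {x} {y} x<y y∈S = ℤ.≮⇒≥ λ y<next → let k , eq = gap-suc x<y in
      proj₂ (proj₂ (above x)) k
        (ℤ.drop‿+<+ (lia 4 (λ x y k m → y :< x :+ (lit 1 :+ m) ∷ y :≡ x :+ (lit 1 :+ k) ∷ [] ⊢ k :< m)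
          x y (+ k) (+ proj₁ (above x)) y<next eq))
        (subst S eq y∈S)

    prev-greatest : ∀ {x y} → y ℤ.< x → S y → y ℤ.≤ prev x
    prev-greatest {x} {y} y<x y∈S = ℤ.≮⇒≥ λ prev<y → let k , eq = gap-suc y<x in
      proj₂ (proj₂ (below x)) k
        (ℤ.drop‿+<+ (lia 4 (λ x y k m → x :- (lit 1 :+ m) :< y ∷ x :≡ y :+ (lit 1 :+ k) ∷ [] ⊢ k :< m)
          x y (+ k) (+ proj₁ (below x)) prev<y eq))
        (subst S (lia 3 (λ x y k → x :≡ y :+ (lit 1 :+ k) ∷ [] ⊢ y :≡ x :- (lit 1 :+ k)) x y (+ k) eq) y∈S)

  next-prev : ∀ {x} → S x → next (prev x) ≡ x
  next-prev {x} x∈S = ℤ.≤-antisym (next-least (prev<x x) x∈S)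
    (ℤ.≮⇒≥ λ lt → ℤ.<⇒≱ (x<next (prev x)) (prev-greatest lt (next∈S (prev x))))

  prev-next : ∀ {x} → S x → prev (next x) ≡ x
  prev-next {x} x∈S = ℤ.≤-antisym
    (ℤ.≮⇒≥ λ lt → ℤ.<⇒≱ (prev<x (next x)) (next-least lt (prev∈S (next x))))
    (prev-greatest (x<next x) x∈S)

  +n∈S : ∀ {x} → S x → S (x ℤ.+ + n)
  +n∈S {x} x∈S = subst (λ d → S (x ℤ.+ d)) (ℤ.*-identityˡ (+ n)) (S-shift 1ℤ x∈S)

  -n∈S : ∀ {x} → S (x ℤ.+ + n) → S x
  -n∈S {x} x∈S = subst S (lia 3 (λ x n m → m :≡ lit 0 :- n ∷ [] ⊢ x :+ n :+ m :≡ x) x (+ n) (-[1+ 0 ] ℤ.* + n)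
    (trans (ℤ.-1*i≡-i (+ n)) (sym (ℤ.+-identityˡ _)))) (S-shift -[1+ 0 ] x∈S)

  next-+n : ∀ x → next (x ℤ.+ + n) ≡ next x ℤ.+ + n
  next-+n x = ℤ.≤-antisym
    (next-least (ℤ.+-monoˡ-< (+ n) (x<next x)) (+n∈S (next∈S x)))
    (lia 3 (λ a b n → b :≤ a :- n ∷ [] ⊢ b :+ n :≤ a) (next (x ℤ.+ + n)) (next x) (+ n)
      (next-least (lia 3 (λ a x n → x :+ n :< a ∷ [] ⊢ x :< a :- n) (next (x ℤ.+ + n)) x (+ n)
        (x<next (x ℤ.+ + n)))
        (-n∈S (subst S (lia 2 (λ a n → [] ⊢ a :≡ a :- n :+ n) (next (x ℤ.+ + n)) (+ n)) (next∈S (x ℤ.+ + n))))))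

  module From (p₁ : ℤ) (p₁∈S : S p₁) where

    upwards downwards : ℕ → ℤ
    upwards zero      = p₁
    upwards (suc k)   = next (upwards k)
    downwards zero    = p₁
    downwards (suc k) = prev (downwards k)

    iterate : ℤ → ℤ
    iterate (+ k)    = upwards k
    iterate -[1+ k ] = downwards (suc k)

    upwards∈S : ∀ k → S (upwards k)
    upwards∈S zero    = p₁∈S
    upwards∈S (suc k) = next∈S _

    downwards∈S : ∀ k → S (downwards k)
    downwards∈S zero    = p₁∈S
    downwards∈S (suc k) = prev∈S _

    iterate∈S : ∀ i → S (iterate i)
    iterate∈S (+ k)    = upwards∈S k
    iterate∈S -[1+ k ] = downwards∈S (suc k)

    iterate-suc : ∀ i → iterate (i ℤ.+ 1ℤ) ≡ next (iterate i)
    iterate-suc (+ k)          = cong upwards (ℕ.+-comm k 1)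
    iterate-suc -[1+ zero ]    = sym (next-prev p₁∈S)
    iterate-suc -[1+ suc k ]   = sym (next-prev (downwards∈S (suc k)))

    iterate-step : ∀ i → iterate i ℤ.< iterate (i ℤ.+ 1ℤ)
    iterate-step i = subst (iterate i ℤ.<_) (sym (iterate-suc i)) (x<next (iterate i))

    open StrictMono iterate (local-mono iterate iterate-step) public

    reach-up : ∀ b k {x} → k ℕ.≤ b → x ≡ p₁ ℤ.+ + k → S x → ∃[ m ] upwards m ≡ x
    reach-up b       zero    _   eq x∈S = 0 , trans (sym (ℤ.+-identityʳ p₁)) (sym eq)
    reach-up (suc b) (suc k) {x} (ℕ.s≤s k≤b) eq x∈S =
      let d , eq′ = gap-ℕ (prev-greatest p₁<x p₁∈S)
          m , e = reach-up b d (ℕ.≤-trans (ℤ.drop‿+≤+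
            (lia 5 (λ x y p d k → x :≡ p :+ (lit 1 :+ k) ∷ y :≡ p :+ d ∷ y :< x ∷ [] ⊢ d :≤ k) x
              (prev x) p₁ (+ d) (+ k) eq eq′ (prev<x x))) k≤b)
            eq′ (prev∈S x)
      in suc m , trans (cong next e) (next-prev x∈S)
      where
      p₁<x : p₁ ℤ.< x
      p₁<x = lia 3 (λ x p k → x :≡ p :+ (lit 1 :+ k) ∷ lit 0 :≤ k ∷ [] ⊢ p :< x) x p₁ (+ k) eq (ℤ.+≤+ ℕ.z≤n)

    reach-down : ∀ b k {x} → k ℕ.≤ b → p₁ ≡ x ℤ.+ + k → S x → ∃[ m ] downwards m ≡ x
    reach-down b       zero    {x} _   eq x∈S = 0 , trans eq (ℤ.+-identityʳ _)
    reach-down (suc b) (suc k) {x} (ℕ.s≤s k≤b) eq x∈S =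
      let d , eq′ = gap-ℕ (next-least x<p₁ p₁∈S)
          m , e = reach-down b d (ℕ.≤-trans (ℤ.drop‿+≤+
            (lia 5 (λ x y p d k → p :≡ x :+ (lit 1 :+ k) ∷ p :≡ y :+ d ∷ x :< y ∷ [] ⊢ d :≤ k) x
              (next x) p₁ (+ d) (+ k) eq eq′ (x<next x))) k≤b)
            eq′ (next∈S x)
      in suc m , trans (cong prev e) (prev-next x∈S)
      where
      x<p₁ : x ℤ.< p₁
      x<p₁ = lia 3 (λ x p k → p :≡ x :+ (lit 1 :+ k) ∷ lit 0 :≤ k ∷ [] ⊢ x :< p) x p₁ (+ k) eq (ℤ.+≤+ ℕ.z≤n)

    reach : ∀ {x} → S x → ∃[ i ] iterate i ≡ x
    reach {x} x∈S with ℤ.≤-total p₁ x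
    ... | inj₁ le = let k , eq = gap-ℕ le
                        m , e  = reach-up k k ℕ.≤-refl eq x∈S in + m , e
    ... | inj₂ le = let k , eq = gap-ℕ le
                        m , e  = reach-down k k ℕ.≤-refl eq x∈S in from m e
      where
      from : ∀ m → downwards m ≡ x → ∃[ i ] iterate i ≡ x
      from zero    e = 0ℤ , e
      from (suc m) e = -[1+ m ] , e

    period : ∃[ r ] 0 ℕ.< r × upwards r ≡ p₁ ℤ.+ + n
    period = positive (reach-up n n ℕ.≤-refl refl (+n∈S p₁∈S))
      where
      positive : (∃[ m ] upwards m ≡ p₁ ℤ.+ + n) → ∃[ r ] 0 ℕ.< r × upwards r ≡ p₁ ℤ.+ + n
      positive (zero  , e) = ⊥-elim (lia 2 (λ p n → p :≡ p :+ n ∷ lit 0 :< n ∷ [] ⊢ :⊥) p₁ (+ n) e 0<n)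
      positive (suc m , e) = suc m , ℕ.s≤s ℕ.z≤n , e

    iterate-period : ∀ i → iterate (i ℤ.+ + proj₁ period) ≡ iterate i ℤ.+ + n
    iterate-period = ℤ-induction 0ℤ (proj₂ (proj₂ period))
      (λ i h → begin
        iterate (i ℤ.+ 1ℤ ℤ.+ r)         ≡⟨ cong iterate (exchange i) ⟩
        iterate (i ℤ.+ r ℤ.+ 1ℤ)         ≡⟨ iterate-suc (i ℤ.+ r) ⟩
        next (iterate (i ℤ.+ r))         ≡⟨ cong next h ⟩
        next (iterate i ℤ.+ + n)         ≡⟨ next-+n (iterate i) ⟩
        next (iterate i) ℤ.+ + n         ≡⟨ cong (ℤ._+ + n) (iterate-suc i) ⟨
        iterate (i ℤ.+ 1ℤ) ℤ.+ + n       ∎)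
      (λ i h → trans (sym (prev-next (iterate∈S (i ℤ.+ r)))) (trans (cong prev (begin
        next (iterate (i ℤ.+ r))         ≡⟨ iterate-suc (i ℤ.+ r) ⟨
        iterate (i ℤ.+ r ℤ.+ 1ℤ)         ≡⟨ cong iterate (exchange i) ⟨
        iterate (i ℤ.+ 1ℤ ℤ.+ r)         ≡⟨ h ⟩
        iterate (i ℤ.+ 1ℤ) ℤ.+ + n       ≡⟨ cong (ℤ._+ + n) (iterate-suc i) ⟩
        next (iterate i) ℤ.+ + n         ≡⟨ next-+n (iterate i) ⟨
        next (iterate i ℤ.+ + n)         ∎)) (prev-next (+n∈S (iterate∈S i)))))
      where
      open ≡-Reasoning
      r = + proj₁ period
      exchange : ∀ i → i ℤ.+ 1ℤ ℤ.+ r ≡ i ℤ.+ r ℤ.+ 1ℤ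
      exchange i = lia 2 (λ i r → [] ⊢ i :+ lit 1 :+ r :≡ i :+ r :+ lit 1) i r

module Skylines (n : ℕ) .{{_ : ℕ.NonZero n}} (v : AffinePermutation n) where
  open Periodic n
  open PeriodicBijection

  V = fromAffine v

  module _ (M : Sky v) where
    open Sky M

    OnSky : ℤ → Set
    OnSky p = T (member (v ⟦ p ⟧))

    onSky? : ∀ p → Dec (OnSky p)
    onSky? p = Bool.T? (member (v ⟦ p ⟧))

    member-shift : ∀ k m → member (m ℤ.+ k ℤ.* + n) ≡ member m
    member-shift k m = ℤ-induction {λ k → ∀ m → member (m ℤ.+ k ℤ.* + n) ≡ member m} 0ℤ
      (λ m → cong member (trans (cong (ℤ._+_ m) (ℤ.*-zeroˡ (+ n))) (ℤ.+-identityʳ m)))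
      (λ k h m → trans (cong member (suc-* k m)) (trans (periodic (m ℤ.+ k ℤ.* + n)) (h m)))
      (λ k h m → trans (sym (trans (cong member (suc-* k m)) (periodic (m ℤ.+ k ℤ.* + n)))) (h m)) k m
      where
      suc-* : ∀ k m → m ℤ.+ (k ℤ.+ 1ℤ) ℤ.* + n ≡ m ℤ.+ k ℤ.* + n ℤ.+ + n
      suc-* k m = trans (cong (ℤ._+_ m)
        (trans (ℤ.*-distribʳ-+ (+ n) k 1ℤ) (cong (ℤ._+_ (k ℤ.* + n)) (ℤ.*-identityˡ (+ n)))))
        (sym (ℤ.+-assoc m _ _))

    onSky-shift : ∀ k {p} → OnSky p → OnSky (p ℤ.+ k ℤ.* + n)
    onSky-shift k {p} = subst T (sym (trans (cong member (to-shift V k p)) (member-shift k (v ⟦ p ⟧))))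

    open PeriodicSubset n OnSky onSky? onSky-shift (v ⁻¹⟦ proj₁ nonempty ⟧)
      (subst (T ∘ member) (sym (to-from V _)) (proj₂ nonempty)) public

    maximum : ∀ {p i} → OnSky p → i ℤ.< p → v ⟦ i ⟧ ℤ.< v ⟦ p ⟧
    maximum {p} {i} s i<p = maxima (v ⟦ p ⟧) s i (subst (i ℤ.<_) (sym (from-to V p)) i<p)

    private
      module I = From (prev (+ 2)) (prev∈S (+ 2))

    indexing : Indexing v M
    indexing = record
      { m          = λ j → v ⟦ I.iterate (j ℤ.- 1ℤ) ⟧
      ; increasing = λ j → maximum (I.iterate∈S (j ℤ.+ 1ℤ ℤ.- 1ℤ))
        (subst (λ i → I.iterate (j ℤ.- 1ℤ) ℤ.< I.iterate i)
          (lia 1 (λ j → [] ⊢ j :- lit 1 :+ lit 1 :≡ j :+ lit 1 :- lit 1) j) (I.iterate-step (j ℤ.- 1ℤ)))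
      ; range      = λ x → mk⇔
          (λ x∈M → let i , e = I.reach {v ⁻¹⟦ x ⟧} (subst (T ∘ member) (sym (to-from V x)) x∈M) in
            i ℤ.+ 1ℤ , trans (cong (v ⟦_⟧)
              (trans (cong I.iterate (lia 1 (λ i → [] ⊢ i :+ lit 1 :- lit 1 :≡ i) i)) e)) (to-from V x))
          (λ (j , e) → subst (T ∘ member) e (I.iterate∈S (j ℤ.- 1ℤ)))
      ; m₁≤1       = subst (ℤ._≤ 1ℤ) (sym (from-to V _)) (≤-suc⇒≤ (prev<x (+ 2)))
      ; 1<m₂       = subst (1ℤ ℤ.<_) (sym (from-to V _)) (ℤ.≰⇒> λ le → ℤ.<⇒≱ (x<next (prev (+ 2)))
          (prev-greatest (ℤ.≤-<-trans le (n<n+1 1ℤ)) (next∈S (prev (+ 2)))))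
      ; r          = proj₁ I.period
      ; r>0        = proj₁ (proj₂ I.period)
      ; shift      = λ j → trans (cong (v ⟦_⟧) (trans
          (cong I.iterate (lia 2 (λ j r → [] ⊢ j :+ r :- lit 1 :≡ j :- lit 1 :+ r) j
            (+ proj₁ I.period))) (I.iterate-period (j ℤ.- 1ℤ))))
          (equivariant V _)
      }

    module Positions (I : Indexing v M) where
      open Indexing I public

      v-position : ∀ j → v ⟦ position j ⟧ ≡ m j
      v-position j = to-from V (m j)

      position∈S : ∀ j → OnSky (position j)
      position∈S j = subst (T ∘ member) (sym (v-position j)) (Equivalence.from (range (m j)) (j , refl))

      position-step : ∀ j → position j ℤ.< position (j ℤ.+ 1ℤ)
      position-step j = ℤ.≰⇒> λ le → case position (j ℤ.+ 1ℤ) ℤ.≟ position j of λ where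
        (yes eq) → ℤ.<-irrefl (trans (sym (v-position j))
          (trans (cong (v ⟦_⟧) (sym eq)) (v-position (j ℤ.+ 1ℤ)))) (increasing j)
        (no ≢)   → ℤ.<-asym (increasing j) (subst₂ ℤ._<_ (v-position (j ℤ.+ 1ℤ)) (v-position j)
                     (maximum (position∈S j) (ℤ.≤∧≢⇒< le ≢)))

      position-mono : ∀ {i j} → i ℤ.< j → position i ℤ.< position j
      position-mono = local-mono position position-step

      open StrictMono position position-mono public

      position-onto : ∀ {p} → OnSky p → ∃[ j ] position j ≡ p
      position-onto {p} p∈S = let j , e = Equivalence.to (range (v ⟦ p ⟧)) p∈S in
        j , trans (cong (v ⁻¹⟦_⟧) e) (from-to V p)

      position-shift : ∀ j → position (j ℤ.+ + r) ≡ position j ℤ.+ + n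
      position-shift j = trans (cong (v ⁻¹⟦_⟧) (shift j)) (from-equivariant V (m j))

      gap-≡ : ∀ j → position (j ℤ.+ 1ℤ) ≡ position j ℤ.+ + suc (gap j)
      gap-≡ j = let k , eq = gap-suc (position-step j) in trans eq (cong (λ d → position j ℤ.+ + suc d) (sym (at k eq)))
        where
        at : ∀ k → position (j ℤ.+ 1ℤ) ≡ position j ℤ.+ + suc k → gap j ≡ k
        at k eq = cong (λ d → ∣ d ∣ ℕ.∸ 1) (lia 3 (λ x y d → y :≡ x :+ d ∷ [] ⊢ y :- x :≡ d)
          (position j) (position (j ℤ.+ 1ℤ)) (+ suc k) eq)

  module IndexingUniqueness {M M′ : Sky v} (M≗M′ : ∀ x → Sky.member M x ≡ Sky.member M′ x)
      (I : Indexing v M) (I′ : Indexing v M′) where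
    module P  = Positions M I
    module P′ = Positions M′ I′

    to′ : ∀ {p} → OnSky M p → OnSky M′ p
    to′ {p} = subst T (M≗M′ (v ⟦ p ⟧))

    from′ : ∀ {p} → OnSky M′ p → OnSky M p
    from′ {p} = subst T (sym (M≗M′ (v ⟦ p ⟧)))

    position-≡ : ∀ j → P.position j ≡ P′.position j
    position-≡ = ℤ-induction 1ℤ
      (ℤ.≤-antisym
        (let i , e = P′.position-onto (to′ (P.position∈S 1ℤ)) in subst (ℤ._≤ P′.position 1ℤ) e
          (P′.mono-≤ (≤-suc⇒≤ (P′.reflect-<
            (subst (ℤ._< P′.position (+ 2)) (sym e) (ℤ.≤-<-trans P.m₁≤1 P′.1<m₂))))))
        (let i , e = P.position-onto (from′ (P′.position∈S 1ℤ)) in subst (ℤ._≤ P.position 1ℤ) e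
          (P.mono-≤ (≤-suc⇒≤ (P.reflect-<
            (subst (ℤ._< P.position (+ 2)) (sym e) (ℤ.≤-<-trans P′.m₁≤1 P.1<m₂)))))))
      (λ j h → ℤ.≤-antisym
        (let i , e = P.position-onto (from′ (P′.position∈S (j ℤ.+ 1ℤ))) in subst (P.position (j ℤ.+ 1ℤ) ℤ.≤_) e
          (P.mono-≤ (<⇒suc≤ (P.reflect-< (subst₂ ℤ._<_ (sym h) (sym e) (P′.position-step j))))))
        (let i , e = P′.position-onto (to′ (P.position∈S (j ℤ.+ 1ℤ))) in subst (P′.position (j ℤ.+ 1ℤ) ℤ.≤_) e
          (P′.mono-≤ (<⇒suc≤ (P′.reflect-< (subst₂ ℤ._<_ h (sym e) (P.position-step j)))))))
      (λ j h → ℤ.≤-antisym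
        (let i , e = P′.position-onto (to′ (P.position∈S j)) in subst (ℤ._≤ P′.position j) e
          (P′.mono-≤ (≤-suc⇒≤ (P′.reflect-< (subst₂ ℤ._<_ (sym e) h (P.position-step j))))))
        (let i , e = P.position-onto (from′ (P′.position∈S j)) in subst (ℤ._≤ P.position j) e
          (P.mono-≤ (≤-suc⇒≤ (P.reflect-< (subst₂ ℤ._<_ (sym e) (sym h) (P′.position-step j)))))))

    r-≡ : P.r ≡ P′.r
    r-≡ = ℤ.+-injective (lia 2 (λ r r′ → lit 1 :+ r :≡ lit 1 :+ r′ ∷ [] ⊢ r :≡ r′) (+ P.r) (+ P′.r)
      (P.injective (trans (P.position-shift 1ℤ) (trans (cong (ℤ._+ + n) (position-≡ 1ℤ))
        (trans (sym (P′.position-shift 1ℤ)) (sym (position-≡ (1ℤ ℤ.+ + P′.r))))))))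

    gap-≡′ : ∀ j → P.gap j ≡ P′.gap j
    gap-≡′ j = cong₂ (λ x y → ∣ x ℤ.- y ∣ ℕ.∸ 1) (position-≡ (j ℤ.+ 1ℤ)) (position-≡ j)

-- The permutation of a decreasing tree, from inorder to postorder labels

perm : Tree → ℕ → ℕ
perm leaf       x = x
perm (node l r) x with ℕ.<-cmp x (size l)
... | tri< _ _ _ = perm l x
... | tri≈ _ _ _ = size l ℕ.+ size r
... | tri> _ _ _ = size l ℕ.+ perm r (x ℕ.∸ suc (size l))

perm⁻¹ : Tree → ℕ → ℕ
perm⁻¹ leaf       y = y
perm⁻¹ (node l r) y with y ℕ.<? size l | y ℕ.<? size l ℕ.+ size r
... | yes _ | _     = perm⁻¹ l y
... | no _  | yes _ = size l ℕ.+ suc (perm⁻¹ r (y ℕ.∸ size l))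
... | no _  | no _  = size l

module _ (l r : Tree) where

  perm-left : ∀ {x} → x ℕ.< size l → perm (node l r) x ≡ perm l x
  perm-left {x} x< with ℕ.<-cmp x (size l)
  ... | tri< _ _ _  = refl
  ... | tri≈ ¬p _ _ = contradiction x< ¬p
  ... | tri> ¬p _ _ = contradiction x< ¬p

  perm-root : perm (node l r) (size l) ≡ size l ℕ.+ size r
  perm-root with ℕ.<-cmp (size l) (size l)
  ... | tri< _ ¬p _ = contradiction refl ¬p
  ... | tri≈ _ _ _  = refl
  ... | tri> _ ¬p _ = contradiction refl ¬p

  perm-right : ∀ k → perm (node l r) (size l ℕ.+ suc k) ≡ size l ℕ.+ perm r k
  perm-right k with ℕ.<-cmp (size l ℕ.+ suc k) (size l)
  ... | tri< _ _ ¬p = contradiction (ℕ.m<m+n (size l) (ℕ.s≤s ℕ.z≤n)) ¬p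
  ... | tri≈ _ _ ¬p = contradiction (ℕ.m<m+n (size l) (ℕ.s≤s ℕ.z≤n)) ¬p
  ... | tri> _ _ _  = cong (λ x → size l ℕ.+ perm r x)
    (trans (cong (ℕ._∸ suc (size l)) (ℕ.+-suc (size l) k)) (ℕ.m+n∸m≡n (suc (size l)) k))

  perm⁻¹-left : ∀ {y} → y ℕ.< size l → perm⁻¹ (node l r) y ≡ perm⁻¹ l y
  perm⁻¹-left {y} y< with y ℕ.<? size l | y ℕ.<? size l ℕ.+ size r
  ... | yes _ | _ = refl
  ... | no ¬p | _ = contradiction y< ¬p

  perm⁻¹-root : perm⁻¹ (node l r) (size l ℕ.+ size r) ≡ size l
  perm⁻¹-root with size l ℕ.+ size r ℕ.<? size l | size l ℕ.+ size r ℕ.<? size l ℕ.+ size r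
  ... | yes p | _     = contradiction p (ℕ.≤⇒≯ (ℕ.m≤m+n (size l) (size r)))
  ... | no _  | yes p = contradiction p (ℕ.<-irrefl refl)
  ... | no _  | no _  = refl

  perm⁻¹-right : ∀ {k} → k ℕ.< size r → perm⁻¹ (node l r) (size l ℕ.+ k) ≡ size l ℕ.+ suc (perm⁻¹ r k)
  perm⁻¹-right {k} k< with size l ℕ.+ k ℕ.<? size l | size l ℕ.+ k ℕ.<? size l ℕ.+ size r
  ... | yes p | _     = contradiction p (ℕ.≤⇒≯ (ℕ.m≤m+n (size l) k))
  ... | no _  | yes _ = cong (λ x → size l ℕ.+ suc (perm⁻¹ r x)) (ℕ.m+n∸m≡n (size l) k)
  ... | no _  | no ¬p = contradiction (ℕ.+-monoʳ-< (size l) k<) ¬p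

  data Inorder : ℕ → Set where
    left  : ∀ {x} → x ℕ.< size l → Inorder x
    root  : Inorder (size l)
    right : ∀ {k} → k ℕ.< size r → Inorder (size l ℕ.+ suc k)

  data Postorder : ℕ → Set where
    left  : ∀ {y} → y ℕ.< size l → Postorder y
    right : ∀ {k} → k ℕ.< size r → Postorder (size l ℕ.+ k)
    root  : Postorder (size l ℕ.+ size r)

  inorder : ∀ {x} → x ℕ.< size (node l r) → Inorder x
  inorder {x} x< with ℕ.<-cmp x (size l)
  ... | tri< p _ _    = left p
  ... | tri≈ _ refl _ = root
  ... | tri> _ _ p with k , refl ← ℕ.m≤n⇒∃[o]m+o≡n p = subst Inorder (ℕ.+-suc (size l) k)
    (right (ℕ.+-cancelˡ-< (size l) k (size r) (ℕ.s≤s⁻¹ x<)))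

  postorder : ∀ {y} → y ℕ.< size (node l r) → Postorder y
  postorder {y} y< with y ℕ.<? size l
  ... | yes p = left p
  ... | no ¬p with k , refl ← ℕ.m≤n⇒∃[o]m+o≡n (ℕ.≮⇒≥ ¬p) with ℕ.m≤n⇒m<n∨m≡n
    (ℕ.+-cancelˡ-≤ (size l) k (size r) (ℕ.s≤s⁻¹ y<))
  ...   | inj₁ q    = right q
  ...   | inj₂ refl = root

perm-< : ∀ t {x} → x ℕ.< size t → perm t x ℕ.< size t
perm-< (node l r) x< with inorder l r x<
... | left p      rewrite perm-left l r p = ℕ.≤-trans (perm-< l p) (ℕ.m≤n⇒m≤1+n (ℕ.m≤m+n (size l) (size r)))
... | root        rewrite perm-root l r = ℕ.n<1+n _
... | right {k} p rewrite perm-right l r k = ℕ.m≤n⇒m≤1+n (ℕ.+-monoʳ-< (size l) (perm-< r p))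

perm⁻¹-< : ∀ t {y} → y ℕ.< size t → perm⁻¹ t y ℕ.< size t
perm⁻¹-< (node l r) y< with postorder l r y<
... | left p  rewrite perm⁻¹-left l r p = ℕ.≤-trans (perm⁻¹-< l p) (ℕ.m≤n⇒m≤1+n (ℕ.m≤m+n (size l) (size r)))
... | right p rewrite perm⁻¹-right l r p = ℕ.s≤s (ℕ.+-monoʳ-≤ (size l) (perm⁻¹-< r p))
... | root    rewrite perm⁻¹-root l r = ℕ.s≤s (ℕ.m≤m+n (size l) (size r))

perm⁻¹-perm : ∀ t {x} → x ℕ.< size t → perm⁻¹ t (perm t x) ≡ x
perm⁻¹-perm (node l r) x< with inorder l r x<
... | left p      rewrite perm-left l r p = trans (perm⁻¹-left l r (perm-< l p)) (perm⁻¹-perm l p)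
... | root        rewrite perm-root l r = perm⁻¹-root l r
... | right {k} p rewrite perm-right l r k =
  trans (perm⁻¹-right l r (perm-< r p)) (cong (λ x → size l ℕ.+ suc x) (perm⁻¹-perm r p))

perm-perm⁻¹ : ∀ t {y} → y ℕ.< size t → perm t (perm⁻¹ t y) ≡ y
perm-perm⁻¹ (node l r) y< with postorder l r y<
... | left p  rewrite perm⁻¹-left l r p = trans (perm-left l r (perm⁻¹-< l p)) (perm-perm⁻¹ l p)
... | right {k} p rewrite perm⁻¹-right l r p =
  trans (perm-right l r (perm⁻¹ r k)) (cong (size l ℕ.+_) (perm-perm⁻¹ r p))
... | root    rewrite perm⁻¹-root l r = perm-root l r

perm-determines : ∀ t t′ → size t ≡ size t′ → (∀ {x} → x ℕ.< size t → perm t x ≡ perm t′ x) → t ≡ t′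
perm-determines leaf       leaf         _  _ = refl
perm-determines (node l r) (node l′ r′) eq h = same-sizes sizes
  where
  total : size l ℕ.+ size r ≡ size l′ ℕ.+ size r′
  total = ℕ.suc-injective eq
  l′< : size l′ ℕ.< size (node l r)
  l′< = subst (size l′ ℕ.<_) (sym eq) (ℕ.s≤s (ℕ.m≤m+n (size l′) (size r′)))
  sizes : size l ≡ size l′
  sizes = begin
    size l                                              ≡⟨ perm⁻¹-root l r ⟨
    perm⁻¹ (node l r) (size l ℕ.+ size r)               ≡⟨ cong (perm⁻¹ (node l r)) total ⟩
    perm⁻¹ (node l r) (size l′ ℕ.+ size r′)             ≡⟨ cong (perm⁻¹ (node l r)) (perm-root l′ r′) ⟨
    perm⁻¹ (node l r) (perm (node l′ r′) (size l′))     ≡⟨ cong (perm⁻¹ (node l r)) (h l′<) ⟨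
    perm⁻¹ (node l r) (perm (node l r) (size l′))       ≡⟨ perm⁻¹-perm (node l r) l′< ⟩
    size l′                                             ∎
    where open ≡-Reasoning
  same-sizes : size l ≡ size l′ → node l r ≡ node l′ r′
  same-sizes l≡ = cong₂ node
    (perm-determines l l′ l≡ λ {x} x< → trans (sym (perm-left l r x<))
      (trans (h (ℕ.<-≤-trans x< (ℕ.m≤n⇒m≤1+n (ℕ.m≤m+n (size l) (size r)))))
        (perm-left l′ r′ (subst (x ℕ.<_) l≡ x<))))
    (perm-determines r r′ r≡ λ {x} x< → ℕ.+-cancelˡ-≡ (size l) _ _ (trans (sym (perm-right l r x))
      (trans (h (ℕ.≤-trans (ℕ.≤-reflexive (cong suc (ℕ.+-suc (size l) x))) (ℕ.s≤s (ℕ.+-monoʳ-< (size l) x<))))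
        (trans (cong (λ s → perm (node l′ r′) (s ℕ.+ suc x)) l≡)
          (trans (perm-right l′ r′ x) (cong (ℕ._+ perm r′ x) (sym l≡)))))))
    where
    r≡ : size r ≡ size r′
    r≡ = ℕ.+-cancelˡ-≡ (size l) _ _ (trans total (cong (ℕ._+ size r′) (sym l≡)))

data Related (u : ℕ → ℕ) (h : ℕ → ℤ) (i j : ℕ) : Set where
  ascent  : u i ℕ.< u j → h (u i) ℤ.< h (u j) ⊎ (∃[ k ] i ℕ.< k × k ℕ.< j × u j ℕ.< u k) → Related u h i j
  descent : u j ℕ.< u i → h (u j) ℤ.< h (u i) → (∀ k → i ℕ.< k → k ℕ.< j → u k ℕ.< u i) → Related u h i j

module TreeWord (g : ℕ → ℤ) where
  open Word g

  tree-related : ∀ lo t → Decreasing lo t → ∀ {i j} → i ℕ.< j → j ℕ.< size t →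
                 Related (perm t) (λ y → g (lo ℕ.+ y)) i j
  tree-related lo (node l r) (dl , dr , dom) i<j j< =
    cases (inorder l r (ℕ.<-trans i<j j<)) (inorder l r j<) i<j
    where
    u = perm (node l r)
    h : ℕ → ℤ
    h y = g (lo ℕ.+ y)
    m = size l ℕ.+ size r
    root-≡ : u (size l) ≡ m
    root-≡ = perm-root l r
    left-< : ∀ {x} → x ℕ.< size l → u x ℕ.< size l
    left-< p = subst (ℕ._< size l) (sym (perm-left l r p)) (perm-< l p)
    right-< : ∀ {k} → k ℕ.< size r → u (size l ℕ.+ suc k) ℕ.< m
    right-< {k} p = subst (ℕ._< m) (sym (perm-right l r k)) (ℕ.+-monoʳ-< (size l) (perm-< r p))
    right-≥ : ∀ k → size l ℕ.≤ u (size l ℕ.+ suc k)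
    right-≥ k = subst (size l ℕ.≤_) (sym (perm-right l r k)) (ℕ.m≤m+n (size l) _)
    top : ∀ {y} → y ℕ.< m → h y ℤ.< h m
    top = dom
    inLeft : ∀ {i j} → i ℕ.< j → i ℕ.< size l → j ℕ.< size l → Related (perm l) h i j → Related u h i j
    inLeft {i} {j} i<j i< j< rel with perm-left l r i< | perm-left l r j<
    inLeft i<j i< j< (ascent a (inj₁ b)) | ei | ej =
      ascent (subst₂ ℕ._<_ (sym ei) (sym ej) a) (inj₁ (subst₂ (λ x y → h x ℤ.< h y) (sym ei) (sym ej) b))
    inLeft i<j i< j< (ascent a (inj₂ (k , i<k , k<j , b))) | ei | ej = ascent (subst₂ ℕ._<_ (sym ei) (sym ej) a)
      (inj₂ (k , i<k , k<j , subst₂ ℕ._<_ (sym ej) (sym (perm-left l r (ℕ.<-trans k<j j<))) b))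
    inLeft i<j i< j< (descent a b c) | ei | ej =
      descent (subst₂ ℕ._<_ (sym ej) (sym ei) a) (subst₂ (λ x y → h x ℤ.< h y) (sym ej) (sym ei) b)
      λ k i<k k<j → subst₂ ℕ._<_ (sym (perm-left l r (ℕ.<-trans k<j j<))) (sym ei) (c k i<k k<j)
    inRight : ∀ {i j} → Related (perm r) (λ y → g (lo ℕ.+ size l ℕ.+ y)) i j →
      Related u h (size l ℕ.+ suc i) (size l ℕ.+ suc j)
    inRight {i} {j} rel = transfer (perm-right l r i) (perm-right l r j) rel
      where
      values : ∀ {x y} → g (lo ℕ.+ size l ℕ.+ x) ℤ.< g (lo ℕ.+ size l ℕ.+ y) → h (size l ℕ.+ x)
        ℤ.< h (size l ℕ.+ y)
      values {x} {y} = subst₂ (λ a b → g a ℤ.< g b) (ℕ.+-assoc lo (size l) x) (ℕ.+-assoc lo (size l) y)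
      inner : ∀ {k} → size l ℕ.+ suc i ℕ.< k → ∃[ k′ ] k ≡ size l ℕ.+ suc k′
      inner {k} p = let o , eq = ℕ.m≤n⇒∃[o]m+o≡n p in suc i ℕ.+ o ,
        liaN 4 (λ s i o k → lit 1 :+ (s :+ (lit 1 :+ i)) :+ o :≡ k ∷ [] ⊢ k :≡ s
          :+ (lit 1 :+ (lit 1 :+ i :+ o))) (size l) i o k eq
      cancel : ∀ {a b} → size l ℕ.+ suc a ℕ.< size l ℕ.+ suc b → a ℕ.< b
      cancel p = ℕ.s≤s⁻¹ (ℕ.+-cancelˡ-< (size l) _ _ p)
      transfer : u (size l ℕ.+ suc i) ≡ size l ℕ.+ perm r i → u (size l ℕ.+ suc j) ≡ size l ℕ.+ perm r j →
        Related (perm r) (λ y → g (lo ℕ.+ size l ℕ.+ y)) i j → Related u h (size l ℕ.+ suc i) (size l ℕ.+ suc j)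
      transfer ei ej (ascent a (inj₁ b)) = ascent (subst₂ ℕ._<_ (sym ei) (sym ej) (ℕ.+-monoʳ-< (size l) a))
        (inj₁ (subst₂ (λ x y → h x ℤ.< h y) (sym ei) (sym ej) (values b)))
      transfer ei ej (ascent a (inj₂ (k , i<k , k<j , b))) =
        ascent (subst₂ ℕ._<_ (sym ei) (sym ej) (ℕ.+-monoʳ-< (size l) a))
        (inj₂ (size l ℕ.+ suc k , ℕ.+-monoʳ-< (size l) (ℕ.s≤s i<k) , ℕ.+-monoʳ-< (size l) (ℕ.s≤s k<j) ,
          subst₂ ℕ._<_ (sym ej) (sym (perm-right l r k)) (ℕ.+-monoʳ-< (size l) b)))
      transfer ei ej (descent a b c) = descent (subst₂ ℕ._<_ (sym ej) (sym ei) (ℕ.+-monoʳ-< (size l) a))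
        (subst₂ (λ x y → h x ℤ.< h y) (sym ej) (sym ei) (values b)) below
        where
        below : ∀ k → size l ℕ.+ suc i ℕ.< k → k ℕ.< size l ℕ.+ suc j → u k ℕ.< u (size l ℕ.+ suc i)
        below k p q with k′ , refl ← inner p =
          subst₂ ℕ._<_ (sym (perm-right l r k′)) (sym ei) (ℕ.+-monoʳ-< (size l) (c k′ (cancel p) (cancel q)))
    cases : ∀ {i j} → Inorder l r i → Inorder l r j → i ℕ.< j → Related u h i j
    cases (left p)  (left q)  i<j = inLeft i<j p q (tree-related lo l dl i<j q)
    cases {i} (left p) root   i<j = ascent (subst (u i ℕ.<_) (sym root-≡) u<m)
      (inj₁ (subst (λ x → h (u i) ℤ.< h x) (sym root-≡) (top u<m)))
      where
      u<m : u i ℕ.< m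
      u<m = ℕ.<-≤-trans (left-< p) (ℕ.m≤m+n (size l) (size r))
    cases (left p)  (right {k} q) i<j = ascent (ℕ.<-≤-trans (left-< p) (right-≥ k))
      (inj₂ (size l , p , ℕ.m<m+n (size l) (ℕ.s≤s ℕ.z≤n) , subst (u (size l ℕ.+ suc k) ℕ.<_)
        (sym root-≡) (right-< q)))
    cases root      (left q)  i<j = contradiction i<j (ℕ.<⇒≯ q)
    cases root      root      i<j = contradiction i<j (ℕ.<-irrefl refl)
    cases root      (right {k} q) i<j = descent (subst (u (size l ℕ.+ suc k) ℕ.<_) (sym root-≡) (right-< q))
      (subst (λ x → h (u (size l ℕ.+ suc k)) ℤ.< h x) (sym root-≡) (top (right-< q))) below
      where
      below : ∀ k′ → size l ℕ.< k′ → k′ ℕ.< size l ℕ.+ suc k → u k′ ℕ.< u (size l)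
      below k′ p p′ with o , refl ← ℕ.m≤n⇒∃[o]m+o≡n p = subst₂ ℕ._<_ (cong u (ℕ.+-suc (size l) o)) (sym root-≡)
        (right-< (ℕ.<-trans (ℕ.s≤s⁻¹
          (ℕ.+-cancelˡ-< (size l) _ _ (subst (ℕ._< size l ℕ.+ suc k) (sym (ℕ.+-suc (size l) o)) p′))) q))
    cases (right p) (left q)  i<j = contradiction i<j (ℕ.<⇒≯ (ℕ.<-trans q (ℕ.m<m+n (size l) (ℕ.s≤s ℕ.z≤n))))
    cases (right p) root      i<j = contradiction i<j (ℕ.<⇒≯ (ℕ.m<m+n (size l) (ℕ.s≤s ℕ.z≤n)))
    cases (right p) (right q) i<j =
      inRight (tree-related (lo ℕ.+ size l) r dr (ℕ.s≤s⁻¹ (ℕ.+-cancelˡ-< (size l) _ _ i<j)) q)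

  module Extract (U : ℕ → ℕ → Set)
    (functional : ∀ {k y y′} → U k y → U k y′ → y ≡ y′)
    (injective  : ∀ {k k′ y} → U k y → U k′ y → k ≡ k′)
    (avoids     : ∀ {k₁ k₂ k₃ y₁ y₂ y₃} → k₁ ℕ.< k₂ → k₂ ℕ.< k₃ → U k₁ y₁ → U k₂ y₂ → U k₃ y₃ →
                  y₃ ℕ.< y₁ → ¬ (y₁ ℕ.< y₂))
    (linear     : ∀ {k k′ y y′} → U k y → U k′ y′ → y ℕ.< y′ →
                  (∀ k″ → k ℕ.⊓ k′ ℕ.< k″ → k″ ℕ.< k ℕ.⊔ k′ → ∃[ y″ ] U k″ y″ × y″ ℕ.≤ y′) → g y ℤ.< g y′)
    where

    Onto : ℕ → ℕ → ℕ → ℕ → Set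
    Onto P lo len e = (∀ k → k ℕ.< len → ∃[ y ] y ℕ.< e × U (P ℕ.+ k) (lo ℕ.+ y)) ×
                      (∀ y → y ℕ.< e → ∃[ k ] k ℕ.< len × U (P ℕ.+ k) (lo ℕ.+ y))

    Extracted : ℕ → ℕ → ℕ → ℕ → Set
    Extracted P lo len e = e ≡ len × Σ[ t ∈ Tree ] size t ≡ len × Decreasing lo t ×
                           (∀ k → k ℕ.< len → U (P ℕ.+ k) (lo ℕ.+ perm t k))

    module Split {P lo len m d : ℕ} (onto : Onto P lo (suc len) (suc m)) (d≤len : d ℕ.≤ len)
        (Ud : U (P ℕ.+ d) (lo ℕ.+ m)) where
      pos = proj₁ onto
      val = proj₂ onto

      same-value : ∀ {k y y′} → U (P ℕ.+ k) (lo ℕ.+ y) → U (P ℕ.+ k) (lo ℕ.+ y′) → y ≡ y′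
      same-value a b = ℕ.+-cancelˡ-≡ lo _ _ (functional a b)

      same-position : ∀ {k k′ y} → U (P ℕ.+ k) (lo ℕ.+ y) → U (P ℕ.+ k′) (lo ℕ.+ y) → k ≡ k′
      same-position a b = ℕ.+-cancelˡ-≡ P _ _ (injective a b)

      OnRight : ℕ → Set
      OnRight y = m ℕ.≤ y ⊎ (∃[ k ] d ℕ.< k × k ℕ.< suc len × U (P ℕ.+ k) (lo ℕ.+ y))

      side : ∀ {y} → y ℕ.< m → (∃[ k ] k ℕ.< d × U (P ℕ.+ k) (lo ℕ.+ y))
        ⊎ (∃[ k ] d ℕ.< k × k ℕ.< suc len × U (P ℕ.+ k) (lo ℕ.+ y))
      side {y} y<m with val y (ℕ.m≤n⇒m≤1+n y<m)
      ... | k , k< , Uk with ℕ.<-cmp k d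
      ...   | tri< k<d _ _  = inj₁ (k , k<d , Uk)
      ...   | tri≈ _ refl _ = contradiction (same-value Uk Ud) (ℕ.<⇒≢ y<m)
      ...   | tri> _ _ d<k  = inj₂ (k , d<k , k< , Uk)

      onRight? : ∀ y → Dec (OnRight y)
      onRight? y with m ℕ.≤? y
      ... | yes m≤y = yes (inj₁ m≤y)
      ... | no m≰y with side (ℕ.≰⇒> m≰y)
      ...   | inj₂ r = yes (inj₂ r)
      ...   | inj₁ (k , k<d , Uk) = no λ where
        (inj₁ m≤y) → m≰y m≤y
        (inj₂ (k′ , d<k′ , _ , Uk′)) → ℕ.<-asym k<d (subst (d ℕ.<_) (same-position Uk′ Uk) d<k′)

      threshold : ∃[ e₁ ] OnRight e₁ × e₁ ℕ.≤ m × (∀ y → y ℕ.< e₁ → ¬ OnRight y)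
      threshold = leastWitness onRight? m (inj₁ ℕ.≤-refl)

      e₁ = proj₁ threshold

      low : ∀ {y} → y ℕ.< e₁ → ∃[ k ] k ℕ.< d × U (P ℕ.+ k) (lo ℕ.+ y)
      low {y} y<e₁ with side (ℕ.<-≤-trans y<e₁ (proj₁ (proj₂ (proj₂ threshold))))
      ... | inj₁ l = l
      ... | inj₂ r = contradiction (inj₂ r) (proj₂ (proj₂ (proj₂ threshold)) y y<e₁)

      -- A small value on the right of the root forces all larger ones to the right, since
      -- the root is higher and the pattern 231 is avoided.
      high : ∀ {y} → e₁ ℕ.≤ y → y ℕ.< m → ∃[ k ] d ℕ.< k × k ℕ.< suc len × U (P ℕ.+ k) (lo ℕ.+ y)
      high {y} e₁≤y y<m with side y<m
      ... | inj₂ r = r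
      ... | inj₁ (k , k<d , Uk) = ⊥-elim (clash (proj₁ (proj₂ threshold)))
        where
        clash : ¬ OnRight e₁
        clash (inj₁ m≤e₁) = ℕ.<⇒≱ y<m (ℕ.≤-trans m≤e₁ e₁≤y)
        clash (inj₂ (k′ , d<k′ , _ , Uk′)) = avoids (ℕ.+-monoʳ-< P k<d) (ℕ.+-monoʳ-< P d<k′) Uk Ud Uk′
          (ℕ.+-monoʳ-< lo (ℕ.≤∧≢⇒< e₁≤y λ { refl → ℕ.<-asym k<d (subst (d ℕ.<_) (same-position Uk′ Uk) d<k′) }))
          (ℕ.+-monoʳ-< lo y<m)

      dominates : Dominates lo m
      dominates {y} y<m =
        let k , k< , Uk = val y (ℕ.m≤n⇒m≤1+n y<m) in
        linear Uk Ud (ℕ.+-monoʳ-< lo y<m) λ k″ p q →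
          let P≤k″ = ℕ.≤-trans (ℕ.⊓-glb (ℕ.m≤m+n P k) (ℕ.m≤m+n P d)) (ℕ.<⇒≤ p)
              o , eq = ℕ.m≤n⇒∃[o]m+o≡n P≤k″
              o<len = ℕ.+-cancelˡ-< P o (suc len) (subst (ℕ._< P ℕ.+ suc len) (sym eq)
                        (ℕ.<-≤-trans q (ℕ.⊔-lub (ℕ.+-monoʳ-≤ P (ℕ.<⇒≤ k<))
                          (ℕ.+-monoʳ-≤ P (ℕ.m≤n⇒m≤1+n d≤len)))))
              y″ , y″< , Uo = pos o o<len
          in lo ℕ.+ y″ , subst (λ k → U k (lo ℕ.+ y″)) eq Uo , ℕ.+-monoʳ-≤ lo (ℕ.s≤s⁻¹ y″<)

      module Halves {d₂ e₂ : ℕ} (len≡ : d ℕ.+ d₂ ≡ len) (m≡ : e₁ ℕ.+ e₂ ≡ m) where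

        right-position : ∀ {k} → d ℕ.< k → k ℕ.< suc len → ∃[ k₂ ] k₂ ℕ.< d₂ × k ≡ suc d ℕ.+ k₂
        right-position {k} d<k k< = let o , eq = ℕ.m≤n⇒∃[o]m+o≡n d<k in
          o , liaN 5 (λ d d₂ len o k → d :+ d₂ :≡ len ∷ lit 1 :+ d :+ o :≡ k ∷ k :< lit 1 :+ len ∷ [] ⊢ o :< d₂)
                d d₂ len o k len≡ eq k< , sym eq

        reassociate : ∀ k → P ℕ.+ (suc d ℕ.+ k) ≡ P ℕ.+ suc d ℕ.+ k
        reassociate k = sym (ℕ.+-assoc P (suc d) k)

        onto-left : Onto P lo d e₁
        onto-left = position , λ y y< → low y<
          where
          position : ∀ k → k ℕ.< d → ∃[ y ] y ℕ.< e₁ × U (P ℕ.+ k) (lo ℕ.+ y)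
          position k k<d with pos k (ℕ.<-≤-trans k<d (ℕ.m≤n⇒m≤1+n d≤len))
          ... | y , y< , Uk with y ℕ.<? e₁
          ...   | yes y<e₁ = y , y<e₁ , Uk
          ...   | no y≮e₁ with ℕ.m≤n⇒m<n∨m≡n (ℕ.s≤s⁻¹ y<)
          ...     | inj₂ refl = contradiction (same-position Uk Ud) (ℕ.<⇒≢ k<d)
          ...     | inj₁ y<m with k′ , d<k′ , _ , Uk′ ← high (ℕ.≮⇒≥ y≮e₁) y<m =
            ⊥-elim (ℕ.<-asym k<d (subst (d ℕ.<_) (same-position Uk′ Uk) d<k′))

        onto-right : Onto (P ℕ.+ suc d) (lo ℕ.+ e₁) d₂ e₂
        onto-right = position , value
          where
          position : ∀ k → k ℕ.< d₂ → ∃[ y ] y ℕ.< e₂ × U (P ℕ.+ suc d ℕ.+ k) (lo ℕ.+ e₁ ℕ.+ y)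
          position k k<d₂ with pos (suc d ℕ.+ k)
            (liaN 4 (λ d d₂ len k → d :+ d₂ :≡ len ∷ k :< d₂ ∷ [] ⊢ lit 1 :+ d :+ k :< lit 1 :+ len)
                                  d d₂ len k len≡ k<d₂)
          ... | y , y< , Uk with y ℕ.<? e₁
          ...   | yes y<e₁ with k′ , k′<d , Uk′ ← low y<e₁ =
            contradiction (same-position Uk Uk′) λ eq →
              ℕ.<⇒≱ k′<d (subst (d ℕ.≤_) eq (ℕ.<⇒≤ (ℕ.s≤s (ℕ.m≤m+n d k))))
          ...   | no y≮e₁ with ℕ.m≤n⇒m<n∨m≡n (ℕ.s≤s⁻¹ y<)
          ...     | inj₂ refl = contradiction (same-position Ud Uk) (ℕ.<⇒≢ (ℕ.s≤s (ℕ.m≤m+n d k)))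
          ...     | inj₁ y<m with o , refl ← ℕ.m≤n⇒∃[o]m+o≡n (ℕ.≮⇒≥ y≮e₁) =
            o , ℕ.+-cancelˡ-< e₁ o e₂ (subst (e₁ ℕ.+ o ℕ.<_) (sym m≡) y<m) ,
            subst₂ U (reassociate k) (sym (ℕ.+-assoc lo e₁ o)) Uk
          value : ∀ y → y ℕ.< e₂ → ∃[ k ] k ℕ.< d₂ × U (P ℕ.+ suc d ℕ.+ k) (lo ℕ.+ e₁ ℕ.+ y)
          value y y<e₂ with k , d<k , k< ,
            Uk ← high (ℕ.m≤m+n e₁ y) (subst (e₁ ℕ.+ y ℕ.<_) m≡ (ℕ.+-monoʳ-< e₁ y<e₂))
            with k₂ , k₂< , refl ← right-position d<k k< =
            k₂ , k₂< , subst₂ U (reassociate k₂) (sym (ℕ.+-assoc lo e₁ y)) Uk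

        assemble : Extracted P lo d e₁ → Extracted (P ℕ.+ suc d) (lo ℕ.+ e₁) d₂ e₂ →
          Extracted P lo (suc len) (suc m)
        assemble (e₁≡d , l , size-l , dec-l , U-l) (e₂≡d₂ , r , size-r , dec-r , U-r) =
          cong suc m≡len , node l r , cong suc (trans (cong₂ ℕ._+_ size-l size-r) len≡) ,
          (dec-l , subst (λ x → Decreasing (lo ℕ.+ x) r) (sym size≡e₁) dec-r ,
           subst (Dominates lo) (trans m≡len (sym (trans (cong₂ ℕ._+_ size-l size-r) len≡)))
             (λ {k} → dominates {k})) , carries
          where
          size≡e₁ : size l ≡ e₁
          size≡e₁ = trans size-l (sym e₁≡d)
          m≡len : m ≡ len
          m≡len = trans (sym m≡) (trans (cong₂ ℕ._+_ e₁≡d e₂≡d₂) len≡)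
          carries : ∀ k → k ℕ.< suc len → U (P ℕ.+ k) (lo ℕ.+ perm (node l r) k)
          carries k k< with ℕ.<-cmp k d
          ... | tri< k<d _ _  = subst (λ y → U (P ℕ.+ k) (lo ℕ.+ y))
            (sym (perm-left l r (subst (k ℕ.<_) (sym size-l) k<d))) (U-l k k<d)
          ... | tri≈ _ refl _ = subst (λ y → U (P ℕ.+ k) (lo ℕ.+ y))
                  (sym (trans (cong (perm (node l r)) (sym size-l)) (trans (perm-root l r)
                    (trans (cong₂ ℕ._+_ size-l size-r) (trans len≡ (sym m≡len)))))) Ud
          ... | tri> _ _ d<k with k₂ , k₂< , refl ← right-position d<k k< = subst₂ U (sym (reassociate k₂))
                  (trans (ℕ.+-assoc lo e₁ (perm r k₂)) (cong (lo ℕ.+_) (sym (trans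
                    (cong (perm (node l r)) (trans (sym (ℕ.+-suc d k₂)) (cong (ℕ._+ suc k₂) (sym size-l))))
                    (trans (perm-right l r k₂) (cong (ℕ._+ perm r k₂) size≡e₁))))))
                  (U-r k₂ k₂<)

    extract : ∀ N P lo len e → len ℕ.≤ N → Onto P lo len e → Extracted P lo len e
    extract N       P lo zero    zero    _ _         = refl , leaf , refl , tt , λ _ ()
    extract N       P lo zero    (suc e) _ (_ , val) with _ , () , _ ← val 0 (ℕ.s≤s ℕ.z≤n)
    extract (suc N) P lo (suc len) zero  _ (pos , _) with _ , () , _ ← pos 0 (ℕ.s≤s ℕ.z≤n)
    extract (suc N) P lo (suc len) (suc m) (ℕ.s≤s len≤N) onto =
      let d , d<len , Ud = proj₂ onto m (ℕ.n<1+n m)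
          d≤len = ℕ.s≤s⁻¹ d<len
          module S = Split onto d≤len Ud
          d₂ , len≡ = ℕ.m≤n⇒∃[o]m+o≡n d≤len
          e₂ , m≡   = ℕ.m≤n⇒∃[o]m+o≡n (proj₁ (proj₂ (proj₂ S.threshold)))
          module H = S.Halves len≡ m≡
      in H.assemble (extract N P lo d S.e₁ (ℕ.≤-trans d≤len len≤N) H.onto-left)
           (extract N (P ℕ.+ suc d) (lo ℕ.+ S.e₁) d₂ e₂
             (ℕ.≤-trans (subst (d₂ ℕ.≤_) len≡ (ℕ.m≤n+m d₂ d)) len≤N) H.onto-right)

-- The fibre over v in terms of skylines and decreasing trees

argmax : ∀ (h : ℕ → ℤ) m → ∃[ k ] k ℕ.≤ m × (∀ j → j ℕ.≤ m → h j ℤ.≤ h k)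
argmax h zero    = 0 , ℕ.z≤n , λ { zero _ → ℤ.≤-refl }
argmax h (suc m) with argmax h m
... | k , k≤m , max with ℤ.≤-total (h k) (h (suc m))
...   | inj₁ le = suc m , ℕ.≤-refl , λ j j≤ → case ℕ.m≤n⇒m<n∨m≡n j≤ of λ where
          (inj₁ j<)   → ℤ.≤-trans (max j (ℕ.s≤s⁻¹ j<)) le
          (inj₂ refl) → ℤ.≤-refl
...   | inj₂ ge = k , ℕ.m≤n⇒m≤1+n k≤m , λ j j≤ → case ℕ.m≤n⇒m<n∨m≡n j≤ of λ where
          (inj₁ j<)   → max j (ℕ.s≤s⁻¹ j<)
          (inj₂ refl) → ge

module Fibers (n : ℕ) .{{_ : ℕ.NonZero n}} where
  open Periodic n
  open PeriodicBijection
  open Avoidance n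

  module LinearExtension {u x : AffinePermutation n}
      (linear : ∀ p q → ¬ Separated u p q → u ⟦ p ⟧ ℤ.< u ⟦ q ⟧ → x ⟦ p ⟧ ℤ.< x ⟦ q ⟧) where

    unseparated : ∀ {p q k} → p ℤ.< q → (∀ k′ → p ℤ.< k′ → k′ ℤ.< q → u ⟦ k′ ⟧ ℤ.≤ u ⟦ k ⟧) →
      k ≡ p ⊎ k ≡ q → ¬ Separated u p q
    unseparated p<q max (inj₁ refl) s = let k′ , a , b , c , _ = separated⁻ u p<q s in ℤ.<⇒≱ c (max k′ a b)
    unseparated p<q max (inj₂ refl) s = let k′ , a , b , _ , c = separated⁻ u p<q s in ℤ.<⇒≱ c (max k′ a b)

    separated-there : ∀ {p q} → p ℤ.< q → Separated u p q → Separated x p q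
    separated-there {p} {q} p<q s
      with k₀ , p<k₀ , k₀<q , up , uq ← separated⁻ u p<q s
      with d , refl ← gap-suc p<k₀
      with e , refl ← gap-suc k₀<q = separated⁺ x p<k k<q
        (linear p k (unseparated p<k (λ k′ a b → max′ k′ a (ℤ.<-trans b k<q)) (inj₂ refl)) (ℤ.<-≤-trans up top))
        (linear q k (λ s′ → unseparated k<q (λ k′ a b → max′ k′ (ℤ.<-trans p<k a) b) (inj₁ refl)
          (separated-sym u s′)) (ℤ.<-≤-trans uq top))
      where
      best = argmax (λ i → u ⟦ p ℤ.+ + suc i ⟧) (d ℕ.+ e)
      k = p ℤ.+ + suc (proj₁ best)
      p<k : p ℤ.< k
      p<k = lia 2 (λ p b → lit 0 :≤ b ∷ [] ⊢ p :< p :+ (lit 1 :+ b)) p (+ proj₁ best) (ℤ.+≤+ ℕ.z≤n)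
      k<q : k ℤ.< p ℤ.+ + suc d ℤ.+ + suc e
      k<q = lia 4 (λ p b d e → b :≤ d :+ e ∷ [] ⊢ p :+ (lit 1 :+ b) :< p :+ (lit 1 :+ d) :+ (lit 1 :+ e))
        p (+ proj₁ best) (+ d) (+ e) (ℤ.+≤+ (proj₁ (proj₂ best)))
      max′ : ∀ k′ → p ℤ.< k′ → k′ ℤ.< p ℤ.+ + suc d ℤ.+ + suc e → u ⟦ k′ ⟧ ℤ.≤ u ⟦ k ⟧
      max′ k′ a b with i , refl ← gap-suc a = proj₂ (proj₂ best) i (ℤ.drop‿+≤+
        (lia 4 (λ p i d e → p :+ (lit 1 :+ i) :< p :+ (lit 1 :+ d) :+ (lit 1 :+ e) ∷ [] ⊢ i :≤ d :+ e) p
          (+ i) (+ d) (+ e) b))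
      top : u ⟦ p ℤ.+ + suc d ⟧ ℤ.≤ u ⟦ k ⟧
      top = proj₂ (proj₂ best) d (ℕ.m≤m+n d e)

    separated? : ∀ {p q} → p ℤ.< q → Dec (Separated u p q)
    separated? {p} {q} p<q with d , refl ← gap-suc p<q
      with ℕ.anyUpTo? (λ i → u ⟦ p ⟧ ℤ.<? u ⟦ p ℤ.+ + suc i ⟧ ×-dec u ⟦ q ⟧ ℤ.<? u ⟦ p ℤ.+ + suc i ⟧) d
    ... | yes (i , i<d , a , b) = yes (separated⁺ u
            (lia 2 (λ p i → lit 0 :≤ i ∷ [] ⊢ p :< p :+ (lit 1 :+ i)) p (+ i) (ℤ.+≤+ ℕ.z≤n))
            (lia 3 (λ p i d → i :< d ∷ [] ⊢ p :+ (lit 1 :+ i) :< p :+ (lit 1 :+ d)) p (+ i) (+ d)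
              (ℤ.+<+ i<d)) a b)
    ... | no ¬any = no λ s → let k , a , b , c , e = separated⁻ u p<q s
                                 i , k≡ = gap-suc a in
            ¬any (i , ℤ.drop‿+<+ (lia 4 (λ p k i d → k :≡ p :+ (lit 1 :+ i) ∷ k :< p :+ (lit 1 :+ d)
              ∷ [] ⊢ i :< d) p k (+ i) (+ d) k≡ b) ,
              subst (λ k → u ⟦ p ⟧ ℤ.< u ⟦ k ⟧) k≡ c , subst (λ k → u ⟦ q ⟧ ℤ.< u ⟦ k ⟧) k≡ e)

    separated-back : ∀ {p q} → p ℤ.< q → Separated x p q → Separated u p q
    separated-back {p} {q} p<q s with separated? p<q
    ... | yes r = r
    ... | no ¬r with k , p<k , k<q , xp , xq ← separated⁻ x p<q s
      with ℤ.<-cmp (u ⟦ p ⟧) (u ⟦ q ⟧)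
    ...   | tri≈ _ eq _ = contradiction p<q (ℤ.<-irrefl (affine-injective u eq))
    ...   | tri< up<uq _ _ = contradiction (linear k q
              (λ s′ → let k′ , a , b , _ , c = separated⁻ u k<q s′ in ¬r (separated⁺ u (ℤ.<-trans p<k a) b (ℤ.<-trans up<uq c) c))
              (ℤ.≤∧≢⇒< (ℤ.≮⇒≥ λ c → ¬r (separated⁺ u p<k k<q (ℤ.<-trans up<uq c) c))
                (λ eq → ℤ.<-irrefl (affine-injective u eq) k<q))) (ℤ.<-asym xq)
    ...   | tri> _ _ uq<up = contradiction (linear k p
              (λ s′ → let k′ , a , b , c , _ = separated⁻ u p<k (separated-sym u s′) in ¬r (separated⁺ u a (ℤ.<-trans b k<q) c (ℤ.<-trans uq<up c)))
              (ℤ.≤∧≢⇒< (ℤ.≮⇒≥ λ c → ¬r (separated⁺ u p<k k<q c (ℤ.<-trans uq<up c)))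
                (λ eq → ℤ.<-irrefl (sym (affine-injective u eq)) p<k))) (ℤ.<-asym xp)

    self-separated : ∀ (w : AffinePermutation n) {p} → ¬ Separated w p p
    self-separated w {p} (k , a , b , _) =
      ℤ.<-asym (subst (ℤ._< k) (ℤ.⊓-idem p) a) (subst (k ℤ.<_) (ℤ.⊔-idem p) b)

    separated⇔ : ∀ p q → Separated u p q ⇔ Separated x p q
    separated⇔ p q with ℤ.<-cmp p q
    ... | tri< p<q _ _  = mk⇔ (separated-there p<q) (separated-back p<q)
    ... | tri≈ _ refl _ = mk⇔ (⊥-elim ∘ self-separated u) (⊥-elim ∘ self-separated x)
    ... | tri> _ _ q<p  = mk⇔ (separated-sym x ∘ separated-there q<p ∘ separated-sym u)
                              (separated-sym u ∘ separated-back q<p ∘ separated-sym x)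

    ≡syl : u ≡syl x
    ≡syl p q = mk⇔
      (λ (le , ¬s) → (case u ⟦ p ⟧ ℤ.≟ u ⟦ q ⟧ of λ where
          (yes eq) → ℤ.≤-reflexive (cong (x ⟦_⟧) (affine-injective u eq))
          (no ≢)   → ℤ.<⇒≤ (linear p q ¬s (ℤ.≤∧≢⇒< le ≢))) ,
        ¬s ∘ Equivalence.from (separated⇔ p q))
      (λ (le , ¬s) → (ℤ.≮⇒≥ λ gt →
        ℤ.<⇒≱ (linear q p (¬s ∘ Equivalence.to (separated⇔ p q) ∘ separated-sym u) gt) le) ,
        ¬s ∘ Equivalence.to (separated⇔ p q))

  ≡syl⇒linear : ∀ {u x : AffinePermutation n} → u ≡syl x →
    ∀ p q → ¬ Separated u p q → u ⟦ p ⟧ ℤ.< u ⟦ q ⟧ → x ⟦ p ⟧ ℤ.< x ⟦ q ⟧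
  ≡syl⇒linear {u} {x} syl p q ¬s lt = ℤ.≤∧≢⇒< (proj₁ (Equivalence.to (syl p q) (ℤ.<⇒≤ lt , ¬s)))
    λ eq → ℤ.<-irrefl (cong (u ⟦_⟧) (affine-injective x eq)) lt

  module Maxima (w : AffinePermutation n) where
    W = fromAffine w

    Record : ℤ → Set
    Record p = ∀ i → i ℤ.< p → w ⟦ i ⟧ ℤ.< w ⟦ p ⟧

    -- By periodicity the n positions to the left of p suffice.
    record? : ∀ p → Dec (Record p)
    record? p = map′ enough (λ rec {k} _ →
      rec (p ℤ.- + suc k) (lia 2 (λ p k → lit 0 :≤ k ∷ [] ⊢ p :- (lit 1 :+ k) :< p) p (+ k) (ℤ.+≤+ ℕ.z≤n)))
      (ℕ.allUpTo? (λ k → w ⟦ p ℤ.- + suc k ⟧ ℤ.<? w ⟦ p ⟧) n)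
      where
      enough : (∀ {k} → k ℕ.< n → w ⟦ p ℤ.- + suc k ⟧ ℤ.< w ⟦ p ⟧) → Record p
      enough h i i<p = let k , eq = gap-suc i<p in reduce k eq
        where
        reduce : ∀ k → p ≡ i ℤ.+ + suc k → w ⟦ i ⟧ ℤ.< w ⟦ p ⟧
        reduce k eq = ℤ.≤-<-trans (subst (w ⟦ i ⟧ ℤ.≤_) (trans (sym (to-shift W (+ q) i)) (cong (w ⟦_⟧) i+qn))
            (lia 2 (λ x y → lit 0 :≤ y ∷ [] ⊢ x :≤ x :+ y) (w ⟦ i ⟧) (+ q ℤ.* + n)
              (subst (0ℤ ℤ.≤_) (ℤ.pos-* q n) (ℤ.+≤+ ℕ.z≤n))))
          (h (ℕ.m%n<n k n))
          where
          q = k ℕ./ n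
          i+qn : i ℤ.+ + q ℤ.* + n ≡ p ℤ.- + suc (k ℕ.% n)
          i+qn = lia 5 (λ i y p r k → p :≡ i :+ (lit 1 :+ k) ∷ k :≡ r :+ y ∷ [] ⊢ i :+ y :≡ p :- (lit 1 :+ r))
            i (+ q ℤ.* + n) p (+ (k ℕ.% n)) (+ k) eq
            (trans (cong +_ (ℕ.m≡m%n+[m/n]*n k n)) (cong (ℤ._+_ (+ (k ℕ.% n))) (ℤ.pos-* q n)))

    record-shift : ∀ p → Record p ⇔ Record (p ℤ.+ + n)
    record-shift p = mk⇔
      (λ rec i i< → subst₂ ℤ._<_ (trans (sym (equivariant W (i ℤ.- + n))) (cong (w ⟦_⟧) (rejoin i)))
        (sym (equivariant W p))
        (ℤ.+-monoˡ-< (+ n) (rec (i ℤ.- + n) (lia 3 (λ i p n → i :< p :+ n ∷ [] ⊢ i :- n :< p) i p (+ n) i<))))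
      (λ rec i i< → lia 3 (λ x y n → x :+ n :< y :+ n ∷ [] ⊢ x :< y) (w ⟦ i ⟧) (w ⟦ p ⟧) (+ n)
        (subst₂ ℤ._<_ (equivariant W i) (equivariant W p) (rec (i ℤ.+ + n) (ℤ.+-monoˡ-< (+ n) i<))))
      where
      rejoin : ∀ i → i ℤ.- + n ℤ.+ + n ≡ i
      rejoin i = lia 2 (λ i n → [] ⊢ i :- n :+ n :≡ i) i (+ n)

    exceeding : ∀ p → ∃[ k ] w ⟦ p ⟧ ℤ.< w ⟦ p ℤ.+ + suc k ⟧ × (∀ j → j ℕ.< k → w ⟦ p ℤ.+ + suc j ⟧ ℤ.< w ⟦ p ⟧)
    exceeding p =
      let k , lt , _ , least = leastWitness (λ k → w ⟦ p ⟧ ℤ.<? w ⟦ p ℤ.+ + suc k ⟧) (ℕ.pred n)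
            (subst (λ m → w ⟦ p ⟧ ℤ.< w ⟦ p ℤ.+ + m ⟧) (sym (ℕ.suc-pred n))
              (subst (w ⟦ p ⟧ ℤ.<_) (sym (equivariant W p))
                (lia 2 (λ x n → lit 0 :< n ∷ [] ⊢ x :< x :+ n) (w ⟦ p ⟧) (+ n) 0<n)))
      in k , lt , λ j j<k → ℤ.≤∧≢⇒< (ℤ.≮⇒≥ (least j j<k)) λ eq →
           lia 2 (λ p j → p :+ (lit 1 :+ j) :≡ p ∷ lit 0 :≤ j ∷ [] ⊢ :⊥) p (+ j) (affine-injective w eq)
             (ℤ.+≤+ ℕ.z≤n)

    record-exists : ∃[ p ] Record p
    record-exists =
      let k , _ , max = argmax (λ i → w ⟦ + i ⟧) (ℕ.pred n) in
      + k , λ i i<k → ℤ.≤∧≢⇒< (ℤ.≤-trans (bound i i<k) (max (toℕ (residue i))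
                (ℕ.s≤s⁻¹ (subst (toℕ (residue i) ℕ.<_) (sym (ℕ.suc-pred n)) (Fin.toℕ<n (residue i))))))
              λ eq → ℤ.<-irrefl (affine-injective w eq) i<k
      where
      quotient≤0 : ∀ k i → k ℕ.< n → i ℤ.< + k → ∀ q → i ≡ + toℕ (residue i) ℤ.+ q ℤ.* + n → q ℤ.* + n ℤ.≤ 0ℤ
      quotient≤0 k i k<n i<k -[1+ q ] eq = ℤ.<⇒≤ (subst (ℤ._< 0ℤ) (ℤ.neg-distribˡ-* (+ suc q) (+ n))
        (ℤ.neg-mono-< (subst (0ℤ ℤ.<_) (ℤ.pos-* (suc q) n)
          (ℤ.+<+ (ℕ.*-mono-≤ (ℕ.s≤s (ℕ.z≤n {q})) (ℕ.>-nonZero⁻¹ n))))))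
      quotient≤0 k i k<n i<k (+ zero)  eq = ℤ.≤-reflexive (ℤ.*-zeroˡ (+ n))
      quotient≤0 k i k<n i<k (+ suc q) eq =
        ⊥-elim (lia 5 (λ i r x n k → i :≡ r :+ (n :+ x) ∷ lit 0 :≤ r ∷ lit 0 :≤ x ∷ i :< k ∷ k :< n ∷ [] ⊢ :⊥)
        i (+ toℕ (residue i)) (+ q ℤ.* + n) (+ n) (+ k)
          (trans eq (cong (ℤ._+_ (+ toℕ (residue i))) (ℤ.suc-* (+ q) (+ n))))
        (ℤ.+≤+ ℕ.z≤n) (subst (0ℤ ℤ.≤_) (ℤ.pos-* q n) (ℤ.+≤+ ℕ.z≤n)) i<k (ℤ.+<+ k<n))
      best = argmax (λ i → w ⟦ + i ⟧) (ℕ.pred n)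
      best<n : proj₁ best ℕ.< n
      best<n = subst (proj₁ best ℕ.<_) (ℕ.suc-pred n) (ℕ.s≤s (proj₁ (proj₂ best)))
      bound : ∀ i → i ℤ.< + proj₁ best → w ⟦ i ⟧ ℤ.≤ w ⟦ + toℕ (residue i) ⟧
      bound i i<k = subst (ℤ._≤ w ⟦ + toℕ (residue i) ⟧)
        (sym (trans (cong (w ⟦_⟧) (residue-quotient i)) (to-shift W (quotient i) (+ toℕ (residue i)))))
        (lia 2 (λ x y → y :≤ lit 0 ∷ [] ⊢ x :+ y :≤ x) (w ⟦ + toℕ (residue i) ⟧) (quotient i ℤ.* + n)
          (quotient≤0 (proj₁ best) i best<n i<k (quotient i) (residue-quotient i)))

  module Cut {u : AffinePermutation n} (avoids : Avoids231 u) where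
    open Maxima u
    U = fromAffine u

    cut : ∀ {a} → Record (u ⁻¹⟦ a ⟧) → (∀ x → x ℤ.≤ a → u ⟦ x ⟧ ℤ.≤ a) × (∀ x → a ℤ.< x → a ℤ.< u ⟦ x ⟧)
    cut {a} rec = subst (λ b → (∀ x → x ℤ.≤ b → u ⟦ x ⟧ ℤ.≤ a) × (∀ x → b ℤ.< x → a ℤ.< u ⟦ x ⟧))
        (cut-aligned U b a (drift-affine u) low high) (low , high)
      where
      t = u ⁻¹⟦ a ⟧
      ut : u ⟦ t ⟧ ≡ a
      ut = to-from U a
      k = proj₁ (exceeding t)
      b = t ℤ.+ + k
      t′ = t ℤ.+ + suc k
      ut′ : a ℤ.< u ⟦ t′ ⟧
      ut′ = subst (ℤ._< u ⟦ t′ ⟧) ut (proj₁ (proj₂ (exceeding t)))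
      low : ∀ x → x ℤ.≤ b → u ⟦ x ⟧ ℤ.≤ a
      low x x≤b with ℤ.<-cmp x t
      ... | tri< x<t _ _  = ℤ.<⇒≤ (subst (u ⟦ x ⟧ ℤ.<_) ut (rec x x<t))
      ... | tri≈ _ refl _ = ℤ.≤-reflexive ut
      ... | tri> _ _ t<x  = let j , eq = gap-suc t<x in
        subst₂ ℤ._≤_ (cong (u ⟦_⟧) (sym eq)) ut (ℤ.<⇒≤ (proj₂ (proj₂ (exceeding t)) j
          (ℤ.drop‿+<+ (lia 4 (λ x t j k → x :≡ t :+ (lit 1 :+ j) ∷ x :≤ t :+ k ∷ [] ⊢ j :< k) x t (+ j)
            (+ k) eq x≤b))))
      high : ∀ x → b ℤ.< x → a ℤ.< u ⟦ x ⟧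
      high x b<x with ℤ.<-cmp t′ x
      ... | tri≈ _ refl _ = ut′
      ... | tri> _ _ x<t′ = ⊥-elim
        (lia 3 (λ t k x → t :+ k :< x ∷ x :< t :+ (lit 1 :+ k) ∷ [] ⊢ :⊥) t (+ k) x b<x x<t′)
      ... | tri< t′<x _ _ = ℤ.≤∧≢⇒<
        (ℤ.≮⇒≥ λ lt → avoids t<t′ t′<x (subst (u ⟦ x ⟧ ℤ.<_) (sym ut) lt) (subst (ℤ._< u ⟦ t′ ⟧) (sym ut) ut′))
        (λ eq → ℤ.<-asym t<t′ (subst (t′ ℤ.<_) (affine-injective u (trans (sym eq) (sym ut))) t′<x))
        where
        t<t′ : t ℤ.< t′
        t<t′ = lia 2 (λ t k → lit 0 :≤ k ∷ [] ⊢ t :< t :+ (lit 1 :+ k)) t (+ k) (ℤ.+≤+ ℕ.z≤n)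

T-does⁻ : ∀ {P : Set} (d : Dec P) → T (does d) → P
T-does⁻ (yes p) _ = p

T-does⁺ : ∀ {P : Set} (d : Dec P) → P → T (does d)
T-does⁺ (yes _) _ = tt
T-does⁺ (no ¬p) p = ¬p p

module Extraction (n : ℕ) .{{_ : ℕ.NonZero n}} (v u w : AffinePermutation n) where
  open Periodic n
  open PeriodicBijection
  open Avoidance n
  open Fibers n
  open Skylines n v
  open Maxima u

  private
    U = fromAffine u

  module _ (avoids : Avoids231 u) (syl : u ≡syl w) (factor : ∀ p → v ⟦ u ⟦ p ⟧ ⟧ ≡ w ⟦ p ⟧) where

    linear : ∀ p q → ¬ Separated u p q → u ⟦ p ⟧ ℤ.< u ⟦ q ⟧ → v ⟦ u ⟦ p ⟧ ⟧ ℤ.< v ⟦ u ⟦ q ⟧ ⟧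
    linear p q ¬s lt = subst₂ ℤ._<_ (sym (factor p)) (sym (factor q)) (≡syl⇒linear {u} {w} syl p q ¬s lt)

    record-maximum : ∀ {t i} → Record t → i ℤ.< u ⟦ t ⟧ → v ⟦ i ⟧ ℤ.< v ⟦ u ⟦ t ⟧ ⟧
    record-maximum {t} {i} rec i<a = subst (λ i → v ⟦ i ⟧ ℤ.< v ⟦ u ⟦ t ⟧ ⟧) ut′
      (linear t′ t unseparated (subst (ℤ._< u ⟦ t ⟧) (sym ut′) i<a))
      where
      t′ = u ⁻¹⟦ i ⟧
      ut′ : u ⟦ t′ ⟧ ≡ i
      ut′ = to-from U i
      unseparated : ¬ Separated u t′ t
      unseparated s with ℤ.<-cmp t′ t
      ... | tri< t′<t _ _ = let k , _ , k<t , _ , ut<uk = separated⁻ u t′<t s in ℤ.<-asym ut<uk (rec k k<t)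
      ... | tri≈ _ eq _   = ℤ.<-irrefl (trans (sym ut′) (cong (u ⟦_⟧) eq)) i<a
      ... | tri> _ _ t<t′ = let k , t<k , k<t′ , ut<uk , _ = separated⁻ u t<t′ (separated-sym u s) in
              avoids t<k k<t′ (subst (ℤ._< u ⟦ t ⟧) (sym ut′) i<a) ut<uk

    skyline : Sky v
    skyline = record
      { member   = λ m → does (record? (u ⁻¹⟦ v ⁻¹⟦ m ⟧ ⟧))
      ; nonempty = let t , rec = record-exists in v ⟦ u ⟦ t ⟧ ⟧ ,
          T-does⁺ (record? _) (subst Record (sym (trans (cong (u ⁻¹⟦_⟧) (from-to V _)) (from-to U t))) rec)
      ; periodic = λ m → does-⇔ (mk⇔
          (λ rec → Equivalence.from (record-shift _) (subst Record (inverse-shift m) rec))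
          (λ rec → subst Record (sym (inverse-shift m)) (Equivalence.to (record-shift _) rec)))
          (record? _) (record? _)
      ; maxima   = λ m m∈ i i< → subst (v ⟦ i ⟧ ℤ.<_) (trans (cong (v ⟦_⟧) (to-from U _)) (to-from V m))
          (record-maximum (T-does⁻ (record? _) m∈) (subst (i ℤ.<_) (sym (to-from U _)) i<))
      }
      where
      inverse-shift : ∀ m → u ⁻¹⟦ v ⁻¹⟦ m ℤ.+ + n ⟧ ⟧ ≡ u ⁻¹⟦ v ⁻¹⟦ m ⟧ ⟧ ℤ.+ + n
      inverse-shift m = trans (cong (u ⁻¹⟦_⟧) (from-equivariant V m)) (from-equivariant U _)

    onSkyline⇔ : ∀ p → OnSky skyline p ⇔ Record (u ⁻¹⟦ p ⟧)
    onSkyline⇔ p = mk⇔ (λ s → subst Record (cong (u ⁻¹⟦_⟧) (from-to V p)) (T-does⁻ (record? _) s))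
      (λ rec → T-does⁺ (record? _) (subst Record (cong (u ⁻¹⟦_⟧) (sym (from-to V p))) rec))

    module Blocks (M : Sky v) (I : Indexing v M) (onSky⇔ : ∀ p → OnSky M p ⇔ Record (u ⁻¹⟦ p ⟧)) (j : ℤ) where
      open Positions M I
      open Cut {u} avoids using (cut)

      private
        s = position j
        s′ = position (j ℤ.+ 1ℤ)
        rec : ∀ j → Record (u ⁻¹⟦ position j ⟧)
        rec j = Equivalence.to (onSky⇔ (position j)) (position∈S j)
        low = proj₁ (cut (rec j))
        high = proj₂ (cut (rec j))
        low′ = proj₁ (cut (rec (j ℤ.+ 1ℤ)))
        high′ = proj₂ (cut (rec (j ℤ.+ 1ℤ)))
        s+1 = s ℤ.+ 1ℤ

      value≥ : s′ ℤ.≤ u ⟦ s+1 ⟧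
      value≥ =
        let i , e = position-onto (Equivalence.from (onSky⇔ (u ⟦ s+1 ⟧)) (subst Record (sym (from-to U s+1))
              λ i i< → ℤ.≤-<-trans (low i (≤-suc⇒≤ i<)) (high s+1 (n<n+1 s))))
        in subst (s′ ℤ.≤_) e (mono-≤ (<⇒suc≤ (reflect-< (subst (s ℤ.<_) (sym e) (high s+1 (n<n+1 s))))))

      first : u ⟦ s+1 ⟧ ≡ s′
      first with ℤ.<-cmp (u ⁻¹⟦ s′ ⟧) s+1
      ... | tri< lt _ _ = contradiction (subst (ℤ._≤ s) (to-from U s′) (low _ (≤-suc⇒≤ lt)))
        (ℤ.<⇒≱ (position-step j))
      ... | tri≈ _ eq _ = trans (cong (u ⟦_⟧) (sym eq)) (to-from U s′)
      ... | tri> _ _ gt = contradiction value≥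
        (ℤ.<⇒≱ (subst (u ⟦ s+1 ⟧ ℤ.<_) (to-from U s′) (rec (j ℤ.+ 1ℤ) s+1 gt)))

      word : ℕ → ℤ
      word k = v ⟦ s ℤ.+ + suc k ⟧

      Carries : ℕ → ℕ → Set
      Carries k y = u ⟦ s ℤ.+ + suc k ⟧ ≡ s ℤ.+ + suc y

      at-injective : ∀ {a b} → s ℤ.+ + suc a ≡ s ℤ.+ + suc b → a ≡ b
      at-injective {a} {b} eq =
        ℤ.+-injective (lia 3 (λ s a b → s :+ (lit 1 :+ a) :≡ s :+ (lit 1 :+ b) ∷ [] ⊢ a :≡ b) s (+ a) (+ b) eq)

      at-mono : ∀ {a b} → a ℕ.< b → s ℤ.+ + suc a ℤ.< s ℤ.+ + suc b
      at-mono {a} {b} lt = lia 3 (λ s a b → a :< b ∷ [] ⊢ s :+ (lit 1 :+ a) :< s :+ (lit 1 :+ b)) s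
        (+ a) (+ b) (ℤ.+<+ lt)

      at-reflect : ∀ {a b} → s ℤ.+ + suc a ℤ.< s ℤ.+ + suc b → a ℕ.< b
      at-reflect {a} {b} lt = ℤ.drop‿+<+
        (lia 3 (λ s a b → s :+ (lit 1 :+ a) :< s :+ (lit 1 :+ b) ∷ [] ⊢ a :< b) s (+ a) (+ b) lt)

      within : ∀ {k} → k ℕ.< suc (gap j) → s ℤ.< s ℤ.+ + suc k × s ℤ.+ + suc k ℤ.≤ s′
      within {k} k< = lia 2 (λ s k → lit 0 :≤ k ∷ [] ⊢ s :< s :+ (lit 1 :+ k)) s (+ k) (ℤ.+≤+ ℕ.z≤n) ,
        lia 4 (λ s k g s′ → k :< lit 1 :+ g ∷ s′ :≡ s :+ (lit 1 :+ g) ∷ [] ⊢ s :+ (lit 1 :+ k) :≤ s′)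
          s (+ k) (+ gap j) s′ (ℤ.+<+ k<) (gap-≡ j)

      offset : ∀ {x} → s ℤ.< x → x ℤ.≤ s′ → ∃[ k ] k ℕ.< suc (gap j) × x ≡ s ℤ.+ + suc k
      offset {x} s<x x≤s′ = let k , eq = gap-suc s<x in
        k , ℤ.drop‿+<+ (lia 5 (λ s k g s′ x → x :≡ s :+ (lit 1 :+ k) ∷ x :≤ s′ ∷ s′ :≡ s :+ (lit 1 :+ g)
          ∷ [] ⊢ k :< lit 1 :+ g)
          s (+ k) (+ gap j) s′ x eq x≤s′ (gap-≡ j)) , eq

      private
        L = suc (gap j)

        block-linear : ∀ {k k′ y y′} → Carries k y → Carries k′ y′ → y ℕ.< y′ →
          (∀ k″ → k ℕ.⊓ k′ ℕ.< k″ → k″ ℕ.< k ℕ.⊔ k′ → ∃[ y″ ] Carries k″ y″ × y″ ℕ.≤ y′) → word y ℤ.< word y′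
        block-linear {k} {k′} {y} {y′} c c′ y<y′ between = subst₂ (λ p q → v ⟦ p ⟧ ℤ.< v ⟦ q ⟧) c c′
          (linear p q unseparated (subst₂ ℤ._<_ (sym c) (sym c′) (at-mono y<y′)))
          where
          p = s ℤ.+ + suc k
          q = s ℤ.+ + suc k′
          too-high : ∀ {κ} → s ℤ.< κ →
            (∀ {k″} → κ ≡ s ℤ.+ + suc k″ → k ℕ.⊓ k′ ℕ.< k″ × k″ ℕ.< k ℕ.⊔ k′) → ¬ (u ⟦ q ⟧ ℤ.< u ⟦ κ ⟧)
          too-high {κ} s<κ bounds lt =
            let k″ , eq = gap-suc s<κ
                b₁ , b₂ = bounds eq
                y″ , c″ , y″≤ = between k″ b₁ b₂
            in ℕ.<⇒≱ (at-reflect (subst₂ ℤ._<_ c′ (trans (cong (u ⟦_⟧) eq) c″) lt)) y″≤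
          past : ∀ a → s ℤ.< s ℤ.+ + suc a
          past a = lia 2 (λ s k → lit 0 :≤ k ∷ [] ⊢ s :< s :+ (lit 1 :+ k)) s (+ a) (ℤ.+≤+ ℕ.z≤n)
          unseparated : ¬ Separated u p q
          unseparated sep with ℕ.<-cmp k k′
          ... | tri< k<k′ _ _ = let κ , a , b , _ , e = separated⁻ u (at-mono k<k′) sep in
            too-high (ℤ.<-trans (past k) a) (λ {k″} eq →
              ℕ.≤-<-trans (ℕ.m⊓n≤m k k′) (at-reflect (subst (p ℤ.<_) eq a)) ,
              ℕ.<-≤-trans (at-reflect (subst (ℤ._< q) eq b)) (ℕ.m≤n⊔m k k′)) e
          ... | tri≈ _ refl _ = ℕ.<-irrefl (at-injective (trans (sym c) c′)) y<y′
          ... | tri> _ _ k′<k = let κ , a , b , e , _ = separated⁻ u (at-mono k′<k) (separated-sym u sep) in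
            too-high (ℤ.<-trans (past k′) a) (λ {k″} eq →
              ℕ.≤-<-trans (ℕ.m⊓n≤n k k′) (at-reflect (subst (q ℤ.<_) eq a)) ,
              ℕ.<-≤-trans (at-reflect (subst (ℤ._< p) eq b)) (ℕ.m≤m⊔n k k′)) e

        open TreeWord word
        open Word word
        open Extract Carries
          (λ c c′ → at-injective (trans (sym c) c′))
          (λ c c′ → at-injective (to-injective U (trans c (sym c′))))
          (λ k₁<k₂ k₂<k₃ c₁ c₂ c₃ y₃<y₁ y₁<y₂ → avoids (at-mono k₁<k₂) (at-mono k₂<k₃)
            (subst₂ ℤ._<_ (sym c₃) (sym c₁) (at-mono y₃<y₁)) (subst₂ ℤ._<_ (sym c₁) (sym c₂) (at-mono y₁<y₂)))
          block-linear

        onto : Onto 0 0 L L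
        onto = (λ k k< → let a , b = within k< in offset (high _ a) (low′ _ b)) ,
          (λ y y< → let a , b = within y<
                        t = u ⁻¹⟦ s ℤ.+ + suc y ⟧
                        ut = to-from U (s ℤ.+ + suc y)
                        k , k< , eq = offset {t}
                          (ℤ.≰⇒> λ le → ℤ.<⇒≱ a (subst (ℤ._≤ s) ut (low t le)))
                          (ℤ.≮⇒≥ λ gt → ℤ.<⇒≱ (subst (s′ ℤ.<_) ut (high′ t gt)) b)
                    in k , k< , trans (cong (u ⟦_⟧) (sym eq)) ut)

      BlockTree : Set
      BlockTree = Σ[ t ∈ Tree ] Word.Decreasing word 0 t × size t ≡ gap j ×
        (∀ k → k ℕ.< suc (gap j) → u ⟦ s ℤ.+ + suc k ⟧ ≡ s ℤ.+ + suc (perm (node leaf t) k))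

      blockTree : BlockTree
      blockTree = strip (extract L 0 0 L L ℕ.≤-refl onto)
        where
        rooted : ∀ l r → suc (size l ℕ.+ size r) ≡ L → Carries 0 (perm (node l r) 0) → size l ≡ 0
        rooted l r size≡ c = begin
          size l                                 ≡⟨ perm⁻¹-root l r ⟨
          perm⁻¹ (node l r) (size l ℕ.+ size r)  ≡⟨ cong (perm⁻¹ (node l r)) (trans (ℕ.suc-injective size≡)
              (at-injective (trans (sym (gap-≡ j)) (trans (sym first) c)))) ⟩
          perm⁻¹ (node l r) (perm (node l r) 0)  ≡⟨ perm⁻¹-perm (node l r) (ℕ.s≤s ℕ.z≤n) ⟩
          0                                      ∎
          where open ≡-Reasoning
        strip : Extracted 0 0 L L → BlockTree
        strip (_ , leaf , () , _)
        strip (_ , node leaf r , size≡ , (_ , dec , _) , carries) = r , dec , ℕ.suc-injective size≡ , carries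
        strip (_ , node (node l₁ l₂) r , size≡ , _ , carries) =
          contradiction (rooted (node l₁ l₂) r size≡ (carries 0 (ℕ.s≤s ℕ.z≤n))) λ ()

module Construction (n : ℕ) .{{_ : ℕ.NonZero n}} (v : AffinePermutation n) (M : Sky v) (I : Indexing v M) where
  open Periodic n
  open PeriodicBijection
  open Avoidance n
  open Fibers n
  open Skylines n v
  open Positions M I

  instance
    r-nonZero : ℕ.NonZero r
    r-nonZero = ℕ.>-nonZero r>0

  private
    module R = Periodic r

  word : ℤ → ℕ → ℤ
  word j k = v ⟦ position j ℤ.+ + suc k ⟧

  index : Fin r → ℤ
  index i = + suc (toℕ i)

  residueIndex : ℤ → Fin r
  residueIndex j = R.residue (j ℤ.- 1ℤ)

  turns : ℤ → ℤ
  turns j = R.quotient (j ℤ.- 1ℤ)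

  index-≡ : ∀ j → j ≡ index (residueIndex j) ℤ.+ turns j ℤ.* + r
  index-≡ j = lia 3 (λ b r q → b :- lit 1 :≡ r :+ q ∷ [] ⊢ b :≡ lit 1 :+ r :+ q)
    j (+ toℕ (residueIndex j)) (turns j ℤ.* + r) (R.residue-quotient (j ℤ.- 1ℤ))

  position-≡ : ∀ j → position j ≡ position (index (residueIndex j)) ℤ.+ turns j ℤ.* + n
  position-≡ j = trans (cong position (index-≡ j)) (R.shift-* position (+ n) position-shift (turns j) _)

  position-suc-≡ : ∀ j → position (j ℤ.+ 1ℤ) ≡ position (index (residueIndex j) ℤ.+ 1ℤ) ℤ.+ turns j ℤ.* + n
  position-suc-≡ j = trans (cong position (trans (cong (ℤ._+ 1ℤ) (index-≡ j))
      (lia 2 (λ a x → [] ⊢ a :+ x :+ lit 1 :≡ a :+ lit 1 :+ x) (index (residueIndex j)) (turns j ℤ.* + r))))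
    (R.shift-* position (+ n) position-shift (turns j) _)

  gap-index : ∀ j → gap j ≡ gap (index (residueIndex j))
  gap-index j = cong (λ d → ∣ d ∣ ℕ.∸ 1) (trans (cong₂ ℤ._-_ (position-suc-≡ j) (position-≡ j))
    (lia 3 (λ a b c → [] ⊢ (a :+ c) :- (b :+ c) :≡ a :- b) (position (index (residueIndex j) ℤ.+ 1ℤ))
      (position (index (residueIndex j))) (turns j ℤ.* + n)))

  word-index : ∀ j k → word j k ≡ word (index (residueIndex j)) k ℤ.+ turns j ℤ.* + n
  word-index j k = trans (cong (v ⟦_⟧) (trans (cong (ℤ._+ + suc k) (position-≡ j))
      (lia 3 (λ a x k → [] ⊢ a :+ x :+ k :≡ a :+ k :+ x) (position (index (residueIndex j)))
        (turns j ℤ.* + n) (+ suc k))))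
    (to-shift V (turns j) _)

  decreasing-shift : ∀ {g h : ℕ → ℤ} c → (∀ k → h k ≡ g k ℤ.+ c) → ∀ lo t → Word.Decreasing g lo t →
    Word.Decreasing h lo t
  decreasing-shift c eq lo leaf       _ = tt
  decreasing-shift c eq lo (node l r) (dl , dr , dom) =
    decreasing-shift c eq lo l dl , decreasing-shift c eq (lo ℕ.+ size l) r dr ,
    λ k< → subst₂ ℤ._<_ (sym (eq _)) (sym (eq _)) (ℤ.+-monoˡ-< c (dom k<))

  BlockTrees : (Fin r → Tree) → Set
  BlockTrees t = ∀ i → Word.Decreasing (word (index i)) 0 (t i) × size (t i) ≡ gap (index i)

  residueIndex-shift : ∀ j → residueIndex (j ℤ.+ + r) ≡ residueIndex j
  residueIndex-shift j = R.residue-≡ (residueIndex j) (turns j ℤ.+ 1ℤ)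
    (lia 5 (λ j r i q q′ → j :≡ lit 1 :+ i :+ q ∷ q′ :≡ q :+ r ∷ [] ⊢ j :+ r :- lit 1 :≡ i :+ q′)
      j (+ r) (+ toℕ (residueIndex j)) (turns j ℤ.* + r) ((turns j ℤ.+ 1ℤ) ℤ.* + r) (index-≡ j)
      (trans (ℤ.*-distribʳ-+ (+ r) (turns j) 1ℤ) (cong (ℤ._+_ (turns j ℤ.* + r)) (ℤ.*-identityˡ (+ r)))))

  residueIndex-index : ∀ i → residueIndex (index i) ≡ i
  residueIndex-index i = R.residue-≡ i 0ℤ (lia 2 (λ i z → z :≡ lit 0 ∷ [] ⊢ lit 1 :+ i :- lit 1 :≡ i :+ z)
    (+ toℕ i) (0ℤ ℤ.* + r) (ℤ.*-zeroˡ (+ r)))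

  InBlock : ℤ → ℤ → Set
  InBlock x j = position j ℤ.< x × x ℤ.≤ position (j ℤ.+ 1ℤ)

  block : ∀ x → ∃[ j ] InBlock x j
  block x = let j , e = position-onto (prev∈S M x) in
    j , subst (ℤ._< x) (sym e) (prev<x M x) ,
    ℤ.≮⇒≥ λ lt → ℤ.<⇒≱ (position-step j)
      (subst (position (j ℤ.+ 1ℤ) ℤ.≤_) (sym e) (prev-greatest M lt (position∈S (j ℤ.+ 1ℤ))))

  block-unique : ∀ {x j j′} → InBlock x j → InBlock x j′ → j ≡ j′
  block-unique (a , b) (a′ , b′) = ℤ.≤-antisym
    (≤-suc⇒≤ (reflect-< (ℤ.<-≤-trans a b′))) (≤-suc⇒≤ (reflect-< (ℤ.<-≤-trans a′ b)))

  offset : ∀ {x j} → InBlock x j → ∃[ k ] k ℕ.< suc (gap j) × x ≡ position j ℤ.+ + suc k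
  offset {x} {j} (a , b) = let k , eq = gap-suc a in
    k , ℤ.drop‿+<+ (lia 5 (λ s k g s′ x → x :≡ s :+ (lit 1 :+ k) ∷ x :≤ s′ ∷ s′ :≡ s :+ (lit 1 :+ g)
      ∷ [] ⊢ k :< lit 1 :+ g)
      (position j) (+ k) (+ gap j) (position (j ℤ.+ 1ℤ)) x eq b (gap-≡ j)) , eq

  in-block : ∀ j {k} → k ℕ.< suc (gap j) → InBlock (position j ℤ.+ + suc k) j
  in-block j {k} k< = lia 2 (λ s k → lit 0 :≤ k ∷ [] ⊢ s :< s :+ (lit 1 :+ k)) (position j) (+ k)
    (ℤ.+≤+ ℕ.z≤n) ,
    lia 4 (λ s k g s′ → k :< lit 1 :+ g ∷ s′ :≡ s :+ (lit 1 :+ g) ∷ [] ⊢ s :+ (lit 1 :+ k) :≤ s′)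
      (position j) (+ k) (+ gap j) (position (j ℤ.+ 1ℤ)) (ℤ.+<+ k<) (gap-≡ j)

  at-injective : ∀ s {a b} → s ℤ.+ + suc a ≡ s ℤ.+ + suc b → a ≡ b
  at-injective s {a} {b} eq =
    ℤ.+-injective (lia 3 (λ s a b → s :+ (lit 1 :+ a) :≡ s :+ (lit 1 :+ b) ∷ [] ⊢ a :≡ b) s (+ a) (+ b) eq)

  at-mono : ∀ s {a b} → a ℕ.< b → s ℤ.+ + suc a ℤ.< s ℤ.+ + suc b
  at-mono s {a} {b} lt = lia 3 (λ s a b → a :< b ∷ [] ⊢ s :+ (lit 1 :+ a) :< s :+ (lit 1 :+ b)) s (+ a)
    (+ b) (ℤ.+<+ lt)

  at-reflect : ∀ s {a b} → s ℤ.+ + suc a ℤ.< s ℤ.+ + suc b → a ℕ.< b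
  at-reflect s {a} {b} lt =
    ℤ.drop‿+<+ (lia 3 (λ s a b → s :+ (lit 1 :+ a) :< s :+ (lit 1 :+ b) ∷ [] ⊢ a :< b) s (+ a) (+ b) lt)

  block-shift : ∀ {x j} → InBlock x j → InBlock (x ℤ.+ + n) (j ℤ.+ + r)
  block-shift {x} {j} (a , b) =
    subst (ℤ._< x ℤ.+ + n) (sym (position-shift j)) (ℤ.+-monoˡ-< (+ n) a) ,
    subst (x ℤ.+ + n ℤ.≤_) (trans (sym (position-shift (j ℤ.+ 1ℤ)))
      (cong position (lia 2 (λ j r → [] ⊢ j :+ lit 1 :+ r :≡ j :+ r :+ lit 1) j (+ r)))) (ℤ.+-monoˡ-≤ (+ n) b)

  module Blockwise (f : Fin r → ℕ → ℕ) where
    opaque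
      glued : ℤ → ℤ
      glued x = let j , b = block x in position j ℤ.+ + suc (f (residueIndex j) (proj₁ (offset b)))

      glued-at : ∀ j {k} → k ℕ.< suc (gap j) → glued (position j ℤ.+ + suc k) ≡ position j
        ℤ.+ + suc (f (residueIndex j) k)
      glued-at j {k} k< = at (proj₁ (block x)) (proj₂ (block x))
        (block-unique (proj₂ (block x)) (in-block j k<))
        where
        x : ℤ
        x = position j ℤ.+ + suc k
        at : ∀ j′ (b : InBlock x j′) → j′ ≡ j → position j′ ℤ.+ + suc (f (residueIndex j′) (proj₁ (offset b))) ≡
             position j ℤ.+ + suc (f (residueIndex j) k)
        at j b refl = cong (λ k → position j ℤ.+ + suc (f (residueIndex j) k))
          (at-injective (position j) (sym (proj₂ (proj₂ (offset b)))))

    glued-equivariant : (∀ i {k} → k ℕ.< suc (gap (index i)) → f i k ℕ.< suc (gap (index i))) → ∀ x →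
      glued (x ℤ.+ + n) ≡ glued x ℤ.+ + n
    glued-equivariant f< x = equivariant-at (block x)
      where
      equivariant-at : ∃[ j ] InBlock x j → glued (x ℤ.+ + n) ≡ glued x ℤ.+ + n
      equivariant-at (j , b) =
        let k , k< , x≡ = offset b
            k′ , k′< , x′≡ = offset (block-shift b)
            k≡ : k′ ≡ k
            k≡ = at-injective (position j)
              (lia 6 (λ x n p p′ k k′ → x :≡ p :+ (lit 1 :+ k) ∷ x :+ n :≡ p′ :+ (lit 1 :+ k′) ∷ p′ :≡ p
              :+ n ∷ []
                     ⊢ p :+ (lit 1 :+ k′) :≡ p :+ (lit 1 :+ k)) x (+ n) (position j)
                       (position (j ℤ.+ + r)) (+ k) (+ k′) x≡ x′≡ (position-shift j))
        in begin
          glued (x ℤ.+ + n)                            ≡⟨ cong glued x′≡ ⟩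
          glued (position (j ℤ.+ + r) ℤ.+ + suc k′)    ≡⟨ glued-at (j ℤ.+ + r) k′< ⟩
          position (j ℤ.+ + r) ℤ.+ + suc (f (residueIndex (j ℤ.+ + r)) k′)
            ≡⟨ cong₂ (λ p m → p ℤ.+ + suc m) (position-shift j) (cong₂ f (residueIndex-shift j) k≡) ⟩
          position j ℤ.+ + n ℤ.+ + suc (f (residueIndex j) k)
            ≡⟨ lia 3 (λ p n m → [] ⊢ p :+ n :+ m :≡ p :+ m :+ n) (position j) (+ n)
              (+ suc (f (residueIndex j) k)) ⟩
          position j ℤ.+ + suc (f (residueIndex j) k) ℤ.+ + n
            ≡⟨ cong (ℤ._+ + n) (trans (cong glued x≡) (glued-at j k<)) ⟨
          glued x ℤ.+ + n ∎
        where open ≡-Reasoning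

  module _ (t : Fin r → Tree) (valid : BlockTrees t) where

    tree : ℤ → Tree
    tree j = node leaf (t (residueIndex j))

    size-tree : ∀ j → size (tree j) ≡ suc (gap j)
    size-tree j = cong suc (trans (proj₂ (valid (residueIndex j))) (sym (gap-index j)))

    opaque
      dominates-block : ∀ j → Word.Dominates (word j) 0 (gap j)
      dominates-block j {k} k< = subst (λ p → word j k ℤ.< v ⟦ p ⟧) (gap-≡ j)
        (maximum M (position∈S (j ℤ.+ 1ℤ))
          (subst (position j ℤ.+ + suc k ℤ.<_) (sym (gap-≡ j)) (at-mono (position j) k<)))

      decreasing-tree : ∀ j → Word.Decreasing (word j) 0 (tree j)
      decreasing-tree j = tt ,
        decreasing-shift (turns j ℤ.* + n) (word-index j) 0 (t (residueIndex j))
          (proj₁ (valid (residueIndex j))) ,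
        λ {k} → subst (Word.Dominates (word j) 0) (ℕ.suc-injective (sym (size-tree j)))
          (λ {k} → dominates-block j {k}) {k}

    private
      module Forward = Blockwise (λ i → perm (node leaf (t i)))
      module Backward = Blockwise (λ i → perm⁻¹ (node leaf (t i)))

      sized : ∀ j {k} → k ℕ.< suc (gap j) → k ℕ.< size (tree j)
      sized j {k} = subst (k ℕ.<_) (sym (size-tree j))

      perm-gap : ∀ j {k} → k ℕ.< suc (gap j) → perm (tree j) k ℕ.< suc (gap j)
      perm-gap j {k} k< = subst (perm (tree j) k ℕ.<_) (size-tree j) (perm-< (tree j) (sized j k<))

      perm⁻¹-gap : ∀ j {k} → k ℕ.< suc (gap j) → perm⁻¹ (tree j) k ℕ.< suc (gap j)
      perm⁻¹-gap j {k} k< = subst (perm⁻¹ (tree j) k ℕ.<_) (size-tree j) (perm⁻¹-< (tree j) (sized j k<))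

    bijection : PeriodicBijection
    bijection = record
      { to          = Forward.glued
      ; from        = Backward.glued
      ; to-from     = λ x → let j , b = block x
                                k , k< , x≡ = offset b in
          trans (cong Forward.glued (trans (cong Backward.glued x≡) (Backward.glued-at j k<)))
            (trans (Forward.glued-at j (perm⁻¹-gap j k<))
              (trans (cong (λ m → position j ℤ.+ + suc m) (perm-perm⁻¹ (tree j) (sized j k<))) (sym x≡)))
      ; from-to     = λ x → let j , b = block x
                                k , k< , x≡ = offset b in
          trans (cong Backward.glued (trans (cong Forward.glued x≡) (Forward.glued-at j k<)))
            (trans (Backward.glued-at j (perm-gap j k<))
              (trans (cong (λ m → position j ℤ.+ + suc m) (perm⁻¹-perm (tree j) (sized j k<))) (sym x≡)))
      ; equivariant = Forward.glued-equivariant λ i {k} k< →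
        subst (λ i′ → perm (node leaf (t i′)) k ℕ.< suc (gap (index i)))
          (residueIndex-index i) (perm-gap (index i) k<)
      }

    bijection-at : ∀ j {k} → k ℕ.< suc (gap j) → to bijection (position j ℤ.+ + suc k) ≡ position j
      ℤ.+ + suc (perm (tree j) k)
    bijection-at = Forward.glued-at

    stays : ∀ {x j} → InBlock x j → InBlock (to bijection x) j
    stays {x} {j} b = let k , k< , x≡ = offset b in
      subst (λ y → InBlock y j) (sym (trans (cong (to bijection) x≡) (bijection-at j k<)))
        (in-block j (perm-gap j k<))

    drift-bijection : drift bijection ≡ 0ℤ
    drift-bijection = drift-cut bijection (position 0ℤ)
      (λ x x≤ → let j , b = block x in
        ℤ.≤-trans (proj₂ (stays b)) (mono-≤ (<⇒suc≤ (reflect-< (ℤ.<-≤-trans (proj₁ b) x≤)))))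
      (λ x x> → let j , b = block x in
        ℤ.≤-<-trans (mono-≤ (≤-suc⇒≤ (reflect-< (ℤ.<-≤-trans x> (proj₂ b))))) (proj₁ (stays b)))

    u : AffinePermutation n
    u = toAffine bijection drift-bijection

    w : AffinePermutation n
    w = toAffine (V ∘ᵇ bijection) (trans (drift-∘ V bijection) (cong₂ ℤ._+_ (drift-affine v) drift-bijection))

    data Comparison (p q : ℤ) : Set where
      ascent  : u ⟦ p ⟧ ℤ.< u ⟦ q ⟧ → w ⟦ p ⟧ ℤ.< w ⟦ q ⟧
        ⊎ (∃[ k ] p ℤ.< k × k ℤ.< q × u ⟦ q ⟧ ℤ.< u ⟦ k ⟧) → Comparison p q
      descent : u ⟦ q ⟧ ℤ.< u ⟦ p ⟧ → w ⟦ q ⟧ ℤ.< w ⟦ p ⟧ →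
        (∀ k → p ℤ.< k → k ℤ.< q → u ⟦ k ⟧ ℤ.< u ⟦ p ⟧) → Comparison p q

    first-at : ∀ j → u ⟦ position j ℤ.+ 1ℤ ⟧ ≡ position (j ℤ.+ 1ℤ)
    first-at j = trans (bijection-at j {0} (ℕ.s≤s ℕ.z≤n))
      (trans (cong (λ m → position j ℤ.+ + suc m)
        (trans (perm-root leaf (t (residueIndex j))) (ℕ.suc-injective (size-tree j)))) (sym (gap-≡ j)))

    same-block : ∀ j {a b} → a ℕ.< b → b ℕ.< suc (gap j) → Comparison (position j ℤ.+ + suc a)
      (position j ℤ.+ + suc b)
    same-block j {a} {b} a<b b< =
      convert (TreeWord.tree-related (word j) 0 (tree j) (decreasing-tree j) a<b (sized j b<))
      where
      s = position j
      a< = ℕ.<-trans a<b b<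
      ua = bijection-at j a<
      ub = bijection-at j b<
      wa : w ⟦ s ℤ.+ + suc a ⟧ ≡ word j (perm (tree j) a)
      wa = cong (v ⟦_⟧) ua
      wb : w ⟦ s ℤ.+ + suc b ⟧ ≡ word j (perm (tree j) b)
      wb = cong (v ⟦_⟧) ub
      convert : Related (perm (tree j)) (word j) a b → Comparison (s ℤ.+ + suc a) (s ℤ.+ + suc b)
      convert (ascent lt (inj₁ wlt)) =
        ascent (subst₂ ℤ._<_ (sym ua) (sym ub) (at-mono s lt)) (inj₁ (subst₂ ℤ._<_ (sym wa) (sym wb) wlt))
      convert (ascent lt (inj₂ (k , a<k , k<b , h))) = ascent (subst₂ ℤ._<_ (sym ua) (sym ub) (at-mono s lt))
        (inj₂ (s ℤ.+ + suc k , at-mono s a<k , at-mono s k<b ,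
          subst₂ ℤ._<_ (sym ub) (sym (bijection-at j (ℕ.<-trans k<b b<))) (at-mono s h)))
      convert (descent lt wlt h) =
        descent (subst₂ ℤ._<_ (sym ub) (sym ua) (at-mono s lt)) (subst₂ ℤ._<_ (sym wb) (sym wa) wlt)
        λ κ a<κ κ<b → let k , k≡ = gap-suc (ℤ.<-trans (proj₁ (in-block j a<)) a<κ)
                          k<b = at-reflect s (subst (ℤ._< s ℤ.+ + suc b) k≡ κ<b) in
          subst₂ ℤ._<_ (sym (trans (cong (u ⟦_⟧) k≡) (bijection-at j (ℕ.<-trans k<b b<)))) (sym ua)
            (at-mono s (h k (at-reflect s (subst (s ℤ.+ + suc a ℤ.<_) k≡ a<κ)) k<b))

    other-block : ∀ {p q j j′} → InBlock p j → InBlock q j′ → j ℤ.< j′ → Comparison p q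
    other-block {p} {q} {j} {j′} bp bq j<j′ = ascent up (further (q ℤ.≟ f))
      where
      f = position j′ ℤ.+ 1ℤ
      up : u ⟦ p ⟧ ℤ.< u ⟦ q ⟧
      up = ℤ.≤-<-trans (ℤ.≤-trans (proj₂ (stays bp)) (mono-≤ (<⇒suc≤ j<j′))) (proj₁ (stays bq))
      p<f : p ℤ.< f
      p<f = ℤ.≤-<-trans (ℤ.≤-trans (proj₂ bp) (mono-≤ (<⇒suc≤ j<j′))) (n<n+1 (position j′))
      further : Dec (q ≡ f) → w ⟦ p ⟧ ℤ.< w ⟦ q ⟧ ⊎ (∃[ k ] p ℤ.< k × k ℤ.< q × u ⟦ q ⟧ ℤ.< u ⟦ k ⟧)
      further (yes refl) = inj₁ (maximum M (subst (OnSky M) (sym (first-at j′)) (position∈S (j′ ℤ.+ 1ℤ))) up)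
      further (no q≢f)   = inj₂ (f , p<f , ℤ.≤∧≢⇒< (<⇒suc≤ (proj₁ bq)) (q≢f ∘ sym) ,
        ℤ.≤∧≢⇒< (subst (u ⟦ q ⟧ ℤ.≤_) (sym (first-at j′)) (proj₂ (stays bq))) (q≢f ∘ affine-injective u))

    comparison : ∀ {p q} → p ℤ.< q → Comparison p q
    comparison {p} {q} p<q = compare (block p) (block q)
      where
      compare : ∃[ j ] InBlock p j → ∃[ j ] InBlock q j → Comparison p q
      compare (j , bp) (j′ , bq) with ℤ.<-cmp j j′
      ... | tri< lt _ _ = other-block bp bq lt
      ... | tri> _ _ gt = contradiction p<q
        (ℤ.≤⇒≯ (ℤ.≤-trans (proj₂ bq) (ℤ.≤-trans (mono-≤ (<⇒suc≤ gt)) (ℤ.<⇒≤ (proj₁ bp)))))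
      ... | tri≈ _ refl _ = let a , a< , p≡ = offset bp
                                b , b< , q≡ = offset bq in
        subst₂ Comparison (sym p≡) (sym q≡) (same-block j (at-reflect (position j) (subst₂ ℤ._<_ p≡ q≡ p<q)) b<)

    avoids : Avoids231 u
    avoids {p} {k} {q} p<k k<q uq<up up<uk with comparison (ℤ.<-trans p<k k<q)
    ... | ascent up<uq _  = ℤ.<-asym uq<up up<uq
    ... | descent _ _ max = ℤ.<-asym up<uk (max k p<k k<q)

    linear : ∀ p q → ¬ Separated u p q → u ⟦ p ⟧ ℤ.< u ⟦ q ⟧ → w ⟦ p ⟧ ℤ.< w ⟦ q ⟧
    linear p q ¬s up<uq with ℤ.<-cmp p q
    ... | tri≈ _ refl _ = contradiction up<uq (ℤ.<-irrefl refl)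
    ... | tri< p<q _ _  = forwards (comparison p<q)
      where
      forwards : Comparison p q → w ⟦ p ⟧ ℤ.< w ⟦ q ⟧
      forwards (ascent _ (inj₁ lt)) = lt
      forwards (ascent _ (inj₂ (k , p<k , k<q , h))) =
        contradiction (separated⁺ u p<k k<q (ℤ.<-trans up<uq h) h) ¬s
      forwards (descent gt _ _)     = contradiction up<uq (ℤ.<-asym gt)
    ... | tri> _ _ q<p  = backwards (comparison q<p)
      where
      backwards : Comparison q p → w ⟦ p ⟧ ℤ.< w ⟦ q ⟧
      backwards (ascent gt _)    = contradiction up<uq (ℤ.<-asym gt)
      backwards (descent _ lt _) = lt

    stackSorts : StackSortsTo w v
    stackSorts = u , avoids⇒projection {u} {w} (LinearExtension.≡syl {u} {w} linear) avoids ,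
      λ i → cong (v ⟦_⟧) (sym (to-from bijection i))

    open Maxima u using (Record)

    record-first : ∀ j → Record (position j ℤ.+ 1ℤ)
    record-first j i i< = subst (u ⟦ i ⟧ ℤ.<_) (sym (first-at j)) (let k , b = block i in
      ℤ.≤-<-trans (ℤ.≤-trans (proj₂ (stays b))
        (mono-≤ (<⇒suc≤ (reflect-< (ℤ.<-≤-trans (proj₁ b) (≤-suc⇒≤ i<)))))) (position-step j))

    onSky⇔record : ∀ p → OnSky M (u ⟦ p ⟧) ⇔ Record p
    onSky⇔record p = mk⇔
      (λ s → let j , e = position-onto s in subst Record
        (affine-injective u (trans (first-at (j ℤ.- 1ℤ))
          (trans (cong position (lia 1 (λ j → [] ⊢ j :- lit 1 :+ lit 1 :≡ j) j)) e)))
        (record-first (j ℤ.- 1ℤ)))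
      (λ rec → first-only rec (block p))
      where
      first-only : Record p → ∃[ j ] InBlock p j → OnSky M (u ⟦ p ⟧)
      first-only rec (j , b) with position j ℤ.+ 1ℤ ℤ.≟ p
      ... | yes refl = subst (OnSky M) (sym (first-at j)) (position∈S (j ℤ.+ 1ℤ))
      ... | no ≢     = contradiction (rec (position j ℤ.+ 1ℤ) (ℤ.≤∧≢⇒< (<⇒suc≤ (proj₁ b)) ≢))
                         (ℤ.≤⇒≯ (subst (u ⟦ p ⟧ ℤ.≤_) (sym (first-at j)) (proj₂ (stays b))))

-- Counting

pairs : ∀ K (size : Fin K → ℕ) → List (Σ (Fin K) (Fin ∘ size))
pairs zero    size = []
pairs (suc K) size = List.map (Fin.zero ,_) (List.allFin (size Fin.zero)) ++
  List.map (λ (a , b) → Fin.suc a , b) (pairs K (size ∘ Fin.suc))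

∈-pairs : ∀ K size (a : Fin K) (b : Fin (size a)) → (a , b) ∈ pairs K size
∈-pairs (suc K) size Fin.zero    b = ∈.∈-++⁺ˡ (∈.∈-map⁺ (Fin.zero ,_) (∈.∈-allFin b))
∈-pairs (suc K) size (Fin.suc a) b =
  ∈.∈-++⁺ʳ _ (∈.∈-map⁺ (λ (a , b) → Fin.suc a , b) (∈-pairs K (size ∘ Fin.suc) a b))

pairs-unique : ∀ K size → Unique (pairs K size)
pairs-unique zero    size = []
pairs-unique (suc K) size = Unique.++⁺
  (Unique.map⁺ (λ { refl → refl }) (Unique.allFin⁺ (size Fin.zero)))
  (Unique.map⁺ (λ { refl → refl }) (pairs-unique K (size ∘ Fin.suc)))
  λ (p , q) → clash (∈.∈-map⁻ (Fin.zero ,_) p) (∈.∈-map⁻ (λ (a , b) → Fin.suc a , b) q)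
  where
  clash : ∀ {x : Σ (Fin (suc K)) (Fin ∘ size)} → (∃[ b ] b ∈ List.allFin (size Fin.zero) × x ≡ (Fin.zero , b)) →
          (∃[ y ] y ∈ pairs K (size ∘ Fin.suc) × x ≡ (Fin.suc (proj₁ y) , proj₂ y)) → ⊥
  clash (_ , _ , refl) (_ , _ , ())

sumMap-pairs : ∀ K size (h : Σ (Fin K) (Fin ∘ size) → ℕ) →
  sumMap h (pairs K size) ≡ sum (List.tabulate {n = K} λ a → sumMap (λ b → h (a , b)) (List.allFin (size a)))
sumMap-pairs zero    size h = refl
sumMap-pairs (suc K) size h = trans (sumMap-++ h (List.map (Fin.zero ,_) (List.allFin (size Fin.zero))) _)
  (cong₂ ℕ._+_ (sumMap-map h (Fin.zero ,_) (List.allFin (size Fin.zero)))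
    (trans (sumMap-map h (λ (a , b) → Fin.suc a , b) (pairs K (size ∘ Fin.suc)))
      (sumMap-pairs K (size ∘ Fin.suc) (λ (a , b) → h (Fin.suc a , b)))))

module Enumeration (S : Setoid 0ℓ 0ℓ) {K : ℕ} (size : Fin K → ℕ)
    (elem : (a : Fin K) → Fin (size a) → Setoid.Carrier S)
    (complete : ∀ x → ∃[ a ] ∃[ b ] Setoid._≈_ S (elem a b) x)
    (distinct : ∀ a b a′ b′ → Setoid._≈_ S (elem a b) (elem a′ b′) → a ≡ a′)
    (distinct′ : ∀ a b b′ → Setoid._≈_ S (elem a b) (elem a b′) → b ≡ b′) where

  open Setoid S using () renaming (_≈_ to _≋_; sym to ≈-sym; trans to ≈-trans; reflexive to ≈-reflexive)

  private
    ps = pairs K size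

    at : Fin (List.length ps) → Setoid.Carrier S
    at i = let a , b = List.lookup ps i in elem a b

    position-of : ∀ x → ∃[ i ] at i ≋ x
    position-of x = let a , b , e = complete x
                        m = ∈-pairs K size a b in
      Any.index m , ≈-trans (≈-reflexive (cong (λ (a , b) → elem a b) (sym (Any.lookup-index m)))) e

    same : ∀ (p q : Σ (Fin K) (Fin ∘ size)) → elem (proj₁ p) (proj₂ p) ≋ elem (proj₁ q) (proj₂ q) → p ≡ q
    same (a , b) (a′ , b′) e with refl ← distinct a b a′ b′ e = cong (a ,_) (distinct′ a b b′ e)

    at-injective : ∀ i j → at i ≋ at j → i ≡ j
    at-injective i j e = lookup-distinct sym (pairs-unique K size) i j
      (same (List.lookup ps i) (List.lookup ps j) e)

  hasCardinality : HasCardinality S (List.length ps)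
  hasCardinality = record
    { to        = λ x → proj₁ (position-of x)
    ; from      = at
    ; to-cong   = λ {x} {y} e → at-injective _ _
        (≈-trans (proj₂ (position-of x)) (≈-trans e (≈-sym (proj₂ (position-of y)))))
    ; from-cong = λ { refl → Setoid.refl S }
    ; inverse   = (λ {i} {x} e → at-injective _ _ (≈-trans (proj₂ (position-of x)) e)) ,
                  (λ { {x} refl → proj₂ (position-of x) })
    }

  hasSum : ∀ f → HasSum S f (sumMap (λ (a , b) → f (elem a b)) ps)
  hasSum f = List.length ps , hasCardinality , cong sum (begin
    List.tabulate (λ i → f (at i))
      ≡⟨ List.map-tabulate (List.lookup ps) (λ (a , b) → f (elem a b)) ⟨
    List.map (λ (a , b) → f (elem a b)) (List.tabulate (List.lookup ps))
      ≡⟨ cong (List.map (λ (a , b) → f (elem a b))) (List.tabulate-lookup ps) ⟩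
    List.map (λ (a , b) → f (elem a b)) ps ∎)
    where open ≡-Reasoning

products : ∀ {X : Set} r → (Fin r → List X) → List (Vec X r)
products zero    F = [] ∷ []
products (suc r) F = List.cartesianProductWith _∷_ (F Fin.zero) (products r (F ∘ Fin.suc))

module _ {X : Set} where

  ∈-products⁺ : ∀ r (F : Fin r → List X) xs → (∀ i → Vec.lookup xs i ∈ F i) → xs ∈ products r F
  ∈-products⁺ zero    F []       h = here refl
  ∈-products⁺ (suc r) F (x ∷ xs) h =
    ∈.∈-cartesianProductWith⁺ _∷_ (h Fin.zero) (∈-products⁺ r (F ∘ Fin.suc) xs (h ∘ Fin.suc))

  ∈-products⁻ : ∀ r (F : Fin r → List X) {xs} → xs ∈ products r F → ∀ i → Vec.lookup xs i ∈ F i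
  ∈-products⁻ (suc r) F m i with ∈.∈-cartesianProductWith⁻ _∷_ (F Fin.zero) (products r (F ∘ Fin.suc)) m
  ∈-products⁻ (suc r) F m Fin.zero    | x , xs , x∈ , xs∈ , refl = x∈
  ∈-products⁻ (suc r) F m (Fin.suc i) | x , xs , x∈ , xs∈ , refl = ∈-products⁻ r (F ∘ Fin.suc) xs∈ i

  products-unique : ∀ r (F : Fin r → List X) → (∀ i → Unique (F i)) → Unique (products r F)
  products-unique zero    F u = [] ∷ []
  products-unique (suc r) F u = Unique.cartesianProductWith⁺ _∷_ (λ { refl → refl , refl })
    (u Fin.zero) (products-unique r (F ∘ Fin.suc) (u ∘ Fin.suc))

  sumMap-products : ∀ r (F : Fin r → List X) (f : Fin r → X → ℕ) →
    sumMap (λ xs → product (List.tabulate (λ i → f i (Vec.lookup xs i)))) (products r F) ≡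
    product (List.tabulate (λ i → sumMap (f i) (F i)))
  sumMap-products zero    F f = refl
  sumMap-products (suc r) F f = trans
    (sumMap-product _∷_ _ (f Fin.zero)
      (λ xs → product (List.tabulate (λ i → f (Fin.suc i) (Vec.lookup xs i)))) (λ x xs → refl)
      (F Fin.zero) (products r (F ∘ Fin.suc)))
    (cong (sumMap (f Fin.zero) (F Fin.zero) ℕ.*_) (sumMap-products r (F ∘ Fin.suc) (f ∘ Fin.suc)))

  length-products : ∀ r (F : Fin r → List X) → List.length (products r F)
    ≡ product (List.tabulate (List.length ∘ F))
  length-products zero    F = refl
  length-products (suc r) F = begin
    List.length (products (suc r) F)                       ≡⟨ sumMap-1 (products (suc r) F) ⟨
    sumMap (λ _ → 1) (products (suc r) F)
      ≡⟨ sumMap-product _∷_ (λ _ → 1) (λ _ → 1) (λ _ → 1) (λ _ _ → refl)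
                                                                (F Fin.zero) (products r (F ∘ Fin.suc)) ⟩
    sumMap (λ _ → 1) (F Fin.zero) ℕ.* sumMap (λ _ → 1) (products r (F ∘ Fin.suc))
      ≡⟨ cong₂ ℕ._*_ (sumMap-1 (F Fin.zero)) (trans (sumMap-1 (products r (F ∘ Fin.suc)))
        (length-products r (F ∘ Fin.suc))) ⟩
    product (List.tabulate (List.length ∘ F))              ∎
    where open ≡-Reasoning

  lookup-ext : ∀ {r} (xs ys : Vec X r) → (∀ i → Vec.lookup xs i ≡ Vec.lookup ys i) → xs ≡ ys
  lookup-ext []       []       h = refl
  lookup-ext (x ∷ xs) (y ∷ ys) h = cong₂ _∷_ (h Fin.zero) (lookup-ext xs ys (h ∘ Fin.suc))

  tabulate-injective : ∀ {r} {f g : Fin r → X} → List.tabulate f ≡ List.tabulate g → ∀ i → f i ≡ g i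
  tabulate-injective eq Fin.zero    = proj₁ (List.∷-injective eq)
  tabulate-injective eq (Fin.suc i) = tabulate-injective (proj₂ (List.∷-injective eq)) i

  tabulate-cast : ∀ {m n} (eq : m ≡ n) (f : Fin m → X) (g : Fin n → X) → (∀ i j → toℕ i ≡ toℕ j → f i ≡ g j) →
    List.tabulate f ≡ List.tabulate g
  tabulate-cast refl f g h = List.tabulate-cong λ i → h i i refl

catalanProduct-++ : ∀ xs ys → catalanProduct (xs ++ ys) ≡ catalanProduct xs ℕ.* catalanProduct ys
catalanProduct-++ xs ys =
  trans (cong product (List.map-++ catalan xs ys)) (ℕ.product-++ (List.map catalan xs) (List.map catalan ys))

catalanProduct-concat : ∀ r (f : Fin r → List ℕ) →
  catalanProduct (List.concat (List.tabulate f)) ≡ product (List.tabulate (catalanProduct ∘ f))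
catalanProduct-concat zero    f = refl
catalanProduct-concat (suc r) f = trans (catalanProduct-++ (f Fin.zero) _)
  (cong (catalanProduct (f Fin.zero) ℕ.*_) (catalanProduct-concat r (f ∘ Fin.suc)))

T-≡ : ∀ x y → (T x → T y) → (T y → T x) → x ≡ y
T-≡ true  true  _ _ = refl
T-≡ true  false f _ = ⊥-elim (f tt)
T-≡ false true  _ g = ⊥-elim (g tt)
T-≡ false false _ _ = refl

module SkylineList (n : ℕ) .{{_ : ℕ.NonZero n}} (v : AffinePermutation n) where
  open Periodic n
  open PeriodicBijection
  open Skylines n v
  open Fibers n
  open Maxima v using (Record; record?; record-shift)

  record-shift* : ∀ k {p} → Record p → Record (p ℤ.+ k ℤ.* + n)
  record-shift* k {p} rec = ℤ-induction {λ k → Record (p ℤ.+ k ℤ.* + n)} 0ℤ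
    (subst Record (sym (trans (cong (ℤ._+_ p) (ℤ.*-zeroˡ (+ n))) (ℤ.+-identityʳ p))) rec)
    (λ k h → subst Record (sym (step k)) (Equivalence.to (record-shift _) h))
    (λ k h → Equivalence.from (record-shift _) (subst Record (step k) h)) k
    where
    step : ∀ k → p ℤ.+ (k ℤ.+ 1ℤ) ℤ.* + n ≡ p ℤ.+ k ℤ.* + n ℤ.+ + n
    step k = trans (cong (ℤ._+_ p)
      (trans (ℤ.*-distribʳ-+ (+ n) k 1ℤ) (cong (ℤ._+_ (k ℤ.* + n)) (ℤ.*-identityˡ (+ n)))))
      (sym (ℤ.+-assoc p _ _))

  Window : Set
  Window = Vec Bool n

  Admissible : Window → Set
  Admissible b = (∃[ i ] T (Vec.lookup b i)) × (∀ i → T (Vec.lookup b i) → Record (+ toℕ i))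

  admissible? : ∀ b → Dec (Admissible b)
  admissible? b = Fin.any? (λ i → Bool.T? (Vec.lookup b i)) ×-dec Fin.all?
    (λ i → Bool.T? (Vec.lookup b i) →-dec record? (+ toℕ i))

  windows : List Window
  windows = List.filter admissible? (products n (λ _ → true ∷ false ∷ []))

  windows-unique : Unique windows
  windows-unique = Unique.filter⁺ admissible? (products-unique n _ λ _ → ((λ ()) ∷ []) ∷ [] ∷ [])

  admissible : ∀ a → Admissible (List.lookup windows a)
  admissible a = proj₂ (∈.∈-filter⁻ admissible? {xs = products n (λ _ → true ∷ false ∷ [])}
    (∈.∈-lookup {xs = windows} a))

  residue-toℕ : ∀ (i : Fin n) → residue (+ toℕ i) ≡ i
  residue-toℕ i = residue-≡ {+ toℕ i} i 0ℤ
    (sym (trans (cong (ℤ._+_ (+ toℕ i)) (ℤ.*-zeroˡ (+ n))) (ℤ.+-identityʳ (+ toℕ i))))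

  fromWindow : (b : Window) → Admissible b → Sky v
  fromWindow b ((i , i∈b) , records) = record
    { member   = λ m → Vec.lookup b (residue (v ⁻¹⟦ m ⟧))
    ; nonempty = v ⟦ + toℕ i ⟧ ,
      subst (T ∘ Vec.lookup b) (sym (trans (cong residue (from-to V (+ toℕ i))) (residue-toℕ i))) i∈b
    ; periodic = λ m → cong (Vec.lookup b)
      (trans (cong residue (from-equivariant V m)) (residue-+n (v ⁻¹⟦ m ⟧)))
    ; maxima   = λ m m∈ i i< → subst (v ⟦ i ⟧ ℤ.<_) (to-from V m)
        (subst Record (sym (residue-quotient (v ⁻¹⟦ m ⟧)))
          (record-shift* (quotient (v ⁻¹⟦ m ⟧)) (records _ m∈)) i i<)
    }
    where
    residue-+n : ∀ x → residue (x ℤ.+ + n) ≡ residue x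
    residue-+n x = residue-≡ (residue x) (quotient x ℤ.+ 1ℤ)
      (trans (cong (ℤ._+ + n) (residue-quotient x))
        (trans (ℤ.+-assoc (+ toℕ (residue x)) (quotient x ℤ.* + n) (+ n))
        (cong (ℤ._+_ (+ toℕ (residue x)))
          (sym (trans (ℤ.*-distribʳ-+ (+ n) (quotient x) 1ℤ)
          (cong (ℤ._+_ (quotient x ℤ.* + n)) (ℤ.*-identityˡ (+ n))))))))

  skyAt : Fin (List.length windows) → Sky v
  skyAt a = fromWindow (List.lookup windows a) (admissible a)

  distinct : ∀ a a′ → (∀ m → Sky.member (skyAt a) m ≡ Sky.member (skyAt a′) m) → a ≡ a′
  distinct a a′ eq = lookup-distinct sym windows-unique a a′ (lookup-ext _ _ λ i →
    subst (λ j → Vec.lookup (List.lookup windows a) j ≡ Vec.lookup (List.lookup windows a′) j)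
      (residue-v i) (eq (v ⟦ + toℕ i ⟧)))
    where
    residue-v : ∀ (i : Fin n) → residue (v ⁻¹⟦ v ⟦ + toℕ i ⟧ ⟧) ≡ i
    residue-v i = trans (cong residue (from-to V (+ toℕ i))) (residue-toℕ i)

  complete : ∀ M → ∃[ a ] (∀ m → Sky.member (skyAt a) m ≡ Sky.member M m)
  complete M = Any.index b∈ ,
    λ m → trans (cong (λ b → Vec.lookup b (residue (v ⁻¹⟦ m ⟧))) (sym (Any.lookup-index b∈)))
    (trans (Vec.lookup∘tabulate _ (residue (v ⁻¹⟦ m ⟧)))
      (trans (sym (member-residue (v ⁻¹⟦ m ⟧))) (cong (Sky.member M) (to-from V m))))
    where
    b : Window
    b = Vec.tabulate (λ i → Sky.member M (v ⟦ + toℕ i ⟧))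
    member-residue : ∀ p → Sky.member M (v ⟦ p ⟧) ≡ Sky.member M (v ⟦ + toℕ (residue p) ⟧)
    member-residue p = trans (cong (Sky.member M)
      (trans (cong (v ⟦_⟧) (residue-quotient p)) (to-shift V (quotient p) _)))
      (member-shift M (quotient p) _)
    either : ∀ x → x ∈ true ∷ false ∷ []
    either true  = here refl
    either false = there (here refl)
    b-admissible : Admissible b
    b-admissible =
      (let m , m∈ = Sky.nonempty M
           p = v ⁻¹⟦ m ⟧ in
        residue p , subst T (sym (trans (Vec.lookup∘tabulate _ (residue p))
          (trans (sym (member-residue p)) (cong (Sky.member M) (to-from V m))))) m∈) ,
      λ i i∈ j j< → maximum M {+ toℕ i} {j} (subst T (Vec.lookup∘tabulate _ i) i∈) j<
    b∈ : b ∈ windows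
    b∈ = ∈.∈-filter⁺ admissible? (∈-products⁺ n _ b (λ i → either _)) b-admissible

module Assembly (n : ℕ) .{{_ : ℕ.NonZero n}} (v : AffinePermutation n) {K : ℕ} (sky : Fin K → Sky v)
    (indexing : (a : Fin K) → Indexing v (sky a))
    (sky-distinct : (a a′ : Fin K) → ((m : ℤ) → Sky.member (sky a) m ≡ Sky.member (sky a′) m) → a ≡ a′)
    (sky-complete : (M : Sky v) → ∃[ a ] ((m : ℤ) → Sky.member (sky a) m ≡ Sky.member M m)) where
  open Periodic n
  open PeriodicBijection
  open Avoidance n
  open Fibers n using (module Maxima)
  open Skylines n v hiding (indexing)

  module C (a : Fin K) = Construction n v (sky a) (indexing a)
  module P (a : Fin K) = Positions (sky a) (indexing a)

  wordAt : (a : Fin K) → Fin (P.r a) → ℕ → ℤ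
  wordAt a i = C.word a (C.index a i)

  gapAt : (a : Fin K) → Fin (P.r a) → ℕ
  gapAt a i = P.gap a (C.index a i)

  word-injective : ∀ a i {k k′} → wordAt a i k ≡ wordAt a i k′ → k ≡ k′
  word-injective a i eq = C.at-injective a (P.position a (C.index a i)) (to-injective V eq)

  treeChoices : (a : Fin K) → List (Vec Tree (P.r a))
  treeChoices a = products (P.r a) λ i → Word.trees (wordAt a i) 0 (gapAt a i)

  configChoices : (a : Fin K) → List (Vec Config (P.r a))
  configChoices a = products (P.r a) λ i → Word.configs (wordAt a i) 0 (gapAt a i)

  chosenTrees : ∀ a → Fin (List.length (treeChoices a)) → Vec Tree (P.r a)
  chosenTrees a = List.lookup (treeChoices a)

  chosenTrees-valid : ∀ a b → C.BlockTrees a (Vec.lookup (chosenTrees a b))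
  chosenTrees-valid a b i = Word.∈-trees⁻ (wordAt a i) 0 (gapAt a i)
    (∈-products⁻ (P.r a) _ (∈.∈-lookup {xs = treeChoices a} b) i)

  chosenConfigs : ∀ a → Fin (List.length (configChoices a)) → Vec Config (P.r a)
  chosenConfigs a = List.lookup (configChoices a)

  chosenConfigs-valid : ∀ a b i → Word.Valid (wordAt a i) 0 (Vec.lookup (chosenConfigs a b) i) ×
                                  width (Vec.lookup (chosenConfigs a b) i) ≡ gapAt a i
  chosenConfigs-valid a b i = Word.∈-configs⁻ (wordAt a i) 0 (gapAt a i)
    (∈-products⁻ (P.r a) _ (∈.∈-lookup {xs = configChoices a} b) i)

  module FiberSide where
    size-of : Fin K → ℕ
    size-of a = List.length (treeChoices a)

    module B (a : Fin K) (b : Fin (size-of a)) where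
      t = Vec.lookup (chosenTrees a b)
      valid = chosenTrees-valid a b

      u : AffinePermutation n
      u = C.u a t valid

      w : AffinePermutation n
      w = C.w a t valid

    elem : (a : Fin K) → Fin (size-of a) → Setoid.Carrier (Fiber v)
    elem a b = B.w a b , C.stackSorts a (B.t a b) (B.valid a b)

    same-u : ∀ a b a′ b′ → (∀ i → B.w a b ⟦ i ⟧ ≡ B.w a′ b′ ⟦ i ⟧) → ∀ i → B.u a b ⟦ i ⟧ ≡ B.u a′ b′ ⟦ i ⟧
    same-u a b a′ b′ eq i = to-injective V (eq i)

    same-member : ∀ a b a′ b′ → (∀ i → B.u a b ⟦ i ⟧ ≡ B.u a′ b′ ⟦ i ⟧) →
      ∀ m → T (Sky.member (sky a) m) → T (Sky.member (sky a′) m)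
    same-member a b a′ b′ eq m m∈ =
      subst (T ∘ Sky.member (sky a′)) (trans (cong (v ⟦_⟧) (trans (sym (eq p)) up)) (to-from V m))
      (Equivalence.from (C.onSky⇔record a′ (B.t a′ b′) (B.valid a′ b′) p)
        (λ i i<p → subst₂ ℤ._<_ (eq i) (eq p) (Equivalence.to (C.onSky⇔record a (B.t a b) (B.valid a b) p)
          (subst (T ∘ Sky.member (sky a)) (sym (trans (cong (v ⟦_⟧) up) (to-from V m))) m∈) i i<p)))
      where
      p = B.u a b ⁻¹⟦ v ⁻¹⟦ m ⟧ ⟧
      up : B.u a b ⟦ p ⟧ ≡ v ⁻¹⟦ m ⟧
      up = to-from (fromAffine (B.u a b)) (v ⁻¹⟦ m ⟧)

    distinct : ∀ a b a′ b′ → (∀ i → B.w a b ⟦ i ⟧ ≡ B.w a′ b′ ⟦ i ⟧) → a ≡ a′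
    distinct a b a′ b′ eq = sky-distinct a a′ λ m → T-≡ _ _
      (same-member a b a′ b′ (same-u a b a′ b′ eq) m)
      (same-member a′ b′ a b (same-u a′ b′ a b (sym ∘ eq)) m)

    distinct′ : ∀ a b b′ → (∀ i → B.w a b ⟦ i ⟧ ≡ B.w a b′ ⟦ i ⟧) → b ≡ b′
    distinct′ a b b′ eq = lookup-distinct sym
      (products-unique (P.r a) _ (λ i → Word.trees-unique (wordAt a i) 0 (gapAt a i))) b b′
        (lookup-ext _ _ same)
      where
      open C a using (index; residueIndex-index)
      same : ∀ i → B.t a b i ≡ B.t a b′ i
      same i = proj₂ (Word.node-injective (wordAt a i)
        (perm-determines (node leaf (B.t a b i)) (node leaf (B.t a b′ i))
        (cong suc (trans (proj₂ (B.valid a b i)) (sym (proj₂ (B.valid a b′ i)))))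
        λ {k} k< → C.at-injective a (P.position a (index i)) (begin
          P.position a (index i) ℤ.+ + suc (perm (node leaf (B.t a b i)) k)   ≡⟨ value b (gap< b k<) ⟨
          B.u a b ⟦ P.position a (index i) ℤ.+ + suc k ⟧                      ≡⟨ same-u a b a b′ eq _ ⟩
          B.u a b′ ⟦ P.position a (index i) ℤ.+ + suc k ⟧                     ≡⟨ value b′ (gap< b k<) ⟩
          P.position a (index i) ℤ.+ + suc (perm (node leaf (B.t a b′ i)) k)  ∎)))
        where
        open ≡-Reasoning
        gap< : ∀ b {k} → k ℕ.< size (node leaf (B.t a b i)) → k ℕ.< suc (gapAt a i)
        gap< b {k} = subst (k ℕ.<_) (cong suc (proj₂ (B.valid a b i)))
        value : ∀ b {k} → k ℕ.< suc (gapAt a i) → B.u a b ⟦ P.position a (index i) ℤ.+ + suc k ⟧ ≡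
          P.position a (index i) ℤ.+ + suc (perm (node leaf (B.t a b i)) k)
        value b {k} k< = subst (λ i′ → B.u a b ⟦ P.position a (index i) ℤ.+ + suc k ⟧ ≡
            P.position a (index i) ℤ.+ + suc (perm (node leaf (B.t a b i′)) k)) (residueIndex-index i)
          (C.bijection-at a (B.t a b) (B.valid a b) (index i) k<)

    BlockTrees : AffinePermutation n → Fin K → Set
    BlockTrees u a = ∀ i → let p = P.position a (C.index a i) in
      Σ[ t ∈ Tree ] Word.Decreasing (wordAt a i) 0 t × size t ≡ gapAt a i ×
        (∀ k → k ℕ.< suc (gapAt a i) → u ⟦ p ℤ.+ + suc k ⟧ ≡ p ℤ.+ + suc (perm (node leaf t) k))

    module Found (u : AffinePermutation n) (a : Fin K) (blockTree : BlockTrees u a) where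
      U = fromAffine u

      open C a using (index; residueIndex; turns; word; position-≡; gap-index; offset; block)

      ts : Vec Tree (P.r a)
      ts = Vec.tabulate (λ i → proj₁ (blockTree i))

      ts-at : ∀ i → Vec.lookup ts i ≡ proj₁ (blockTree i)
      ts-at = Vec.lookup∘tabulate (λ i → proj₁ (blockTree i))

      ts∈ : ts ∈ treeChoices a
      ts∈ = ∈-products⁺ (P.r a) _ ts λ i → subst (λ t → t ∈ Word.trees (wordAt a i) 0 (gapAt a i))
        (sym (ts-at i))
        (let t , dec , size≡ , _ = blockTree i in
          subst (λ g → t ∈ Word.trees (wordAt a i) 0 g) size≡ (Word.∈-trees⁺ (wordAt a i) 0 t dec))

      b : Fin (size-of a)
      b = Any.index ts∈

      b-at : ∀ i → B.t a b i ≡ proj₁ (blockTree i)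
      b-at i = trans (cong (λ ts → Vec.lookup ts i) (sym (Any.lookup-index ts∈))) (ts-at i)

      agrees : ∀ x → B.u a b ⟦ x ⟧ ≡ u ⟦ x ⟧
      agrees x = in-block-agrees (block x)
        where
        open ≡-Reasoning
        in-block-agrees : ∃[ j ] C.InBlock a x j → B.u a b ⟦ x ⟧ ≡ u ⟦ x ⟧
        in-block-agrees (j , bl) =
          let k , k< , x≡ = offset bl
              i = residueIndex j
              s = P.position a (index i)
              k<′ = subst (λ g → k ℕ.< suc g) (gap-index j) k<
              t = proj₁ (blockTree i)
              c = turns j ℤ.* + n
          in begin
            B.u a b ⟦ x ⟧                                             ≡⟨ cong (B.u a b ⟦_⟧) x≡ ⟩
            B.u a b ⟦ P.position a j ℤ.+ + suc k ⟧
              ≡⟨ C.bijection-at a (B.t a b) (B.valid a b) j k< ⟩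
            P.position a j ℤ.+ + suc (perm (node leaf (B.t a b i)) k)
              ≡⟨ cong₂ (λ p t → p ℤ.+ + suc (perm (node leaf t) k)) (position-≡ j) (b-at i) ⟩
            s ℤ.+ c ℤ.+ + suc (perm (node leaf t) k)
              ≡⟨ lia 3 (λ s c m → [] ⊢ s :+ c :+ m :≡ s :+ m :+ c) s c (+ suc (perm (node leaf t) k)) ⟩
            s ℤ.+ + suc (perm (node leaf t) k) ℤ.+ c
              ≡⟨ cong (ℤ._+ c) (proj₂ (proj₂ (proj₂ (blockTree i))) k k<′) ⟨
            u ⟦ s ℤ.+ + suc k ⟧ ℤ.+ c                                 ≡⟨ to-shift U (turns j) (s ℤ.+ + suc k) ⟨
            u ⟦ s ℤ.+ + suc k ℤ.+ c ⟧
              ≡⟨ cong (u ⟦_⟧) (lia 3 (λ s c m → [] ⊢ s :+ m :+ c :≡ s :+ c :+ m) s c (+ suc k)) ⟩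
            u ⟦ s ℤ.+ c ℤ.+ + suc k ⟧
              ≡⟨ cong (λ p → u ⟦ p ℤ.+ + suc k ⟧) (position-≡ j) ⟨
            u ⟦ P.position a j ℤ.+ + suc k ⟧                          ≡⟨ cong (u ⟦_⟧) x≡ ⟨
            u ⟦ x ⟧                                                   ∎

    blockTrees : ∀ {u w : AffinePermutation n} → IsProjection w u → (∀ i → v ⟦ i ⟧ ≡ w ⟦ u ⁻¹⟦ i ⟧ ⟧) →
      ∃[ a ] BlockTrees u a
    blockTrees {u} {w} projection sorts = from-sky (sky-complete (skyline avoids syl factor))
      where
      avoids = projection⇒avoids {u} {w} projection
      syl = proj₁ projection
      factor : ∀ p → v ⟦ u ⟦ p ⟧ ⟧ ≡ w ⟦ p ⟧
      factor p = trans (sorts (u ⟦ p ⟧)) (cong (w ⟦_⟧) (from-to (fromAffine u) p))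
      open Extraction n v u w
      from-sky : ∃[ a ] (∀ m → Sky.member (sky a) m ≡ Sky.member (skyline avoids syl factor) m) →
        ∃[ a ] BlockTrees u a
      from-sky (a , same) = a , λ i → Blocks.blockTree avoids syl factor (sky a) (indexing a) onSky⇔
        (C.index a i)
        where
        onSky⇔ : ∀ p → OnSky (sky a) p ⇔ Maxima.Record u (u ⁻¹⟦ p ⟧)
        onSky⇔ p = mk⇔
          (λ s → Equivalence.to (onSkyline⇔ avoids syl factor p) (subst T (same (v ⟦ p ⟧)) s))
          (λ rec → subst T (sym (same (v ⟦ p ⟧))) (Equivalence.from (onSkyline⇔ avoids syl factor p) rec))

    complete : ∀ x → ∃[ a ] ∃[ b ] Setoid._≈_ (Fiber v) (elem a b) x
    complete (w , u , projection , sorts) = found (blockTrees {u} {w} projection sorts)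
      where
      found : ∃[ a ] BlockTrees u a → ∃[ a ] ∃[ b ] (∀ i → B.w a b ⟦ i ⟧ ≡ w ⟦ i ⟧)
      found (a , blockTree) = a , b , λ x → trans (cong (v ⟦_⟧) (agrees x))
          (trans (sorts (u ⟦ x ⟧)) (cong (w ⟦_⟧) (from-to (fromAffine u) x)))
        where open Found u a blockTree using (b; agrees)

    open Enumeration (Fiber v) size-of elem complete distinct distinct′ public

  module HookSide where
    size-of : Fin K → ℕ
    size-of a = List.length (configChoices a)

    configAt : ∀ a → Fin (size-of a) → Fin (P.r a) → Config
    configAt a b i = Vec.lookup (chosenConfigs a b) i

    module W (a : Fin K) (i : Fin (P.r a)) = WordVHC (wordAt a i) (word-injective a i) (gapAt a i)

    vhcAt : ∀ a b i → VHC (W.word a i)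
    vhcAt a b i = W.fromConfig a i (configAt a b i) (proj₁ (chosenConfigs-valid a b i))
      (proj₂ (chosenConfigs-valid a b i))

    elem : (a : Fin K) → Fin (size-of a) → AVHC v
    elem a b = record { skyline = sky a ; indexing = indexing a ; configurations = vhcAt a b }

    hookData-elem : ∀ a b → AVHC.hookData (elem a b) ≡ List.tabulate (λ i → hookList 0 (configAt a b i))
    hookData-elem a b = List.tabulate-cong λ i → W.endpoints-fromConfig a i (configAt a b i)
      (proj₁ (chosenConfigs-valid a b i)) (proj₂ (chosenConfigs-valid a b i))

    weight-elem : ∀ a b → weight v (elem a b) ≡ product (List.tabulate (λ i → configWeight (configAt a b i)))
    weight-elem a b = trans (catalanProduct-concat (P.r a) (λ i → composition (W.word a i) (vhcAt a b i)))
      (cong product (List.tabulate-cong λ i → trans (composition-weight (W.word a i) (vhcAt a b i))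
        (W.colourProduct-fromConfig a i (configAt a b i) (proj₁ (chosenConfigs-valid a b i))
          (proj₂ (chosenConfigs-valid a b i)))))

    distinct : ∀ a b a′ b′ → Setoid._≈_ (AVHC-setoid v) (elem a b) (elem a′ b′) → a ≡ a′
    distinct a b a′ b′ (eq , _) = sky-distinct a a′ eq

    distinct′ : ∀ a b b′ → Setoid._≈_ (AVHC-setoid v) (elem a b) (elem a b′) → b ≡ b′
    distinct′ a b b′ (_ , eq) = lookup-distinct sym
      (products-unique (P.r a) _ (λ i → Word.configs-unique (wordAt a i) 0 (gapAt a i))) b b′
        (lookup-ext _ _ λ i →
        ConfigHooks.hookList-injective (wordAt a i) (word-injective a i) 0 (configAt a b i) (configAt a b′ i)
          (proj₁ (chosenConfigs-valid a b i)) (proj₁ (chosenConfigs-valid a b′ i))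
          (trans (proj₂ (chosenConfigs-valid a b i)) (sym (proj₂ (chosenConfigs-valid a b′ i))))
          (tabulate-injective (trans (sym (hookData-elem a b)) (trans eq (hookData-elem a b′))) i))

    module Found (X : AVHC v) where
      private
        M = AVHC.skyline X
        I = AVHC.indexing X
      module Q = Positions M I

      a : Fin K
      a = proj₁ (sky-complete M)

      module Same = IndexingUniqueness {sky a} {M} (proj₂ (sky-complete M)) (indexing a) I

      q : Fin (P.r a) → Fin Q.r
      q i = Fin.cast Same.r-≡ i

      index-q : ∀ i → + suc (toℕ (q i)) ≡ C.index a i
      index-q i = cong (λ m → + suc m) (Fin.toℕ-cast Same.r-≡ i)

      ConfigFor : ℤ → ℕ → List (ℕ × ℕ) → Set
      ConfigFor p g hs = Σ[ c ∈ Config ] Word.Valid (λ k → v ⟦ p ℤ.+ + suc k ⟧) 0 c × width c ≡ g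
        × hookList 0 c ≡ hs

      endpointsAt : Fin Q.r → List (ℕ × ℕ)
      endpointsAt i = endpoints (Q.z i) (AVHC.configurations X i)

      found : ∀ i → ConfigFor (Q.position (+ suc (toℕ i))) (Q.gap (+ suc (toℕ i))) (endpointsAt i)
      found i = let c , valid , w , hs , _ = WordVHC.toConfig (λ k → v ⟦ Q.position (+ suc (toℕ i)) ℤ.+ + suc k ⟧)
                      (λ eq → C.at-injective a (Q.position (+ suc (toℕ i))) (to-injective V eq))
                      (Q.gap (+ suc (toℕ i))) (AVHC.configurations X i) in c , valid , w , hs

      config : ∀ i → ConfigFor (P.position a (C.index a i)) (gapAt a i) (endpointsAt (q i))
      config i = subst₂ (λ p g → ConfigFor p g (endpointsAt (q i)))
        (trans (cong Q.position (index-q i)) (sym (Same.position-≡ (C.index a i))))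
        (trans (cong Q.gap (index-q i)) (sym (Same.gap-≡′ (C.index a i)))) (found (q i))

      cs : Vec Config (P.r a)
      cs = Vec.tabulate (λ i → proj₁ (config i))

      cs-at : ∀ i → Vec.lookup cs i ≡ proj₁ (config i)
      cs-at = Vec.lookup∘tabulate (λ i → proj₁ (config i))

      cs∈ : cs ∈ configChoices a
      cs∈ = ∈-products⁺ (P.r a) _ cs λ i → subst (λ c → c ∈ Word.configs (wordAt a i) 0 (gapAt a i))
        (sym (cs-at i))
        (let c , valid , w , _ = config i in
          subst (λ g → c ∈ Word.configs (wordAt a i) 0 g) w (Word.∈-configs⁺ (wordAt a i) 0 c valid))

      b : Fin (size-of a)
      b = Any.index cs∈

      b-at : ∀ i → configAt a b i ≡ proj₁ (config i)
      b-at i = trans (cong (λ cs → Vec.lookup cs i) (sym (Any.lookup-index cs∈))) (cs-at i)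

      hookData-≡ : AVHC.hookData (elem a b) ≡ AVHC.hookData X
      hookData-≡ = trans (hookData-elem a b) (tabulate-cast Same.r-≡ _ endpointsAt λ i j i≡j →
        trans (cong (hookList 0) (b-at i)) (trans (proj₂ (proj₂ (proj₂ (config i))))
          (cong endpointsAt (Fin.toℕ-injective (trans (Fin.toℕ-cast Same.r-≡ i) i≡j)))))

    complete : ∀ X → ∃[ a ] ∃[ b ] Setoid._≈_ (AVHC-setoid v) (elem a b) X
    complete X = F.a , F.b , proj₂ (sky-complete (AVHC.skyline X)) , F.hookData-≡
      where module F = Found X

    open Enumeration (AVHC-setoid v) size-of elem complete distinct distinct′ public

  private
    total = List.length (pairs K FiberSide.size-of)

    open HookSide using (configAt; elem; weight-elem)

    weights : ∀ a → sumMap (λ b → weight v (elem a b)) (List.allFin (HookSide.size-of a)) ≡ FiberSide.size-of a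
    weights a = begin
      sumMap (λ b → weight v (elem a b)) (List.allFin (HookSide.size-of a))
        ≡⟨ sumMap-cong (List.allFin (HookSide.size-of a)) (λ {b} _ → weight-elem a b) ⟩
      sumMap (λ b → W (List.lookup (configChoices a) b)) (List.allFin (HookSide.size-of a))
        ≡⟨ sumMap-map W (List.lookup (configChoices a)) (List.allFin (HookSide.size-of a)) ⟨
      sumMap W (List.map (List.lookup (configChoices a)) (List.allFin (HookSide.size-of a)))
        ≡⟨ cong (sumMap W) (trans (List.map-tabulate id (List.lookup (configChoices a)))
          (List.tabulate-lookup (configChoices a))) ⟩
      sumMap W (configChoices a)
        ≡⟨ sumMap-products (P.r a) (λ i → Word.configs (wordAt a i) 0 (gapAt a i)) (λ _ → configWeight) ⟩
      product (List.tabulate (λ i → sumMap configWeight (Word.configs (wordAt a i) 0 (gapAt a i))))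
        ≡⟨ cong product (List.tabulate-cong λ i → FertilityFormula.fertility (wordAt a i)
          (word-injective a i) 0 (gapAt a i)) ⟨
      product (List.tabulate (λ i → List.length (Word.trees (wordAt a i) 0 (gapAt a i))))
        ≡⟨ length-products (P.r a) (λ i → Word.trees (wordAt a i) 0 (gapAt a i)) ⟨
      FiberSide.size-of a ∎
      where
      open ≡-Reasoning
      W : Vec Config (P.r a) → ℕ
      W cs = product (List.tabulate (λ i → configWeight (Vec.lookup cs i)))

    totals : sumMap (λ (a , b) → weight v (elem a b)) (pairs K HookSide.size-of) ≡ total
    totals = begin
      sumMap (λ (a , b) → weight v (elem a b)) (pairs K HookSide.size-of)
        ≡⟨ sumMap-pairs K HookSide.size-of (λ (a , b) → weight v (elem a b)) ⟩
      sum (List.tabulate (λ a → sumMap (λ b → weight v (elem a b)) (List.allFin (HookSide.size-of a))))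
        ≡⟨ cong sum (List.tabulate-cong λ a → trans (weights a)
             (trans (sym (List.length-tabulate id)) (sym (sumMap-1 (List.allFin (FiberSide.size-of a)))))) ⟩
      sum (List.tabulate (λ a → sumMap (λ b → 1) (List.allFin (FiberSide.size-of a))))
        ≡⟨ sumMap-pairs K FiberSide.size-of (λ _ → 1) ⟨
      sumMap (λ _ → 1) (pairs K FiberSide.size-of)
        ≡⟨ sumMap-1 (pairs K FiberSide.size-of) ⟩
      total ∎
      where open ≡-Reasoning

  affineFertility : ∃[ N ] (HasCardinality (Fiber v) N × HasSum (AVHC-setoid v) (weight v) N)
  affineFertility = total , FiberSide.hasCardinality ,
    subst (HasSum (AVHC-setoid v) (weight v)) totals (HookSide.hasSum (weight v))

theorem8p12 : ∀ (n : ℕ) .{{_ : NonZero n}} (v : AffinePermutation n) →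
    ∃[ N ] (HasCardinality (Fiber v) N × HasSum (AVHC-setoid v) (weight v) N)
theorem8p12 n v = affineFertility
  where
  open SkylineList n v
  open Assembly n v skyAt (λ a → Skylines.indexing n v (skyAt a)) distinct complete
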